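{- Let $N$ be a square-free integer, let $E_N: y^2=x^3-N^2x$, and let $P\in E_N(\mathbb{Q})$ be a non-torsion integral point. Then there is at most one integer $n>1$ such that $nP$ is integral.
   Context: A point of $E_N(\mathbb{Q})$ is integral if it is an affine point with integer coordinates. -}

module Defs where

open import Data.Nat as ℕ using (ℕ; zero; suc)
open import Data.Nat.Divisibility as ℕD using ()
open import Data.Integer as ℤ using (ℤ; ∣_∣)
open import Data.Rational as ℚ using (ℚ; 0ℚ; 1ℚ; _+_; _-_; _*_; -_; _÷_; _/_)
open import Data.Rational.Properties using (_≟_)
open import Data.Product using (∃; _×_; _,_)
open import Relation.Binary.PropositionalEquality using (_≡_; _≢_)
open import Relation.Nullary using (yes; no)
open import Data.Unit using (⊤)

-- N is square-free: the only natural d with d² ∣ N is d = 1.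
-- (This forces N ≠ 0, as 2² ∣ 0.)
SquareFree : ℤ → Set
SquareFree N = ∀ (d : ℕ) → (d ℕ.* d) ℕD.∣ ∣ N ∣ → d ≡ 1

fromℤ : ℤ → ℚ
fromℤ z = z / 1

data Point : Set where
  O   : Point
  aff : ℚ → ℚ → Point

OnCurve : ℤ → Point → Set
OnCurve N O         = ⊤
OnCurve N (aff x y) = y * y ≡ x * x * x - fromℤ N * fromℤ N * x

-- Division in ℚ (total; the junk value at 0 is never used by the group law below).
div : ℚ → ℚ → ℚ
div p q with q ≟ 0ℚ
... | yes _  = 0ℚ
... | no q≢0 = _÷_ p q {{ℚ.≢-nonZero q≢0}}

-- Given slope l through (x₁,y₁) and second x-coordinate x₂, the sum point.
third : ℚ → ℚ → ℚ → ℚ → Point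
third x₁ y₁ x₂ l = let x₃ = l * l - x₁ - x₂ in aff x₃ (l * (x₁ - x₃) - y₁)

-- The chord-and-tangent group law on E_N (a = -N², b = 0).
add : ℤ → Point → Point → Point
add N O Q = Q
add N P O = P
add N (aff x₁ y₁) (aff x₂ y₂) with x₁ ≟ x₂
... | no _ = third x₁ y₁ x₂ (div (y₂ - y₁) (x₂ - x₁))
... | yes _ with y₁ + y₂ ≟ 0ℚ
...   | yes _ = O
...   | no _ = third x₁ y₁ x₂ (div (fromℤ (ℤ.+ 3) * x₁ * x₁ - fromℤ N * fromℤ N) (fromℤ (ℤ.+ 2) * y₁))

smul : ℤ → ℕ → Point → Point
smul N zero    P = O
smul N (suc n) P = add N P (smul N n P)

NonTorsion : ℤ → Point → Set
NonTorsion N P = ∀ (n : ℕ) → 1 ℕ.≤ n → smul N n P ≢ O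

data Integral : Point → Set where
  integral : ∀ (a b : ℤ) → Integral (aff (fromℤ a) (fromℤ b))

{-# OPTIONS --safe #-}
-- Write M = |N| and x(nP)/M = p/q in lowest terms, with height H(nP) = max(|p|, q). The chord construction shows that
-- x(nP) - r, for each r in {0, M, -M}, is a square when n is even and has the square class of x(P) - r when n is odd.
-- If nP is integral, then n is odd, since three squares in arithmetic progression have a common difference divisible
-- by 4; and since M is square-free, the denominator q of nP equals that of P. The formulas for x(Q+R) + x(Q-R) and
-- x(Q+R) x(Q-R) show that heights grow quadratically in n, up to contents at most 4. On the egg (x < 0) the height is
-- the denominator, so P lies on the identity component.
--
-- Suppose mP and nP are integral, 1 < m < n. Then both are near O, in the sense that √(q/p) is small, and √(q/p)
-- satisfies the triangle inequality. For n < 8m this puts 4mP, 8mP or some rP with 0 < 2r ≤ m closer to O than the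
-- duplication formula or its height allows, so n ≥ 8m; the height growth then gives p(nP) ≥ p(mP)^43. On the other
-- hand X = p(mP), x₂ = p(nP) make X x₂, (X - q)(x₂ - q) and (X + q)(x₂ + q) squares, so √(1 - q/X) and √(1 + q/X) have
-- a common rational approximation of denominator √(X x₂). Rickert's simultaneous Padé forms, realised as divided
-- differences of powers of 1 + qz/X with multiple nodes -1, 0, 1, exclude this once X ≥ 2^25 q^4, which the height
-- growth supplies except when m = 3 and p(P) < 56; there 3P is never integral, by a finite verification.
module Submission where

-- The group law enters through iP + jP = (i + j)P, proved for a division-free relation `Line` that
-- covers chords and tangents alike.
--
-- The hard point of the Padé step is that the forms do not all vanish once the square roots in them
-- are replaced by rational numbers. Divided differences see a function only through its jets at the
-- nodes, and the recursion between consecutive Taylor coefficients of a power involves one node at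
-- a time; hence it stays exact when the jets at a node are multiplied by a constant. It links
-- neighbouring divided differences, and a simultaneous vanishing would descend to the value at one
-- node.
--
-- The constants depend on each other. A form of degree k is small under two opposite conditions on
-- k. With X ≥ 2^25 q^4 the failure of one at k + 1 implies the other at k as soon as k ≥ 13, and at
-- k = 13 the first one needs √(X x₂) ≥ X^20. The exponent 43 = 64 - 21 comes from three doublings,
-- each raising heights to the fourth power, with 21 factors 4 lost to contents.

-- Chords and tangents as division-free algebra

module Line where

  open import Data.Rational using (ℚ; 0ℚ; 1ℚ; _+_; _*_; _-_; -_)
  open import Data.Rational.Properties
  open import Data.Rational.Solver using (module +-*-Solver)
  open +-*-Solver
  open import Data.Product using (_×_; _,_)
  open import Data.Sum using (_⊎_; inj₁; inj₂)
  open import Data.Empty using (⊥-elim)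
  open import Relation.Binary.PropositionalEquality
  open import Relation.Nullary using (yes; no)

  x-x≡0 : ∀ {x y} → x ≡ y → x - y ≡ 0ℚ
  x-x≡0 {x} refl = +-inverseʳ x

  x-y≡0⇒x≡y : ∀ x y → x - y ≡ 0ℚ → x ≡ y
  x-y≡0⇒x≡y x y e = trans (ring x y) (trans (cong (_+ y) e) (+-identityˡ y))
    where
    ring : ∀ x y → x ≡ (x - y) + y
    ring = solve 2 (λ x y → x := (x :- y) :+ y) refl

  integral-domain : ∀ x y → x * y ≡ 0ℚ → x ≢ 0ℚ → y ≡ 0ℚ
  integral-domain x y e x≢0 with y ≟ 0ℚ
  ... | yes y≡0 = y≡0
  ... | no y≢0 = ⊥-elim (x≢0 (*-cancelʳ-≡ y≢0 (trans e (sym (*-zeroˡ y)))))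
    where
    open import Data.Rational using (≢-nonZero; 1/_)
    *-cancelʳ-≡ : ∀ {x z} {y} (y≢0 : y ≢ 0ℚ) → x * y ≡ z * y → x ≡ z
    *-cancelʳ-≡ {x} {z} {y} y≢0 e = trans (sym (unit x)) (trans (cong (_* (1/ y)) e) (unit z))
      where
      instance _ = ≢-nonZero y≢0
      unit : ∀ x → x * y * (1/ y) ≡ x
      unit x = trans (*-assoc x y (1/ y)) (trans (cong (x *_) (*-inverseʳ y)) (*-identityʳ x))

  cancelˡ : ∀ x {y z} → x ≢ 0ℚ → x * y ≡ x * z → y ≡ z
  cancelˡ x {y} {z} x≢0 e = x-y≡0⇒x≡y y z (integral-domain x (y - z) (trans (ring x y z) (x-x≡0 e)) x≢0)
    where
    ring : ∀ x y z → x * (y - z) ≡ x * y - x * z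
    ring = solve 3 (λ x y z → x :* (y :- z) := x :* y :- x :* z) refl

  On : ℚ → ℚ → ℚ → Set
  On D x y = y * y ≡ x * x * x - D * x

  -- The line of slope l through (x₁, y₁) and (x₂, y₂) (tangent if these coincide) meets the curve
  -- y² = x³ - D x again in (x₃, - y₃).
  record Line (D x₁ y₁ x₂ y₂ x₃ y₃ l : ℚ) : Set where
    constructor line
    field
      y₂-eq : y₂ ≡ y₁ + l * (x₂ - x₁)
      -- The difference of the two curve equations divided by x₂ - x₁; for coinciding points it is
      -- the equation of the tangent slope.
      D-eq  : D ≡ x₁ * x₁ + x₁ * x₂ + x₂ * x₂ - l * (y₁ + y₂)
      x₃-eq : x₃ ≡ l * l - x₁ - x₂
      y₃-eq : y₃ ≡ l * (x₁ - x₃) - y₁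

  -- Matching the four equations with `refl` leaves x₁, y₁, x₂ and l as free parameters, and the
  -- claim becomes polynomial identities. Later lemmas on `Line` use the same device.
  Line-comm : ∀ {D x₁ y₁ x₂ y₂ x₃ y₃ l} → Line D x₁ y₁ x₂ y₂ x₃ y₃ l → Line D x₂ y₂ x₁ y₁ x₃ y₃ l
  Line-comm {x₁ = x₁} {y₁} {x₂} {l = l} (line refl refl refl refl) = line (r₁ x₁ y₁ x₂ l) (r₂ x₁ y₁ x₂ l) (r₃ x₁ x₂ l) (r₄ x₁ y₁ x₂ l)
    where
    r₁ : ∀ a b c l → b ≡ (b + l * (c - a)) + l * (a - c)
    r₁ = solve 4 (λ a b c l → b := (b :+ l :* (c :- a)) :+ l :* (a :- c)) refl
    r₂ : ∀ a b c l → a * a + a * c + c * c - l * (b + (b + l * (c - a))) ≡ c * c + c * a + a * a - l * ((b + l * (c - a)) + b)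
    r₂ = solve 4 (λ a b c l → a :* a :+ a :* c :+ c :* c :- l :* (b :+ (b :+ l :* (c :- a))) := c :* c :+ c :* a :+ a :* a :- l :* ((b :+ l :* (c :- a)) :+ b)) refl
    r₃ : ∀ a c l → l * l - a - c ≡ l * l - c - a
    r₃ = solve 3 (λ a c l → l :* l :- a :- c := l :* l :- c :- a) refl
    r₄ : ∀ a b c l → l * (a - (l * l - a - c)) - b ≡ l * (c - (l * l - a - c)) - (b + l * (c - a))
    r₄ = solve 4 (λ a b c l → l :* (a :- (l :* l :- a :- c)) :- b := l :* (c :- (l :* l :- a :- c)) :- (b :+ l :* (c :- a))) refl

  Line-on₃ : ∀ {D x₁ y₁ x₂ y₂ x₃ y₃ l} → Line D x₁ y₁ x₂ y₂ x₃ y₃ l → On D x₁ y₁ → On D x₃ y₃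
  Line-on₃ {D} {x₁} {y₁} {x₂} {l = l} (line refl refl refl refl) on = x-y≡0⇒x≡y _ _ (trans (r x₁ y₁ x₂ l) (x-x≡0 on))
    where
    r : ∀ a b c l → (l * (a - (l * l - a - c)) - b) * (l * (a - (l * l - a - c)) - b) - ((l * l - a - c) * (l * l - a - c) * (l * l - a - c) - (a * a + a * c + c * c - l * (b + (b + l * (c - a)))) * (l * l - a - c)) ≡ b * b - (a * a * a - (a * a + a * c + c * c - l * (b + (b + l * (c - a)))) * a)
    r = solve 4 (λ a b c l → (l :* (a :- (l :* l :- a :- c)) :- b) :* (l :* (a :- (l :* l :- a :- c)) :- b) :- ((l :* l :- a :- c) :* (l :* l :- a :- c) :* (l :* l :- a :- c) :- (a :* a :+ a :* c :+ c :* c :- l :* (b :+ (b :+ l :* (c :- a)))) :* (l :* l :- a :- c)) := b :* b :- (a :* a :* a :- (a :* a :+ a :* c :+ c :* c :- l :* (b :+ (b :+ l :* (c :- a)))) :* a)) refl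

  -- The value of the monic cubic with roots x₁, x₂, x₃ at a root r of x³ - D x is minus a square.
  Line-square : ∀ {D x₁ y₁ x₂ y₂ x₃ y₃ l} → Line D x₁ y₁ x₂ y₂ x₃ y₃ l → On D x₁ y₁ → ∀ r → r * r * r - D * r ≡ 0ℚ →
    (x₁ - r) * (x₂ - r) * (x₃ - r) ≡ (l * (r - x₁) + y₁) * (l * (r - x₁) + y₁)
  Line-square {D} {x₁} {y₁} {x₂} {l = l} (line refl refl refl refl) on r root = x-y≡0⇒x≡y _ _
    (trans (id x₁ y₁ x₂ l r) (cong₂ (λ s t → s - t) (x-x≡0 (sym on)) root))
    where
    id : ∀ a b c l r → (a - r) * (c - r) * ((l * l - a - c) - r) - (l * (r - a) + b) * (l * (r - a) + b) ≡ ((a * a * a - (a * a + a * c + c * c - l * (b + (b + l * (c - a)))) * a) - b * b) - (r * r * r - (a * a + a * c + c * c - l * (b + (b + l * (c - a)))) * r)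
    id = solve 5 (λ a b c l r → (a :- r) :* (c :- r) :* ((l :* l :- a :- c) :- r) :- (l :* (r :- a) :+ b) :* (l :* (r :- a) :+ b) := ((a :* a :* a :- (a :* a :+ a :* c :+ c :* c :- l :* (b :+ (b :+ l :* (c :- a)))) :* a) :- b :* b) :- (r :* r :* r :- (a :* a :+ a :* c :+ c :* c :- l :* (b :+ (b :+ l :* (c :- a)))) :* r)) refl

  -- With P₂ = P₃ - P₁ and P₄ = P₃ + P₁.
  module _ {D x₁ y₁ x₂ y₂ x₃ y₃ l x₄ y₄ m : ℚ} (L : Line D x₁ y₁ x₂ y₂ x₃ y₃ l) (L' : Line D x₁ y₁ x₃ y₃ x₄ y₄ m) (on : On D x₁ y₁) where
    private
      on₃ = Line-on₃ L on

      -- P₂ = P₃ - P₁, so x₂ comes from the line through P₁ and -P₃; its slope is l, with l (x₁ -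
      -- x₃) = y₁ + y₃.
      difference : x₂ * ((x₃ - x₁) * (x₃ - x₁)) ≡ (y₁ + y₃) * (y₁ + y₃) - (x₁ + x₃) * ((x₃ - x₁) * (x₃ - x₁))
      difference = trans (cong (_* ((x₃ - x₁) * (x₃ - x₁))) (trans (r₁ x₁ x₂ l) (cong (λ t → l * l - x₁ - t) (sym (Line.x₃-eq L)))))
        (trans (r₂ x₁ x₃ l) (cong (λ t → t * t - (x₁ + x₃) * ((x₃ - x₁) * (x₃ - x₁))) (trans (r₃ x₁ y₁ x₃ l) (cong (y₁ +_) (sym (Line.y₃-eq L))))))
        where
        r₁ : ∀ a c l → c ≡ l * l - a - (l * l - a - c)
        r₁ = solve 3 (λ a c l → c := l :* l :- a :- (l :* l :- a :- c)) refl
        r₂ : ∀ a c l → (l * l - a - c) * ((c - a) * (c - a)) ≡ (l * (a - c)) * (l * (a - c)) - (a + c) * ((c - a) * (c - a))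
        r₂ = solve 3 (λ a c l → (l :* l :- a :- c) :* ((c :- a) :* (c :- a)) := (l :* (a :- c)) :* (l :* (a :- c)) :- (a :+ c) :* ((c :- a) :* (c :- a))) refl
        r₃ : ∀ a b c l → l * (a - c) ≡ b + (l * (a - c) - b)
        r₃ = solve 4 (λ a b c l → l :* (a :- c) := b :+ (l :* (a :- c) :- b)) refl

      sum : x₄ * ((x₃ - x₁) * (x₃ - x₁)) ≡ (y₃ - y₁) * (y₃ - y₁) - (x₁ + x₃) * ((x₃ - x₁) * (x₃ - x₁))
      sum = trans (cong (_* ((x₃ - x₁) * (x₃ - x₁))) (Line.x₃-eq L'))
        (trans (r₂ x₁ x₃ m) (cong (λ t → t * t - (x₁ + x₃) * ((x₃ - x₁) * (x₃ - x₁))) (trans (r₃ x₁ y₁ x₃ m) (cong (_- y₁) (sym (Line.y₂-eq L'))))))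
        where
        r₂ : ∀ a c l → (l * l - a - c) * ((c - a) * (c - a)) ≡ (l * (c - a)) * (l * (c - a)) - (a + c) * ((c - a) * (c - a))
        r₂ = solve 3 (λ a c l → (l :* l :- a :- c) :* ((c :- a) :* (c :- a)) := (l :* (c :- a)) :* (l :* (c :- a)) :- (a :+ c) :* ((c :- a) :* (c :- a))) refl
        r₃ : ∀ a b c l → l * (c - a) ≡ (b + l * (c - a)) - b
        r₃ = solve 4 (λ a b c l → l :* (c :- a) := (b :+ l :* (c :- a)) :- b) refl

    -- The terms ± 2 y₁ y₃ of `difference` and `sum` cancel, and the squares of the ordinates are
    -- eliminated by the curve equations.
    pair-sum : (x₂ + x₄) * ((x₃ - x₁) * (x₃ - x₁)) ≡ (x₁ * x₃ - D) * (x₁ + x₃) + (x₁ * x₃ - D) * (x₁ + x₃)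
    pair-sum = trans (*-distribʳ-+ ((x₃ - x₁) * (x₃ - x₁)) x₂ x₄) (trans (cong₂ _+_ difference sum)
      (x-y≡0⇒x≡y _ _ (trans (r D x₁ y₁ x₃ y₃) (trans (cong₂ (λ s t → (s + s) + (t + t)) (x-x≡0 on) (x-x≡0 on₃)) refl))))
      where
      r : ∀ D a b c d → ((b + d) * (b + d) - (a + c) * ((c - a) * (c - a))) + ((d - b) * (d - b) - (a + c) * ((c - a) * (c - a))) - ((a * c - D) * (a + c) + (a * c - D) * (a + c)) ≡ ((b * b - (a * a * a - D * a)) + (b * b - (a * a * a - D * a))) + ((d * d - (c * c * c - D * c)) + (d * d - (c * c * c - D * c)))
      r = solve 5 (λ D a b c d → ((b :+ d) :* (b :+ d) :- (a :+ c) :* ((c :- a) :* (c :- a))) :+ ((d :- b) :* (d :- b) :- (a :+ c) :* ((c :- a) :* (c :- a))) :- ((a :* c :- D) :* (a :+ c) :+ (a :* c :- D) :* (a :+ c)) := ((b :* b :- (a :* a :* a :- D :* a)) :+ (b :* b :- (a :* a :* a :- D :* a))) :+ ((d :* d :- (c :* c :* c :- D :* c)) :+ (d :* d :- (c :* c :* c :- D :* c)))) refl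

    -- The product of `difference` and `sum` is even in y₁ and in y₃, so the curve equations remove
    -- both ordinates; one factor (x₃ - x₁)² then cancels.
    pair-product : x₃ ≢ x₁ → (x₂ * x₄) * ((x₃ - x₁) * (x₃ - x₁)) ≡ (x₁ * x₃ + D) * (x₁ * x₃ + D)
    pair-product x₃≢x₁ = cancelˡ s s≢0 (trans (r₁ x₂ x₄ s) (trans (cong₂ _*_ difference sum) (trans (r₂ y₁ y₃ ((x₁ + x₃) * s))
      (trans (cong₂ (λ p q → (p + q - (x₁ + x₃) * s) * (p + q - (x₁ + x₃) * s) - (p * q + p * q + (p * q + p * q))) on on₃) (r₃ D x₁ x₃)))))
      where
      s = (x₃ - x₁) * (x₃ - x₁)
      s≢0 : s ≢ 0ℚ
      s≢0 e = x₃≢x₁ (x-y≡0⇒x≡y x₃ x₁ (integral-domain (x₃ - x₁) (x₃ - x₁) e (λ z → x₃≢x₁ (x-y≡0⇒x≡y x₃ x₁ z))))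
      r₁ : ∀ b d s → s * ((b * d) * s) ≡ (b * s) * (d * s)
      r₁ = solve 3 (λ b d s → s :* ((b :* d) :* s) := (b :* s) :* (d :* s)) refl
      r₂ : ∀ b d k → ((b + d) * (b + d) - k) * ((d - b) * (d - b) - k) ≡ (b * b + d * d - k) * (b * b + d * d - k) - (b * b * (d * d) + b * b * (d * d) + (b * b * (d * d) + b * b * (d * d)))
      r₂ = solve 3 (λ b d k → ((b :+ d) :* (b :+ d) :- k) :* ((d :- b) :* (d :- b) :- k) := (b :* b :+ d :* d :- k) :* (b :* b :+ d :* d :- k) :- (b :* b :* (d :* d) :+ b :* b :* (d :* d) :+ (b :* b :* (d :* d) :+ b :* b :* (d :* d)))) refl
      r₃ : ∀ D a c → ((a * a * a - D * a) + (c * c * c - D * c) - (a + c) * ((c - a) * (c - a))) * ((a * a * a - D * a) + (c * c * c - D * c) - (a + c) * ((c - a) * (c - a))) - ((a * a * a - D * a) * (c * c * c - D * c) + (a * a * a - D * a) * (c * c * c - D * c) + ((a * a * a - D * a) * (c * c * c - D * c) + (a * a * a - D * a) * (c * c * c - D * c))) ≡ ((c - a) * (c - a)) * ((a * c + D) * (a * c + D))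
      r₃ = solve 3 (λ D a c → ((a :* a :* a :- D :* a) :+ (c :* c :* c :- D :* c) :- (a :+ c) :* ((c :- a) :* (c :- a))) :* ((a :* a :* a :- D :* a) :+ (c :* c :* c :- D :* c) :- (a :+ c) :* ((c :- a) :* (c :- a))) :- ((a :* a :* a :- D :* a) :* (c :* c :* c :- D :* c) :+ (a :* a :* a :- D :* a) :* (c :* c :* c :- D :* c) :+ ((a :* a :* a :- D :* a) :* (c :* c :* c :- D :* c) :+ (a :* a :* a :- D :* a) :* (c :* c :* c :- D :* c))) := ((c :- a) :* (c :- a)) :* ((a :* c :+ D) :* (a :* c :+ D))) refl

  -- For coinciding points `D-eq` reads l · 2y = 3x² - D; squaring it and eliminating y² leaves (x²
  -- + D)².
  doubling : ∀ {D x₁ y₁ x₃ y₃ l} → Line D x₁ y₁ x₁ y₁ x₃ y₃ l → On D x₁ y₁ → x₃ * ((y₁ + y₁) * (y₁ + y₁)) ≡ (x₁ * x₁ + D) * (x₁ * x₁ + D)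
  doubling {D} {x} {y} {x₃} {y₃} {l} L on = trans (cong (_* ((y + y) * (y + y))) (Line.x₃-eq L)) (trans (r₁ x y l)
    (trans (cong₂ (λ t u → t * t - (x + x) * (u + u + (u + u))) slope on) (r₂ D x)))
    where
    r₁ : ∀ x y l → (l * l - x - x) * ((y + y) * (y + y)) ≡ (l * (y + y)) * (l * (y + y)) - (x + x) * (y * y + y * y + (y * y + y * y))
    r₁ = solve 3 (λ x y l → (l :* l :- x :- x) :* ((y :+ y) :* (y :+ y)) := (l :* (y :+ y)) :* (l :* (y :+ y)) :- (x :+ x) :* (y :* y :+ y :* y :+ (y :* y :+ y :* y))) refl
    r₂ : ∀ D x → (x * x + x * x + x * x - D) * (x * x + x * x + x * x - D) - (x + x) * ((x * x * x - D * x) + (x * x * x - D * x) + ((x * x * x - D * x) + (x * x * x - D * x))) ≡ (x * x + D) * (x * x + D)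
    r₂ = solve 2 (λ D x → (x :* x :+ x :* x :+ x :* x :- D) :* (x :* x :+ x :* x :+ x :* x :- D) :- (x :+ x) :* ((x :* x :* x :- D :* x) :+ (x :* x :* x :- D :* x) :+ ((x :* x :* x :- D :* x) :+ (x :* x :* x :- D :* x))) := (x :* x :+ D) :* (x :* x :+ D)) refl
    r₃ : ∀ s t → t ≡ s - (s - t)
    r₃ = solve 2 (λ s t → t := s :- (s :- t)) refl
    slope : l * (y + y) ≡ x * x + x * x + x * x - D
    slope = trans (r₃ (x * x + x * x + x * x) (l * (y + y))) (cong (λ t → x * x + x * x + x * x - t) (sym (Line.D-eq L)))

  -- `y₂-eq` determines the slope if x₁ ≢ x₂, and `D-eq` does if y₁ + y₂ ≢ 0.
  Line-unique : ∀ {D x₁ y₁ x₂ y₂ x₃ y₃ l x₃' y₃' l'} → Line D x₁ y₁ x₂ y₂ x₃ y₃ l → Line D x₁ y₁ x₂ y₂ x₃' y₃' l' →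
    x₁ ≢ x₂ ⊎ y₁ + y₂ ≢ 0ℚ → l ≡ l'
  Line-unique {D} {x₁} {y₁} {x₂} {y₂} {l = l} {l' = l'} L L' (inj₁ x₁≢x₂) =
    cancelˡ (x₂ - x₁) (λ e → x₁≢x₂ (sym (x-y≡0⇒x≡y x₂ x₁ e))) (trans (r y₁ (x₂ - x₁) l) (trans (cong (_- y₁) (trans (sym (Line.y₂-eq L)) (Line.y₂-eq L'))) (sym (r y₁ (x₂ - x₁) l'))))
    where
    r : ∀ y d l → d * l ≡ (y + l * d) - y
    r = solve 3 (λ y d l → d :* l := (y :+ l :* d) :- y) refl
  Line-unique {D} {x₁} {y₁} {x₂} {y₂} {l = l} {l' = l'} L L' (inj₂ y₁+y₂≢0) =
    cancelˡ (y₁ + y₂) y₁+y₂≢0 (trans (r s (y₁ + y₂) l) (trans (cong (λ t → s - t) (trans (sym (Line.D-eq L)) (Line.D-eq L'))) (sym (r s (y₁ + y₂) l'))))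
    where
    s = x₁ * x₁ + x₁ * x₂ + x₂ * x₂
    r : ∀ s d l → d * l ≡ s - (s - l * d)
    r = solve 3 (λ s d l → d :* l := s :- (s :- l :* d)) refl

  -- Associativity (U + V) + W = U + (V + W), with λ₁, μ the slopes of UV and VW. Writing xU - xW = (λ₁ - μ) s,
  -- the slopes of the two final chords are s - λ₁ and s - μ.
  associativity : ∀ {D v y p yU xS yS w yW xT yT λ₁ μ} → Line D v y p yU xS yS λ₁ → Line D v y w yW xT yT μ → λ₁ ≢ μ →
    ∀ s → w ≡ p - (λ₁ - μ) * s →
    let xZ = (s - λ₁) * (s - λ₁) - xS - w; yZ = (s - λ₁) * (xS - xZ) - yS in
    Line D xS yS w yW xZ yZ (s - λ₁) × Line D p yU xT yT xZ yZ (s - μ)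
  associativity {v = v} {y} {p} {λ₁ = λ₁} {μ} (line refl refl refl refl) (line refl D-eq refl refl) λ≢μ s refl =
    line (via 1ℚ (u₁ v y p λ₁ μ s)) (via (- λ₁) (u₂ v y p λ₁ μ s)) refl refl ,
    line (via (- 1ℚ) (t₁ v y p λ₁ μ s)) (via (- λ₁) (t₂ v y p λ₁ μ s)) (t₃ v p λ₁ μ s) (via 1ℚ (t₄ v y p λ₁ μ s))
    where
    -- Both lines pass through (v, y), and their two `D-eq` differ by (λ₁ - μ)(2y - κ). Hence 2y =
    -- κ, and an identity below need only hold up to a multiple of 2y - κ; `via` takes the factor.
    κ : ℚ
    κ = s * (v + p + (p - (λ₁ - μ) * s)) - (λ₁ + μ) * (p - v) - μ * μ * s
    r : ∀ v y p l m s → (l - m) * (y + y) ≡ (l - m) * (s * (v + p + (p - (l - m) * s)) - (l + m) * (p - v) - m * m * s) + ((v * v + v * (p - (l - m) * s) + (p - (l - m) * s) * (p - (l - m) * s) - m * (y + (y + m * ((p - (l - m) * s) - v)))) - (v * v + v * p + p * p - l * (y + (y + l * (p - v)))))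
    r = solve 6 (λ v y p l m s → (l :- m) :* (y :+ y) := (l :- m) :* (s :* (v :+ p :+ (p :- (l :- m) :* s)) :- (l :+ m) :* (p :- v) :- m :* m :* s) :+ ((v :* v :+ v :* (p :- (l :- m) :* s) :+ (p :- (l :- m) :* s) :* (p :- (l :- m) :* s) :- m :* (y :+ (y :+ m :* ((p :- (l :- m) :* s) :- v)))) :- (v :* v :+ v :* p :+ p :* p :- l :* (y :+ (y :+ l :* (p :- v)))))) refl
    2y≡κ : y + y ≡ κ
    2y≡κ = cancelˡ (λ₁ - μ) (λ e → λ≢μ (x-y≡0⇒x≡y λ₁ μ e)) (trans (r v y p λ₁ μ s) (trans (cong ((λ₁ - μ) * κ +_) (x-x≡0 (sym D-eq))) (+-identityʳ _)))
    via : ∀ {a b} c → a - b ≡ c * ((y + y) - κ) → a ≡ b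
    via {a} {b} c e = x-y≡0⇒x≡y a b (trans e (trans (cong (c *_) (x-x≡0 2y≡κ)) (*-zeroʳ c)))
    u₁ : ∀ v y p l m s → (y + m * ((p - (l - m) * s) - v)) - ((l * (v - (l * l - v - p)) - y) + (s - l) * ((p - (l - m) * s) - (l * l - v - p))) ≡ 1ℚ * ((y + y) - (s * (v + p + (p - (l - m) * s)) - (l + m) * (p - v) - m * m * s))
    u₁ = solve 6 (λ v y p l m s → (y :+ m :* ((p :- (l :- m) :* s) :- v)) :- ((l :* (v :- (l :* l :- v :- p)) :- y) :+ (s :- l) :* ((p :- (l :- m) :* s) :- (l :* l :- v :- p))) := con 1ℚ :* ((y :+ y) :- (s :* (v :+ p :+ (p :- (l :- m) :* s)) :- (l :+ m) :* (p :- v) :- m :* m :* s))) refl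
    u₂ : ∀ v y p l m s → (v * v + v * p + p * p - l * (y + (y + l * (p - v)))) - ((l * l - v - p) * (l * l - v - p) + (l * l - v - p) * (p - (l - m) * s) + (p - (l - m) * s) * (p - (l - m) * s) - (s - l) * ((l * (v - (l * l - v - p)) - y) + (y + m * ((p - (l - m) * s) - v)))) ≡ (- l) * ((y + y) - (s * (v + p + (p - (l - m) * s)) - (l + m) * (p - v) - m * m * s))
    u₂ = solve 6 (λ v y p l m s → (v :* v :+ v :* p :+ p :* p :- l :* (y :+ (y :+ l :* (p :- v)))) :- ((l :* l :- v :- p) :* (l :* l :- v :- p) :+ (l :* l :- v :- p) :* (p :- (l :- m) :* s) :+ (p :- (l :- m) :* s) :* (p :- (l :- m) :* s) :- (s :- l) :* ((l :* (v :- (l :* l :- v :- p)) :- y) :+ (y :+ m :* ((p :- (l :- m) :* s) :- v)))) := (:- l) :* ((y :+ y) :- (s :* (v :+ p :+ (p :- (l :- m) :* s)) :- (l :+ m) :* (p :- v) :- m :* m :* s))) refl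
    t₁ : ∀ v y p l m s → (m * (v - (m * m - v - (p - (l - m) * s))) - y) - ((y + l * (p - v)) + (s - m) * ((m * m - v - (p - (l - m) * s)) - p)) ≡ (- 1ℚ) * ((y + y) - (s * (v + p + (p - (l - m) * s)) - (l + m) * (p - v) - m * m * s))
    t₁ = solve 6 (λ v y p l m s → (m :* (v :- (m :* m :- v :- (p :- (l :- m) :* s))) :- y) :- ((y :+ l :* (p :- v)) :+ (s :- m) :* ((m :* m :- v :- (p :- (l :- m) :* s)) :- p)) := (:- con 1ℚ) :* ((y :+ y) :- (s :* (v :+ p :+ (p :- (l :- m) :* s)) :- (l :+ m) :* (p :- v) :- m :* m :* s))) refl
    t₂ : ∀ v y p l m s → (v * v + v * p + p * p - l * (y + (y + l * (p - v)))) - (p * p + p * (m * m - v - (p - (l - m) * s)) + (m * m - v - (p - (l - m) * s)) * (m * m - v - (p - (l - m) * s)) - (s - m) * ((y + l * (p - v)) + (m * (v - (m * m - v - (p - (l - m) * s))) - y))) ≡ (- l) * ((y + y) - (s * (v + p + (p - (l - m) * s)) - (l + m) * (p - v) - m * m * s))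
    t₂ = solve 6 (λ v y p l m s → (v :* v :+ v :* p :+ p :* p :- l :* (y :+ (y :+ l :* (p :- v)))) :- (p :* p :+ p :* (m :* m :- v :- (p :- (l :- m) :* s)) :+ (m :* m :- v :- (p :- (l :- m) :* s)) :* (m :* m :- v :- (p :- (l :- m) :* s)) :- (s :- m) :* ((y :+ l :* (p :- v)) :+ (m :* (v :- (m :* m :- v :- (p :- (l :- m) :* s))) :- y))) := (:- l) :* ((y :+ y) :- (s :* (v :+ p :+ (p :- (l :- m) :* s)) :- (l :+ m) :* (p :- v) :- m :* m :* s))) refl
    t₃ : ∀ v p l m s → (s - l) * (s - l) - (l * l - v - p) - (p - (l - m) * s) ≡ (s - m) * (s - m) - p - (m * m - v - (p - (l - m) * s))
    t₃ = solve 5 (λ v p l m s → (s :- l) :* (s :- l) :- (l :* l :- v :- p) :- (p :- (l :- m) :* s) := (s :- m) :* (s :- m) :- p :- (m :* m :- v :- (p :- (l :- m) :* s))) refl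
    t₄ : ∀ v y p l m s → ((s - l) * ((l * l - v - p) - ((s - l) * (s - l) - (l * l - v - p) - (p - (l - m) * s))) - (l * (v - (l * l - v - p)) - y)) - ((s - m) * (p - ((s - l) * (s - l) - (l * l - v - p) - (p - (l - m) * s))) - (y + l * (p - v))) ≡ 1ℚ * ((y + y) - (s * (v + p + (p - (l - m) * s)) - (l + m) * (p - v) - m * m * s))
    t₄ = solve 6 (λ v y p l m s → ((s :- l) :* ((l :* l :- v :- p) :- ((s :- l) :* (s :- l) :- (l :* l :- v :- p) :- (p :- (l :- m) :* s))) :- (l :* (v :- (l :* l :- v :- p)) :- y)) :- ((s :- m) :* (p :- ((s :- l) :* (s :- l) :- (l :* l :- v :- p) :- (p :- (l :- m) :* s))) :- (y :+ l :* (p :- v))) := con 1ℚ :* ((y :+ y) :- (s :* (v :+ p :+ (p :- (l :- m) :* s)) :- (l :+ m) :* (p :- v) :- m :* m :* s))) refl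

-- The multiples of P and the relations among them

module Multiples where

  open import Defs
  open Line
  open import Data.Nat as ℕ using (ℕ; zero; suc; s≤s; z≤n)
  open import Data.Integer as ℤ using (ℤ)
  open import Data.Rational using (ℚ; 0ℚ; 1ℚ; _+_; _*_; _-_; -_; 1/_; ≢-nonZero)
  open import Data.Rational.Properties
  open import Data.Rational.Solver using (module +-*-Solver)
  open +-*-Solver
  open import Data.Product using (∃; _×_; _,_; proj₁; proj₂)
  open import Data.Sum using (_⊎_; inj₁; inj₂)
  open import Data.Empty using (⊥; ⊥-elim)
  open import Relation.Binary.PropositionalEquality
  open import Relation.Nullary using (yes; no)

  div-* : ∀ p q → q ≢ 0ℚ → div p q * q ≡ p
  div-* p q q≢0 with q ≟ 0ℚ
  ... | yes q≡0 = ⊥-elim (q≢0 q≡0)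
  ... | no q≢0' = trans (*-assoc p (1/ q) q) (trans (cong (p *_) (*-inverseˡ q)) (*-identityʳ p))
    where instance _ = ≢-nonZero q≢0'

  -‿≢0 : ∀ {x y} → x ≢ y → y - x ≢ 0ℚ
  -‿≢0 {x} {y} x≢y e = x≢y (sym (x-y≡0⇒x≡y y x e))

  x+x≡0⇒x≡0 : ∀ x → x + x ≡ 0ℚ → x ≡ 0ℚ
  x+x≡0⇒x≡0 x e = integral-domain (1ℚ + 1ℚ) x (trans (r x) e) (λ ())
    where
    r : ∀ x → (1ℚ + 1ℚ) * x ≡ x + x
    r = solve 1 (λ x → (con 1ℚ :+ con 1ℚ) :* x := x :+ x) refl

  Nondegenerate : (x₁ y₁ x₂ y₂ : ℚ) → Set
  Nondegenerate x₁ y₁ x₂ y₂ = x₁ ≢ x₂ ⊎ y₁ + y₂ ≢ 0ℚ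

  module Construction (N : ℤ) where
    private
      D : ℚ
      D = fromℤ N * fromℤ N

    -- Both finite branches of `add` yield a `Line`. On a chord `D-eq` follows from the two curve
    -- equations by cancelling x₂ - x₁; on a tangent y₁ + y₂ ≢ 0 forces y₁ = y₂, and the slope
    -- formula is `D-eq`.
    add-line : ∀ x₁ y₁ x₂ y₂ → On D x₁ y₁ → On D x₂ y₂ →
      add N (aff x₁ y₁) (aff x₂ y₂) ≡ O ⊎
      (∃ λ x₃ → ∃ λ y₃ → ∃ λ l → add N (aff x₁ y₁) (aff x₂ y₂) ≡ aff x₃ y₃ × Line D x₁ y₁ x₂ y₂ x₃ y₃ l × Nondegenerate x₁ y₁ x₂ y₂)
    add-line x₁ y₁ x₂ y₂ on₁ on₂ with x₁ ≟ x₂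
    ... | no x₁≢x₂ = inj₂ (_ , _ , l , refl , line chord tangent refl refl , inj₁ x₁≢x₂)
      where
      l : ℚ
      l = div (y₂ - y₁) (x₂ - x₁)
      l* : l * (x₂ - x₁) ≡ y₂ - y₁
      l* = div-* (y₂ - y₁) (x₂ - x₁) (-‿≢0 x₁≢x₂)
      r₁ : ∀ a b → b ≡ a + (b - a)
      r₁ = solve 2 (λ a b → b := a :+ (b :- a)) refl
      r₂ : ∀ D a c → (c - a) * D ≡ c * c * c - a * a * a - ((c * c * c - D * c) - (a * a * a - D * a))
      r₂ = solve 3 (λ D a c → (c :- a) :* D := c :* c :* c :- a :* a :* a :- ((c :* c :* c :- D :* c) :- (a :* a :* a :- D :* a))) refl
      r₃ : ∀ a b c d l → c * c * c - a * a * a - (d * d - b * b) ≡ c * c * c - a * a * a - (d - b) * (b + d)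
      r₃ = solve 5 (λ a b c d l → c :* c :* c :- a :* a :* a :- (d :* d :- b :* b) := c :* c :* c :- a :* a :* a :- (d :- b) :* (b :+ d)) refl
      r₄ : ∀ a b c d l → c * c * c - a * a * a - (l * (c - a)) * (b + d) ≡ (c - a) * (a * a + a * c + c * c - l * (b + d))
      r₄ = solve 5 (λ a b c d l → c :* c :* c :- a :* a :* a :- (l :* (c :- a)) :* (b :+ d) := (c :- a) :* (a :* a :+ a :* c :+ c :* c :- l :* (b :+ d))) refl
      chord : y₂ ≡ y₁ + l * (x₂ - x₁)
      chord = trans (r₁ y₁ y₂) (cong (y₁ +_) (sym l*))
      tangent : D ≡ x₁ * x₁ + x₁ * x₂ + x₂ * x₂ - l * (y₁ + y₂)
      tangent = cancelˡ (x₂ - x₁) (-‿≢0 x₁≢x₂) (trans (r₂ D x₁ x₂)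
        (trans (cong₂ (λ s t → x₂ * x₂ * x₂ - x₁ * x₁ * x₁ - (s - t)) (sym on₂) (sym on₁))
        (trans (r₃ x₁ y₁ x₂ y₂ l) (trans (cong (λ t → x₂ * x₂ * x₂ - x₁ * x₁ * x₁ - t * (y₁ + y₂)) (sym l*)) (r₄ x₁ y₁ x₂ y₂ l)))))
    ... | yes refl with y₁ + y₂ ≟ 0ℚ
    ...   | yes _ = inj₁ refl
    ...   | no y₁+y₂≢0 = inj₂ (_ , _ , l , refl , line chord tangent refl refl , inj₂ y₁+y₂≢0)
      where
      l : ℚ
      l = div (fromℤ (ℤ.+ 3) * x₁ * x₁ - fromℤ N * fromℤ N) (fromℤ (ℤ.+ 2) * y₁)
      r₁ : ∀ b d → (b + d) * (b - d) ≡ b * b - d * d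
      r₁ = solve 2 (λ b d → (b :+ d) :* (b :- d) := b :* b :- d :* d) refl
      r₂ : ∀ a y l → y ≡ y + l * (a - a)
      r₂ = solve 3 (λ a y l → y := y :+ l :* (a :- a)) refl
      r₃ : ∀ y → (1ℚ + 1ℚ) * y ≡ y + y
      r₃ = solve 1 (λ y → (con 1ℚ :+ con 1ℚ) :* y := y :+ y) refl
      r₄ : ∀ D x → (1ℚ + 1ℚ + 1ℚ) * x * x - D ≡ x * x + x * x + x * x - D
      r₄ = solve 2 (λ D x → (con 1ℚ :+ con 1ℚ :+ con 1ℚ) :* x :* x :- D := x :* x :+ x :* x :+ x :* x :- D) refl
      r₅ : ∀ s t → t ≡ s - (s - t)
      r₅ = solve 2 (λ s t → t := s :- (s :- t)) refl
      y₁≡y₂ : y₁ ≡ y₂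
      y₁≡y₂ = x-y≡0⇒x≡y y₁ y₂ (integral-domain (y₁ + y₂) (y₁ - y₂) (trans (r₁ y₁ y₂) (x-x≡0 (trans on₁ (sym on₂)))) y₁+y₂≢0)
      2y≡ : fromℤ (ℤ.+ 2) * y₁ ≡ y₁ + y₂
      2y≡ = trans (r₃ y₁) (cong (y₁ +_) y₁≡y₂)
      l* : l * (y₁ + y₂) ≡ x₁ * x₁ + x₁ * x₁ + x₁ * x₁ - D
      l* = trans (cong (l *_) (sym 2y≡)) (trans (div-* _ (fromℤ (ℤ.+ 2) * y₁) (λ e → y₁+y₂≢0 (trans (sym 2y≡) e))) (r₄ D x₁))
      chord : y₂ ≡ y₁ + l * (x₁ - x₁)
      chord = trans (sym y₁≡y₂) (r₂ x₁ y₁ l)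
      tangent : D ≡ x₁ * x₁ + x₁ * x₁ + x₁ * x₁ - l * (y₁ + y₂)
      tangent = trans (r₅ (x₁ * x₁ + x₁ * x₁ + x₁ * x₁) D) (cong (λ t → x₁ * x₁ + x₁ * x₁ + x₁ * x₁ - t) (sym l*))

    module _ (x₀ y₀ : ℚ) (on₀ : On D x₀ y₀) (nt : NonTorsion N (aff x₀ y₀)) (D≢0 : D ≢ 0ℚ) where
      private
        P : Point
        P = aff x₀ y₀

        xOf yOf : Point → ℚ
        xOf O         = 0ℚ
        xOf (aff x _) = x
        yOf O         = 0ℚ
        yOf (aff _ y) = y

      x y : ℕ → ℚ
      x n = xOf (smul N n P)
      y n = yOf (smul N n P)

      private
        coords : ∀ {Q} → Q ≢ O → Q ≡ aff (xOf Q) (yOf Q)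
        coords {O}       Q≢O = ⊥-elim (Q≢O refl)
        coords {aff _ _} _   = refl

      smul≡ : ∀ n → smul N (suc n) P ≡ aff (x (suc n)) (y (suc n))
      smul≡ n = coords (nt (suc n) (s≤s z≤n))

      private
        sum-line : ∀ n → On D (x (suc n)) (y (suc n)) → ∃ λ l → Line D (x 1) (y 1) (x (suc n)) (y (suc n)) (x (suc (suc n))) (y (suc (suc n))) l × Nondegenerate (x 1) (y 1) (x (suc n)) (y (suc n))
        sum-line n on with add-line (x 1) (y 1) (x (suc n)) (y (suc n)) on₀ on
        ... | inj₁ e = ⊥-elim (nt (suc (suc n)) (s≤s z≤n) (trans (cong (add N P) (smul≡ n)) e))
        ... | inj₂ (x₃ , y₃ , l , e , L , nd) = l , subst₂ (λ a b → Line D (x 1) (y 1) (x (suc n)) (y (suc n)) a b l) (cong xOf (sym e')) (cong yOf (sym e')) L , nd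
          where
          e' : smul N (suc (suc n)) P ≡ aff x₃ y₃
          e' = trans (cong (add N P) (smul≡ n)) e

      on : ∀ n → On D (x (suc n)) (y (suc n))
      on zero    = on₀
      on (suc n) = Line-on₃ (proj₁ (proj₂ (sum-line n (on n)))) on₀

      private
        line₁ : ∀ n → ∃ λ l → Line D (x 1) (y 1) (x (suc n)) (y (suc n)) (x (suc (suc n))) (y (suc (suc n))) l × Nondegenerate (x 1) (y 1) (x (suc n)) (y (suc n))
        line₁ n = sum-line n (on n)

      private
        SumLine : ℕ → ℕ → Set
        SumLine i j = ∃ λ l → Line D (x i) (y i) (x j) (y j) (x (i ℕ.+ j)) (y (i ℕ.+ j)) l

      private
        same : ∀ {v y p yU xS yS yW xT yT xZ yZ λ₁ σ} → Line D v y p yU xS yS λ₁ → Line D v y p yW xT yT λ₁ →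
          Line D p yU xT yT xZ yZ σ → Line D xS yS p yW xZ yZ σ
        same (line refl _ refl refl) (line refl _ refl refl) L = Line-comm L

        -- U = P, V = j P, W = i P
        step : ∀ {v y p yU xS yS w yW xT yT xZ yZ λ₁ μ σ} → Line D v y p yU xS yS λ₁ → Line D v y w yW xT yT μ →
          Line D p yU xT yT xZ yZ σ → Nondegenerate p yU xT yT → ∃ λ l → Line D xS yS w yW xZ yZ l
        step {v} {y} {p} {yU} {xS} {yS} {w} {yW} {xT} {yT} {xZ} {yZ} {λ₁} {μ} {σ} L L' LZ nd with λ₁ ≟ μ
        ... | no λ≢μ = s - λ₁ , subst₂ (λ a b → Line D xS yS w yW a b (s - λ₁)) (sym xZ≡) (sym yZ≡) (proj₁ assoc)
          where
          s : ℚ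
          s = div (p - w) (λ₁ - μ)
          r : ∀ p w → w ≡ p - (p - w)
          r = solve 2 (λ p w → w := p :- (p :- w)) refl
          r' : ∀ s t → t * s ≡ s * t
          r' = solve 2 (λ s t → t :* s := s :* t) refl
          w≡ : w ≡ p - (λ₁ - μ) * s
          w≡ = trans (r p w) (cong (λ t → p - t) (sym (trans (r' s (λ₁ - μ)) (div-* (p - w) (λ₁ - μ) (λ e → λ≢μ (x-y≡0⇒x≡y λ₁ μ e))))))
          assoc = associativity L L' λ≢μ s w≡
          σ≡ : σ ≡ s - μ
          σ≡ = Line-unique LZ (proj₂ assoc) nd
          xZ≡ : xZ ≡ (s - λ₁) * (s - λ₁) - xS - w
          xZ≡ = trans (Line.x₃-eq LZ) (trans (cong (λ t → t * t - p - xT) σ≡) (sym (Line.x₃-eq (proj₂ assoc))))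
          yZ≡ : yZ ≡ (s - λ₁) * (xS - ((s - λ₁) * (s - λ₁) - xS - w)) - yS
          yZ≡ = trans (Line.y₃-eq LZ) (trans (cong₂ (λ t u → t * (p - u) - yU) σ≡ xZ≡) (sym (Line.y₃-eq (proj₂ assoc))))
        -- Equal slopes put U, V and W on one line. Either U and W coincide, and commutativity
        -- suffices, or V + W = -U, and then U and V + W are the excluded degenerate pair.
        ... | yes refl = cases (p ≟ w)
          where
          r₁ : ∀ v y p w l → (p - w) * (v + p + w - l * l) ≡ (v * v + v * p + p * p - l * (y + (y + l * (p - v)))) - (v * v + v * w + w * w - l * (y + (y + l * (w - v))))
          r₁ = solve 5 (λ v y p w l → (p :- w) :* (v :+ p :+ w :- l :* l) := (v :* v :+ v :* p :+ p :* p :- l :* (y :+ (y :+ l :* (p :- v)))) :- (v :* v :+ v :* w :+ w :* w :- l :* (y :+ (y :+ l :* (w :- v))))) refl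
          r₂ : ∀ v p w l → l * l - v - w ≡ p - (v + p + w - l * l)
          r₂ = solve 4 (λ v p w l → l :* l :- v :- w := p :- (v :+ p :+ w :- l :* l)) refl
          r₃ : ∀ v y p l → (y + l * (p - v)) + (l * (v - p) - y) ≡ 0ℚ
          r₃ = solve 4 (λ v y p l → (y :+ l :* (p :- v)) :+ (l :* (v :- p) :- y) := con 0ℚ) refl
          D≡ : ∀ {w yW xT yT} → Line D v y w yW xT yT λ₁ → D ≡ v * v + v * w + w * w - λ₁ * (y + (y + λ₁ * (w - v)))
          D≡ (line refl e _ _) = e
          cases : _ → ∃ λ l → Line D xS yS w yW xZ yZ l
          cases (yes refl) = σ , same L L' LZ
          cases (no p≢w) = ⊥-elim (degenerate nd)
            where
            root : v + p + w - λ₁ * λ₁ ≡ 0ℚ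
            root = integral-domain (p - w) _ (trans (r₁ v y p w λ₁) (x-x≡0 (trans (sym (D≡ L)) (D≡ L')))) (λ e → p≢w (x-y≡0⇒x≡y p w e))
            xT≡ : xT ≡ p
            xT≡ = trans (Line.x₃-eq L') (trans (r₂ v p w λ₁) (trans (cong (λ t → p - t) root) (+-identityʳ p)))
            degenerate : Nondegenerate p yU xT yT → ⊥
            degenerate (inj₁ p≢xT) = p≢xT (sym xT≡)
            degenerate (inj₂ ≢0) = ≢0 (trans (cong₂ _+_ (Line.y₂-eq L) (trans (Line.y₃-eq L') (cong (λ t → λ₁ * (v - t) - y) xT≡))) (r₃ v y p λ₁))

      -- Induction on i: with (i + 2)P = P + (i + 1)P, associativity moves the first P to the
      -- outside of the sum. The required nondegeneracy comes from `line₁`, that is from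
      -- `NonTorsion`.
      sumLine : ∀ i j → SumLine (suc i) (suc j)
      sumLine zero j = proj₁ (line₁ j) , proj₁ (proj₂ (line₁ j))
      sumLine (suc i) j = step (Line-comm (proj₁ (proj₂ (line₁ i)))) (proj₂ (sumLine i j)) (proj₁ (proj₂ last)) (proj₂ (proj₂ last))
        where last = line₁ (i ℕ.+ suc j)

      -- Doubling a multiple never gives O, so its tangent line exists. If y = 0, `D-eq` of this
      -- line becomes D = 3x², while the curve gives x³ = Dx; so x = 0 and D = 0.
      y≢0 : ∀ n → y (suc n) ≢ 0ℚ
      y≢0 n y≡0 = D≢0 (trans D≡ (trans (cong (λ t → t * t + t * t + t * t - l * (y' + y')) x≡0) (trans (cong (λ t → 0ℚ - l * (t + t)) y≡0) (r₂ l))))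
        where
        x' = x (suc n)
        y' = y (suc n)
        l = proj₁ (sumLine n n)
        r₂ : ∀ l → 0ℚ - l * (0ℚ + 0ℚ) ≡ 0ℚ
        r₂ = solve 1 (λ l → con 0ℚ :- l :* (con 0ℚ :+ con 0ℚ) := con 0ℚ) refl
        r₃ : ∀ x → x * x * x - (x * x + x * x + x * x) * x ≡ (0ℚ - (1ℚ + 1ℚ)) * (x * (x * x))
        r₃ = solve 1 (λ x → x :* x :* x :- (x :* x :+ x :* x :+ x :* x) :* x := (con 0ℚ :- (con 1ℚ :+ con 1ℚ)) :* (x :* (x :* x))) refl
        D≡ : D ≡ x' * x' + x' * x' + x' * x' - l * (y' + y')
        D≡ = Line.D-eq (proj₂ (sumLine n n))
        D≡' : D ≡ x' * x' + x' * x' + x' * x'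
        D≡' = trans D≡ (trans (cong (λ t → x' * x' + x' * x' + x' * x' - l * (t + t)) y≡0) (trans (cong (λ t → x' * x' + x' * x' + x' * x' - t) (*-zeroʳ l)) (+-identityʳ _)))
        cube : (0ℚ - (1ℚ + 1ℚ)) * (x' * (x' * x')) ≡ 0ℚ
        cube = trans (sym (r₃ x')) (trans (cong (λ t → x' * x' * x' - t * x') (sym D≡')) (trans (sym (on n)) (cong (λ t → t * t) y≡0)))
        nonzero : x' ≢ 0ℚ → ⊥
        nonzero x≢0 = x≢0 (integral-domain x' x' (integral-domain x' (x' * x') (integral-domain (0ℚ - (1ℚ + 1ℚ)) _ cube (λ ())) x≢0) x≢0)
        x≡0 : x' ≡ 0ℚ
        x≡0 with x' ≟ 0ℚ
        ... | yes e = e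
        ... | no x≢0 = ⊥-elim (nonzero x≢0)

      -- For equal abscissae the line through the two multiples gives equal ordinates, since its
      -- slope is finite, and the line expressing the larger multiple as a sum gives opposite ones.
      -- So the ordinate would be 0.
      x-injective : ∀ i j → x (suc (i ℕ.+ suc j)) ≢ x (suc i)
      x-injective i j e = y≢0 i (x+x≡0⇒x≡0 (y (suc i)) (trans (cong₂ _+_ (sym from-sum) from-difference) (r (y (suc (i ℕ.+ suc j))) (proj₁ (sumLine i j)) (x (suc i)))))
        where
        xᵢ = x (suc i)
        k = suc (i ℕ.+ suc j)
        L = proj₂ (sumLine i j)
        l = proj₁ (sumLine i j)
        L' = proj₂ (sumLine i (i ℕ.+ suc j))
        from-difference : y (suc i) ≡ l * (xᵢ - xᵢ) - y k
        from-difference = trans (r₁ (l * (xᵢ - xᵢ)) (y (suc i))) (cong (λ t → l * (xᵢ - xᵢ) - t) (sym (trans (Line.y₃-eq L) (cong (λ t → l * (xᵢ - t) - y (suc i)) e))))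
          where
          r₁ : ∀ a b → b ≡ a - (a - b)
          r₁ = solve 2 (λ a b → b := a :- (a :- b)) refl
        from-sum : y k ≡ y (suc i)
        from-sum = trans (Line.y₂-eq L') (trans (cong (λ t → y (suc i) + proj₁ (sumLine i (i ℕ.+ suc j)) * (t - xᵢ)) e) (r₂ (y (suc i)) (proj₁ (sumLine i (i ℕ.+ suc j))) xᵢ))
          where
          r₂ : ∀ y l a → y + l * (a - a) ≡ y
          r₂ = solve 3 (λ y l a → y :+ l :* (a :- a) := y) refl
        r : ∀ y l a → y + (l * (a - a) - y) ≡ 0ℚ
        r = solve 3 (λ y l a → y :+ (l :* (a :- a) :- y) := con 0ℚ) refl

  -- The interface to the curve: from here on the multiples are handled through these relations
  -- instead of `add`.
  record Orbit (N : ℤ) (P : Point) : Set where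
    D : ℚ
    D = fromℤ N * fromℤ N
    field
      x y         : ℕ → ℚ
      point       : P ≡ aff (x 1) (y 1)
      multiple    : ∀ n → smul N (suc n) P ≡ aff (x (suc n)) (y (suc n))
      on-curve    : ∀ n → On D (x (suc n)) (y (suc n))
      sum-line    : ∀ i j → ∃ λ l → Line D (x (suc i)) (y (suc i)) (x (suc j)) (y (suc j)) (x (suc i ℕ.+ suc j)) (y (suc i ℕ.+ suc j)) l
      y≢0         : ∀ n → y (suc n) ≢ 0ℚ
      x-injective : ∀ i j → x (suc (i ℕ.+ suc j)) ≢ x (suc i)

  orbit : ∀ N x₀ y₀ → OnCurve N (aff x₀ y₀) → NonTorsion N (aff x₀ y₀) → fromℤ N * fromℤ N ≢ 0ℚ → Orbit N (aff x₀ y₀)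
  orbit N x₀ y₀ on₀ nt D≢0 = record
    { x = Construction.x N x₀ y₀ on₀ nt D≢0
    ; y = Construction.y N x₀ y₀ on₀ nt D≢0
    ; point = refl
    ; multiple = Construction.smul≡ N x₀ y₀ on₀ nt D≢0
    ; on-curve = Construction.on N x₀ y₀ on₀ nt D≢0
    ; sum-line = Construction.sumLine N x₀ y₀ on₀ nt D≢0
    ; y≢0 = Construction.y≢0 N x₀ y₀ on₀ nt D≢0
    ; x-injective = Construction.x-injective N x₀ y₀ on₀ nt D≢0
    }

-- Clearing denominators

module Fractions where

  open import Defs
  open Line
  open Multiples
  open import Data.Nat as ℕ using (ℕ; suc; s≤s; z≤n)
  import Data.Nat.Properties as ℕₚ
  import Data.Nat.Divisibility as ℕD
  open import Data.Nat.Coprimality as C using (Coprime)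
  open import Data.Integer as ℤ using (ℤ; +_; -[1+_]; ∣_∣; 0ℤ)
  import Data.Integer.Properties as ℤₚ
  open import Data.Rational using (ℚ; mkℚ; 0ℚ; 1ℚ; _+_; _*_; _-_; -_; ↥_; ↧_; ↧ₙ_; _<_; _≤_; toℚᵘ)
  open import Data.Rational.Properties
  import Data.Rational.Unnormalised as ℚᵘ
  import Data.Rational.Unnormalised.Properties as ℚᵘₚ
  open import Data.Rational.Solver using (module +-*-Solver)
  open +-*-Solver
  open import Data.Product using (∃; _,_)
  open import Relation.Binary.PropositionalEquality

  ι : ℤ → ℚ
  ι = fromℤ

  private
    toℚᵘ-ι : ∀ a → toℚᵘ (ι a) ℚᵘ.≃ ℚᵘ.mkℚᵘ a 0
    toℚᵘ-ι a = toℚᵘ-fromℚᵘ (ℚᵘ.mkℚᵘ a 0)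

  ι-* : ∀ a b → ι a * ι b ≡ ι (a ℤ.* b)
  ι-* a b = toℚᵘ-injective (ℚᵘₚ.≃-trans (toℚᵘ-homo-* (ι a) (ι b)) (ℚᵘₚ.≃-trans (ℚᵘₚ.*-cong (toℚᵘ-ι a) (toℚᵘ-ι b)) (ℚᵘₚ.≃-sym (toℚᵘ-ι (a ℤ.* b)))))

  ι-+ : ∀ a b → ι a + ι b ≡ ι (a ℤ.+ b)
  ι-+ a b = toℚᵘ-injective (ℚᵘₚ.≃-trans (toℚᵘ-homo-+ (ι a) (ι b)) (ℚᵘₚ.≃-trans (ℚᵘₚ.+-cong (toℚᵘ-ι a) (toℚᵘ-ι b))
    (ℚᵘₚ.≃-trans (ℚᵘ.*≡* (cong (ℤ._* + 1) (cong₂ ℤ._+_ (ℤₚ.*-identityʳ a) (ℤₚ.*-identityʳ b)))) (ℚᵘₚ.≃-sym (toℚᵘ-ι (a ℤ.+ b))))))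

  ι-neg : ∀ a → - ι a ≡ ι (ℤ.- a)
  ι-neg a = toℚᵘ-injective (ℚᵘₚ.≃-trans (toℚᵘ-homo‿- (ι a)) (ℚᵘₚ.≃-trans (ℚᵘₚ.-‿cong (toℚᵘ-ι a)) (ℚᵘₚ.≃-sym (toℚᵘ-ι (ℤ.- a)))))

  ι-- : ∀ a b → ι a - ι b ≡ ι (a ℤ.- b)
  ι-- a b = trans (cong (λ t → ι a + t) (ι-neg b)) (ι-+ a (ℤ.- b))

  ι-injective : ∀ {a b} → ι a ≡ ι b → a ≡ b
  ι-injective {a} {b} e with ℚᵘₚ.≃-trans (ℚᵘₚ.≃-sym (toℚᵘ-ι a)) (ℚᵘₚ.≃-trans (toℚᵘ-cong e) (toℚᵘ-ι b))
  ... | ℚᵘ.*≡* e' = trans (sym (ℤₚ.*-identityʳ a)) (trans e' (ℤₚ.*-identityʳ b))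

  ι≢0 : ∀ {a} → a ≢ 0ℤ → ι a ≢ 0ℚ
  ι≢0 a≢0 e = a≢0 (ι-injective e)

  *-denominator : ∀ x → x * ι (↧ x) ≡ ι (↥ x)
  *-denominator x@(mkℚ n d c) = toℚᵘ-injective (ℚᵘₚ.≃-trans (toℚᵘ-homo-* x (ι (↧ x))) (ℚᵘₚ.≃-trans (ℚᵘₚ.*-cong (ℚᵘₚ.≃-refl {toℚᵘ x}) (toℚᵘ-ι (↧ x)))
    (ℚᵘₚ.≃-trans (ℚᵘ.*≡* (trans (ℤₚ.*-identityʳ _) (cong (λ m → n ℤ.* + suc m) (sym (ℕₚ.*-identityʳ d))))) (ℚᵘₚ.≃-sym (toℚᵘ-ι n)))))

  coprime-numerator : ∀ x → Coprime ∣ ↥ x ∣ (↧ₙ x)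
  coprime-numerator (mkℚ n d c) = C.recompute c

  -- With r = n / d in lowest terms, a d² = n² makes d divide n, so d = 1.
  integer-square : ∀ a r → ι a ≡ r * r → ∃ λ (s : ℕ) → a ≡ + (s ℕ.* s)
  integer-square a r e = ∣ n ∣ , trans a≡n² (trans (sym (ℤₚ.0≤i⇒+∣i∣≡i (square≥0 n))) (cong +_ (ℤₚ.abs-* n n)))
    where
    n = ↥ r
    d = ↧ₙ r
    r₁ : ∀ r t → (r * r) * (t * t) ≡ (r * t) * (r * t)
    r₁ = solve 2 (λ r t → (r :* r) :* (t :* t) := (r :* t) :* (r :* t)) refl
    cleared : a ℤ.* (+ d ℤ.* + d) ≡ n ℤ.* n
    cleared = ι-injective (trans (sym (trans (cong (ι a *_) (ι-* (+ d) (+ d))) (ι-* a (+ d ℤ.* + d)))) (trans (cong (_* (ι (+ d) * ι (+ d))) e)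
      (trans (r₁ r (ι (+ d))) (trans (cong₂ _*_ (*-denominator r) (*-denominator r)) (ι-* n n)))))
    natural : ∣ a ∣ ℕ.* (d ℕ.* d) ≡ ∣ n ∣ ℕ.* ∣ n ∣
    natural = trans (cong (∣ a ∣ ℕ.*_) (sym (ℤₚ.abs-* (+ d) (+ d)))) (trans (sym (ℤₚ.abs-* a _)) (trans (cong ∣_∣ cleared) (ℤₚ.abs-* n n)))
    d≡1 : d ≡ 1
    d≡1 = coprime-numerator r ((C.coprime-divisor (C.sym (coprime-numerator r)) (ℕD.divides (∣ a ∣ ℕ.* d) (trans (sym natural) (sym (ℕₚ.*-assoc ∣ a ∣ d d))))) , ℕD.∣-refl)
    a≡n² : a ≡ n ℤ.* n
    a≡n² = trans (sym (ℤₚ.*-identityʳ a)) (trans (cong (a ℤ.*_) (sym (cong₂ (λ s t → + s ℤ.* + t) d≡1 d≡1))) cleared)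
    square≥0 : ∀ n → 0ℤ ℤ.≤ n ℤ.* n
    square≥0 (+ n)    = subst (0ℤ ℤ.≤_) (ℤₚ.pos-* n n) (ℤ.+≤+ z≤n)
    square≥0 -[1+ n ] = ℤ.+≤+ z≤n

  -- p / q is ξ = x / M in lowest terms. In this scale x³ - M² x becomes M³ (ξ³ - ξ), with the roots
  -- 0, 1 and -1 for every M.
  record Fraction (M : ℕ) (x : ℚ) : Set where
    field
      p       : ℤ
      q       : ℕ
      q>0     : 0 ℕ.< q
      coprime : Coprime ∣ p ∣ q
      value   : x * ι (+ q) ≡ ι (+ M) * ι p

  fraction : ∀ M → 0 ℕ.< M → ∀ x → Fraction M x
  fraction M M>0 x = record { p = ↥ ξ ; q = ↧ₙ ξ ; q>0 = s≤s z≤n ; coprime = coprime-numerator ξ ; value = value }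
    where
    ξ : ℚ
    ξ = div x (ι (+ M))
    r : ∀ ξ m q → (ξ * m) * q ≡ m * (ξ * q)
    r = solve 3 (λ ξ m q → (ξ :* m) :* q := m :* (ξ :* q)) refl
    value : x * ι (+ ↧ₙ ξ) ≡ ι (+ M) * ι (↥ ξ)
    value = trans (cong (_* ι (+ ↧ₙ ξ)) (sym (div-* x (ι (+ M)) (ι≢0 (λ e → ℕₚ.<⇒≢ M>0 (sym (ℤₚ.+-injective e)))))))
      (trans (r ξ (ι (+ M)) (ι (+ ↧ₙ ξ))) (cong (ι (+ M) *_) (*-denominator ξ)))

  module _ {M : ℕ} (M>0 : 0 ℕ.< M) {D : ℚ} (D≡ : D ≡ ι (+ M) * ι (+ M)) where
    private
      m : ℚ
      m = ι (+ M)

      m≢0 : m ≢ 0ℚ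
      m≢0 = ι≢0 (λ e → ℕₚ.<⇒≢ M>0 (sym (ℤₚ.+-injective e)))

      m²≢0 : m * m ≢ 0ℚ
      m²≢0 e = m≢0 (integral-domain m m e m≢0)

      cross : ∀ a b c d → ι a * ι b - ι c * ι d ≡ ι (a ℤ.* b ℤ.- c ℤ.* d)
      cross a b c d = trans (cong₂ _-_ (ι-* a b) (ι-* c d)) (ι-- (a ℤ.* b) (c ℤ.* d))

      cross⁺ : ∀ a b c d → ι a * ι b + ι c * ι d ≡ ι (a ℤ.* b ℤ.+ c ℤ.* d)
      cross⁺ a b c d = trans (cong₂ _+_ (ι-* a b) (ι-* c d)) (ι-+ (a ℤ.* b) (c ℤ.* d))

      square : ∀ {x} a → x ≡ ι a → x * x ≡ ι (a ℤ.* a)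
      square a refl = ι-* a a

    module PairZ {x₁ x₂ x₃ x₄ : ℚ} (F₁ : Fraction M x₁) (F₂ : Fraction M x₂) (F₃ : Fraction M x₃) (F₄ : Fraction M x₄) where
      open Fraction F₁ using () renaming (p to p₁; q to q₁; value to v₁)
      open Fraction F₂ using () renaming (p to p₂; q to q₂; value to v₂)
      open Fraction F₃ using () renaming (p to p₃; q to q₃; value to v₃)
      open Fraction F₄ using () renaming (p to p₄; q to q₄; value to v₄)
      private
        P₁ = ι p₁
        P₂ = ι p₂
        P₃ = ι p₃
        P₄ = ι p₄
        Q₁ = ι (+ q₁)
        Q₂ = ι (+ q₂)
        Q₃ = ι (+ q₃)
        Q₄ = ι (+ q₄)

      -- Since D = M², clearing the denominators leaves the same factor M⁴ on both sides, and it
      -- cancels.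
      productZ : (x₂ * x₄) * ((x₃ - x₁) * (x₃ - x₁)) ≡ (x₁ * x₃ + D) * (x₁ * x₃ + D) →
        (p₂ ℤ.* p₄) ℤ.* ((p₃ ℤ.* + q₁ ℤ.- p₁ ℤ.* + q₃) ℤ.* (p₃ ℤ.* + q₁ ℤ.- p₁ ℤ.* + q₃)) ≡
        (+ q₂ ℤ.* + q₄) ℤ.* ((p₁ ℤ.* p₃ ℤ.+ + q₁ ℤ.* + q₃) ℤ.* (p₁ ℤ.* p₃ ℤ.+ + q₁ ℤ.* + q₃))
      productZ e = ι-injective (trans (sym (trans (cong₂ _*_ (ι-* p₂ p₄) (square w (cross p₃ (+ q₁) p₁ (+ q₃)))) (ι-* (p₂ ℤ.* p₄) (w ℤ.* w))))
        (trans rational (trans (cong₂ _*_ (ι-* (+ q₂) (+ q₄)) (square u (cross⁺ p₁ p₃ (+ q₁) (+ q₃)))) (ι-* (+ q₂ ℤ.* + q₄) (u ℤ.* u)))))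
        where
        w = p₃ ℤ.* + q₁ ℤ.- p₁ ℤ.* + q₃
        u = p₁ ℤ.* p₃ ℤ.+ + q₁ ℤ.* + q₃
        r₁ : ∀ m a b c d q r → (m * m) * ((m * m) * ((b * d) * ((c * q - a * r) * (c * q - a * r)))) ≡ ((m * b) * (m * d)) * (((m * c) * q - (m * a) * r) * ((m * c) * q - (m * a) * r))
        r₁ = solve 7 (λ m a b c d q r → (m :* m) :* ((m :* m) :* ((b :* d) :* ((c :* q :- a :* r) :* (c :* q :- a :* r)))) := ((m :* b) :* (m :* d)) :* (((m :* c) :* q :- (m :* a) :* r) :* ((m :* c) :* q :- (m :* a) :* r))) refl
        r₂ : ∀ x y z w a b c d → ((y * b) * (w * d)) * (((z * c) * a - (x * a) * c) * ((z * c) * a - (x * a) * c)) ≡ (b * d) * (((a * c) * (a * c)) * ((y * w) * ((z - x) * (z - x))))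
        r₂ = solve 8 (λ x y z w a b c d → ((y :* b) :* (w :* d)) :* (((z :* c) :* a :- (x :* a) :* c) :* ((z :* c) :* a :- (x :* a) :* c)) := (b :* d) :* (((a :* c) :* (a :* c)) :* ((y :* w) :* ((z :- x) :* (z :- x))))) refl
        r₃ : ∀ D x z a b c d → (b * d) * (((a * c) * (a * c)) * ((x * z + D) * (x * z + D))) ≡ (b * d) * (((x * a) * (z * c) + D * (a * c)) * ((x * a) * (z * c) + D * (a * c)))
        r₃ = solve 7 (λ D x z a b c d → (b :* d) :* (((a :* c) :* (a :* c)) :* ((x :* z :+ D) :* (x :* z :+ D))) := (b :* d) :* (((x :* a) :* (z :* c) :+ D :* (a :* c)) :* ((x :* a) :* (z :* c) :+ D :* (a :* c)))) refl
        r₄ : ∀ m p r a b c d → (b * d) * (((m * p) * (m * r) + (m * m) * (a * c)) * ((m * p) * (m * r) + (m * m) * (a * c))) ≡ (m * m) * ((m * m) * ((b * d) * ((p * r + a * c) * (p * r + a * c))))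
        r₄ = solve 7 (λ m p r a b c d → (b :* d) :* (((m :* p) :* (m :* r) :+ (m :* m) :* (a :* c)) :* ((m :* p) :* (m :* r) :+ (m :* m) :* (a :* c))) := (m :* m) :* ((m :* m) :* ((b :* d) :* ((p :* r :+ a :* c) :* (p :* r :+ a :* c))))) refl
        rational : (P₂ * P₄) * ((P₃ * Q₁ - P₁ * Q₃) * (P₃ * Q₁ - P₁ * Q₃)) ≡ (Q₂ * Q₄) * ((P₁ * P₃ + Q₁ * Q₃) * (P₁ * P₃ + Q₁ * Q₃))
        rational = cancelˡ (m * m) m²≢0 (cancelˡ (m * m) m²≢0 (trans (r₁ m P₁ P₂ P₃ P₄ Q₁ Q₃)
          (trans (cong₂ _*_ (cong₂ _*_ (sym v₂) (sym v₄)) (cong₂ (λ s t → (s * Q₁ - t * Q₃) * (s * Q₁ - t * Q₃)) (sym v₃) (sym v₁)))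
          (trans (r₂ x₁ x₂ x₃ x₄ Q₁ Q₂ Q₃ Q₄) (trans (cong (λ t → (Q₂ * Q₄) * (((Q₁ * Q₃) * (Q₁ * Q₃)) * t)) e)
          (trans (r₃ D x₁ x₃ Q₁ Q₂ Q₃ Q₄) (trans (cong₂ (λ s t → (Q₂ * Q₄) * ((s * t + D * (Q₁ * Q₃)) * (s * t + D * (Q₁ * Q₃)))) v₁ v₃)
          (trans (cong (λ t → (Q₂ * Q₄) * (((m * P₁) * (m * P₃) + t * (Q₁ * Q₃)) * ((m * P₁) * (m * P₃) + t * (Q₁ * Q₃)))) D≡) (r₄ m P₁ P₃ Q₁ Q₂ Q₃ Q₄)))))))))

      sumZ : (x₂ + x₄) * ((x₃ - x₁) * (x₃ - x₁)) ≡ (x₁ * x₃ - D) * (x₁ + x₃) + (x₁ * x₃ - D) * (x₁ + x₃) →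
        (p₂ ℤ.* + q₄ ℤ.+ p₄ ℤ.* + q₂) ℤ.* ((p₃ ℤ.* + q₁ ℤ.- p₁ ℤ.* + q₃) ℤ.* (p₃ ℤ.* + q₁ ℤ.- p₁ ℤ.* + q₃)) ≡
        (+ q₂ ℤ.* + q₄) ℤ.* ((p₁ ℤ.* p₃ ℤ.- + q₁ ℤ.* + q₃) ℤ.* (p₁ ℤ.* + q₃ ℤ.+ p₃ ℤ.* + q₁) ℤ.+ (p₁ ℤ.* p₃ ℤ.- + q₁ ℤ.* + q₃) ℤ.* (p₁ ℤ.* + q₃ ℤ.+ p₃ ℤ.* + q₁))
      sumZ e = ι-injective (trans (sym (trans (cong₂ _*_ (cross⁺ p₂ (+ q₄) p₄ (+ q₂)) (square w (cross p₃ (+ q₁) p₁ (+ q₃)))) (ι-* (p₂ ℤ.* + q₄ ℤ.+ p₄ ℤ.* + q₂) (w ℤ.* w))))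
        (trans rational (trans (cong₂ _*_ (ι-* (+ q₂) (+ q₄)) (twice (u ℤ.* u') (trans (cong₂ _*_ (cross p₁ p₃ (+ q₁) (+ q₃)) (cross⁺ p₁ (+ q₃) p₃ (+ q₁))) (ι-* u u')))) (ι-* (+ q₂ ℤ.* + q₄) (u ℤ.* u' ℤ.+ u ℤ.* u')))))
        where
        w = p₃ ℤ.* + q₁ ℤ.- p₁ ℤ.* + q₃
        u = p₁ ℤ.* p₃ ℤ.- + q₁ ℤ.* + q₃
        u' = p₁ ℤ.* + q₃ ℤ.+ p₃ ℤ.* + q₁
        twice : ∀ {x} a → x ≡ ι a → x + x ≡ ι (a ℤ.+ a)
        twice a refl = ι-+ a a
        r₁ : ∀ m a b c d q r s t → m * ((m * m) * ((b * t + d * s) * ((c * q - a * r) * (c * q - a * r)))) ≡ ((m * b) * t + (m * d) * s) * (((m * c) * q - (m * a) * r) * ((m * c) * q - (m * a) * r))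
        r₁ = solve 9 (λ m a b c d q r s t → m :* ((m :* m) :* ((b :* t :+ d :* s) :* ((c :* q :- a :* r) :* (c :* q :- a :* r)))) := ((m :* b) :* t :+ (m :* d) :* s) :* (((m :* c) :* q :- (m :* a) :* r) :* ((m :* c) :* q :- (m :* a) :* r))) refl
        r₂ : ∀ x y z w a b c d → ((y * b) * d + (w * d) * b) * (((z * c) * a - (x * a) * c) * ((z * c) * a - (x * a) * c)) ≡ (b * d) * (((a * c) * (a * c)) * ((y + w) * ((z - x) * (z - x))))
        r₂ = solve 8 (λ x y z w a b c d → ((y :* b) :* d :+ (w :* d) :* b) :* (((z :* c) :* a :- (x :* a) :* c) :* ((z :* c) :* a :- (x :* a) :* c)) := (b :* d) :* (((a :* c) :* (a :* c)) :* ((y :+ w) :* ((z :- x) :* (z :- x))))) refl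
        r₃ : ∀ D x z a b c d → (b * d) * (((a * c) * (a * c)) * ((x * z - D) * (x + z) + (x * z - D) * (x + z))) ≡ (b * d) * (((x * a) * (z * c) - D * (a * c)) * ((x * a) * c + (z * c) * a) + ((x * a) * (z * c) - D * (a * c)) * ((x * a) * c + (z * c) * a))
        r₃ = solve 7 (λ D x z a b c d → (b :* d) :* (((a :* c) :* (a :* c)) :* ((x :* z :- D) :* (x :+ z) :+ (x :* z :- D) :* (x :+ z))) := (b :* d) :* (((x :* a) :* (z :* c) :- D :* (a :* c)) :* ((x :* a) :* c :+ (z :* c) :* a) :+ ((x :* a) :* (z :* c) :- D :* (a :* c)) :* ((x :* a) :* c :+ (z :* c) :* a))) refl
        r₄ : ∀ m p r a b c d → (b * d) * (((m * p) * (m * r) - (m * m) * (a * c)) * ((m * p) * c + (m * r) * a) + ((m * p) * (m * r) - (m * m) * (a * c)) * ((m * p) * c + (m * r) * a)) ≡ m * ((m * m) * ((b * d) * ((p * r - a * c) * (p * c + r * a) + (p * r - a * c) * (p * c + r * a))))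
        r₄ = solve 7 (λ m p r a b c d → (b :* d) :* (((m :* p) :* (m :* r) :- (m :* m) :* (a :* c)) :* ((m :* p) :* c :+ (m :* r) :* a) :+ ((m :* p) :* (m :* r) :- (m :* m) :* (a :* c)) :* ((m :* p) :* c :+ (m :* r) :* a)) := m :* ((m :* m) :* ((b :* d) :* ((p :* r :- a :* c) :* (p :* c :+ r :* a) :+ (p :* r :- a :* c) :* (p :* c :+ r :* a))))) refl
        rational : (P₂ * Q₄ + P₄ * Q₂) * ((P₃ * Q₁ - P₁ * Q₃) * (P₃ * Q₁ - P₁ * Q₃)) ≡ (Q₂ * Q₄) * ((P₁ * P₃ - Q₁ * Q₃) * (P₁ * Q₃ + P₃ * Q₁) + (P₁ * P₃ - Q₁ * Q₃) * (P₁ * Q₃ + P₃ * Q₁))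
        rational = cancelˡ (m * m) m²≢0 (cancelˡ m m≢0 (trans (r₁ m P₁ P₂ P₃ P₄ Q₁ Q₃ Q₂ Q₄)
          (trans (cong₂ _*_ (cong₂ (λ s t → s * Q₄ + t * Q₂) (sym v₂) (sym v₄)) (cong₂ (λ s t → (s * Q₁ - t * Q₃) * (s * Q₁ - t * Q₃)) (sym v₃) (sym v₁)))
          (trans (r₂ x₁ x₂ x₃ x₄ Q₁ Q₂ Q₃ Q₄) (trans (cong (λ t → (Q₂ * Q₄) * (((Q₁ * Q₃) * (Q₁ * Q₃)) * t)) e)
          (trans (r₃ D x₁ x₃ Q₁ Q₂ Q₃ Q₄) (trans (cong₂ (λ s t → (Q₂ * Q₄) * ((s * t - D * (Q₁ * Q₃)) * (s * Q₃ + t * Q₁) + (s * t - D * (Q₁ * Q₃)) * (s * Q₃ + t * Q₁))) v₁ v₃)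
          (trans (cong (λ d → (Q₂ * Q₄) * (((m * P₁) * (m * P₃) - d * (Q₁ * Q₃)) * ((m * P₁) * Q₃ + (m * P₃) * Q₁) + ((m * P₁) * (m * P₃) - d * (Q₁ * Q₃)) * ((m * P₁) * Q₃ + (m * P₃) * Q₁))) D≡) (r₄ m P₁ P₃ Q₁ Q₂ Q₃ Q₄)))))))))

    distinctZ : ∀ {x₁ x₃} (F₁ : Fraction M x₁) (F₃ : Fraction M x₃) → x₃ ≢ x₁ →
      Fraction.p F₃ ℤ.* + Fraction.q F₁ ℤ.- Fraction.p F₁ ℤ.* + Fraction.q F₃ ≢ 0ℤ
    distinctZ {x₁} {x₃} F₁ F₃ x₃≢x₁ e = x₃≢x₁ (cancelˡ (Q₁ * Q₃) (λ z → Q₃≢0 (integral-domain Q₁ Q₃ z Q₁≢0))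
        (trans (r₁ x₃ Q₁ Q₃) (trans (cong (_* Q₁) (Fraction.value F₃)) (trans (r₂ m (ι p₃) Q₁) (trans (cong (m *_) same) (trans (sym (r₂ m (ι p₁) Q₃)) (trans (cong (_* Q₃) (sym (Fraction.value F₁))) (r₃ x₁ Q₁ Q₃))))))))
      where
      p₁ = Fraction.p F₁
      p₃ = Fraction.p F₃
      Q₁ = ι (+ Fraction.q F₁)
      Q₃ = ι (+ Fraction.q F₃)
      Q₁≢0 : Q₁ ≢ 0ℚ
      Q₁≢0 = ι≢0 (λ e → ℕₚ.<⇒≢ (Fraction.q>0 F₁) (sym (ℤₚ.+-injective e)))
      Q₃≢0 : Q₃ ≢ 0ℚ
      Q₃≢0 = ι≢0 (λ e → ℕₚ.<⇒≢ (Fraction.q>0 F₃) (sym (ℤₚ.+-injective e)))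
      same : ι p₃ * Q₁ ≡ ι p₁ * Q₃
      same = x-y≡0⇒x≡y _ _ (trans (cross p₃ (+ Fraction.q F₁) p₁ (+ Fraction.q F₃)) (cong ι e))
      r₁ : ∀ x a b → (a * b) * x ≡ (x * b) * a
      r₁ = solve 3 (λ x a b → (a :* b) :* x := (x :* b) :* a) refl
      r₂ : ∀ m p q → (m * p) * q ≡ m * (p * q)
      r₂ = solve 3 (λ m p q → (m :* p) :* q := m :* (p :* q)) refl
      r₃ : ∀ x a b → (x * a) * b ≡ (a * b) * x
      r₃ = solve 3 (λ x a b → (x :* a) :* b := (a :* b) :* x) refl

    doubleZ : ∀ {x₁ y₁ x₃} (F₁ : Fraction M x₁) (F₃ : Fraction M x₃) → On D x₁ y₁ → x₃ * ((y₁ + y₁) * (y₁ + y₁)) ≡ (x₁ * x₁ + D) * (x₁ * x₁ + D) →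
      let p = Fraction.p F₁; q = + Fraction.q F₁ in
      Fraction.p F₃ ℤ.* (+ 4 ℤ.* ((p ℤ.* q) ℤ.* (p ℤ.* p ℤ.- q ℤ.* q))) ≡ + Fraction.q F₃ ℤ.* ((p ℤ.* p ℤ.+ q ℤ.* q) ℤ.* (p ℤ.* p ℤ.+ q ℤ.* q))
    doubleZ {x₁} {y₁} {x₃} F₁ F₃ on e = ι-injective (trans (sym (trans (cong (ι p₃ *_) (trans (cong (ι (+ 4) *_) (trans (cong₂ _*_ (ι-* p q) (cross p p q q)) (ι-* (p ℤ.* q) w))) (ι-* (+ 4) ((p ℤ.* q) ℤ.* w)))) (ι-* p₃ (+ 4 ℤ.* ((p ℤ.* q) ℤ.* w)))))
        (trans rational (trans (cong (Q₃ *_) (square u (cross⁺ p p q q))) (ι-* (+ Fraction.q F₃) (u ℤ.* u)))))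
      where
      p = Fraction.p F₁
      q = + Fraction.q F₁
      p₃ = Fraction.p F₃
      w = p ℤ.* p ℤ.- q ℤ.* q
      u = p ℤ.* p ℤ.+ q ℤ.* q
      P = ι p
      Q = ι q
      Q₃ = ι (+ Fraction.q F₃)
      v = Fraction.value F₁
      r₁ : ∀ m p q r → (m * m) * ((m * m) * (r * ((1ℚ + 1ℚ + 1ℚ + 1ℚ) * ((p * q) * (p * p - q * q))))) ≡ (1ℚ + 1ℚ + 1ℚ + 1ℚ) * ((m * r) * (((m * p) * (m * p) * (m * p) - (m * m) * (q * q) * (m * p)) * q))
      r₁ = solve 4 (λ m p q r → (m :* m) :* ((m :* m) :* (r :* ((con 1ℚ :+ con 1ℚ :+ con 1ℚ :+ con 1ℚ) :* ((p :* q) :* (p :* p :- q :* q))))) := (con 1ℚ :+ con 1ℚ :+ con 1ℚ :+ con 1ℚ) :* ((m :* r) :* (((m :* p) :* (m :* p) :* (m :* p) :- (m :* m) :* (q :* q) :* (m :* p)) :* q))) refl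
      r₂ : ∀ D x z q s → (1ℚ + 1ℚ + 1ℚ + 1ℚ) * ((z * s) * (((x * q) * (x * q) * (x * q) - D * (q * q) * (x * q)) * q)) ≡ (z * ((1ℚ + 1ℚ + 1ℚ + 1ℚ) * (x * x * x - D * x))) * (s * ((q * q) * (q * q)))
      r₂ = solve 5 (λ D x z q s → (con 1ℚ :+ con 1ℚ :+ con 1ℚ :+ con 1ℚ) :* ((z :* s) :* (((x :* q) :* (x :* q) :* (x :* q) :- D :* (q :* q) :* (x :* q)) :* q)) := (z :* ((con 1ℚ :+ con 1ℚ :+ con 1ℚ :+ con 1ℚ) :* (x :* x :* x :- D :* x))) :* (s :* ((q :* q) :* (q :* q)))) refl
      r₃ : ∀ y → (1ℚ + 1ℚ + 1ℚ + 1ℚ) * (y * y) ≡ (y + y) * (y + y)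
      r₃ = solve 1 (λ y → (con 1ℚ :+ con 1ℚ :+ con 1ℚ :+ con 1ℚ) :* (y :* y) := (y :+ y) :* (y :+ y)) refl
      r₄ : ∀ D x q s → ((x * x + D) * (x * x + D)) * (s * ((q * q) * (q * q))) ≡ s * (((x * q) * (x * q) + D * (q * q)) * ((x * q) * (x * q) + D * (q * q)))
      r₄ = solve 4 (λ D x q s → ((x :* x :+ D) :* (x :* x :+ D)) :* (s :* ((q :* q) :* (q :* q))) := s :* (((x :* q) :* (x :* q) :+ D :* (q :* q)) :* ((x :* q) :* (x :* q) :+ D :* (q :* q)))) refl
      r₅ : ∀ m p q s → s * (((m * p) * (m * p) + (m * m) * (q * q)) * ((m * p) * (m * p) + (m * m) * (q * q))) ≡ (m * m) * ((m * m) * (s * ((p * p + q * q) * (p * p + q * q))))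
      r₅ = solve 4 (λ m p q s → s :* (((m :* p) :* (m :* p) :+ (m :* m) :* (q :* q)) :* ((m :* p) :* (m :* p) :+ (m :* m) :* (q :* q))) := (m :* m) :* ((m :* m) :* (s :* ((p :* p :+ q :* q) :* (p :* p :+ q :* q))))) refl
      four : ℚ
      four = 1ℚ + 1ℚ + 1ℚ + 1ℚ
      rational : ι p₃ * (ι (+ 4) * ((P * Q) * (P * P - Q * Q))) ≡ Q₃ * ((P * P + Q * Q) * (P * P + Q * Q))
      rational = cancelˡ (m * m) m²≢0 (cancelˡ (m * m) m²≢0 (trans (r₁ m P Q (ι p₃))
        (trans (cong₂ (λ s t → four * (t * ((s * s * s - (m * m) * (Q * Q) * s) * Q))) (sym v) (sym (Fraction.value F₃)))
        (trans (cong (λ d → four * ((x₃ * Q₃) * (((x₁ * Q) * (x₁ * Q) * (x₁ * Q) - d * (Q * Q) * (x₁ * Q)) * Q))) (sym D≡))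
        (trans (r₂ D x₁ x₃ Q Q₃) (trans (cong (λ t → (x₃ * t) * (Q₃ * ((Q * Q) * (Q * Q)))) (trans (cong (four *_) (sym on)) (r₃ y₁)))
        (trans (cong (_* (Q₃ * ((Q * Q) * (Q * Q)))) e) (trans (r₄ D x₁ Q Q₃) (trans (cong (λ s → Q₃ * ((s * s + D * (Q * Q)) * (s * s + D * (Q * Q)))) v)
        (trans (cong (λ d → Q₃ * (((m * P) * (m * P) + d * (Q * Q)) * ((m * P) * (m * P) + d * (Q * Q)))) D≡) (r₅ m P Q Q₃)))))))))))

-- Square classes, and the denominators of integral multiples

module Classes where

  open import Defs
  open Line
  open Multiples
  open Fractions
  open import Data.Nat as ℕ using (ℕ; zero; suc)
  import Data.Nat.Properties as ℕₚ
  open import Data.Nat.Divisibility as ℕD using (_∣_; divides)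
  open import Data.Nat.GCD using (gcd; gcd[m,n]∣m; gcd[m,n]∣n; gcd-greatest; gcd[m,n]≢0)
  open import Data.Nat.Coprimality as C using (Coprime)
  open import Data.Nat.Tactic.RingSolver using () renaming (solve-∀ to ℕsolve-∀)
  open import Data.Integer as ℤ using (ℤ; +_; -[1+_]) renaming (∣_∣ to abs)
  import Data.Integer.Properties as ℤₚ
  open import Data.Integer.Tactic.RingSolver using () renaming (solve-∀ to ℤsolve-∀)
  open import Data.Rational using (ℚ; 0ℚ; _+_; _*_; _-_; -_)
  open import Data.Rational.Properties
  open import Data.Rational.Solver using (module +-*-Solver)
  open +-*-Solver
  open import Data.Product using (∃; _,_; proj₁; proj₂)
  open import Data.Sum using (_⊎_; inj₁; inj₂)
  open import Data.Empty using (⊥-elim)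
  open import Relation.Binary.PropositionalEquality
  open import Relation.Nullary using (yes; no)

  -- Square classes of x - r

  module _ {N : ℤ} {P : Point} (O : Orbit N P) (r : ℚ) (root : r * r * r - Orbit.D O * r ≡ 0ℚ) where
    open Orbit O renaming (x to X; y to Y)
    x-root≢0 : ∀ n → X (suc n) - r ≢ 0ℚ
    x-root≢0 n z = y≢0 n (y²≡0 (trans (on-curve n) (trans (cong (λ t → t * t * t - D * t) (x-y≡0⇒x≡y (X (suc n)) r z)) root)))
      where
      y²≡0 : ∀ {y} → y * y ≡ 0ℚ → y ≡ 0ℚ
      y²≡0 {y} h with y ≟ 0ℚ
      ... | yes y≡0 = y≡0
      ... | no y≢0 = integral-domain y y h y≢0

    private
      e : ℕ → ℚ
      e n = X (suc n) - r

      consecutive : ∀ n → ∃ λ ν → e 0 * e n * e (suc n) ≡ ν * ν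
      consecutive n = proj₁ (sum-line 0 n) * (r - X 1) + Y 1 , Line-square (proj₂ (sum-line 0 n)) (on-curve 0) r root

      divide : ∀ {a c} → a ≢ 0ℚ → (∃ λ t → a ≡ t * t) → (∃ λ ν → a * c ≡ ν * ν) → ∃ λ s → c ≡ s * s
      divide {a} {c} a≢0 (t , a≡t²) (ν , ac≡ν²) = s , cancelˡ a a≢0 (trans ac≡ν² (trans (cong₂ _*_ (sym ν≡) (sym ν≡)) (trans (r₁ s t) (cong (_* (s * s)) (sym a≡t²)))))
        where
        s : ℚ
        s = div ν t
        t≢0 : t ≢ 0ℚ
        t≢0 z = a≢0 (trans a≡t² (trans (cong (_* t) z) (*-zeroˡ t)))
        ν≡ : s * t ≡ ν
        ν≡ = div-* ν t t≢0
        r₁ : ∀ d t → (d * t) * (d * t) ≡ (t * t) * (d * d)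
        r₁ = solve 2 (λ d t → (d :* t) :* (d :* t) := (t :* t) :* (d :* d)) refl

      swap : ∀ {a b c} → (∃ λ ν → a * b * c ≡ ν * ν) → ∃ λ ν → b * (a * c) ≡ ν * ν
      swap {a} {b} {c} (ν , h) = ν , trans (r₁ a b c) h
        where
        r₁ : ∀ a b c → b * (a * c) ≡ a * b * c
        r₁ = solve 3 (λ a b c → b :* (a :* c) := a :* b :* c) refl

    -- By `Line-square` for P, nP and (n + 1)P the product of the three values of x - r is a square.
    -- So the square class alternates between that of P and the trivial one.
    odd-class  : ∀ k → ∃ λ t → (X 1 - r) * (X (suc (k ℕ.+ k)) - r) ≡ t * t
    even-class : ∀ k → ∃ λ t → X (suc (suc (k ℕ.+ k))) - r ≡ t * t

    even-class k = divide (λ z → x-root≢0 (k ℕ.+ k) (integral-domain (e 0) (e (k ℕ.+ k)) z (x-root≢0 0))) (odd-class k) (consecutive (k ℕ.+ k))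

    odd-class zero = X 1 - r , refl
    odd-class (suc k) = subst (λ n → ∃ λ t → e 0 * e n ≡ t * t) (cong suc (sym (ℕₚ.+-suc k k)))
      (divide (x-root≢0 (suc (k ℕ.+ k))) (even-class k) (swap {e 0} {e (suc (k ℕ.+ k))} {e (suc (suc (k ℕ.+ k)))} (consecutive (suc (k ℕ.+ k)))))

  -- Three squares in arithmetic progression

  parity : ∀ n → (∃ λ k → n ≡ 2 ℕ.* k) ⊎ (∃ λ k → n ≡ suc (2 ℕ.* k))
  parity zero = inj₁ (0 , refl)
  parity (suc n) with parity n
  ... | inj₁ (k , e) = inj₂ (k , cong suc e)
  ... | inj₂ (k , e) = inj₁ (suc k , trans (cong suc e) (ring k))
    where
    ring : ∀ k → suc (suc (2 ℕ.* k)) ≡ 2 ℕ.* suc k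
    ring = ℕsolve-∀

  -- Here t² + u² = 2 s². Modulo 4 this excludes different parities of t and s; if the parities
  -- agree, M = s² - t² is divisible by 4.
  progression : ∀ {t s u M} → s ℕ.* s ≡ t ℕ.* t ℕ.+ M → u ℕ.* u ≡ s ℕ.* s ℕ.+ M → 4 ∣ M
  progression {t} {s} {u} {M} e₁ e₂ = go (parity t) (parity s) (parity u)
    where
    sum : u ℕ.* u ℕ.+ t ℕ.* t ≡ 2 ℕ.* (s ℕ.* s)
    sum = trans (cong (ℕ._+ t ℕ.* t) e₂) (trans (ring (s ℕ.* s) (t ℕ.* t) M) (trans (cong (s ℕ.* s ℕ.+_) (sym e₁)) (cong (s ℕ.* s ℕ.+_) (sym (ℕₚ.+-identityʳ (s ℕ.* s))))))
      where
      ring : ∀ a b M → a ℕ.+ M ℕ.+ b ≡ a ℕ.+ (b ℕ.+ M)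
      ring = ℕsolve-∀
    even² : ∀ j → 2 ℕ.* j ℕ.* (2 ℕ.* j) ≡ 4 ℕ.* (j ℕ.* j)
    even² = ℕsolve-∀
    odd² : ∀ j → suc (2 ℕ.* j) ℕ.* suc (2 ℕ.* j) ≡ suc (4 ℕ.* (j ℕ.* j ℕ.+ j))
    odd² = ℕsolve-∀
    mixed : ∀ a b → suc (4 ℕ.* a) ℕ.+ 4 ℕ.* b ≡ suc (2 ℕ.* (2 ℕ.* a ℕ.+ 2 ℕ.* b))
    mixed = ℕsolve-∀
    even+even : ∀ a b → 4 ℕ.* a ℕ.+ 4 ℕ.* b ≡ 2 ℕ.* (2 ℕ.* (a ℕ.+ b))
    even+even = ℕsolve-∀
    odd+odd : ∀ a b → suc (4 ℕ.* a) ℕ.+ suc (4 ℕ.* b) ≡ 2 ℕ.* suc (2 ℕ.* (a ℕ.+ b))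
    odd+odd = ℕsolve-∀
    twice : ∀ a → 4 ℕ.* a ≡ 2 ℕ.* (2 ℕ.* a)
    twice = ℕsolve-∀
    sum-of : ∀ {a b} → u ℕ.* u ≡ a → t ℕ.* t ≡ b → a ℕ.+ b ≡ 2 ℕ.* (s ℕ.* s)
    sum-of refl refl = sum
    go : (∃ λ k → t ≡ 2 ℕ.* k) ⊎ (∃ λ k → t ≡ suc (2 ℕ.* k)) → (∃ λ k → s ≡ 2 ℕ.* k) ⊎ (∃ λ k → s ≡ suc (2 ℕ.* k)) →
         (∃ λ k → u ≡ 2 ℕ.* k) ⊎ (∃ λ k → u ≡ suc (2 ℕ.* k)) → 4 ∣ M
    go (inj₁ (i , refl)) (inj₁ (j , refl)) _ = ℕD.∣m+n∣m⇒∣n (subst (4 ∣_) (trans (sym (even² j)) e₁) (ℕD.m∣m*n (j ℕ.* j))) (subst (4 ∣_) (sym (even² i)) (ℕD.m∣m*n (i ℕ.* i)))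
    go (inj₂ (i , refl)) (inj₂ (j , refl)) _ = ℕD.∣m+n∣m⇒∣n (subst (4 ∣_) (ℕₚ.suc-injective (trans (sym (odd² j)) (trans e₁ (cong (ℕ._+ M) (odd² i))))) (ℕD.m∣m*n (j ℕ.* j ℕ.+ j))) (ℕD.m∣m*n (i ℕ.* i ℕ.+ i))
    go (inj₁ (i , refl)) (inj₂ (j , refl)) (inj₁ (k , refl)) = ⊥-elim (ℕₚ.even≢odd (k ℕ.* k ℕ.+ i ℕ.* i) (2 ℕ.* (j ℕ.* j ℕ.+ j))
      (ℕₚ.*-cancelˡ-≡ _ _ 2 (trans (sym (even+even (k ℕ.* k) (i ℕ.* i))) (trans (sum-of (even² k) (even² i)) (cong (2 ℕ.*_) (trans (odd² j) (cong suc (twice (j ℕ.* j ℕ.+ j)))))))))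
    go (inj₁ (i , refl)) (inj₂ (j , refl)) (inj₂ (k , refl)) = ⊥-elim (ℕₚ.even≢odd (s ℕ.* s) (2 ℕ.* (k ℕ.* k ℕ.+ k) ℕ.+ 2 ℕ.* (i ℕ.* i)) (sym (trans (sym (mixed (k ℕ.* k ℕ.+ k) (i ℕ.* i))) (sum-of (odd² k) (even² i)))))
    go (inj₂ (i , refl)) (inj₁ (j , refl)) (inj₁ (k , refl)) = ⊥-elim (ℕₚ.even≢odd (s ℕ.* s) (2 ℕ.* (i ℕ.* i ℕ.+ i) ℕ.+ 2 ℕ.* (k ℕ.* k)) (sym (trans (sym (trans (ℕₚ.+-comm (4 ℕ.* (k ℕ.* k)) _) (mixed (i ℕ.* i ℕ.+ i) (k ℕ.* k)))) (sum-of (even² k) (odd² i)))))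
    go (inj₂ (i , refl)) (inj₁ (j , refl)) (inj₂ (k , refl)) = ⊥-elim (ℕₚ.even≢odd (2 ℕ.* (j ℕ.* j)) ((k ℕ.* k ℕ.+ k) ℕ.+ (i ℕ.* i ℕ.+ i))
      (sym (ℕₚ.*-cancelˡ-≡ _ _ 2 (trans (sym (odd+odd (k ℕ.* k ℕ.+ k) (i ℕ.* i ℕ.+ i))) (trans (sum-of (odd² k) (odd² i)) (cong (2 ℕ.*_) (trans (even² j) (twice (j ℕ.* j)))))))))

  -- Divisors of M in square classes

  SquareFreeℕ : ℕ → Set
  SquareFreeℕ M = ∀ d → d ℕ.* d ∣ M → d ≡ 1

  -- With d = gcd g a, g = h d and a = a' d, h is coprime to a', so h d ∣ a'² d² gives h ∣ d. Then
  -- h² ∣ g ∣ M, so h = 1.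
  squarefree-∣ : ∀ {M g a} → SquareFreeℕ M → 0 ℕ.< g → g ∣ M → g ∣ a ℕ.* a → g ∣ a
  squarefree-∣ {M} {g} {a} sf g>0 g∣M g∣a² = subst (_∣ a) (sym g≡d) (gcd[m,n]∣n g a)
    where
    d = gcd g a
    instance
      g≢0 : ℕ.NonZero g
      g≢0 = ℕ.>-nonZero g>0
      d≢0 : ℕ.NonZero d
      d≢0 = ℕ.≢-nonZero (gcd[m,n]≢0 g a (inj₁ (ℕ.≢-nonZero⁻¹ g)))
    h = ℕD.quotient (gcd[m,n]∣m g a)
    a' = ℕD.quotient (gcd[m,n]∣n g a)
    g≡ : g ≡ h ℕ.* d
    g≡ = ℕD._∣_.equality (gcd[m,n]∣m g a)
    a≡ : a ≡ a' ℕ.* d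
    a≡ = ℕD._∣_.equality (gcd[m,n]∣n g a)
    coprime : Coprime h a'
    coprime {i} (i∣h , i∣a') = ℕD.∣1⇒≡1 (ℕD.*-cancelʳ-∣ d (subst (i ℕ.* d ∣_) (sym (ℕₚ.*-identityˡ d))
      (gcd-greatest (subst (i ℕ.* d ∣_) (sym g≡) (ℕD.*-monoˡ-∣ d i∣h)) (subst (i ℕ.* d ∣_) (sym a≡) (ℕD.*-monoˡ-∣ d i∣a')))))
    ring : ∀ a d → a ℕ.* d ℕ.* (a ℕ.* d) ≡ a ℕ.* (a ℕ.* d) ℕ.* d
    ring = ℕsolve-∀
    h∣d : h ∣ d
    h∣d = C.coprime-divisor coprime (C.coprime-divisor coprime (ℕD.*-cancelʳ-∣ d (subst₂ _∣_ g≡ (trans (cong₂ ℕ._*_ a≡ a≡) (ring a' d)) g∣a²)))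
    h≡1 : h ≡ 1
    h≡1 = sf h (ℕD.∣-trans (ℕD.*-monoʳ-∣ h h∣d) (subst (_∣ M) g≡ g∣M))
    g≡d : g ≡ d
    g≡d = trans g≡ (trans (cong (ℕ._* d) h≡1) (ℕₚ.*-identityˡ d))

  module _ {M : ℕ} (M>0 : 0 ℕ.< M) (sf : SquareFreeℕ M) where
    private instance
      M≢0 : ℕ.NonZero M
      M≢0 = ℕ.>-nonZero M>0

    -- g is square-free, so it divides A and B. Cancelling one factor g, it divides (X/g) Z and ((X
    -- - M)/g)(Z - M); the difference is (M/g) Z modulo g, and M/g is coprime to g.
    gcd∣ : ∀ (X Z : ℤ) (A B : ℕ) → X ℤ.* Z ≡ + (A ℕ.* A) → (X ℤ.- + M) ℤ.* (Z ℤ.- + M) ≡ + (B ℕ.* B) → gcd (abs X) M ∣ (abs Z)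
    gcd∣ X Z A B eA eB = C.coprime-divisor coprime g∣bZ
      where
      g = gcd (abs X) M
      instance
        g≢0 : ℕ.NonZero g
        g≢0 = ℕ.≢-nonZero (gcd[m,n]≢0 (abs X) M (inj₂ (ℕ.≢-nonZero⁻¹ M)))
      g>0 : 0 ℕ.< g
      g>0 = ℕ.>-nonZero⁻¹ g
      g∣M : g ∣ M
      g∣M = gcd[m,n]∣n (abs X) M
      b = ℕD.quotient g∣M
      M≡ : M ≡ b ℕ.* g
      M≡ = ℕD._∣_.equality g∣M
      coprime : Coprime g b
      coprime {i} (i∣g , i∣b) = sf i (ℕD.∣-trans (ℕD.*-monoˡ-∣ i i∣b) (subst (b ℕ.* i ∣_) (sym M≡) (ℕD.*-monoʳ-∣ b i∣g)))
      signed : ∀ Z → g ∣ (abs Z) → ∃ λ z → Z ≡ z ℤ.* + g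
      signed (+ n)    (divides k e) = + k , trans (cong +_ e) (ℤₚ.pos-* k g)
      signed -[1+ n ] (divides k e) = ℤ.- + k , trans (cong (λ m → ℤ.- (+ m)) e) (trans (cong ℤ.-_ (ℤₚ.pos-* k g)) (ℤₚ.neg-distribˡ-* (+ k) (+ g)))
      a = proj₁ (signed X (gcd[m,n]∣m (abs X) M))
      X≡ : X ≡ a ℤ.* + g
      X≡ = proj₂ (signed X (gcd[m,n]∣m (abs X) M))
      M≡ℤ : + M ≡ + b ℤ.* + g
      M≡ℤ = trans (cong +_ M≡) (ℤₚ.pos-* b g)
      X-M≡ : X ℤ.- + M ≡ (a ℤ.- + b) ℤ.* + g
      X-M≡ = trans (cong₂ ℤ._-_ X≡ M≡ℤ) (ring a (+ b) (+ g))
        where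
        ring : ∀ a b g → a ℤ.* g ℤ.- b ℤ.* g ≡ (a ℤ.- b) ℤ.* g
        ring = ℤsolve-∀
      -- Since g is square-free it divides A, so one factor g cancels.
      cancel : ∀ c Z A → (c ℤ.* + g) ℤ.* Z ≡ + (A ℕ.* A) → ∃ λ k → c ℤ.* Z ≡ + k ℤ.* + g
      cancel c Z A e = α ℕ.* α , ℤₚ.*-cancelʳ-≡ (c ℤ.* Z) (+ (α ℕ.* α) ℤ.* + g) (+ g) (trans (ring₁ c Z (+ g)) (trans e (trans (cong +_ (trans (cong₂ ℕ._*_ A≡ A≡) (ring₂ α g))) (trans (ℤₚ.pos-* (α ℕ.* α ℕ.* g) g) (cong (ℤ._* + g) (ℤₚ.pos-* (α ℕ.* α) g))))))
        where
        g∣A : g ∣ A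
        g∣A = squarefree-∣ sf g>0 g∣M (subst (g ∣_) (trans (trans (cong (ℕ._* (abs Z)) (sym (ℤₚ.abs-* c (+ g)))) (sym (ℤₚ.abs-* (c ℤ.* + g) Z))) (cong abs e)) (ℕD.∣m⇒∣m*n (abs Z) (ℕD.n∣m*n (abs c))))
        α = ℕD.quotient g∣A
        A≡ : A ≡ α ℕ.* g
        A≡ = ℕD._∣_.equality g∣A
        ring₁ : ∀ c Z g → c ℤ.* Z ℤ.* g ≡ (c ℤ.* g) ℤ.* Z
        ring₁ = ℤsolve-∀
        ring₂ : ∀ a g → a ℕ.* g ℕ.* (a ℕ.* g) ≡ a ℕ.* a ℕ.* g ℕ.* g
        ring₂ = ℕsolve-∀
      C₁ = cancel a Z A (trans (cong (ℤ._* Z) (sym X≡)) eA)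
      C₂ = cancel (a ℤ.- + b) (Z ℤ.- + M) B (trans (cong (ℤ._* (Z ℤ.- + M)) (sym X-M≡)) eB)
      k₁ = + proj₁ C₁
      k₂ = + proj₁ C₂
      bZ≡ : + b ℤ.* Z ≡ (k₁ ℤ.- k₂ ℤ.- (a ℤ.- + b) ℤ.* + b) ℤ.* + g
      bZ≡ = trans (ring₁ a (+ b) Z (+ M)) (trans (cong₂ (λ s t → s ℤ.- t ℤ.- (a ℤ.- + b) ℤ.* + M) (proj₂ C₁) (proj₂ C₂)) (trans (cong (λ m → k₁ ℤ.* + g ℤ.- k₂ ℤ.* + g ℤ.- (a ℤ.- + b) ℤ.* m) M≡ℤ) (ring₂ k₁ k₂ (a ℤ.- + b) (+ b) (+ g))))
        where
        ring₁ : ∀ a b Z M → b ℤ.* Z ≡ a ℤ.* Z ℤ.- (a ℤ.- b) ℤ.* (Z ℤ.- M) ℤ.- (a ℤ.- b) ℤ.* M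
        ring₁ = ℤsolve-∀
        ring₂ : ∀ k l c b g → k ℤ.* g ℤ.- l ℤ.* g ℤ.- c ℤ.* (b ℤ.* g) ≡ (k ℤ.- l ℤ.- c ℤ.* b) ℤ.* g
        ring₂ = ℤsolve-∀
      g∣bZ : g ∣ b ℕ.* (abs Z)
      g∣bZ = divides (abs (k₁ ℤ.- k₂ ℤ.- (a ℤ.- + b) ℤ.* + b)) (trans (sym (ℤₚ.abs-* (+ b) Z)) (trans (cong abs bZ≡) (ℤₚ.abs-* (k₁ ℤ.- k₂ ℤ.- (a ℤ.- + b) ℤ.* + b) (+ g))))

    -- With g = gcd a M, the number M/g divides q because it is coprime to a/g, and q' divides M/g
    -- because g also divides a'. So q' ∣ q, and the situation is symmetric.
    denominator-unique : ∀ {a a' p p' q q'} → a ℕ.* q ≡ M ℕ.* p → a' ℕ.* q' ≡ M ℕ.* p' → Coprime p q → Coprime p' q' → gcd a M ∣ a' → gcd a' M ∣ a → q ≡ q'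
    denominator-unique {a} {a'} {p} {p'} {q} {q'} e e' cop cop' d d' = ℕD.∣-antisym (half {a'} {a} e' cop' cop e d') (half {a} {a'} e cop cop' e' d)
      where
      half : ∀ {a a' p p' q q'} → a ℕ.* q ≡ M ℕ.* p → Coprime p q → Coprime p' q' → a' ℕ.* q' ≡ M ℕ.* p' → gcd a M ∣ a' → q' ∣ q
      half {a} {a'} {p} {p'} {q} {q'} e cop cop' e' g∣a' = ℕD.∣-trans q'∣b b∣q
        where
        g = gcd a M
        instance
          g≢0 : ℕ.NonZero g
          g≢0 = ℕ.≢-nonZero (gcd[m,n]≢0 a M (inj₂ (ℕ.≢-nonZero⁻¹ M)))
        b = ℕD.quotient (gcd[m,n]∣n a M)
        M≡ : M ≡ b ℕ.* g
        M≡ = ℕD._∣_.equality (gcd[m,n]∣n a M)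
        c = ℕD.quotient (gcd[m,n]∣m a M)
        a≡ : a ≡ c ℕ.* g
        a≡ = ℕD._∣_.equality (gcd[m,n]∣m a M)
        c' = ℕD.quotient g∣a'
        a'≡ : a' ≡ c' ℕ.* g
        a'≡ = ℕD._∣_.equality g∣a'
        coprime : Coprime b c
        coprime {i} (i∣b , i∣c) = ℕD.∣1⇒≡1 (ℕD.*-cancelʳ-∣ g (subst (i ℕ.* g ∣_) (sym (ℕₚ.*-identityˡ g))
          (gcd-greatest (subst (i ℕ.* g ∣_) (sym a≡) (ℕD.*-monoˡ-∣ g i∣c)) (subst (i ℕ.* g ∣_) (sym M≡) (ℕD.*-monoˡ-∣ g i∣b)))))
        ring : ∀ x y g → x ℕ.* g ℕ.* y ≡ x ℕ.* y ℕ.* g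
        ring = ℕsolve-∀
        reduced : ∀ {a c q p} → a ≡ c ℕ.* g → a ℕ.* q ≡ M ℕ.* p → c ℕ.* q ≡ b ℕ.* p
        reduced {a} {c} {q} {p} a≡ e = ℕₚ.*-cancelʳ-≡ (c ℕ.* q) (b ℕ.* p) g (trans (sym (ring c q g)) (trans (cong (ℕ._* q) (sym a≡)) (trans e (trans (cong (ℕ._* p) M≡) (ring b p g)))))
        b∣q : b ∣ q
        b∣q = C.coprime-divisor coprime (divides p (trans (reduced {a} {c} a≡ e) (ℕₚ.*-comm b p)))
        q'∣b : q' ∣ b
        q'∣b = C.coprime-divisor (C.sym cop') (divides c' (trans (ℕₚ.*-comm p' b) (sym (reduced {a'} {c'} a'≡ e'))))

-- The common factor of α², β² and 2γδ

module Content where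

  open import Data.Nat as ℕ using (ℕ; suc; s≤s)
  import Data.Nat.Properties as ℕₚ
  import Data.Nat.Divisibility as ℕD
  open import Data.Nat.GCD using (gcd; gcd[m,n]∣m; gcd[m,n]∣n; gcd-greatest; gcd[m,n]≢0)
  open import Data.Nat.Coprimality as C using (Coprime)
  open import Data.Nat.Tactic.RingSolver using () renaming (solve-∀ to ℕsolve-∀)
  open import Data.Integer using (ℤ; +_; -[1+_]; 0ℤ; _+_; _*_; _-_; -_) renaming (∣_∣ to abs)
  open import Data.Integer.Properties
  open import Data.Integer.Divisibility.Signed
  open import Data.Integer.Tactic.RingSolver using (solve-∀)
  open Classes using (parity)
  open import Data.Product using (_,_)
  open import Data.Sum using (inj₁; inj₂)
  open import Data.Empty using (⊥-elim)
  open import Relation.Binary.PropositionalEquality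
  open import Relation.Nullary using (yes; no; ¬_)

  -- Coprimality

  coprime-*ʳ : ∀ {m n o} → Coprime m n → Coprime m o → Coprime m (n ℕ.* o)
  coprime-*ʳ mn mo {d} (d∣m , d∣no) = mo (d∣m , C.coprime-divisor (λ (e∣d , e∣n) → mn (ℕD.∣-trans e∣d d∣m , e∣n)) d∣no)

  coprime-*ˡ : ∀ {m n o} → Coprime m o → Coprime n o → Coprime (m ℕ.* n) o
  coprime-*ˡ m⊥o n⊥o = C.sym (coprime-*ʳ (C.sym m⊥o) (C.sym n⊥o))

  coprime-square : ∀ {m n} → Coprime m n → Coprime (m ℕ.* m) (n ℕ.* n)
  coprime-square mn = coprime-*ˡ (coprime-*ʳ mn mn) (coprime-*ʳ mn mn)

  coprime-∣ : ∀ {m n o} → Coprime m n → o ℕD.∣ n → Coprime o m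
  coprime-∣ mn o∣n (d∣o , d∣m) = mn (d∣m , ℕD.∣-trans d∣o o∣n)

  module _ (c : ℕ) where

    unsigned : ∀ {z} → + c ∣ z → c ℕD.∣ abs z
    unsigned h = ∣⇒∣ᵤ h

    signed : ∀ {z} → c ℕD.∣ abs z → + c ∣ z
    signed h = ∣ᵤ⇒∣ h

    cancel-coprime : ∀ {a z} → Coprime c (abs a) → + c ∣ a * z → + c ∣ z
    cancel-coprime {a} {z} cop h = signed (C.coprime-divisor cop (subst (c ℕD.∣_) (abs-* a z) (unsigned h)))

    cancel-coprime₂ : ∀ {a b z} → Coprime (abs a) (abs b) → + c ∣ a * z → + c ∣ b * z → + c ∣ z
    cancel-coprime₂ {a} {b} {z} cop h k = signed (C.coprime-factors cop (subst (c ℕD.∣_) (abs-* a z) (unsigned h) , subst (c ℕD.∣_) (abs-* b z) (unsigned k)))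

    -- c divides the gcd of a² and b², which is the square of gcd a b, and this square divides a b.
    ∣a²∣b²⇒∣ab : ∀ {a b} → + c ∣ a * a → + c ∣ b * b → + c ∣ a * b
    ∣a²∣b²⇒∣ab {a} {b} h k with abs a ℕ.≟ 0
    ... | yes a≡0 = divides 0ℤ (trans (cong (λ z → z * b) {a} {0ℤ} (∣i∣≡0⇒i≡0 a≡0)) refl)
    ... | no a≢0 = signed (subst (c ℕD.∣_) (sym (trans (abs-* a b) (trans (cong₂ ℕ._*_ a≡ b≡) (ring a' b' g)))) (ℕD.∣n⇒∣m*n (a' ℕ.* b') c∣g²))
      where
      g = gcd (abs a) (abs b)
      instance
        g≢0 : ℕ.NonZero g
        g≢0 = ℕ.≢-nonZero (gcd[m,n]≢0 (abs a) (abs b) (inj₁ a≢0))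
      a' = ℕD.quotient (gcd[m,n]∣m (abs a) (abs b))
      b' = ℕD.quotient (gcd[m,n]∣n (abs a) (abs b))
      a≡ : abs a ≡ a' ℕ.* g
      a≡ = ℕD._∣_.equality (gcd[m,n]∣m (abs a) (abs b))
      b≡ : abs b ≡ b' ℕ.* g
      b≡ = ℕD._∣_.equality (gcd[m,n]∣n (abs a) (abs b))
      ring : ∀ a b g → a ℕ.* g ℕ.* (b ℕ.* g) ≡ a ℕ.* b ℕ.* (g ℕ.* g)
      ring = ℕsolve-∀
      cop : Coprime a' b'
      cop {i} (i∣a , i∣b) = ℕD.∣1⇒≡1 (ℕD.*-cancelʳ-∣ g (subst (i ℕ.* g ℕD.∣_) (sym (ℕₚ.*-identityˡ g))
        (gcd-greatest (subst (i ℕ.* g ℕD.∣_) (sym a≡) (ℕD.*-monoˡ-∣ g i∣a)) (subst (i ℕ.* g ℕD.∣_) (sym b≡) (ℕD.*-monoˡ-∣ g i∣b)))))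
      c∣g² : c ℕD.∣ g ℕ.* g
      c∣g² = C.coprime-factors (coprime-square cop)
        ( subst (c ℕD.∣_) (trans (abs-* a a) (trans (cong₂ ℕ._*_ a≡ a≡) (ring a' a' g))) (unsigned h)
        , subst (c ℕD.∣_) (trans (abs-* b b) (trans (cong₂ ℕ._*_ b≡ b≡) (ring b' b' g))) (unsigned k) )

  -- p² + q² for coprime p and q

  norm : ℤ → ℤ → ℤ
  norm p q = p * p + q * q

  private
    abs-norm : ∀ p q → abs (norm p q) ≡ abs p ℕ.* abs p ℕ.+ abs q ℕ.* abs q
    abs-norm p q = cong abs (trans (cong₂ _+_ (sq p) (sq q)) (sym (pos-+ (abs p ℕ.* abs p) (abs q ℕ.* abs q))))
      where
      sq : ∀ p → p * p ≡ + (abs p ℕ.* abs p)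
      sq (+ n)    = sym (pos-* n n)
      sq -[1+ n ] = refl

  coprime-norm : ∀ {p q} → Coprime (abs p) (abs q) → Coprime (abs p ℕ.* abs q) (abs (norm p q))
  coprime-norm {p} {q} cop = subst (Coprime (abs p ℕ.* abs q)) (sym (abs-norm p q)) (coprime-*ˡ
    (λ (d∣p , d∣s) → coprime-*ʳ cop cop (d∣p , ℕD.∣m+n∣m⇒∣n d∣s (ℕD.∣m⇒∣m*n (abs p) d∣p)))
    (λ {d} (d∣q , d∣s) → coprime-*ʳ (C.sym cop) (C.sym cop) (d∣q , ℕD.∣m+n∣m⇒∣n (subst (d ℕD.∣_) (ℕₚ.+-comm (abs p ℕ.* abs p) (abs q ℕ.* abs q)) d∣s) (ℕD.∣m⇒∣m*n (abs q) d∣q))))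

  private
    even-square : ∀ a → 2 ℕD.∣ a ℕ.* a → 2 ℕD.∣ a
    even-square a h with parity a
    ... | inj₁ (k , refl) = ℕD.m∣m*n k
    ... | inj₂ (k , refl) = ⊥-elim (ℕₚ.even≢odd (ℕD.quotient h) (2 ℕ.* (k ℕ.* k ℕ.+ k)) (trans (ℕₚ.*-comm 2 (ℕD.quotient h)) (trans (sym (ℕD._∣_.equality h)) (ring k))))
      where
      ring : ∀ k → suc (2 ℕ.* k) ℕ.* suc (2 ℕ.* k) ≡ suc (2 ℕ.* (2 ℕ.* (k ℕ.* k ℕ.+ k)))
      ring = ℕsolve-∀

    8∣square : ∀ a → 8 ℕD.∣ a ℕ.* a → 4 ℕD.∣ a
    8∣square a h with even-square a (ℕD.∣-trans (ℕD.divides 4 refl) h)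
    ... | ℕD.divides b refl = ℕD.*-monoˡ-∣ 2 (even-square b (ℕD.*-cancelʳ-∣ 4 (subst (8 ℕD.∣_) (ring b) h)))
      where
      ring : ∀ b → b ℕ.* 2 ℕ.* (b ℕ.* 2) ≡ b ℕ.* b ℕ.* 4
      ring = ℕsolve-∀

    4∤norm : ∀ a b → Coprime a b → ¬ (4 ℕD.∣ a ℕ.* a ℕ.+ b ℕ.* b)
    4∤norm a b cop h with parity a | parity b
    ... | inj₁ (i , refl) | inj₁ (j , refl) with cop (ℕD.m∣m*n {2} i , ℕD.m∣m*n {2} j)
    ...   | ()
    4∤norm a b cop (ℕD.divides k e) | inj₁ (i , refl) | inj₂ (j , refl) = ℕₚ.even≢odd (2 ℕ.* k) (2 ℕ.* (i ℕ.* i) ℕ.+ 2 ℕ.* (j ℕ.* j ℕ.+ j)) (trans (r₁ k) (trans (sym e) (r₂ i j)))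
      where
      r₁ : ∀ k → 2 ℕ.* (2 ℕ.* k) ≡ k ℕ.* 4
      r₁ = ℕsolve-∀
      r₂ : ∀ i j → 2 ℕ.* i ℕ.* (2 ℕ.* i) ℕ.+ suc (2 ℕ.* j) ℕ.* suc (2 ℕ.* j) ≡ suc (2 ℕ.* (2 ℕ.* (i ℕ.* i) ℕ.+ 2 ℕ.* (j ℕ.* j ℕ.+ j)))
      r₂ = ℕsolve-∀
    4∤norm a b cop (ℕD.divides k e) | inj₂ (i , refl) | inj₁ (j , refl) = ℕₚ.even≢odd (2 ℕ.* k) (2 ℕ.* (i ℕ.* i ℕ.+ i) ℕ.+ 2 ℕ.* (j ℕ.* j)) (trans (r₁ k) (trans (sym e) (r₂ i j)))
      where
      r₁ : ∀ k → 2 ℕ.* (2 ℕ.* k) ≡ k ℕ.* 4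
      r₁ = ℕsolve-∀
      r₂ : ∀ i j → suc (2 ℕ.* i) ℕ.* suc (2 ℕ.* i) ℕ.+ 2 ℕ.* j ℕ.* (2 ℕ.* j) ≡ suc (2 ℕ.* (2 ℕ.* (i ℕ.* i ℕ.+ i) ℕ.+ 2 ℕ.* (j ℕ.* j)))
      r₂ = ℕsolve-∀
    4∤norm a b cop (ℕD.divides k e) | inj₂ (i , refl) | inj₂ (j , refl) = ℕₚ.even≢odd k (i ℕ.* i ℕ.+ i ℕ.+ (j ℕ.* j ℕ.+ j)) (ℕₚ.*-cancelˡ-≡ _ _ 2 (trans (r₁ k) (trans (sym e) (r₂ i j))))
      where
      r₁ : ∀ k → 2 ℕ.* (2 ℕ.* k) ≡ k ℕ.* 4
      r₁ = ℕsolve-∀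
      r₂ : ∀ i j → suc (2 ℕ.* i) ℕ.* suc (2 ℕ.* i) ℕ.+ suc (2 ℕ.* j) ℕ.* suc (2 ℕ.* j) ≡ 2 ℕ.* suc (2 ℕ.* (i ℕ.* i ℕ.+ i ℕ.+ (j ℕ.* j ℕ.+ j)))
      r₂ = ℕsolve-∀

    ∣16 : ∀ c → c ℕD.∣ 16 → ¬ 8 ℕD.∣ c → c ℕ.≤ 4
    ∣16 c (ℕD.divides 0 ()) _
    ∣16 c (ℕD.divides 1 e) 8∤c = ⊥-elim (8∤c (ℕD.divides 2 (trans (sym (ℕₚ.*-identityˡ c)) (sym e))))
    ∣16 c (ℕD.divides 2 e) 8∤c = ⊥-elim (8∤c (ℕD.divides 1 (ℕₚ.*-cancelˡ-≡ c 8 2 (sym e))))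
    ∣16 c (ℕD.divides (suc (suc (suc k))) e) 8∤c with c ℕ.≤? 4
    ... | yes c≤4 = c≤4
    ∣16 c (ℕD.divides 3 e) 8∤c | no c≰4 = ⊥-elim (three c e)
      where
      three : ∀ c → 16 ≢ 3 ℕ.* c
      three c e with ℕD.∣m+n∣m⇒∣n {3} {15} {1} (ℕD.divides c (trans e (ℕₚ.*-comm 3 c))) (ℕD.divides 5 refl)
      ... | d with ℕD.∣1⇒≡1 d
      ...   | ()
    ∣16 c (ℕD.divides (suc (suc (suc (suc k)))) e) 8∤c | no c≰4 = ⊥-elim (ℕₚ.<⇒≱ (ℕₚ.≤-trans (ℕₚ.*-mono-≤ {4} {4 ℕ.+ k} (ℕₚ.m≤m+n 4 k) (ℕₚ.≰⇒> c≰4)) (ℕₚ.≤-reflexive (sym e))) (ℕₚ.m≤m+n 16 3))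

    ∣16-odd : ∀ c → c ℕD.∣ 16 → ¬ 2 ℕD.∣ c → c ≡ 1
    ∣16-odd c h 2∤c = ℕD.∣1⇒≡1 (strip (strip (strip (strip h))))
      where
      cop : Coprime c 2
      cop {0} (0∣c , 0∣2) with ℕD.0∣⇒≡0 0∣2
      ... | ()
      cop {1} _ = refl
      cop {2} (2∣c , _) = ⊥-elim (2∤c 2∣c)
      cop {suc (suc (suc d))} (_ , d∣2) with ℕD.∣⇒≤ d∣2
      ... | s≤s (s≤s ())
      strip : ∀ {m} → c ℕD.∣ 2 ℕ.* m → c ℕD.∣ m
      strip = C.coprime-divisor cop

  Odd : ℤ → Set
  Odd s = ¬ 2 ℕD.∣ abs s

  module _ {c : ℕ} {p q p' q' : ℤ} (cop : Coprime (abs p) (abs q)) (cop' : Coprime (abs p') (abs q'))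
           (c∣α² : + c ∣ (p * p' + q * q') * (p * p' + q * q')) (c∣β² : + c ∣ (p' * q - p * q') * (p' * q - p * q'))
           (c∣2γδ : + c ∣ (p * p' - q * q') * (p * q' + p' * q) + (p * p' - q * q') * (p * q' + p' * q)) where
    private
      α β γ δ : ℤ
      α = p * p' + q * q'
      β = p' * q - p * q'
      γ = p * p' - q * q'
      δ = p * q' + p' * q

      c∣αβ : + c ∣ α * β
      c∣αβ = ∣a²∣b²⇒∣ab c {α} {β} c∣α² c∣β²

      combine : ∀ {z} a b d → z ≡ a * (α * α) + b * (β * β) + d * (α * β) → + c ∣ z
      combine a b d e = subst (+ c ∣_) (sym e) (∣m∣n⇒∣m+n (∣m∣n⇒∣m+n (∣n⇒∣m*n a c∣α²) (∣n⇒∣m*n b c∣β²)) (∣n⇒∣m*n d c∣αβ))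

      s s' : ℤ
      s = norm p q
      s' = norm p' q'

      square-coprime : ∀ {a b} → Coprime (abs a) (abs b) → Coprime (abs (a * a)) (abs (b * b))
      square-coprime {a} {b} h = subst₂ Coprime (sym (abs-* a a)) (sym (abs-* b b)) (coprime-square h)

    -- p s' = p' α - q' β and q s' = q' α + p' β. Squaring, c divides p² s'² and q² s'², and p and q
    -- are coprime.
    content∣s'² : + c ∣ s' * s'
    content∣s'² = cancel-coprime₂ c {p * p} {q * q} (square-coprime {p} {q} cop)
      (combine (p' * p') (q' * q') (- (+ 2 * (p' * q'))) (r₁ p q p' q')) (combine (q' * q') (p' * p') (+ 2 * (p' * q')) (r₂ p q p' q'))
      where
      r₁ : ∀ p q p' q' → (p * p) * ((p' * p' + q' * q') * (p' * p' + q' * q')) ≡ (p' * p') * ((p * p' + q * q') * (p * p' + q * q')) + (q' * q') * ((p' * q - p * q') * (p' * q - p * q')) + (- (+ 2 * (p' * q'))) * ((p * p' + q * q') * (p' * q - p * q'))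
      r₁ = solve-∀
      r₂ : ∀ p q p' q' → (q * q) * ((p' * p' + q' * q') * (p' * p' + q' * q')) ≡ (q' * q') * ((p * p' + q * q') * (p * p' + q * q')) + (p' * p') * ((p' * q - p * q') * (p' * q - p * q')) + (+ 2 * (p' * q')) * ((p * p' + q * q') * (p' * q - p * q'))
      r₂ = solve-∀

    content∣s² : + c ∣ s * s
    content∣s² = cancel-coprime₂ c {p' * p'} {q' * q'} (square-coprime {p'} {q'} cop')
      (combine (p * p) (q * q) (+ 2 * (p * q)) (r₁ p q p' q')) (combine (q * q) (p * p) (- (+ 2 * (p * q))) (r₂ p q p' q'))
      where
      r₁ : ∀ p q p' q' → (p' * p') * ((p * p + q * q) * (p * p + q * q)) ≡ (p * p) * ((p * p' + q * q') * (p * p' + q * q')) + (q * q) * ((p' * q - p * q') * (p' * q - p * q')) + (+ 2 * (p * q)) * ((p * p' + q * q') * (p' * q - p * q'))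
      r₁ = solve-∀
      r₂ : ∀ p q p' q' → (q' * q') * ((p * p + q * q) * (p * p + q * q)) ≡ (q * q) * ((p * p' + q * q') * (p * p' + q * q')) + (p * p) * ((p' * q - p * q') * (p' * q - p * q')) + (- (+ 2 * (p * q))) * ((p * p' + q * q') * (p' * q - p * q'))
      r₂ = solve-∀

    private
      coprime-to : ∀ {p q} → Coprime (abs p) (abs q) → + c ∣ norm p q * norm p q → Coprime c (abs (p * q))
      coprime-to {p} {q} h c∣ = subst (Coprime c) (sym (abs-* p q)) (coprime-∣ (coprime-*ʳ (coprime-norm {p} {q} h) (coprime-norm {p} {q} h)) (subst (c ℕD.∣_) (abs-* (norm p q) (norm p q)) (unsigned c c∣)))

      c∣4[p²-q²] : + c ∣ + 4 * (p * p - q * q)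
      c∣4[p²-q²] = cancel-coprime c {p' * q'} (coprime-to {p'} {q'} cop' content∣s'²) (subst (+ c ∣_) (r p q p' q') (∣m∣n⇒∣m-n c∣2γδ (∣m∣n⇒∣m+n c∣αβ c∣αβ)))
        where
        r : ∀ p q p' q' → ((p * p' - q * q') * (p * q' + p' * q) + (p * p' - q * q') * (p * q' + p' * q)) - ((p * p' + q * q') * (p' * q - p * q') + (p * p' + q * q') * (p' * q - p * q')) ≡ (p' * q') * (+ 4 * (p * p - q * q))
        r = solve-∀

    -- Dividing s² and s'², c is coprime to p q and p' q'. By 2γδ - 2αβ = 4 p' q' (p² - q²) it
    -- divides 4 (p² - q²), and 4 s² - 4 (p² - q²)² = 16 p² q².
    content∣16 : c ℕD.∣ 16
    content∣16 = unsigned c (cancel-coprime c {p * q} pq (cancel-coprime c {p * q} pq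
      (subst (+ c ∣_) (r p q) (∣m∣n⇒∣m-n (∣n⇒∣m*n (+ 4) content∣s²) (∣m⇒∣m*n (p * p - q * q) c∣4[p²-q²])))))
      where
      pq = coprime-to {p} {q} cop content∣s²
      r : ∀ p q → + 4 * ((p * p + q * q) * (p * p + q * q)) - + 4 * (p * p - q * q) * (p * p - q * q) ≡ (p * q) * ((p * q) * (+ 16))
      r = solve-∀

    -- If 8 divided c, then 4 would divide α and β, hence p s' and q s', hence s'. But a sum of two
    -- coprime squares is not divisible by 4.
    content≤4 : c ℕ.≤ 4
    content≤4 = ∣16 c content∣16 (λ 8∣c → 4∤norm (abs p') (abs q') cop' (subst (4 ℕD.∣_) (abs-norm p' q')
      (unsigned 4 (cancel-coprime₂ 4 {p} {q} cop
        (subst (+ 4 ∣_) (r₁ p q p' q') (∣m∣n⇒∣m-n (∣n⇒∣m*n p' (4∣ α 8∣c c∣α²)) (∣n⇒∣m*n q' (4∣ β 8∣c c∣β²))))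
        (subst (+ 4 ∣_) (r₂ p q p' q') (∣m∣n⇒∣m+n (∣n⇒∣m*n q' (4∣ α 8∣c c∣α²)) (∣n⇒∣m*n p' (4∣ β 8∣c c∣β²))))))))
      where
      4∣ : ∀ a → 8 ℕD.∣ c → + c ∣ a * a → + 4 ∣ a
      4∣ a 8∣c h = signed 4 (8∣square (abs a) (ℕD.∣-trans 8∣c (subst (c ℕD.∣_) (abs-* a a) (unsigned c h))))
      r₁ : ∀ p q p' q' → p' * (p * p' + q * q') - q' * (p' * q - p * q') ≡ p * (p' * p' + q' * q')
      r₁ = solve-∀
      r₂ : ∀ p q p' q' → q' * (p * p' + q * q') + p' * (p' * q - p * q') ≡ q * (p' * p' + q' * q')
      r₂ = solve-∀

    private
      odd⇒1 : ∀ {s} → + c ∣ s * s → Odd s → c ≡ 1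
      odd⇒1 {s} h odd = ∣16-odd c content∣16 (λ 2∣c → odd (even-square (abs s) (ℕD.∣-trans 2∣c (subst (c ℕD.∣_) (abs-* s s) (unsigned c h)))))

    -- c divides 16 and the square of an odd number.
    content-odd : Odd (norm p q) → c ≡ 1
    content-odd = odd⇒1 {s} content∣s²

    content-odd' : Odd (norm p' q') → c ≡ 1
    content-odd' = odd⇒1 {s'} content∣s'²

-- The parallelogram law for heights

module Heights where

  open Content
  open import Data.Nat as ℕ using (ℕ; zero; suc; s≤s; z≤n; _⊔_)
  import Data.Nat.Properties as ℕₚ
  import Data.Nat.Divisibility as ℕD
  open import Data.Nat.Coprimality as C using (Coprime)
  open import Data.Nat.Tactic.RingSolver using () renaming (solve-∀ to ℕsolve-∀)
  open import Data.Integer using (ℤ; +_; -[1+_]; +[1+_]; 0ℤ; 1ℤ; _+_; _*_; _-_; -_) renaming (∣_∣ to abs)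
  open import Data.Integer.Properties
  open import Data.Integer.Divisibility.Signed
  open import Data.Integer.Tactic.RingSolver using (solve-∀)
  open import Data.Product using (∃; _×_; _,_; proj₁; proj₂)
  open import Data.Sum using (_⊎_; inj₁; inj₂)
  open import Data.Empty using (⊥-elim)
  open import Relation.Binary.PropositionalEquality
  open import Relation.Nullary using (¬_)
  open Classes using (parity)

  -- The abscissae x(nP) / M in lowest terms
  record Abscissae : Set where
    field
      p         : ℕ → ℤ
      q         : ℕ → ℕ
      q>0       : ∀ n → 0 ℕ.< q (suc n)
      coprime   : ∀ n → Coprime (abs (p (suc n))) (q (suc n))
      component : ∀ n → ∃ λ k → p (suc n) * (p (suc n) * p (suc n) - + q (suc n) * + q (suc n)) ≡ + suc k
      product   : ∀ i j → let a = suc i; b = suc j; c = a ℕ.+ b; d = a ℕ.+ c in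
        (p b * p d) * ((p c * + q a - p a * + q c) * (p c * + q a - p a * + q c)) ≡ (+ q b * + q d) * ((p a * p c + + q a * + q c) * (p a * p c + + q a * + q c))
      sum       : ∀ i j → let a = suc i; b = suc j; c = a ℕ.+ b; d = a ℕ.+ c in
        (p b * + q d + p d * + q b) * ((p c * + q a - p a * + q c) * (p c * + q a - p a * + q c)) ≡
        (+ q b * + q d) * ((p a * p c - + q a * + q c) * (p a * + q c + p c * + q a) + (p a * p c - + q a * + q c) * (p a * + q c + p c * + q a))
      distinct  : ∀ i j → let a = suc i; c = a ℕ.+ suc j in p c * + q a - p a * + q c ≢ 0ℤ
      double    : ∀ i → let a = suc i; b = a ℕ.+ a in
        p b * (+ 4 * ((p a * + q a) * (p a * p a - + q a * + q a))) ≡ + q b * ((p a * p a + + q a * + q a) * (p a * p a + + q a * + q a))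

  private
    nonzero-pos : ∀ {n} → 0 ℕ.< n → ℕ.NonZero n
    nonzero-pos = ℕ.>-nonZero

    *-cancelˡ : ∀ q {x y} → 0 ℕ.< q → + q * x ≡ + q * y → x ≡ y
    *-cancelˡ q {x} {y} q>0 e = *-cancelˡ-≡ (+ q) x y {{nonzero-pos q>0}} e

  module _ {p₂ p₄ : ℤ} {q₂ q₄ : ℕ} (q₂>0 : 0 ℕ.< q₂) (q₄>0 : 0 ℕ.< q₄) (cop₂ : Coprime (abs p₂) q₂) (cop₄ : Coprime (abs p₄) q₄)
           {u v w : ℤ} (su : (p₂ * p₄) * w ≡ (+ q₂ * + q₄) * u) (tv : (p₂ * + q₄ + p₄ * + q₂) * w ≡ (+ q₂ * + q₄) * v) where
    private
      q₂∣w : + q₂ ∣ w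
      q₂∣w = cancel-coprime q₂ {p₂} (C.sym cop₂) (cancel-coprime q₂ {p₂} (C.sym cop₂) (divides (p₂ * v - + q₂ * u) (*-cancelˡ q₄ q₄>0
        (trans (r₁ p₂ p₄ (+ q₂) (+ q₄) w) (trans (cong₂ (λ a b → p₂ * a - + q₂ * b) tv su) (r₂ p₂ (+ q₂) (+ q₄) u v))))))
        where
        r₁ : ∀ p₂ p₄ q₂ q₄ w → q₄ * (p₂ * (p₂ * w)) ≡ p₂ * ((p₂ * q₄ + p₄ * q₂) * w) - q₂ * ((p₂ * p₄) * w)
        r₁ = solve-∀
        r₂ : ∀ p₂ q₂ q₄ u v → p₂ * ((q₂ * q₄) * v) - q₂ * ((q₂ * q₄) * u) ≡ q₄ * ((p₂ * v - q₂ * u) * q₂)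
        r₂ = solve-∀
      w₁ : ℤ
      w₁ = quotient q₂∣w
      w≡ : w ≡ w₁ * + q₂
      w≡ = _∣_.equality q₂∣w
      su₁ : (p₂ * p₄) * w₁ ≡ + q₄ * u
      su₁ = *-cancelˡ q₂ q₂>0 (trans (r₁ (p₂ * p₄) w₁ (+ q₂)) (trans (cong ((p₂ * p₄) *_) (sym w≡)) (trans su (*-assoc (+ q₂) (+ q₄) u))))
        where
        r₁ : ∀ s w q → q * (s * w) ≡ s * (w * q)
        r₁ = solve-∀
      tv₁ : (p₂ * + q₄ + p₄ * + q₂) * w₁ ≡ + q₄ * v
      tv₁ = *-cancelˡ q₂ q₂>0 (trans (r₁ (p₂ * + q₄ + p₄ * + q₂) w₁ (+ q₂)) (trans (cong ((p₂ * + q₄ + p₄ * + q₂) *_) (sym w≡)) (trans tv (*-assoc (+ q₂) (+ q₄) v))))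
        where
        r₁ : ∀ s w q → q * (s * w) ≡ s * (w * q)
        r₁ = solve-∀
      q₄∣w₁ : + q₄ ∣ w₁
      q₄∣w₁ = cancel-coprime q₄ {p₄} (C.sym cop₄) (cancel-coprime₂ q₄ {p₂} {+ q₂} cop₂
        (divides u (trans (r₁ p₂ p₄ w₁) (trans su₁ (*-comm (+ q₄) u))))
        (divides (v - p₂ * w₁) (trans (r₂ p₂ p₄ (+ q₂) (+ q₄) w₁) (trans (cong (_- (p₂ * + q₄) * w₁) tv₁) (r₃ p₂ (+ q₄) v w₁)))))
        where
        r₁ : ∀ p₂ p₄ w → p₂ * (p₄ * w) ≡ (p₂ * p₄) * w
        r₁ = solve-∀
        r₂ : ∀ p₂ p₄ q₂ q₄ w → q₂ * (p₄ * w) ≡ (p₂ * q₄ + p₄ * q₂) * w - (p₂ * q₄) * w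
        r₂ = solve-∀
        r₃ : ∀ p q v w → q * v - (p * q) * w ≡ (v - p * w) * q
        r₃ = solve-∀
      C : ℤ
      C = quotient q₄∣w₁
      w₁≡ : w₁ ≡ C * + q₄
      w₁≡ = _∣_.equality q₄∣w₁

    -- Gauss's lemma for the product (q₂ T - p₂)(q₄ T - p₄) of primitive linear forms: an integral
    -- triple proportional to its coefficients (up to sign) is an integral multiple of them.
    gauss : ∃ λ C → u ≡ (p₂ * p₄) * C × v ≡ (p₂ * + q₄ + p₄ * + q₂) * C × w ≡ (+ q₂ * + q₄) * C
    gauss = C , *-cancelˡ q₄ q₄>0 (trans (sym su₁) (trans (cong ((p₂ * p₄) *_) w₁≡) (r (p₂ * p₄) C (+ q₄))))
              , *-cancelˡ q₄ q₄>0 (trans (sym tv₁) (trans (cong ((p₂ * + q₄ + p₄ * + q₂) *_) w₁≡) (r (p₂ * + q₄ + p₄ * + q₂) C (+ q₄))))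
              , trans w≡ (trans (cong (_* + q₂) w₁≡) (r' C (+ q₄) (+ q₂)))
      where
      r : ∀ s c q → s * (c * q) ≡ q * (s * c)
      r = solve-∀
      r' : ∀ c q r → c * q * r ≡ r * q * c
      r' = solve-∀

  pos*⇒pos : ∀ q C k → + q * C ≡ + suc k → ∃ λ c → C ≡ + suc c
  pos*⇒pos q (+ zero) k e with trans (sym (*-zeroʳ (+ q))) e
  ... | ()
  pos*⇒pos q (+ suc c) k e = c , refl
  pos*⇒pos zero -[1+ c ] k ()
  pos*⇒pos (suc q) -[1+ c ] k ()

  square-pos : ∀ z → z ≢ 0ℤ → ∃ λ k → z * z ≡ + suc k
  square-pos (+ zero) z≢0 = ⊥-elim (z≢0 refl)
  square-pos (+ suc n) _ = _ , refl
  square-pos -[1+ n ] _ = _ , refl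

  -- p (p² - q²) > 0 means p/q > 1 or -1 < p/q < 0: the unbounded branch of the real curve, or its
  -- oval.
  data Component (p : ℤ) (q : ℕ) : Set where
    identity : ∀ a → p ≡ + a → q ℕ.< a → Component p q
    egg      : ∀ a → p ≡ -[1+ a ] → suc a ℕ.< q → Component p q

  private
    to-component : ∀ p q k → p * (p * p - + q * + q) ≡ + suc k → Component p q
    to-component (+ a) q k e = identity a refl (ℕₚ.≰⇒> λ a≤q → neg a≤q (pos*⇒pos a _ k e))
      where
      neg : a ℕ.≤ q → ¬ (∃ λ c → + a * + a - + q * + q ≡ + suc c)
      neg a≤q (c , e') = ℕₚ.<⇒≱ (ℕₚ.m<m+n (q ℕ.* q) (s≤s (z≤n {c}))) (ℕₚ.≤-trans (ℕₚ.≤-reflexive (sym a²≡)) (ℕₚ.*-mono-≤ a≤q a≤q))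
        where
        r : ∀ x y → x ≡ y + (x - y)
        r = solve-∀
        a²≡ : a ℕ.* a ≡ q ℕ.* q ℕ.+ suc c
        a²≡ = +-injective (trans (pos-* a a) (trans (r (+ a * + a) (+ q * + q)) (cong₂ _+_ (sym (pos-* q q)) e')))
    to-component -[1+ a ] q k e = egg a refl (ℕₚ.≰⇒> λ q≤a → neg q≤a (pos*⇒pos (suc a) _ k (trans (r +[1+ a ] (+ q)) e)))
      where
      r : ∀ a q → a * (q * q - a * a) ≡ (- a) * ((- a) * (- a) - q * q)
      r = solve-∀
      neg : q ℕ.≤ suc a → ¬ (∃ λ c → + q * + q - + suc a * + suc a ≡ + suc c)
      neg q≤a (c , e') = ℕₚ.<⇒≱ (ℕₚ.m<m+n (suc a ℕ.* suc a) (s≤s (z≤n {c}))) (ℕₚ.≤-trans (ℕₚ.≤-reflexive (sym q²≡)) (ℕₚ.*-mono-≤ q≤a q≤a))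
        where
        r' : ∀ x y → x ≡ y + (x - y)
        r' = solve-∀
        q²≡ : q ℕ.* q ≡ suc a ℕ.* suc a ℕ.+ suc c
        q²≡ = +-injective (trans (pos-* q q) (trans (r' (+ q * + q) (+ suc a * + suc a)) (cong₂ _+_ (sym (pos-* (suc a) (suc a))) e')))

    H′ : ℤ → ℕ → ℕ
    H′ p q = abs p ⊔ q

    H-id : ∀ {p q a} → p ≡ + a → q ℕ.< a → H′ p q ≡ a
    H-id refl q<a = ℕₚ.m≥n⇒m⊔n≡m (ℕₚ.<⇒≤ q<a)

    H-egg : ∀ {p q a} → p ≡ -[1+ a ] → suc a ℕ.< q → H′ p q ≡ q
    H-egg refl a<q = ℕₚ.m≤n⇒m⊔n≡n (ℕₚ.<⇒≤ a<q)

    -- Nothing cancels: on equal components the two terms of α have the same sign, on different ones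
    -- those of β. The product of the heights is the absolute value of one of these terms.
    max-lemma : ∀ {p q p' q'} → Component p q → Component p' q' →
      H′ p q ℕ.* H′ p' q' ℕ.≤ abs (p * p' + + q * + q') ⊎ H′ p q ℕ.* H′ p' q' ℕ.≤ abs (p' * + q - p * + q')
    max-lemma {q = q} {q' = q'} (identity a refl h) (identity a' refl h') = inj₁ (subst₂ ℕ._≤_ (sym (cong₂ ℕ._*_ (H-id {+ a} refl h) (H-id {+ a'} refl h'))) (cong abs (cong₂ _+_ (pos-* a a') (pos-* q q'))) (ℕₚ.m≤m+n (a ℕ.* a') (q ℕ.* q')))
    max-lemma {q = q} {q' = q'} (egg a refl h) (egg a' refl h') = inj₁ (subst₂ ℕ._≤_ (sym (cong₂ ℕ._*_ (H-egg { -[1+ a ]} refl h) (H-egg { -[1+ a' ]} refl h'))) (cong abs (cong (λ t → + (suc a ℕ.* suc a') + t) (pos-* q q'))) (ℕₚ.m≤n+m (q ℕ.* q') (suc a ℕ.* suc a')))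
    max-lemma {q = q} {q' = q'} (identity a refl h) (egg a' refl h') = inj₂ (subst₂ ℕ._≤_ (sym (cong₂ ℕ._*_ (H-id {+ a} refl h) (H-egg { -[1+ a' ]} refl h'))) eq (ℕₚ.m≤n+m (a ℕ.* q') (suc a' ℕ.* q)))
      where
      r : ∀ x y z w → (- x) * y - z * w ≡ - (x * y + z * w)
      r = solve-∀
      eq : suc a' ℕ.* q ℕ.+ a ℕ.* q' ≡ abs (-[1+ a' ] * + q - + a * + q')
      eq = sym (trans (cong abs (r +[1+ a' ] (+ q) (+ a) (+ q'))) (trans (∣-i∣≡∣i∣ (+[1+ a' ] * + q + + a * + q')) (cong abs (sym (cong₂ _+_ (pos-* (suc a') q) (pos-* a q'))))))
    max-lemma {q = q} {q' = q'} (egg a refl h) (identity a' refl h') = inj₂ (subst₂ ℕ._≤_ (sym (trans (cong₂ ℕ._*_ (H-egg { -[1+ a ]} refl h) (H-id {+ a'} refl h')) (ℕₚ.*-comm q a'))) eq (ℕₚ.m≤m+n (a' ℕ.* q) (suc a ℕ.* q')))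
      where
      r : ∀ x y z w → z * w - (- x) * y ≡ z * w + x * y
      r = solve-∀
      eq : a' ℕ.* q ℕ.+ suc a ℕ.* q' ≡ abs (+ a' * + q - -[1+ a ] * + q')
      eq = sym (trans (cong abs (r +[1+ a ] (+ q') (+ a') (+ q))) (cong abs (sym (cong₂ _+_ (pos-* a' q) (pos-* (suc a) q')))))

  module _ {p₁ p₂ p₃ p₄ : ℤ} {q₁ q₂ q₃ q₄ : ℕ} (q₂>0 : 0 ℕ.< q₂) (q₄>0 : 0 ℕ.< q₄) (cop₁ : Coprime (abs p₁) q₁) (cop₂ : Coprime (abs p₂) q₂)
           (cop₃ : Coprime (abs p₃) q₃) (cop₄ : Coprime (abs p₄) q₄) (comp₁ : Component p₁ q₁) (comp₃ : Component p₃ q₃) where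
    private
      α β γ δ : ℤ
      α = p₁ * p₃ + + q₁ * + q₃
      β = p₃ * + q₁ - p₁ * + q₃
      γ = p₁ * p₃ - + q₁ * + q₃
      δ = p₁ * + q₃ + p₃ * + q₁
      H₁ H₂ H₃ H₄ : ℕ
      H₁ = H′ p₁ q₁
      H₂ = H′ p₂ q₂
      H₃ = H′ p₃ q₃
      H₄ = H′ p₄ q₄
      bound : ∀ {x k X Y} → x * x ≡ X * + k → abs X ℕ.≤ Y → H₁ ℕ.* H₃ ℕ.≤ abs x → (H₁ ℕ.* H₃) ℕ.* (H₁ ℕ.* H₃) ℕ.≤ k ℕ.* Y
      bound {x} {k} {X} {Y} e X≤Y h = ℕₚ.≤-trans (ℕₚ.*-mono-≤ h h) (ℕₚ.≤-trans (ℕₚ.≤-reflexive (trans (sym (abs-* x x)) (trans (cong abs e) (trans (abs-* X (+ k)) (ℕₚ.*-comm (abs X) k))))) (ℕₚ.*-monoʳ-≤ k X≤Y))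

    -- k is the content of the triple of forms α², 2γδ, β².
    parallelogram : (p₂ * p₄) * (β * β) ≡ (+ q₂ * + q₄) * (α * α) →
      (p₂ * + q₄ + p₄ * + q₂) * (β * β) ≡ (+ q₂ * + q₄) * (γ * δ + γ * δ) → β ≢ 0ℤ →
      ∃ λ k → k ℕ.≤ 4 × (Odd (norm p₁ (+ q₁)) → k ≡ 1) × (Odd (norm p₃ (+ q₃)) → k ≡ 1) × (H₁ ℕ.* H₃) ℕ.* (H₁ ℕ.* H₃) ℕ.≤ k ℕ.* (H₂ ℕ.* H₄)
    parallelogram product sum β≢0 = conclude (gauss {p₂} {p₄} {q₂} {q₄} q₂>0 q₄>0 cop₂ cop₄ {α * α} {γ * δ + γ * δ} {β * β} product sum)
      where
      conclude : (∃ λ C → α * α ≡ (p₂ * p₄) * C × γ * δ + γ * δ ≡ (p₂ * + q₄ + p₄ * + q₂) * C × β * β ≡ (+ q₂ * + q₄) * C) →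
        ∃ λ k → k ℕ.≤ 4 × (Odd (norm p₁ (+ q₁)) → k ≡ 1) × (Odd (norm p₃ (+ q₃)) → k ≡ 1) × (H₁ ℕ.* H₃) ℕ.* (H₁ ℕ.* H₃) ℕ.≤ k ℕ.* (H₂ ℕ.* H₄)
      conclude (C , eu , ev , ew) = suc k , content≤4 {suc k} {p₁} {+ q₁} {p₃} {+ q₃} cop₁ cop₃ c∣α² c∣β² c∣2γδ
          , content-odd {suc k} {p₁} {+ q₁} {p₃} {+ q₃} cop₁ cop₃ c∣α² c∣β² c∣2γδ
          , content-odd' {suc k} {p₁} {+ q₁} {p₃} {+ q₃} cop₁ cop₃ c∣α² c∣β² c∣2γδ
          , height (max-lemma comp₁ comp₃)
        where
        β²>0 = square-pos β β≢0
        positive : ∃ λ k → C ≡ + suc k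
        positive = pos*⇒pos (q₂ ℕ.* q₄) C (proj₁ β²>0) (trans (cong (_* C) (pos-* (q₂) (q₄))) (trans (sym ew) (proj₂ β²>0)))
        k = proj₁ positive
        eu' : α * α ≡ (p₂ * p₄) * + suc k
        eu' = trans eu (cong ((p₂ * p₄) *_) (proj₂ positive))
        ew' : β * β ≡ (+ q₂ * + q₄) * + suc k
        ew' = trans ew (cong ((+ q₂ * + q₄) *_) (proj₂ positive))
        c∣α² : + suc k ∣ α * α
        c∣α² = divides (p₂ * p₄) eu'
        c∣β² : + suc k ∣ β * β
        c∣β² = divides (+ q₂ * + q₄) ew'
        c∣2γδ : + suc k ∣ γ * δ + γ * δ
        c∣2γδ = divides (p₂ * + q₄ + p₄ * + q₂) (trans ev (cong ((p₂ * + q₄ + p₄ * + q₂) *_) (proj₂ positive)))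
        height : H₁ ℕ.* H₃ ℕ.≤ abs α ⊎ H₁ ℕ.* H₃ ℕ.≤ abs β → (H₁ ℕ.* H₃) ℕ.* (H₁ ℕ.* H₃) ℕ.≤ suc k ℕ.* (H₂ ℕ.* H₄)
        height (inj₁ h) = bound {α} {suc k} {p₂ * p₄} eu' (ℕₚ.≤-trans (ℕₚ.≤-reflexive (abs-* (p₂) (p₄))) (ℕₚ.*-mono-≤ (ℕₚ.m≤m⊔n (abs (p₂)) (q₂)) (ℕₚ.m≤m⊔n (abs (p₄)) (q₄)))) h
        height (inj₂ h) = bound {β} {suc k} {+ q₂ * + q₄} ew' (ℕₚ.≤-trans (ℕₚ.≤-reflexive (abs-* (+ q₂) (+ q₄))) (ℕₚ.*-mono-≤ (ℕₚ.m≤n⊔m (abs (p₂)) (q₂)) (ℕₚ.m≤n⊔m (abs (p₄)) (q₄)))) h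

  -- Doubling is the degenerate case of coinciding points of the parallelogram law.
  module _ {P p₂ : ℤ} {q₁ q₂ : ℕ} (q₁>0 : 0 ℕ.< q₁) (q₂>0 : 0 ℕ.< q₂) (cop : Coprime (abs P) q₁) (cop₂ : Coprime (abs p₂) q₂)
           (component : ∃ λ k → P * (P * P - + q₁ * + q₁) ≡ + suc k)
           (double : p₂ * (+ 4 * ((P * + q₁) * (P * P - + q₁ * + q₁))) ≡ + q₂ * ((P * P + + q₁ * + q₁) * (P * P + + q₁ * + q₁))) where
    private
      Q s s₂ : ℤ
      Q = + q₁
      s = norm P Q
      s₂ = norm p₂ (+ q₂)
      h h₂ : ℕ
      h = H′ P q₁
      h₂ = H′ p₂ q₂
      f = + 4 * ((P * Q) * (P * P - Q * Q))
      q∣f : + q₂ ∣ f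
      q∣f = cancel-coprime (q₂) {p₂} (C.sym cop₂) (divides (s * s) (trans double (*-comm (+ q₂) (s * s))))
      f>0 : ∃ λ k → f ≡ + suc k
      f>0 = pos-product (q₁) q₁>0 (proj₁ component) (trans (r P Q) (cong (λ t → + 4 * (Q * t)) (proj₂ component)))
        where
        r : ∀ P Q → + 4 * ((P * Q) * (P * P - Q * Q)) ≡ + 4 * (Q * (P * (P * P - Q * Q)))
        r = solve-∀
        pos-product : ∀ {f} q → 0 ℕ.< q → ∀ k → f ≡ + 4 * (+ q * + suc k) → ∃ λ k → f ≡ + suc k
        pos-product (suc q) _ k refl = _ , refl
      positive : ∃ λ k → quotient q∣f ≡ + suc k
      positive = pos*⇒pos (q₂) (quotient q∣f) (proj₁ f>0) (trans (*-comm (+ q₂) (quotient q∣f)) (trans (sym (_∣_.equality q∣f)) (proj₂ f>0)))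
      k = proj₁ positive
      f≡ : f ≡ + suc k * + q₂
      f≡ = trans (_∣_.equality q∣f) (cong (_* + q₂) (proj₂ positive))
      s²≡ : s * s ≡ p₂ * + suc k
      s²≡ = sym (*-cancelˡ (q₂) q₂>0 (trans (r (+ q₂) (p₂) (+ suc k)) (trans (cong (p₂ *_) (sym f≡)) double)))
        where
        r : ∀ q p k → q * (p * k) ≡ p * (k * q)
        r = solve-∀
      c∣α² : + suc k ∣ (P * P + Q * Q) * (P * P + Q * Q)
      c∣α² = divides (p₂) s²≡
      c∣β² : + suc k ∣ (P * Q - P * Q) * (P * Q - P * Q)
      c∣β² = divides 0ℤ (r (P * Q))
        where
        r : ∀ x → (x - x) * (x - x) ≡ 0ℤ
        r = solve-∀
      c∣2γδ : + suc k ∣ (P * P - Q * Q) * (P * Q + P * Q) + (P * P - Q * Q) * (P * Q + P * Q)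
      c∣2γδ = divides (+ q₂) (trans (r P Q) (trans f≡ (*-comm (+ suc k) (+ q₂))))
        where
        r : ∀ P Q → (P * P - Q * Q) * (P * Q + P * Q) + (P * P - Q * Q) * (P * Q + P * Q) ≡ + 4 * ((P * Q) * (P * P - Q * Q))
        r = solve-∀
      abs-s : abs (s) ≡ abs P ℕ.* abs P ℕ.+ q₁ ℕ.* q₁
      abs-s = cong abs (cong₂ _+_ (sq P) (sym (pos-* (q₁) (q₁))))
        where
        sq : ∀ p → p * p ≡ + (abs p ℕ.* abs p)
        sq (+ n)    = sym (pos-* n n)
        sq -[1+ n ] = refl
      H²≤s : h ℕ.* h ℕ.≤ abs (s)
      H²≤s = subst (h ℕ.* h ℕ.≤_) (sym abs-s) (max² (abs P) (q₁))
        where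
        max² : ∀ m n → (m ⊔ n) ℕ.* (m ⊔ n) ℕ.≤ m ℕ.* m ℕ.+ n ℕ.* n
        max² m n with ℕₚ.≤-total m n
        ... | inj₁ m≤n rewrite ℕₚ.m≤n⇒m⊔n≡n m≤n = ℕₚ.m≤n+m (n ℕ.* n) (m ℕ.* m)
        ... | inj₂ n≤m rewrite ℕₚ.m≥n⇒m⊔n≡m n≤m = ℕₚ.m≤m+n (m ℕ.* m) (n ℕ.* n)
      height : (h ℕ.* h) ℕ.* (h ℕ.* h) ℕ.≤ suc k ℕ.* h₂
      height = ℕₚ.≤-trans (ℕₚ.*-mono-≤ H²≤s H²≤s) (ℕₚ.≤-trans (ℕₚ.≤-reflexive (trans (sym (abs-* (s) (s))) (trans (cong abs s²≡) (trans (abs-* (p₂) (+ suc k)) (ℕₚ.*-comm (abs (p₂)) (suc k)))))) (ℕₚ.*-monoʳ-≤ (suc k) (ℕₚ.m≤m⊔n (abs (p₂)) (q₂))))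
      -- 8 divides f while the content is at most 4.
      even : 2 ℕD.∣ q₂
      even = half (suc k) (content≤4 {suc k} {P} {Q} {P} {Q} cop cop c∣α² c∣β² c∣2γδ) (content∣16 {suc k} {P} {Q} {P} {Q} cop cop c∣α² c∣β² c∣2γδ)
               (subst (8 ℕD.∣_) (trans (cong abs f≡) (abs-* (+ suc k) (+ q₂))) 8∣f)
        where
        8∣f : 8 ℕD.∣ abs f
        8∣f = subst (8 ℕD.∣_) (sym (abs-* (+ 4) ((P * Q) * (P * P - Q * Q)))) (ℕD.*-monoʳ-∣ 4 (∣⇒∣ᵤ (even-product P Q)))
          where
          factor : ∀ {z} w → z ≡ w * + 2 → + 2 ∣ z
          factor w e = divides w e
          signed-parity : ∀ z → ∃ λ w → z ≡ w * + 2 ⊎ z ≡ w * + 2 + 1ℤ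
          signed-parity (+ n) with parity n
          ... | inj₁ (k , refl) = + k , inj₁ (trans (pos-* 2 k) (*-comm (+ 2) (+ k)))
          ... | inj₂ (k , refl) = + k , inj₂ (trans (+-comm 1ℤ (+ (2 ℕ.* k))) (cong (_+ 1ℤ) (trans (pos-* 2 k) (*-comm (+ 2) (+ k)))))
          signed-parity -[1+ n ] with parity n
          ... | inj₁ (k , refl) = - (+ suc k) , inj₂ (trans (cong -_ (cong (λ t → 1ℤ + t) (pos-* 2 k))) (r (+ k)))
            where
            r : ∀ k → - (1ℤ + + 2 * k) ≡ (- (1ℤ + k)) * + 2 + 1ℤ
            r = solve-∀
          ... | inj₂ (k , refl) = - (+ suc k) , inj₁ (trans (cong -_ (cong (λ t → 1ℤ + (1ℤ + t)) (pos-* 2 k))) (r (+ k)))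
            where
            r : ∀ k → - (1ℤ + (1ℤ + + 2 * k)) ≡ (- (1ℤ + k)) * + 2
            r = solve-∀
          even-product : ∀ P Q → + 2 ∣ (P * Q) * (P * P - Q * Q)
          even-product P Q with signed-parity P | signed-parity Q
          ... | a , inj₁ refl | _ = factor (a * (Q * ((a * + 2) * (a * + 2) - Q * Q))) (r a Q)
            where
            r : ∀ a Q → ((a * + 2) * Q) * ((a * + 2) * (a * + 2) - Q * Q) ≡ (a * (Q * ((a * + 2) * (a * + 2) - Q * Q))) * + 2
            r = solve-∀
          ... | _ | b , inj₁ refl = factor (b * (P * (P * P - (b * + 2) * (b * + 2)))) (r b P)
            where
            r : ∀ b P → (P * (b * + 2)) * (P * P - (b * + 2) * (b * + 2)) ≡ (b * (P * (P * P - (b * + 2) * (b * + 2)))) * + 2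
            r = solve-∀
          ... | a , inj₂ refl | b , inj₂ refl = factor (((a * + 2 + 1ℤ) * (b * + 2 + 1ℤ)) * (+ 2 * (a * a + a) - + 2 * (b * b + b))) (r a b)
            where
            r : ∀ a b → ((a * + 2 + 1ℤ) * (b * + 2 + 1ℤ)) * ((a * + 2 + 1ℤ) * (a * + 2 + 1ℤ) - (b * + 2 + 1ℤ) * (b * + 2 + 1ℤ)) ≡ (((a * + 2 + 1ℤ) * (b * + 2 + 1ℤ)) * (+ 2 * (a * a + a) - + 2 * (b * b + b))) * + 2
            r = solve-∀
        cancel₂ : ∀ {q} → 8 ℕD.∣ 2 ℕ.* q → 4 ℕD.∣ q
        cancel₂ {q} (ℕD.divides t e) = ℕD.divides t (ℕₚ.*-cancelˡ-≡ q (t ℕ.* 4) 2 (trans e (r t)))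
          where
          r : ∀ t → t ℕ.* 8 ≡ 2 ℕ.* (t ℕ.* 4)
          r = ℕsolve-∀
        cancel₄ : ∀ {q} → 8 ℕD.∣ 4 ℕ.* q → 2 ℕD.∣ q
        cancel₄ {q} (ℕD.divides t e) = ℕD.divides t (ℕₚ.*-cancelˡ-≡ q (t ℕ.* 2) 4 (trans e (r t)))
          where
          r : ∀ t → t ℕ.* 8 ≡ 4 ℕ.* (t ℕ.* 2)
          r = ℕsolve-∀
        half : ∀ c → c ℕ.≤ 4 → c ℕD.∣ 16 → ∀ {q} → 8 ℕD.∣ c ℕ.* q → 2 ℕD.∣ q
        half 0 _ c∣16 _ with ℕD.0∣⇒≡0 c∣16
        ... | ()
        half 1 _ _ {q} h = ℕD.∣-trans (ℕD.divides 4 refl) (subst (8 ℕD.∣_) (ℕₚ.*-identityˡ q) h)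
        half 2 _ _ {q} h = ℕD.∣-trans (ℕD.divides 2 refl) (cancel₂ h)
        half 3 _ c∣16 _ with ℕD.∣m+n∣m⇒∣n {3} {15} {1} c∣16 (ℕD.divides 5 refl)
        ... | d with ℕD.∣1⇒≡1 d
        ...   | ()
        half 4 _ _ {q} h = cancel₄ h
        half (suc (suc (suc (suc (suc c))))) (s≤s (s≤s (s≤s (s≤s ())))) _ _
      -- q₂ is even, so p₂ is odd by coprimality. This oddness later makes the content 1 in the
      -- parallelogram law for P and 2P.
      odd : Odd (s₂)
      odd 2∣s = two (cop₂ (2∣p , even))
        where
        two : ¬ 2 ≡ 1
        two ()
        abs-sb : abs (s₂) ≡ abs (p₂) ℕ.* abs (p₂) ℕ.+ q₂ ℕ.* q₂
        abs-sb = cong abs (cong₂ _+_ (sq (p₂)) (sym (pos-* (q₂) (q₂))))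
          where
          sq : ∀ p → p * p ≡ + (abs p ℕ.* abs p)
          sq (+ n)    = sym (pos-* n n)
          sq -[1+ n ] = refl
        even-root : ∀ m → 2 ℕD.∣ m ℕ.* m → 2 ℕD.∣ m
        even-root m h with parity m
        ... | inj₁ (k , refl) = ℕD.m∣m*n k
        ... | inj₂ (k , refl) = ⊥-elim (ℕₚ.even≢odd (ℕD.quotient h) (2 ℕ.* (k ℕ.* k ℕ.+ k)) (trans (ℕₚ.*-comm 2 (ℕD.quotient h)) (trans (sym (ℕD._∣_.equality h)) (ring k))))
          where
          ring : ∀ k → suc (2 ℕ.* k) ℕ.* suc (2 ℕ.* k) ≡ suc (2 ℕ.* (2 ℕ.* (k ℕ.* k ℕ.+ k)))
          ring = ℕsolve-∀
        2∣p : 2 ℕD.∣ abs (p₂)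
        2∣p = even-root (abs (p₂)) (ℕD.∣m+n∣m⇒∣n (subst (2 ℕD.∣_) (trans abs-sb (ℕₚ.+-comm (abs (p₂) ℕ.* abs (p₂)) (q₂ ℕ.* q₂))) 2∣s) (ℕD.∣m⇒∣m*n (q₂) even))

    duplication : ∃ λ k → k ℕ.≤ 4 × (Odd s → k ≡ 1) × (h ℕ.* h) ℕ.* (h ℕ.* h) ℕ.≤ k ℕ.* h₂ × Odd s₂
    duplication = suc k , content≤4 {suc k} {P} {Q} {P} {Q} cop cop c∣α² c∣β² c∣2γδ
      , content-odd {suc k} {P} {Q} {P} {Q} cop cop c∣α² c∣β² c∣2γδ , height , odd

  module _ (S : Abscissae) where
    open Abscissae S

    comp : ∀ n → Component (p (suc n)) (q (suc n))
    comp n = to-component (p (suc n)) (q (suc n)) (proj₁ (component n)) (proj₂ (component n))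

    H : ℕ → ℕ
    H n = abs (p n) ⊔ q n

    s : ℕ → ℤ
    s n = norm (p n) (+ q n)

    pair-height : ∀ i j → let a = suc i; b = suc j; c = a ℕ.+ b; d = a ℕ.+ c in
      ∃ λ k → k ℕ.≤ 4 × (Odd (s a) → k ≡ 1) × (Odd (s c) → k ≡ 1) × (H a ℕ.* H c) ℕ.* (H a ℕ.* H c) ℕ.≤ k ℕ.* (H b ℕ.* H d)
    pair-height i j = parallelogram {p (suc i)} {p (suc j)} {p (suc i ℕ.+ suc j)} {p (suc i ℕ.+ (suc i ℕ.+ suc j))}
      {q (suc i)} {q (suc j)} {q (suc i ℕ.+ suc j)} {q (suc i ℕ.+ (suc i ℕ.+ suc j))} (q>0 j) (q>0 (i ℕ.+ (suc i ℕ.+ suc j))) (coprime i) (coprime j) (coprime (i ℕ.+ suc j)) (coprime (i ℕ.+ (suc i ℕ.+ suc j)))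
      (comp i) (comp (i ℕ.+ suc j)) (product i j) (sum i j) (distinct i j)

    double-height : ∀ i → let a = suc i; b = a ℕ.+ a in
      ∃ λ k → k ℕ.≤ 4 × (Odd (s a) → k ≡ 1) × (H a ℕ.* H a) ℕ.* (H a ℕ.* H a) ℕ.≤ k ℕ.* H b × Odd (s b)
    double-height i = duplication {p (suc i)} {p (suc i ℕ.+ suc i)} {q (suc i)} {q (suc i ℕ.+ suc i)} (q>0 i) (q>0 (i ℕ.+ suc i)) (coprime i) (coprime (i ℕ.+ suc i)) (component i) (double i)

-- Quadratic growth of heights

module Growth where

  open Content using (Odd; norm)
  open Heights
  open Classes using (parity)
  open import Data.Nat hiding (parity)
  open import Data.Nat.Properties
  import Data.Nat.Divisibility as ℕD
  open import Data.Nat.Tactic.RingSolver using (solve-∀)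
  import Data.Integer as ℤ
  import Data.Integer.Properties as ℤₚ
  open import Data.Integer using (+_)
  open import Data.Product using (∃; _×_; _,_)
  open import Data.Sum using (_⊎_; inj₁; inj₂)
  open import Data.Empty using (⊥-elim)
  open import Relation.Binary.PropositionalEquality
  open import Relation.Nullary using (yes; no; ¬_)
  open ≤-Reasoning

  -- A height h ≥ 2 absorbs the content 4, and a ≤ b then lets one factor b cancel.
  convex-step : ∀ {h a b c} → 2 ≤ h → 0 < b → a ≤ b → (h * b) * (h * b) ≤ 4 * (a * c) → b ≤ c
  convex-step {h} {a} {b} {c} h≥2 b>0 a≤b le = *-cancelˡ-≤ b {{>-nonZero b>0}} (*-cancelˡ-≤ 4 (begin
    4 * (b * b)            ≡⟨ ring b ⟩
    (2 * b) * (2 * b)      ≤⟨ *-mono-≤ (*-monoˡ-≤ b h≥2) (*-monoˡ-≤ b h≥2) ⟩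
    (h * b) * (h * b)      ≤⟨ le ⟩
    4 * (a * c)            ≤⟨ *-monoʳ-≤ 4 (*-monoˡ-≤ c a≤b) ⟩
    4 * (b * c)            ∎))
    where
    ring : ∀ b → 4 * (b * b) ≡ (2 * b) * (2 * b)
    ring = solve-∀

  -- K bounds the contents in the height inequalities for the first five multiples.
  module _ (K h₁ h₂ h₃ h₄ h₅ : ℕ) (h₁>0 : 0 < h₁) (h₂>0 : 0 < h₂) (h₃>0 : 0 < h₃)
           (A : (h₁ * h₁) * (h₁ * h₁) ≤ K * h₂) (B : (h₁ * h₂) * (h₁ * h₂) ≤ h₁ * h₃) where
    private
      B' : h₁ * (h₂ * h₂) ≤ h₃
      B' = *-cancelˡ-≤ h₁ {{>-nonZero h₁>0}} (≤-trans (≤-reflexive (ring h₁ h₂)) B)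
        where
        ring : ∀ a b → a * (a * (b * b)) ≡ (a * b) * (a * b)
        ring = solve-∀

    -- The exponent 9 = 3² is that of quadratic growth. The loss K² comes from using A twice; B
    -- carries no content.
    third-height : h₁ * ((h₁ * h₁) * (h₁ * h₁) * ((h₁ * h₁) * (h₁ * h₁))) ≤ K * K * h₃
    third-height = begin
      h₁ * ((h₁ * h₁) * (h₁ * h₁) * ((h₁ * h₁) * (h₁ * h₁)))  ≤⟨ *-monoʳ-≤ h₁ (*-mono-≤ A A) ⟩
      h₁ * (K * h₂ * (K * h₂))                                ≡⟨ ring K h₁ h₂ ⟩
      K * K * (h₁ * (h₂ * h₂))                                ≤⟨ *-monoʳ-≤ (K * K) B' ⟩
      K * K * h₃                                              ∎
      where
      ring : ∀ K a b → a * (K * b * (K * b)) ≡ K * K * (a * (b * b))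
      ring = solve-∀

    -- The exponent is 5². Of the seven factors K, four come from the fourth power of A, one from
    -- `C'` and two from `D'`.
    fifth-height : (h₁ * h₃) * (h₁ * h₃) ≤ K * (h₂ * h₄) → (h₁ * h₄) * (h₁ * h₄) ≤ K * (h₃ * h₅) → h₁ ^ 25 ≤ K ^ 7 * h₅
    fifth-height C D = begin
      h₁ ^ 25                                                       ≡⟨ trans (^-distribˡ-+-* h₁ 9 16) (cong (h₁ ^ 9 *_) (sym (^-*-assoc h₁ 4 4))) ⟩
      h₁ ^ 9 * (h₁ ^ 4) ^ 4                                         ≤⟨ *-monoʳ-≤ (h₁ ^ 9) (^-monoˡ-≤ 4 (≤-trans (≤-reflexive (ring₁ h₁)) A)) ⟩
      h₁ ^ 9 * (K * h₂) ^ 4                                         ≡⟨ ring₂ (h₁ ^ 5) h₁ K h₂ ⟩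
      K ^ 4 * (h₁ ^ 5 * h₂ * (h₁ * h₁ * h₁ * h₂ * (h₁ * (h₂ * h₂)))) ≤⟨ *-monoʳ-≤ (K ^ 4) (*-monoʳ-≤ (h₁ ^ 5 * h₂) (≤-trans (*-monoʳ-≤ (h₁ * h₁ * h₁ * h₂) B') C')) ⟩
      K ^ 4 * (h₁ ^ 5 * h₂ * (K * h₄))                              ≡⟨ ring₃ (K ^ 4) (h₁ ^ 5) h₂ K h₄ ⟩
      K ^ 4 * (K * (h₁ ^ 5 * h₂ * h₄))                              ≤⟨ *-monoʳ-≤ (K ^ 4) (*-monoʳ-≤ K D') ⟩
      K ^ 4 * (K * (K * K * h₅))                                    ≡⟨ ring₄ K h₅ ⟩
      K ^ 7 * h₅                                                    ∎
      where
      ring₁ : ∀ a → a * (a * (a * (a * 1))) ≡ (a * a) * (a * a)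
      ring₁ = solve-∀
      ring₂ : ∀ p a K b → a * (a * (a * (a * p))) * ((K * b) * ((K * b) * ((K * b) * ((K * b) * 1)))) ≡ (K * (K * (K * (K * 1)))) * (p * b * (a * a * a * b * (a * (b * b))))
      ring₂ = solve-∀
      ring₃ : ∀ q p b K d → q * (p * b * (K * d)) ≡ q * (K * (p * b * d))
      ring₃ = solve-∀
      ring₄ : ∀ K e → (K * (K * (K * (K * 1)))) * (K * (K * K * e)) ≡ (K * (K * (K * (K * (K * (K * (K * 1))))))) * e
      ring₄ = solve-∀
      C' : h₁ * h₁ * h₁ * h₂ * h₃ ≤ K * h₄
      C' = *-cancelˡ-≤ h₂ {{>-nonZero h₂>0}} (begin
        h₂ * (h₁ * h₁ * h₁ * h₂ * h₃)        ≡⟨ r₁ h₁ h₂ h₃ ⟩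
        h₁ * h₁ * h₃ * (h₁ * (h₂ * h₂))      ≤⟨ *-monoʳ-≤ (h₁ * h₁ * h₃) B' ⟩
        h₁ * h₁ * h₃ * h₃                    ≡⟨ r₂ h₁ h₃ ⟩
        (h₁ * h₃) * (h₁ * h₃)                ≤⟨ C ⟩
        K * (h₂ * h₄)                        ≡⟨ r₃ K h₂ h₄ ⟩
        h₂ * (K * h₄)                        ∎)
        where
        r₁ : ∀ a b c → b * (a * a * a * b * c) ≡ a * a * c * (a * (b * b))
        r₁ = solve-∀
        r₂ : ∀ a c → a * a * c * c ≡ (a * c) * (a * c)
        r₂ = solve-∀
        r₃ : ∀ K b d → K * (b * d) ≡ b * (K * d)
        r₃ = solve-∀
      D' : h₁ ^ 5 * h₂ * h₄ ≤ K * K * h₅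
      D' = *-cancelˡ-≤ h₃ {{>-nonZero h₃>0}} (begin
        h₃ * (h₁ ^ 5 * h₂ * h₄)                     ≡⟨ r₁ h₁ h₂ h₃ h₄ ⟩
        h₁ * h₁ * h₄ * (h₁ * h₁ * h₁ * h₂ * h₃)     ≤⟨ *-monoʳ-≤ (h₁ * h₁ * h₄) C' ⟩
        h₁ * h₁ * h₄ * (K * h₄)                     ≡⟨ r₂ K h₁ h₄ ⟩
        K * ((h₁ * h₄) * (h₁ * h₄))                 ≤⟨ *-monoʳ-≤ K D ⟩
        K * (K * (h₃ * h₅))                         ≡⟨ r₃ K h₃ h₅ ⟩
        h₃ * (K * K * h₅)                           ∎)
        where
        r₁ : ∀ a b c d → c * (a * (a * (a * (a * (a * 1)))) * b * d) ≡ a * a * d * (a * a * a * b * c)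
        r₁ = solve-∀
        r₂ : ∀ K a d → a * a * d * (K * d) ≡ K * ((a * d) * (a * d))
        r₂ = solve-∀
        r₃ : ∀ K c e → K * (K * (c * e)) ≡ c * (K * K * e)
        r₃ = solve-∀

  private
    pair-bound : ∀ {P Q : Set} K X Y → (∀ {k} → k ≤ 4 → (P → k ≡ 1) → k ≤ K) → (∃ λ k → k ≤ 4 × (P → k ≡ 1) × (Q → k ≡ 1) × X ≤ k * Y) → X ≤ K * Y
    pair-bound K X Y k≤K (k , k≤4 , unit , _ , le) = ≤-trans le (*-monoˡ-≤ Y (k≤K k≤4 unit))

    double-bound : ∀ {P Q : Set} K X Y → (∀ {k} → k ≤ 4 → (P → k ≡ 1) → k ≤ K) → (∃ λ k → k ≤ 4 × (P → k ≡ 1) × X ≤ k * Y × Q) → X ≤ K * Y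
    double-bound K X Y k≤K (k , k≤4 , unit , le , _) = ≤-trans le (*-monoˡ-≤ Y (k≤K k≤4 unit))

    pair-bound₁ : ∀ {P Q : Set} X Y → Q → (∃ λ k → k ≤ 4 × (P → k ≡ 1) × (Q → k ≡ 1) × X ≤ k * Y) → X ≤ Y
    pair-bound₁ X Y odd (k , _ , _ , unit , le) = ≤-trans le (≤-reflexive (trans (cong (_* Y) (unit odd)) (*-identityˡ Y)))

    last-component : ∀ {P Q : Set} {X Y} → (∃ λ k → k ≤ 4 × (P → k ≡ 1) × X ≤ k * Y × Q) → Q
    last-component (_ , _ , _ , _ , odd) = odd

  module _ (S : Abscissae) where
    open Abscissae S
    private
      h : ℕ → ℕ
      h = H S

    h₁≥2 : 2 ≤ h 1
    h₁≥2 = go (comp S 0)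
      where
      go : Component (p 1) (q 1) → 2 ≤ h 1
      go (identity a p≡ q<a) = ≤-trans (≤-trans (s≤s (q>0 0)) q<a) (≤-trans (≤-reflexive (sym (cong ℤ.∣_∣ p≡))) (m≤m⊔n ℤ.∣ p 1 ∣ (q 1)))
      go (egg a p≡ a<q) = ≤-trans (≤-trans (s≤s (s≤s z≤n)) a<q) (m≤n⊔m ℤ.∣ p 1 ∣ (q 1))

    h>0 : ∀ n → 0 < h (suc n)
    h>0 n = ≤-trans (q>0 n) (m≤n⊔m ℤ.∣ p (suc n) ∣ (q (suc n)))

    h-double : ∀ i → (h (suc i) * h (suc i)) * (h (suc i) * h (suc i)) ≤ 4 * h (suc i + suc i)
    h-double i = double-bound 4 ((h (suc i) * h (suc i)) * (h (suc i) * h (suc i))) (h (suc i + suc i)) (λ k≤4 _ → k≤4) (double-height S i)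

    private
      convex : ∀ K → (∀ {k} → k ≤ 4 → (Odd (s S 1) → k ≡ 1) → k ≤ K) → ∀ n → (h 1 * h (suc (suc n))) * (h 1 * h (suc (suc n))) ≤ K * (h (suc n) * h (suc (suc (suc n))))
      convex K k≤K n = pair-bound K ((h 1 * h (suc (suc n))) * (h 1 * h (suc (suc n)))) (h (suc n) * h (suc (suc (suc n)))) k≤K (pair-height S 0 n)

    -- The first step is duplication, h₁⁴ ≤ 4 h₂; convexity then propagates monotonicity.
    h-step : ∀ n → h (suc n) ≤ h (suc (suc n))
    h-step zero = *-cancelˡ-≤ 4 (begin
      4 * h 1                  ≤⟨ *-monoʳ-≤ 4 (m≤m*n (h 1) (h 1) {{>-nonZero (h>0 0)}}) ⟩
      4 * (h 1 * h 1)          ≤⟨ *-monoˡ-≤ (h 1 * h 1) (*-mono-≤ h₁≥2 h₁≥2) ⟩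
      (h 1 * h 1) * (h 1 * h 1) ≤⟨ h-double 0 ⟩
      4 * h 2                  ∎)
    h-step (suc n) = convex-step {h 1} {h (suc n)} {h (suc (suc n))} {h (suc (suc (suc n)))} h₁≥2 (h>0 (suc n)) (h-step n) (convex 4 (λ k≤4 _ → k≤4) n)

    h-mono : ∀ {m n} → suc m ≤ n → h (suc m) ≤ h n
    h-mono {m} {suc n} (s≤s m≤n) = go m (n ∸ m) (m+[n∸m]≡n m≤n)
      where
      go : ∀ m d → m + d ≡ n → h (suc m) ≤ h (suc n)
      go m zero e = ≤-reflexive (cong (λ k → h (suc k)) (trans (sym (+-identityʳ m)) e))
      go m (suc d) e = ≤-trans (h-step m) (go (suc m) d (trans (sym (+-suc m d)) e))

    private
      -- No content appears because the norm of 2P is odd.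
      B₁ : (h 1 * h 2) * (h 1 * h 2) ≤ h 1 * h 3
      B₁ = pair-bound₁ ((h 1 * h 2) * (h 1 * h 2)) (h 1 * h 3) (last-component (double-height S 0)) (pair-height S 0 0)

      third : h 1 * ((h 1 * h 1) * (h 1 * h 1) * ((h 1 * h 1) * (h 1 * h 1))) ≤ 16 * h 3
      third = third-height 4 (h 1) (h 2) (h 3) 0 0 (h>0 0) (h>0 1) (h>0 2) (h-double 0) B₁

      fifth : ∀ K → (∀ {k} → k ≤ 4 → (Odd (s S 1) → k ≡ 1) → k ≤ K) → h 1 ^ 25 ≤ K ^ 7 * h 5
      fifth K k≤K = fifth-height K (h 1) (h 2) (h 3) (h 4) (h 5) (h>0 0) (h>0 1) (h>0 2)
        (double-bound K ((h 1 * h 1) * (h 1 * h 1)) (h 2) k≤K (double-height S 0)) B₁ (convex K k≤K 1) (convex K k≤K 2)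

    module _ {a : ℕ} (p₁≡ : p 1 ≡ + a) (q<a : q 1 < a) where
      private
        h₁≡ : h 1 ≡ a
        h₁≡ = trans (cong (λ t → ℤ.∣ t ∣ ⊔ q 1) p₁≡) (m≥n⇒m⊔n≡m (<⇒≤ q<a))

        abs-s : ℤ.∣ s S 1 ∣ ≡ a * a + q 1 * q 1
        abs-s = trans (cong (λ t → ℤ.∣ norm t (+ q 1) ∣) p₁≡) (cong ℤ.∣_∣ (sym (cong₂ ℤ._+_ (ℤₚ.pos-* a a) (ℤₚ.pos-* (q 1) (q 1)))))

        power : ∀ e b n → 2 ^ e ≤ b ^ n → b ≤ a → 2 ^ e * q 1 ^ 4 ≤ a ^ (4 + n)
        power e b n 2ᵉ≤ b≤a = begin
          2 ^ e * q 1 ^ 4     ≤⟨ *-mono-≤ (≤-trans 2ᵉ≤ (^-monoˡ-≤ n b≤a)) (^-monoˡ-≤ 4 (<⇒≤ q<a)) ⟩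
          a ^ n * a ^ 4       ≡⟨ trans (*-comm (a ^ n) (a ^ 4)) (sym (^-distribˡ-+-* a 4 n)) ⟩
          a ^ (4 + n)         ∎

        unit : ∀ e b n → 2 ^ e ≤ b ^ n → b ≤ a → q 1 ≡ 1 → 2 ^ e * q 1 ^ 4 ≤ a ^ n
        unit e b n 2ᵉ≤ b≤a q≡1 = begin
          2 ^ e * q 1 ^ 4     ≡⟨ trans (cong (λ t → 2 ^ e * t ^ 4) q≡1) (*-identityʳ (2 ^ e)) ⟩
          2 ^ e               ≤⟨ ≤-trans 2ᵉ≤ (^-monoˡ-≤ n b≤a) ⟩
          a ^ n               ∎

        -- All contents are 1, so a^25 ≤ h 5. For q = 1 it is enough that a ≥ 2; otherwise a ≥ 3, a
        -- > q and 3^21 ≥ 2^25.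
        odd-case : ∀ e → e ≡ 25 → Odd (s S 1) → 2 ^ e * q 1 ^ 4 ≤ h 5
        odd-case e e≡ odd = ≤-trans (go (q 1 ≟ 1)) (≤-trans (≤-reflexive (cong (_^ 25) (sym h₁≡))) (≤-trans (fifth 1 (λ _ unit → ≤-reflexive (unit odd))) (≤-reflexive (*-identityˡ (h 5)))))
          where
          go : _ → 2 ^ e * q 1 ^ 4 ≤ a ^ 25
          go (yes q≡1) = unit e 2 25 (≤-reflexive (cong (2 ^_) e≡)) (≤-trans (s≤s (q>0 0)) q<a) q≡1
          go (no q≢1) = power e 3 21 (subst (λ e → 2 ^ e ≤ 3 ^ 21) (sym e≡) (≤ᵇ⇒≤ (2 ^ 25) (3 ^ 21) _)) (≤-trans (s≤s (≤∧≢⇒< (q>0 0) (λ z → q≢1 (sym z)))) q<a)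

        shift : ∀ c d e → 2 ^ c ≡ d → ∀ n → 2 ^ (c + e) * q 1 ^ 4 ≤ a ^ n → ∀ k → h 1 ^ n ≤ d * k → 2 ^ e * q 1 ^ 4 ≤ k
        shift c d e 2ᶜ≡ n le k bound = *-cancelˡ-≤ (2 ^ c) {{m^n≢0 2 c}} (begin
          2 ^ c * (2 ^ e * q 1 ^ 4)  ≡⟨ trans (sym (*-assoc (2 ^ c) (2 ^ e) (q 1 ^ 4))) (cong (_* q 1 ^ 4) (sym (^-distribˡ-+-* 2 c e))) ⟩
          2 ^ (c + e) * q 1 ^ 4      ≤⟨ le ⟩
          a ^ n                      ≡⟨ cong (_^ n) (sym h₁≡) ⟩
          h 1 ^ n                    ≤⟨ bound ⟩
          d * k                      ≡⟨ cong (_* k) (sym 2ᶜ≡) ⟩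
          2 ^ c * k                  ∎)

        -- An even norm means that a and q are both odd. The contents cost 4^7 = 2^14, which is
        -- covered by 3^25 ≥ 2^39 if q = 1, and by 5^21 ≥ 2^39 if q ≥ 3, where a ≥ 5.
        even-case : ∀ c e → c ≡ 14 → e ≡ 25 → ¬ Odd (s S 1) → 2 ^ e * q 1 ^ 4 ≤ h 5
        even-case c e c≡ e≡ ¬odd = go (parity a) (parity (q 1))
          where
          odd-sum : ∀ t → a * a + q 1 * q 1 ≡ suc (2 * t) → Odd (s S 1)
          odd-sum t eq (ℕD.divides k k≡) = even≢odd k t (trans (*-comm 2 k) (trans (sym k≡) (trans abs-s eq)))
          two : ¬ 2 ≡ 1
          two ()
          c+e≡ : c + e ≡ 39
          c+e≡ = cong₂ _+_ c≡ e≡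
          enough : 2 ^ (c + e) * q 1 ^ 4 ≤ a ^ 25 → 2 ^ e * q 1 ^ 4 ≤ h 5
          enough le = shift c (4 ^ 7) e (cong (2 ^_) c≡) 25 le (h 5) (fifth 4 (λ k≤4 _ → k≤4))
          both-odd : ∀ j k → a ≡ suc (2 * j) → q 1 ≡ suc (2 * k) → 2 ^ (c + e) * q 1 ^ 4 ≤ a ^ 25
          both-odd j zero a≡ q≡ = unit (c + e) 3 25 (subst (λ e → 2 ^ e ≤ 3 ^ 25) (sym c+e≡) (≤ᵇ⇒≤ (2 ^ 39) (3 ^ 25) _)) (a≥3 j a≡) q≡
            where
            a≥3 : ∀ j → a ≡ suc (2 * j) → 3 ≤ a
            a≥3 zero a≡ = ⊥-elim (<-irrefl (trans q≡ (sym a≡)) q<a)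
            a≥3 (suc j) a≡ = subst (3 ≤_) (sym (trans a≡ (cong suc (*-suc 2 j)))) (s≤s (s≤s (s≤s z≤n)))
          both-odd j (suc k) a≡ q≡ = power (c + e) 5 21 (subst (λ e → 2 ^ e ≤ 5 ^ 21) (sym c+e≡) (≤ᵇ⇒≤ (2 ^ 39) (5 ^ 21) _))
            (subst (5 ≤_) (sym a≡) (s≤s (*-monoʳ-≤ 2 (≤-trans (s≤s (s≤s z≤n)) (*-cancelˡ-< 2 (suc k) j (s≤s⁻¹ (subst₂ _<_ q≡ a≡ q<a)))))))
          go : _ → _ → 2 ^ e * q 1 ^ 4 ≤ h 5
          go (inj₁ (j , a≡)) (inj₁ (k , q≡)) = ⊥-elim (two (coprime 0 (subst (2 ℕD.∣_) (sym (trans (cong ℤ.∣_∣ p₁≡) a≡)) (ℕD.m∣m*n j) , subst (2 ℕD.∣_) (sym q≡) (ℕD.m∣m*n k))))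
          go (inj₁ (j , a≡)) (inj₂ (k , q≡)) = ⊥-elim (¬odd (odd-sum (2 * (j * j) + 2 * (k * k + k)) (trans (cong₂ (λ x y → x * x + y * y) a≡ q≡) (ring j k))))
            where
            ring : ∀ j k → (2 * j) * (2 * j) + suc (2 * k) * suc (2 * k) ≡ suc (2 * (2 * (j * j) + 2 * (k * k + k)))
            ring = solve-∀
          go (inj₂ (j , a≡)) (inj₁ (k , q≡)) = ⊥-elim (¬odd (odd-sum (2 * (k * k) + 2 * (j * j + j)) (trans (cong₂ (λ x y → x * x + y * y) a≡ q≡) (ring k j))))
            where
            ring : ∀ j k → suc (2 * k) * suc (2 * k) + (2 * j) * (2 * j) ≡ suc (2 * (2 * (j * j) + 2 * (k * k + k)))
            ring = solve-∀
          go (inj₂ (j , a≡)) (inj₂ (k , q≡)) = enough (both-odd j k a≡ q≡)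

      -- For m = 3 the available bound is a^9 ≤ 16 h 3, and 56 is the least integer whose fifth
      -- power reaches 16 · 2^25.
      large-height : ∀ e → e ≡ 25 → ∀ {m} → 5 ≤ m ⊎ (56 ≤ a × 3 ≤ m) → 2 ^ e * q 1 ^ 4 ≤ h m
      large-height e e≡ (inj₁ 5≤m) = ≤-trans (go (2 ℕD.∣? ℤ.∣ s S 1 ∣)) (h-mono 5≤m)
        where
        go : _ → 2 ^ e * q 1 ^ 4 ≤ h 5
        go (yes even) = even-case 14 e refl e≡ (λ odd → odd even)
        go (no odd) = odd-case e e≡ odd
      large-height e e≡ (inj₂ (56≤a , 3≤m)) = ≤-trans
        (shift 4 16 e refl 9 (power (4 + e) 56 5 (subst (λ e → 2 ^ (4 + e) ≤ 56 ^ 5) (sym e≡) (≤ᵇ⇒≤ (2 ^ 29) (56 ^ 5) _)) 56≤a) (h 3)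
          (≤-trans (≤-reflexive (ring (h 1))) third))
        (h-mono 3≤m)
        where
        ring : ∀ b → b * (b * (b * (b * (b * (b * (b * (b * (b * 1)))))))) ≡ b * ((b * b) * (b * b) * ((b * b) * (b * b)))
        ring = solve-∀

-- Divided differences with multiple nodes -1, 0, 1

module DividedDifferences where

  open import Data.Nat as ℕ using (ℕ; zero; suc)
  import Data.Nat.Properties as ℕₚ
  open import Data.Integer using (ℤ; +_; 0ℤ; 1ℤ; _+_; _*_; _-_; -_; ∣_∣; suc)
  open import Data.Integer.Properties
  open import Data.Integer.Tactic.RingSolver using (solve-∀)
  open import Data.Nat.Tactic.RingSolver using () renaming (solve-∀ to ℕsolve-∀)
  open import Relation.Binary.PropositionalEquality

  2ℤ : ℤ
  2ℤ = + 2

  record Jets : Set where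
    constructor jets
    field at₋ at₀ at₊ : ℕ → ℤ
  open Jets public

  -- 2^(a+c) times the divided difference with the node 0 taken b times, 1 taken c times and -1 taken a times;
  -- the i-th Taylor coefficients at the nodes ∓1 are stored with the factor 2^(i+1).
  dd : Jets → ℕ → ℕ → ℕ → ℤ
  dd F ℕ.zero    ℕ.zero    ℕ.zero    = 0ℤ
  dd F ℕ.zero    ℕ.zero    (ℕ.suc a) = at₋ F a
  dd F (ℕ.suc b) ℕ.zero    ℕ.zero    = at₀ F b
  dd F (ℕ.suc b) ℕ.zero    (ℕ.suc a) = 2ℤ * dd F (ℕ.suc b) 0 a - dd F b 0 (ℕ.suc a)
  dd F ℕ.zero    (ℕ.suc c) ℕ.zero    = at₊ F c
  dd F ℕ.zero    (ℕ.suc c) (ℕ.suc a) = dd F 0 (ℕ.suc c) a - dd F 0 c (ℕ.suc a)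
  dd F (ℕ.suc b) (ℕ.suc c) a         = dd F b (ℕ.suc c) a - 2ℤ * dd F (ℕ.suc b) c a

  -- `dd` removes nodes in a fixed order. This lemma and the next give the recursion for the other
  -- pairs of distinct nodes, so the order does not matter.
  dd-₀₋ : ∀ F b c a → dd F (ℕ.suc b) c (ℕ.suc a) ≡ 2ℤ * dd F (ℕ.suc b) c a - dd F b c (ℕ.suc a)
  dd-₊₋ : ∀ F b c a → dd F b (ℕ.suc c) (ℕ.suc a) ≡ dd F b (ℕ.suc c) a - dd F b c (ℕ.suc a)

  dd-₀₋ F b zero a = refl
  dd-₀₋ F b (ℕ.suc c) a rewrite dd-₊₋ F b c a | dd-₀₋ F b c a =
    ring (dd F b (ℕ.suc c) a) (dd F b c (ℕ.suc a)) (dd F (ℕ.suc b) c a)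
    where
    ring : ∀ x y z → (x - y) - 2ℤ * (2ℤ * z - y) ≡ 2ℤ * (x - 2ℤ * z) - (x - y)
    ring = solve-∀

  dd-₊₋ F zero c a = refl
  dd-₊₋ F (ℕ.suc b) c a rewrite dd-₊₋ F b c a | dd-₀₋ F b c a =
    ring (dd F b (ℕ.suc c) a) (dd F b c (ℕ.suc a)) (dd F (ℕ.suc b) c a)
    where
    ring : ∀ x y z → (x - y) - 2ℤ * (2ℤ * z - y) ≡ (x - 2ℤ * z) - (2ℤ * z - y)
    ring = solve-∀

  -- Linearity

  _·_⊖_·_ : ℤ → Jets → ℤ → Jets → Jets
  (s · F ⊖ t · G) = jets (λ i → s * at₋ F i - t * at₋ G i) (λ i → s * at₀ F i - t * at₀ G i) (λ i → s * at₊ F i - t * at₊ G i)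

  dd-linear : ∀ s F t G b c a → dd (s · F ⊖ t · G) b c a ≡ s * dd F b c a - t * dd G b c a
  dd-linear s F t G zero zero zero = ring s t
    where
    ring : ∀ s t → 0ℤ ≡ s * 0ℤ - t * 0ℤ
    ring = solve-∀
  dd-linear s F t G zero zero (ℕ.suc a) = refl
  dd-linear s F t G (ℕ.suc b) zero zero = refl
  dd-linear s F t G zero (ℕ.suc c) zero = refl
  dd-linear s F t G (ℕ.suc b) zero (ℕ.suc a)
    rewrite dd-linear s F t G (ℕ.suc b) 0 a | dd-linear s F t G b 0 (ℕ.suc a) =
    ring s t (dd F (ℕ.suc b) 0 a) (dd G (ℕ.suc b) 0 a) (dd F b 0 (ℕ.suc a)) (dd G b 0 (ℕ.suc a))
    where
    ring : ∀ s t x y z w → 2ℤ * (s * x - t * y) - (s * z - t * w) ≡ s * (2ℤ * x - z) - t * (2ℤ * y - w)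
    ring = solve-∀
  dd-linear s F t G zero (ℕ.suc c) (ℕ.suc a)
    rewrite dd-linear s F t G 0 (ℕ.suc c) a | dd-linear s F t G 0 c (ℕ.suc a) =
    ring s t (dd F 0 (ℕ.suc c) a) (dd G 0 (ℕ.suc c) a) (dd F 0 c (ℕ.suc a)) (dd G 0 c (ℕ.suc a))
    where
    ring : ∀ s t x y z w → (s * x - t * y) - (s * z - t * w) ≡ s * (x - z) - t * (y - w)
    ring = solve-∀
  dd-linear s F t G (ℕ.suc b) (ℕ.suc c) a
    rewrite dd-linear s F t G b (ℕ.suc c) a | dd-linear s F t G (ℕ.suc b) c a =
    ring s t (dd F b (ℕ.suc c) a) (dd G b (ℕ.suc c) a) (dd F (ℕ.suc b) c a) (dd G (ℕ.suc b) c a)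
    where
    ring : ∀ s t x y z w → (s * x - t * y) - 2ℤ * (s * z - t * w) ≡ s * (x - 2ℤ * z) - t * (y - 2ℤ * w)
    ring = solve-∀

  -- Multiplication by z and vanishing on polynomials

  infixl 6 _-ˢ_
  _-ˢ_ : (ℕ → ℤ) → ℕ → ℤ
  (f -ˢ zero)    = 0ℤ
  (f -ˢ ℕ.suc i) = f i

  -- z = (z + 1) - 1 = (z - 1) + 1 shifts the Taylor coefficients; the factors 2 stem from the
  -- stored scaling 2^(i+1).
  mulz : Jets → Jets
  mulz F = jets (λ i → 2ℤ * (at₋ F -ˢ i) - at₋ F i) (at₀ F -ˢ_) (λ i → 2ℤ * (at₊ F -ˢ i) + at₊ F i)

  -- This and the next two are the Leibniz rule (z f)[S, x] = f[S] + x f[S, x] at x = 0, -1, 1, with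
  -- the scaling by powers of 2.
  mulz-₀ : ∀ F b c a → dd (mulz F) (ℕ.suc b) c a ≡ dd F b c a
  mulz-₋ : ∀ F b c a → dd (mulz F) b c (ℕ.suc a) ≡ 2ℤ * dd F b c a - dd F b c (ℕ.suc a)
  mulz-₊ : ∀ F b c a → dd (mulz F) b (ℕ.suc c) a ≡ 2ℤ * dd F b c a + dd F b (ℕ.suc c) a

  mulz-₀ F zero zero zero = refl
  mulz-₀ F (ℕ.suc b) zero zero = refl
  mulz-₀ F b zero (ℕ.suc a) rewrite mulz-₀ F b 0 a | mulz-₋ F b 0 a =
    ring (dd F b 0 a) (dd F b 0 (ℕ.suc a))
    where
    ring : ∀ x y → 2ℤ * x - (2ℤ * x - y) ≡ y
    ring = solve-∀
  mulz-₀ F b (ℕ.suc c) a rewrite mulz-₀ F b c a | mulz-₊ F b c a =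
    ring (dd F b c a) (dd F b (ℕ.suc c) a)
    where
    ring : ∀ x y → (2ℤ * x + y) - 2ℤ * x ≡ y
    ring = solve-∀

  mulz-₋ F zero zero zero = refl
  mulz-₋ F zero zero (ℕ.suc a) = refl
  mulz-₋ F zero (ℕ.suc c) a rewrite mulz-₊ F 0 c a | mulz-₋ F 0 c a =
    ring (dd F 0 c a) (dd F 0 (ℕ.suc c) a) (dd F 0 c (ℕ.suc a))
    where
    ring : ∀ x y z → (2ℤ * x + y) - (2ℤ * x - z) ≡ 2ℤ * y - (y - z)
    ring = solve-∀
  mulz-₋ F (ℕ.suc b) c a rewrite mulz-₀ F b c (ℕ.suc a) | dd-₀₋ F b c a =
    ring (dd F (ℕ.suc b) c a) (dd F b c (ℕ.suc a))
    where
    ring : ∀ x y → y ≡ 2ℤ * x - (2ℤ * x - y)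
    ring = solve-∀

  mulz-₊ F zero zero zero = refl
  mulz-₊ F zero (ℕ.suc c) zero = refl
  mulz-₊ F zero c (ℕ.suc a) rewrite mulz-₊ F 0 c a | mulz-₋ F 0 c a =
    ring (dd F 0 c a) (dd F 0 (ℕ.suc c) a) (dd F 0 c (ℕ.suc a))
    where
    ring : ∀ x y z → (2ℤ * x + y) - (2ℤ * x - z) ≡ 2ℤ * z + (y - z)
    ring = solve-∀
  mulz-₊ F (ℕ.suc b) c a rewrite mulz-₀ F b (ℕ.suc c) a =
    ring (dd F (ℕ.suc b) c a) (dd F b (ℕ.suc c) a)
    where
    ring : ∀ x y → y ≡ 2ℤ * x + (y - 2ℤ * x)
    ring = solve-∀

  δ₀ : ℕ → ℤ → ℤ
  δ₀ zero      x = x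
  δ₀ (ℕ.suc _) x = 0ℤ

  one : Jets
  one = jets (λ i → δ₀ i 2ℤ) (λ i → δ₀ i 1ℤ) (λ i → δ₀ i 2ℤ)

  zpow : ℕ → Jets
  zpow zero      = one
  zpow (ℕ.suc h) = mulz (zpow h)

  module _ where
    private
      2*0-0 : ∀ {x y} → x ≡ 0ℤ → y ≡ 0ℤ → 2ℤ * x - y ≡ 0ℤ
      2*0-0 refl refl = refl

      0-0 : ∀ {x y} → x ≡ 0ℤ → y ≡ 0ℤ → x - y ≡ 0ℤ
      0-0 refl refl = refl

      0-2*0 : ∀ {x y} → x ≡ 0ℤ → y ≡ 0ℤ → x - 2ℤ * y ≡ 0ℤ
      0-2*0 refl refl = refl

    dd-one₂ : ∀ b c a {n} → b ℕ.+ c ℕ.+ a ≡ ℕ.suc (ℕ.suc n) → dd one b c a ≡ 0ℤ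
    dd-one₂ zero zero (ℕ.suc (ℕ.suc a)) _ = refl
    dd-one₂ (ℕ.suc (ℕ.suc b)) zero zero _ = refl
    dd-one₂ zero (ℕ.suc (ℕ.suc c)) zero _ = refl
    dd-one₂ (ℕ.suc zero) zero (ℕ.suc zero) _ = refl
    dd-one₂ (ℕ.suc b) zero (ℕ.suc (ℕ.suc a)) e = 2*0-0 (dd-one₂ (ℕ.suc b) 0 (ℕ.suc a) (cong ℕ.suc (ℕₚ.+-suc _ a))) (step b)
      where
      step : ∀ b → dd one b 0 (ℕ.suc (ℕ.suc a)) ≡ 0ℤ
      step b = dd-one₂ b 0 (ℕ.suc (ℕ.suc a)) (trans (ℕₚ.+-suc _ _) (cong ℕ.suc (ℕₚ.+-suc _ a)))
    dd-one₂ (ℕ.suc (ℕ.suc b)) zero (ℕ.suc zero) e = 2*0-0 refl (dd-one₂ (ℕ.suc b) 0 1 (cong ℕ.suc (ℕₚ.+-suc _ 0)))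
    dd-one₂ zero (ℕ.suc zero) (ℕ.suc zero) _ = refl
    dd-one₂ zero (ℕ.suc c) (ℕ.suc (ℕ.suc a)) _ = 0-0 (dd-one₂ 0 (ℕ.suc c) (ℕ.suc a) (cong ℕ.suc (ℕₚ.+-suc c a))) (dd-one₂ 0 c (ℕ.suc (ℕ.suc a)) (trans (ℕₚ.+-suc c _) (cong ℕ.suc (ℕₚ.+-suc c a))))
    dd-one₂ zero (ℕ.suc (ℕ.suc c)) (ℕ.suc zero) _ = 0-0 refl (dd-one₂ 0 (ℕ.suc c) 1 (cong ℕ.suc (ℕₚ.+-suc c 0)))
    dd-one₂ (ℕ.suc zero) (ℕ.suc zero) zero _ = refl
    dd-one₂ (ℕ.suc b) (ℕ.suc c) (ℕ.suc a) _ = 0-2*0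
      (dd-one₂ b (ℕ.suc c) (ℕ.suc a) (trans (ℕₚ.+-suc _ a) (cong (λ m → ℕ.suc (m ℕ.+ a)) (ℕₚ.+-suc b c))))
      (dd-one₂ (ℕ.suc b) c (ℕ.suc a) (cong ℕ.suc (ℕₚ.+-suc _ a)))
    dd-one₂ (ℕ.suc (ℕ.suc b)) (ℕ.suc zero) zero _ = 0-2*0 (dd-one₂ (ℕ.suc b) 1 0 (cong (λ m → ℕ.suc (m ℕ.+ 0)) (ℕₚ.+-suc b 0))) refl
    dd-one₂ (ℕ.suc b) (ℕ.suc (ℕ.suc c)) zero _ = 0-2*0
      (dd-one₂ b (ℕ.suc (ℕ.suc c)) 0 (trans (cong (ℕ._+ 0) (ℕₚ.+-suc b (ℕ.suc c))) (cong (λ m → ℕ.suc (m ℕ.+ 0)) (ℕₚ.+-suc b c))))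
      (dd-one₂ (ℕ.suc b) (ℕ.suc c) 0 (cong (λ m → ℕ.suc (m ℕ.+ 0)) (ℕₚ.+-suc b c)))

  dd-one : ∀ b c a → 2 ℕ.≤ b ℕ.+ c ℕ.+ a → dd one b c a ≡ 0ℤ
  dd-one b c a 2≤ = dd-one₂ b c a (sym (ℕₚ.m+[n∸m]≡n 2≤))

  -- A divided difference on n nodes has order n - 1 and kills degrees below n - 1; hence h + 2. By
  -- the Leibniz rule each factor z uses up one node.
  dd-zpow : ∀ h b c a → h ℕ.+ 2 ℕ.≤ b ℕ.+ c ℕ.+ a → dd (zpow h) b c a ≡ 0ℤ
  dd-zpow zero b c a p = dd-one b c a p
  dd-zpow (ℕ.suc h) b c (ℕ.suc a) p
    rewrite mulz-₋ (zpow h) b c a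
          | dd-zpow h b c a (ℕ.s≤s⁻¹ (subst (ℕ.suc (h ℕ.+ 2) ℕ.≤_) (ℕₚ.+-suc (b ℕ.+ c) a) p))
          | dd-zpow h b c (ℕ.suc a) (ℕₚ.<⇒≤ p) = refl
  dd-zpow (ℕ.suc h) b (ℕ.suc c) zero p
    rewrite mulz-₊ (zpow h) b c 0
          | dd-zpow h b c 0 (ℕ.s≤s⁻¹ (subst (ℕ.suc (h ℕ.+ 2) ℕ.≤_) (cong (ℕ._+ 0) (ℕₚ.+-suc b c)) p))
          | dd-zpow h b (ℕ.suc c) 0 (ℕₚ.<⇒≤ p) = refl
  dd-zpow (ℕ.suc h) (ℕ.suc b) zero zero p
    rewrite mulz-₀ (zpow h) b 0 0 | dd-zpow h b 0 0 (ℕ.s≤s⁻¹ p) = refl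

  -- Growth

  -- Each removed node splits a term into two, whence 2^(a + b + c); the other factor 2^(a + c) is
  -- the scaling built into `dd`.
  dd-bound : ∀ F k E → (∀ i → i ℕ.≤ k → ∣ at₋ F i ∣ ℕ.≤ 2 ℕ.^ ℕ.suc i ℕ.* E) → (∀ i → i ℕ.≤ k → ∣ at₀ F i ∣ ℕ.≤ E) →
    (∀ i → i ℕ.≤ k → ∣ at₊ F i ∣ ℕ.≤ 2 ℕ.^ ℕ.suc i ℕ.* E) →
    ∀ b c a → b ℕ.≤ ℕ.suc k → c ℕ.≤ ℕ.suc k → a ℕ.≤ ℕ.suc k → ∣ dd F b c a ∣ ℕ.≤ 2 ℕ.^ (a ℕ.+ c) ℕ.* (2 ℕ.^ (a ℕ.+ b ℕ.+ c) ℕ.* E)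
  dd-bound F k E h₋ h₀ h₊ = go
    where
    open ℕₚ.≤-Reasoning
    W : ℕ → ℕ → ℕ → ℕ
    W b c a = 2 ℕ.^ (a ℕ.+ c) ℕ.* (2 ℕ.^ (a ℕ.+ b ℕ.+ c) ℕ.* E)
    ∣2*∣ : ∀ x → ∣ 2ℤ * x ∣ ≡ 2 ℕ.* ∣ x ∣
    ∣2*∣ x = abs-* 2ℤ x
    absorb : ∀ m n → n ℕ.≤ 2 ℕ.^ m ℕ.* n
    absorb m n = ℕₚ.m≤n*m n (2 ℕ.^ m) {{ℕₚ.m^n≢0 2 m}}
    go : ∀ b c a → b ℕ.≤ ℕ.suc k → c ℕ.≤ ℕ.suc k → a ℕ.≤ ℕ.suc k → ∣ dd F b c a ∣ ℕ.≤ W b c a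
    go zero zero zero _ _ _ = ℕ.z≤n
    go zero zero (ℕ.suc a) _ _ p = ℕₚ.≤-trans (h₋ a (ℕ.s≤s⁻¹ p)) (begin
      2 ℕ.^ ℕ.suc a ℕ.* E                                        ≡⟨ cong (λ n → 2 ℕ.^ n ℕ.* E) (sym (ℕₚ.+-identityʳ (ℕ.suc a))) ⟩
      2 ℕ.^ (ℕ.suc a ℕ.+ 0) ℕ.* E                                ≤⟨ ℕₚ.*-monoʳ-≤ (2 ℕ.^ (ℕ.suc a ℕ.+ 0)) (absorb (ℕ.suc a ℕ.+ 0 ℕ.+ 0) E) ⟩
      W 0 0 (ℕ.suc a)                                            ∎)
    go (ℕ.suc b) zero zero p _ _ = ℕₚ.≤-trans (h₀ b (ℕ.s≤s⁻¹ p)) (ℕₚ.≤-trans (absorb (ℕ.suc b ℕ.+ 0) E) (absorb 0 _))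
    go zero (ℕ.suc c) zero _ p _ = ℕₚ.≤-trans (h₊ c (ℕ.s≤s⁻¹ p)) (ℕₚ.*-monoʳ-≤ (2 ℕ.^ ℕ.suc c) (absorb (ℕ.suc c) E))
    go (ℕ.suc b) zero (ℕ.suc a) p q r = begin
      ∣ 2ℤ * dd F (ℕ.suc b) 0 a - dd F b 0 (ℕ.suc a) ∣          ≤⟨ ∣i-j∣≤∣i∣+∣j∣ (2ℤ * dd F (ℕ.suc b) 0 a) _ ⟩
      ∣ 2ℤ * dd F (ℕ.suc b) 0 a ∣ ℕ.+ ∣ dd F b 0 (ℕ.suc a) ∣    ≡⟨ cong (ℕ._+ ∣ dd F b 0 (ℕ.suc a) ∣) (∣2*∣ (dd F (ℕ.suc b) 0 a)) ⟩
      2 ℕ.* ∣ dd F (ℕ.suc b) 0 a ∣ ℕ.+ ∣ dd F b 0 (ℕ.suc a) ∣   ≤⟨ ℕₚ.+-mono-≤ (ℕₚ.*-monoʳ-≤ 2 (go (ℕ.suc b) 0 a p q (ℕₚ.<⇒≤ r))) (go b 0 (ℕ.suc a) (ℕₚ.<⇒≤ p) q r) ⟩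
      2 ℕ.* W (ℕ.suc b) 0 a ℕ.+ W b 0 (ℕ.suc a)                 ≡⟨ eq (ℕₚ.+-suc a b) (2 ℕ.^ (a ℕ.+ 0)) E ⟩
      W (ℕ.suc b) 0 (ℕ.suc a)                                   ∎
      where
      eq : ∀ {a b} → a ℕ.+ ℕ.suc b ≡ ℕ.suc (a ℕ.+ b) → ∀ p E → 2 ℕ.* (p ℕ.* (2 ℕ.^ (a ℕ.+ ℕ.suc b ℕ.+ 0) ℕ.* E)) ℕ.+ (2 ℕ.* p) ℕ.* (2 ℕ.^ (ℕ.suc a ℕ.+ b ℕ.+ 0) ℕ.* E) ≡ (2 ℕ.* p) ℕ.* (2 ℕ.^ (ℕ.suc a ℕ.+ ℕ.suc b ℕ.+ 0) ℕ.* E)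
      eq {a} {b} e p E rewrite e = ring p (2 ℕ.^ (a ℕ.+ b ℕ.+ 0)) E
        where
        ring : ∀ p q E → 2 ℕ.* (p ℕ.* (2 ℕ.* q ℕ.* E)) ℕ.+ (2 ℕ.* p) ℕ.* (2 ℕ.* q ℕ.* E) ≡ (2 ℕ.* p) ℕ.* (2 ℕ.* (2 ℕ.* q) ℕ.* E)
        ring = ℕsolve-∀
    go zero (ℕ.suc c) (ℕ.suc a) p q r = begin
      ∣ dd F 0 (ℕ.suc c) a - dd F 0 c (ℕ.suc a) ∣          ≤⟨ ∣i-j∣≤∣i∣+∣j∣ (dd F 0 (ℕ.suc c) a) _ ⟩
      ∣ dd F 0 (ℕ.suc c) a ∣ ℕ.+ ∣ dd F 0 c (ℕ.suc a) ∣    ≤⟨ ℕₚ.+-mono-≤ (go 0 (ℕ.suc c) a p q (ℕₚ.<⇒≤ r)) (go 0 c (ℕ.suc a) p (ℕₚ.<⇒≤ q) r) ⟩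
      W 0 (ℕ.suc c) a ℕ.+ W 0 c (ℕ.suc a)                  ≤⟨ eq (ℕₚ.+-suc a c) (trans (ℕₚ.+-suc (a ℕ.+ 0) c) refl) E ⟩
      W 0 (ℕ.suc c) (ℕ.suc a)                              ∎
      where
      eq : ∀ {a c} → a ℕ.+ ℕ.suc c ≡ ℕ.suc (a ℕ.+ c) → a ℕ.+ 0 ℕ.+ ℕ.suc c ≡ ℕ.suc (a ℕ.+ 0 ℕ.+ c) → ∀ E →
        2 ℕ.^ (a ℕ.+ ℕ.suc c) ℕ.* (2 ℕ.^ (a ℕ.+ 0 ℕ.+ ℕ.suc c) ℕ.* E) ℕ.+ 2 ℕ.^ (ℕ.suc a ℕ.+ c) ℕ.* (2 ℕ.^ (ℕ.suc a ℕ.+ 0 ℕ.+ c) ℕ.* E) ℕ.≤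
        2 ℕ.^ (ℕ.suc a ℕ.+ ℕ.suc c) ℕ.* (2 ℕ.^ (ℕ.suc a ℕ.+ 0 ℕ.+ ℕ.suc c) ℕ.* E)
      eq {a} {c} e f E rewrite e | f = ℕₚ.≤-trans (ℕₚ.m≤m+n w w) (ℕₚ.≤-reflexive (ring (2 ℕ.^ (a ℕ.+ c)) (2 ℕ.^ (a ℕ.+ 0 ℕ.+ c)) E))
        where
        w = 2 ℕ.^ ℕ.suc (a ℕ.+ c) ℕ.* (2 ℕ.^ ℕ.suc (a ℕ.+ 0 ℕ.+ c) ℕ.* E) ℕ.+ 2 ℕ.^ ℕ.suc (a ℕ.+ c) ℕ.* (2 ℕ.^ ℕ.suc (a ℕ.+ 0 ℕ.+ c) ℕ.* E)
        ring : ∀ p q E → ((2 ℕ.* p) ℕ.* (2 ℕ.* q ℕ.* E) ℕ.+ (2 ℕ.* p) ℕ.* (2 ℕ.* q ℕ.* E)) ℕ.+ ((2 ℕ.* p) ℕ.* (2 ℕ.* q ℕ.* E) ℕ.+ (2 ℕ.* p) ℕ.* (2 ℕ.* q ℕ.* E)) ≡ (2 ℕ.* (2 ℕ.* p)) ℕ.* (2 ℕ.* (2 ℕ.* q) ℕ.* E)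
        ring = ℕsolve-∀
    go (ℕ.suc b) (ℕ.suc c) a p q r = begin
      ∣ dd F b (ℕ.suc c) a - 2ℤ * dd F (ℕ.suc b) c a ∣          ≤⟨ ∣i-j∣≤∣i∣+∣j∣ (dd F b (ℕ.suc c) a) _ ⟩
      ∣ dd F b (ℕ.suc c) a ∣ ℕ.+ ∣ 2ℤ * dd F (ℕ.suc b) c a ∣    ≡⟨ cong (∣ dd F b (ℕ.suc c) a ∣ ℕ.+_) (∣2*∣ (dd F (ℕ.suc b) c a)) ⟩
      ∣ dd F b (ℕ.suc c) a ∣ ℕ.+ 2 ℕ.* ∣ dd F (ℕ.suc b) c a ∣   ≤⟨ ℕₚ.+-mono-≤ (go b (ℕ.suc c) a (ℕₚ.<⇒≤ p) q r) (ℕₚ.*-monoʳ-≤ 2 (go (ℕ.suc b) c a p (ℕₚ.<⇒≤ q) r)) ⟩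
      W b (ℕ.suc c) a ℕ.+ 2 ℕ.* W (ℕ.suc b) c a                 ≡⟨ eq (ℕₚ.+-suc a c) (ℕₚ.+-suc (a ℕ.+ b) c) (ℕₚ.+-suc a b) E ⟩
      W (ℕ.suc b) (ℕ.suc c) a                                   ∎
      where
      eq : ∀ {a b c} → a ℕ.+ ℕ.suc c ≡ ℕ.suc (a ℕ.+ c) → a ℕ.+ b ℕ.+ ℕ.suc c ≡ ℕ.suc (a ℕ.+ b ℕ.+ c) → a ℕ.+ ℕ.suc b ≡ ℕ.suc (a ℕ.+ b) → ∀ E →
        2 ℕ.^ (a ℕ.+ ℕ.suc c) ℕ.* (2 ℕ.^ (a ℕ.+ b ℕ.+ ℕ.suc c) ℕ.* E) ℕ.+ 2 ℕ.* (2 ℕ.^ (a ℕ.+ c) ℕ.* (2 ℕ.^ (a ℕ.+ ℕ.suc b ℕ.+ c) ℕ.* E)) ≡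
        2 ℕ.^ (a ℕ.+ ℕ.suc c) ℕ.* (2 ℕ.^ (a ℕ.+ ℕ.suc b ℕ.+ ℕ.suc c) ℕ.* E)
      eq {a} {b} {c} e f g E rewrite g | e | f = ring (2 ℕ.^ (a ℕ.+ c)) (2 ℕ.^ (a ℕ.+ b ℕ.+ c)) E
        where
        ring : ∀ p q E → (2 ℕ.* p) ℕ.* (2 ℕ.* q ℕ.* E) ℕ.+ 2 ℕ.* (p ℕ.* (2 ℕ.* q ℕ.* E)) ≡ (2 ℕ.* p) ℕ.* (2 ℕ.* (2 ℕ.* q) ℕ.* E)
        ring = ℕsolve-∀

-- Contiguity relations and non-vanishing

module Contiguity where

  open DividedDifferences
  open import Data.Nat as ℕ using (ℕ; zero; suc)
  import Data.Nat.Properties as ℕₚ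
  open import Data.Integer using (ℤ; +_; 0ℤ; 1ℤ; _+_; _*_; _-_; -_)
  open import Data.Integer.Properties
  open import Data.Integer.Tactic.RingSolver using (solve-∀)
  open import Data.Sum using ([_,_]′)
  open import Data.Product using (_×_; _,_; proj₁; proj₂)
  open import Data.Empty using (⊥-elim)
  open import Relation.Binary.PropositionalEquality
  open import Relation.Nullary using (¬_)

  -- The jets of (1 + 4 N z / Y)^(κ/2 - 1), Y = 4 X.
  record Hypergeometric (F : Jets) (k : ℕ) (X N κ : ℤ) : Set where
    field
      step₋ : ∀ i → i ℕ.< k → (+ suc i) * ((2ℤ * (X - N)) * at₋ F (suc i)) ≡ (2ℤ * N) * ((κ - 2ℤ * (+ suc i)) * at₋ F i)
      step₀ : ∀ i → i ℕ.< k → (+ suc i) * ((2ℤ * (2ℤ * X)) * at₀ F (suc i)) ≡ (2ℤ * N) * ((κ - 2ℤ * (+ suc i)) * at₀ F i)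
      step₊ : ∀ i → i ℕ.< k → (+ suc i) * ((2ℤ * (X + N)) * at₊ F (suc i)) ≡ (2ℤ * N) * ((κ - 2ℤ * (+ suc i)) * at₊ F i)

  module _ {F k X N κ} (hyp : Hypergeometric F k X N κ) where
    open Hypergeometric hyp

    -- The differential equation (X + N z) f' = N (κ/2 - 1) f for divided differences: over a
    -- multiset S of nodes, the sum of (X + N x) f[S, x] for x in S equals N (κ/2 - |S|) f[S].
    defect : ℕ → ℕ → ℕ → ℤ
    defect b c a = (+ a) * ((2ℤ * (X - N)) * dd F b c (suc a)) + (+ b) * ((2ℤ * (2ℤ * X)) * dd F (suc b) c a)
                 + (+ c) * ((2ℤ * (X + N)) * dd F b (suc c) a) - (2ℤ * N) * ((κ - 2ℤ * ((+ a) + (+ b) + (+ c))) * dd F b c a)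

    -- On one multiple node this is the recursion of the Taylor coefficients. If two distinct nodes
    -- occur, the defect is the same combination of two smaller defects as in the recursion for
    -- `dd`.
    defect≡0 : ∀ b c a → b ℕ.≤ k → c ℕ.≤ k → a ℕ.≤ k → defect b c a ≡ 0ℤ
    defect≡0 zero zero zero _ _ _ = ring X N κ (at₋ F 0) (at₀ F 0) (at₊ F 0)
      where
      ring : ∀ X N κ u v w → (+ 0) * ((2ℤ * (X - N)) * u) + (+ 0) * ((2ℤ * (2ℤ * X)) * v) + (+ 0) * ((2ℤ * (X + N)) * w)
        - (2ℤ * N) * ((κ - 2ℤ * ((+ 0) + (+ 0) + (+ 0))) * 0ℤ) ≡ 0ℤ
      ring = solve-∀
    defect≡0 zero zero (suc a) _ _ p rewrite step₋ a p = ring X N κ (+ suc a) 0ℤ 0ℤ (at₋ F a)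
      where
      ring : ∀ X N κ a v w u → (2ℤ * N) * ((κ - 2ℤ * a) * u) + (+ 0) * ((2ℤ * (2ℤ * X)) * v) + (+ 0) * ((2ℤ * (X + N)) * w)
        - (2ℤ * N) * ((κ - 2ℤ * (a + (+ 0) + (+ 0))) * u) ≡ 0ℤ
      ring = solve-∀
    defect≡0 (suc b) zero zero p _ _ rewrite step₀ b p = ring X N κ (+ suc b) 0ℤ 0ℤ (at₀ F b)
      where
      ring : ∀ X N κ b v w u → (+ 0) * ((2ℤ * (X - N)) * v) + (2ℤ * N) * ((κ - 2ℤ * b) * u) + (+ 0) * ((2ℤ * (X + N)) * w)
        - (2ℤ * N) * ((κ - 2ℤ * ((+ 0) + b + (+ 0))) * u) ≡ 0ℤ
      ring = solve-∀
    defect≡0 zero (suc c) zero _ p _ rewrite step₊ c p = ring X N κ (+ suc c) 0ℤ 0ℤ (at₊ F c)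
      where
      ring : ∀ X N κ c v w u → (+ 0) * ((2ℤ * (X - N)) * v) + (+ 0) * ((2ℤ * (2ℤ * X)) * w) + (2ℤ * N) * ((κ - 2ℤ * c) * u)
        - (2ℤ * N) * ((κ - 2ℤ * ((+ 0) + (+ 0) + c)) * u) ≡ 0ℤ
      ring = solve-∀
    defect≡0 (suc b) zero (suc a) p q r = trans
      (ring X N κ (+ a) (+ b) (dd F (suc b) 0 (suc a)) (dd F b 0 (suc (suc a))) (dd F (suc (suc b)) 0 a) 0ℤ (dd F (suc b) 0 a) (dd F b 0 (suc a)) 0ℤ 0ℤ)
      (cong₂ (λ x y → 2ℤ * x - y) (defect≡0 (suc b) 0 a p q (ℕₚ.<⇒≤ r)) (defect≡0 b 0 (suc a) (ℕₚ.<⇒≤ p) q r))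
      where
      -- u, u', u'' : dd (1+b) 0 (1+a), dd b 0 (2+a), dd (2+b) 0 a
      ring : ∀ X N κ a b u u' u'' w x y w' w'' →
        (1ℤ + a) * ((2ℤ * (X - N)) * (2ℤ * (2ℤ * x - y) - u')) + (1ℤ + b) * ((2ℤ * (2ℤ * X)) * (2ℤ * u'' - (2ℤ * x - y)))
        + (+ 0) * ((2ℤ * (X + N)) * w) - (2ℤ * N) * ((κ - 2ℤ * ((1ℤ + a) + (1ℤ + b) + (+ 0))) * (2ℤ * x - y)) ≡
        2ℤ * (a * ((2ℤ * (X - N)) * (2ℤ * x - y)) + (1ℤ + b) * ((2ℤ * (2ℤ * X)) * u'') + (+ 0) * ((2ℤ * (X + N)) * w')
              - (2ℤ * N) * ((κ - 2ℤ * (a + (1ℤ + b) + (+ 0))) * x))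
        - ((1ℤ + a) * ((2ℤ * (X - N)) * u') + b * ((2ℤ * (2ℤ * X)) * (2ℤ * x - y)) + (+ 0) * ((2ℤ * (X + N)) * w'')
              - (2ℤ * N) * ((κ - 2ℤ * ((1ℤ + a) + b + (+ 0))) * y))
      ring = solve-∀
    defect≡0 zero (suc c) (suc a) p q r = trans
      (ring X N κ (+ a) (+ c) (dd F 0 c (suc (suc a))) (dd F 0 (suc (suc c)) a) 0ℤ (dd F 0 (suc c) a) (dd F 0 c (suc a)) 0ℤ 0ℤ)
      (cong₂ (λ x y → x - y) (defect≡0 0 (suc c) a p q (ℕₚ.<⇒≤ r)) (defect≡0 0 c (suc a) p (ℕₚ.<⇒≤ q) r))
      where
      ring : ∀ X N κ a c u' u'' w x y w' w'' →
        (1ℤ + a) * ((2ℤ * (X - N)) * ((x - y) - u')) + (+ 0) * ((2ℤ * (2ℤ * X)) * w)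
        + (1ℤ + c) * ((2ℤ * (X + N)) * (u'' - (x - y))) - (2ℤ * N) * ((κ - 2ℤ * ((1ℤ + a) + (+ 0) + (1ℤ + c))) * (x - y)) ≡
        (a * ((2ℤ * (X - N)) * (x - y)) + (+ 0) * ((2ℤ * (2ℤ * X)) * w') + (1ℤ + c) * ((2ℤ * (X + N)) * u'')
              - (2ℤ * N) * ((κ - 2ℤ * (a + (+ 0) + (1ℤ + c))) * x))
        - ((1ℤ + a) * ((2ℤ * (X - N)) * u') + (+ 0) * ((2ℤ * (2ℤ * X)) * w'') + c * ((2ℤ * (X + N)) * (x - y))
              - (2ℤ * N) * ((κ - 2ℤ * ((1ℤ + a) + (+ 0) + c)) * y))
      ring = solve-∀
    defect≡0 (suc b) (suc c) a p q r = trans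
      (ring X N κ (+ a) (+ b) (+ c) (dd F b (suc c) (suc a)) (dd F (suc b) c (suc a)) (dd F (suc (suc b)) c a) (dd F b (suc (suc c)) a)
        (dd F b (suc c) a) (dd F (suc b) c a))
      (cong₂ (λ x y → x - 2ℤ * y) (defect≡0 b (suc c) a (ℕₚ.<⇒≤ p) q r) (defect≡0 (suc b) c a p (ℕₚ.<⇒≤ q) r))
      where
      ring : ∀ X N κ a b c s t u v x y →
        a * ((2ℤ * (X - N)) * (s - 2ℤ * t)) + (1ℤ + b) * ((2ℤ * (2ℤ * X)) * ((x - 2ℤ * y) - 2ℤ * u))
        + (1ℤ + c) * ((2ℤ * (X + N)) * (v - 2ℤ * (x - 2ℤ * y))) - (2ℤ * N) * ((κ - 2ℤ * (a + (1ℤ + b) + (1ℤ + c))) * (x - 2ℤ * y)) ≡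
        (a * ((2ℤ * (X - N)) * s) + b * ((2ℤ * (2ℤ * X)) * (x - 2ℤ * y)) + (1ℤ + c) * ((2ℤ * (X + N)) * v)
              - (2ℤ * N) * ((κ - 2ℤ * (a + b + (1ℤ + c))) * x))
        - 2ℤ * (a * ((2ℤ * (X - N)) * t) + (1ℤ + b) * ((2ℤ * (2ℤ * X)) * u) + c * ((2ℤ * (X + N)) * (x - 2ℤ * y))
              - (2ℤ * N) * ((κ - 2ℤ * (a + (1ℤ + b) + c)) * y))
      ring = solve-∀

    Vanishes : ℕ → ℕ → ℕ → Set
    Vanishes b c a = (dd F b c (suc a) ≡ 0ℤ) × (dd F (suc b) c a ≡ 0ℤ) × (dd F b (suc c) a ≡ 0ℤ)

    module _ (N≢0 : N ≢ 0ℤ) (κ-odd : ∀ m → κ - 2ℤ * m ≢ 0ℤ) where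

      private
        cancel : ∀ {x y} → x ≢ 0ℤ → x * y ≡ 0ℤ → y ≡ 0ℤ
        cancel {x} x≢0 e = [ (λ x≡0 → ⊥-elim (x≢0 x≡0)) , (λ y≡0 → y≡0) ]′ (i*j≡0⇒i≡0∨j≡0 x e)

        2*≡0 : ∀ {x} → 2ℤ * x ≡ 0ℤ → x ≡ 0ℤ
        2*≡0 = cancel {2ℤ} (λ ())

        0-≡0 : ∀ {x} → 0ℤ - x ≡ 0ℤ → x ≡ 0ℤ
        0-≡0 {x} e = trans (sym (neg-involutive x)) (cong -_ (trans (sym (+-identityˡ (- x))) e))

        -0≡0 : ∀ {x} → x - 0ℤ ≡ 0ℤ → x ≡ 0ℤ
        -0≡0 {x} e = trans (sym (+-identityʳ x)) e

      vanish-centre : ∀ b c a → b ℕ.≤ k → c ℕ.≤ k → a ℕ.≤ k → Vanishes b c a → dd F b c a ≡ 0ℤ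
      vanish-centre b c a p q r (e₋ , e₀ , e₊) =
        cancel (κ-odd ((+ a) + (+ b) + (+ c))) (cancel N≢0 (2*≡0 (trans (sym (*-assoc 2ℤ N _)) (0-≡0 main))))
        where
        main : 0ℤ - (2ℤ * N) * ((κ - 2ℤ * ((+ a) + (+ b) + (+ c))) * dd F b c a) ≡ 0ℤ
        main with defect≡0 b c a p q r
        ... | e rewrite e₋ | e₀ | e₊ = trans (ring (+ a) (+ b) (+ c) X N ((2ℤ * N) * ((κ - 2ℤ * ((+ a) + (+ b) + (+ c))) * dd F b c a))) e
          where
          ring : ∀ a b c X N t → 0ℤ - t ≡ a * ((2ℤ * (X - N)) * 0ℤ) + b * ((2ℤ * (2ℤ * X)) * 0ℤ) + c * ((2ℤ * (X + N)) * 0ℤ) - t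
          ring = solve-∀

      descend₀ : ∀ b c a → suc b ℕ.≤ k → c ℕ.≤ k → a ℕ.≤ k → Vanishes (suc b) c a → Vanishes b c a
      descend₀ b c a p q r v@(e₋ , e₀ , e₊) = f₋ , centre , f₊
        where
        centre = vanish-centre (suc b) c a p q r v
        f₋ : dd F b c (suc a) ≡ 0ℤ
        f₋ = 0-≡0 (subst (λ t → 2ℤ * t - dd F b c (suc a) ≡ 0ℤ) centre (trans (sym (dd-₀₋ F b c a)) e₋))
        f₊ : dd F b (suc c) a ≡ 0ℤ
        f₊ = -0≡0 (subst (λ t → dd F b (suc c) a - 2ℤ * t ≡ 0ℤ) centre e₊)

      descend₊ : ∀ c a → suc c ℕ.≤ k → a ℕ.≤ k → Vanishes 0 (suc c) a → Vanishes 0 c a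
      descend₊ c a q r v@(e₋ , e₀ , e₊) = f₋ , f₀ , centre
        where
        centre = vanish-centre 0 (suc c) a ℕ.z≤n q r v
        f₋ : dd F 0 c (suc a) ≡ 0ℤ
        f₋ = 0-≡0 (subst (λ t → t - dd F 0 c (suc a) ≡ 0ℤ) centre e₋)
        f₀ : dd F 1 c a ≡ 0ℤ
        f₀ = 2*≡0 (0-≡0 (subst (λ t → t - 2ℤ * dd F 1 c a ≡ 0ℤ) centre e₀))

      descend₋ : ∀ a → suc a ℕ.≤ k → Vanishes 0 0 (suc a) → Vanishes 0 0 a
      descend₋ a r v@(e₋ , e₀ , e₊) = centre , f₀ , f₊
        where
        centre = vanish-centre 0 0 (suc a) ℕ.z≤n ℕ.z≤n r v
        f₀ : dd F 1 0 a ≡ 0ℤ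
        f₀ = 2*≡0 (-0≡0 (subst (λ t → 2ℤ * dd F 1 0 a - t ≡ 0ℤ) centre e₀))
        f₊ : dd F 0 1 a ≡ 0ℤ
        f₊ = -0≡0 (subst (λ t → dd F 0 1 a - t ≡ 0ℤ) centre e₊)

      -- If the three forms with one node added to S vanish, the contiguity relation gives f[S] = 0,
      -- as κ is never 2m. By the recursion the three forms over S minus a node vanish too, and the
      -- descent ends at the value of F at 0.
      nonvanishing : at₀ F 0 ≢ 0ℤ → ∀ b c a → b ℕ.≤ k → c ℕ.≤ k → a ℕ.≤ k → ¬ Vanishes b c a
      nonvanishing F₀≢0 zero zero zero p q r v = F₀≢0 (proj₁ (proj₂ v))
      nonvanishing F₀≢0 zero zero (suc a) p q r v = nonvanishing F₀≢0 0 0 a p q (ℕₚ.<⇒≤ r) (descend₋ a r v)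
      nonvanishing F₀≢0 zero (suc c) a p q r v = nonvanishing F₀≢0 0 c a p (ℕₚ.<⇒≤ q) r (descend₊ c a q r v)
      nonvanishing F₀≢0 (suc b) c a p q r v = nonvanishing F₀≢0 b c a (ℕₚ.<⇒≤ p) q r (descend₀ b c a p q r v)

-- Binomial coefficients of half-integers

module HalfBinomial where

  open DividedDifferences
  open import Data.Nat as ℕ using (ℕ; zero; suc)
  import Data.Nat.Properties as ℕₚ
  open import Data.Nat.Tactic.RingSolver using () renaming (solve-∀ to ℕsolve-∀)
  open import Data.Integer using (ℤ; +_; 0ℤ; 1ℤ; -1ℤ; _+_; _*_; _-_; -_; ∣_∣; _^_)
  open import Data.Integer.Properties
  open import Data.Integer.Tactic.RingSolver using (solve-∀)
  open import Relation.Binary.PropositionalEquality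

  -- bin i j is the binomial coefficient (i + j)! / (i! j!)
  bin : ℕ → ℕ → ℕ
  bin zero    j       = 1
  bin (suc i) zero    = 1
  bin (suc i) (suc j) = bin i (suc j) ℕ.+ bin (suc i) j

  bin-zeroʳ : ∀ i → bin i 0 ≡ 1
  bin-zeroʳ zero    = refl
  bin-zeroʳ (suc i) = refl

  bin-sucˡ : ∀ i j → suc i ℕ.* bin (suc i) j ≡ suc (i ℕ.+ j) ℕ.* bin i j
  bin-sucʳ : ∀ i j → suc j ℕ.* bin i (suc j) ≡ suc (i ℕ.+ j) ℕ.* bin i j

  bin-sucˡ zero zero = refl
  bin-sucˡ (suc i) zero = cong (λ n → suc n ℕ.* 1) (sym (ℕₚ.+-identityʳ (suc i)))
  bin-sucˡ i (suc j) = begin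
    suc i ℕ.* (bin i (suc j) ℕ.+ bin (suc i) j)               ≡⟨ ℕₚ.*-distribˡ-+ (suc i) (bin i (suc j)) _ ⟩
    suc i ℕ.* bin i (suc j) ℕ.+ suc i ℕ.* bin (suc i) j       ≡⟨ cong (suc i ℕ.* bin i (suc j) ℕ.+_) (trans (bin-sucˡ i j) (sym (bin-sucʳ i j))) ⟩
    suc i ℕ.* bin i (suc j) ℕ.+ suc j ℕ.* bin i (suc j)       ≡⟨ sym (ℕₚ.*-distribʳ-+ (bin i (suc j)) (suc i) (suc j)) ⟩
    suc (i ℕ.+ suc j) ℕ.* bin i (suc j)                       ∎
    where open ≡-Reasoning

  bin-sucʳ zero zero = refl
  bin-sucʳ zero (suc j) = refl
  bin-sucʳ (suc i) j = begin
    suc j ℕ.* (bin i (suc j) ℕ.+ bin (suc i) j)               ≡⟨ ℕₚ.*-distribˡ-+ (suc j) (bin i (suc j)) _ ⟩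
    suc j ℕ.* bin i (suc j) ℕ.+ suc j ℕ.* bin (suc i) j       ≡⟨ cong (ℕ._+ suc j ℕ.* bin (suc i) j) (trans (bin-sucʳ i j) (sym (bin-sucˡ i j))) ⟩
    suc i ℕ.* bin (suc i) j ℕ.+ suc j ℕ.* bin (suc i) j       ≡⟨ sym (ℕₚ.*-distribʳ-+ (bin (suc i) j) (suc i) (suc j)) ⟩
    (suc i ℕ.+ suc j) ℕ.* bin (suc i) j                       ≡⟨ cong (ℕ._* bin (suc i) j) (cong suc (ℕₚ.+-suc i j)) ⟩
    suc (suc i ℕ.+ j) ℕ.* bin (suc i) j                       ∎
    where open ≡-Reasoning

  central-suc : ∀ n → suc n ℕ.* bin (suc n) (suc n) ≡ 2 ℕ.* (suc (n ℕ.+ n) ℕ.* bin n n)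
  central-suc n = trans (bin-sucˡ n (suc n)) (trans (cong (ℕ._* bin n (suc n)) (double n)) (trans (ring (suc n) (bin n (suc n))) (cong (2 ℕ.*_) (bin-sucʳ n n))))
    where
    double : ∀ n → suc (n ℕ.+ suc n) ≡ 2 ℕ.* suc n
    double = ℕsolve-∀
    ring : ∀ x y → 2 ℕ.* x ℕ.* y ≡ 2 ℕ.* (x ℕ.* y)
    ring = ℕsolve-∀

  central≤4^ : ∀ n → bin n n ℕ.≤ 4 ℕ.^ n
  central≤4^ zero = ℕₚ.≤-refl
  central≤4^ (suc n) = ℕₚ.*-cancelˡ-≤ (suc n) (begin
    suc n ℕ.* bin (suc n) (suc n)         ≡⟨ central-suc n ⟩
    2 ℕ.* (suc (n ℕ.+ n) ℕ.* bin n n)     ≤⟨ ℕₚ.*-monoʳ-≤ 2 (ℕₚ.*-mono-≤ (ℕₚ.n≤1+n (suc (n ℕ.+ n))) (central≤4^ n)) ⟩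
    2 ℕ.* (suc (suc (n ℕ.+ n)) ℕ.* 4 ℕ.^ n) ≡⟨ ring n (4 ℕ.^ n) ⟩
    suc n ℕ.* (4 ℕ.* 4 ℕ.^ n)             ∎)
    where
    open ℕₚ.≤-Reasoning
    ring : ∀ n p → 2 ℕ.* (suc (suc (n ℕ.+ n)) ℕ.* p) ≡ suc n ℕ.* (4 ℕ.* p)
    ring = ℕsolve-∀

  -- B K i is 4^i times the binomial coefficient of K - 1/2 over i.
  B : ℕ → ℕ → ℤ
  B zero    i       = -1ℤ ^ i * + bin i i
  B (suc K) zero    = B K 0
  B (suc K) (suc i) = B K (suc i) + + 4 * B K i

  B₀ : ∀ K → B K 0 ≡ 1ℤ
  B₀ zero    = refl
  B₀ (suc K) = B₀ K

  B-suc : ∀ K i → + suc i * B K (suc i) ≡ (2ℤ * (2ℤ * + K - 1ℤ - 2ℤ * + i)) * B K i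
  B-suc zero i = begin
    + suc i * (-1ℤ * s * + e')                    ≡⟨ ring₁ (+ suc i) s (+ e') ⟩
    - s * (+ suc i * + e')                         ≡⟨ cong (- s *_) (trans (sym (pos-* (suc i) e')) (trans (cong +_ (central-suc i)) push)) ⟩
    - s * (2ℤ * ((1ℤ + (+ i + + i)) * + e))        ≡⟨ ring₂ s (+ i) (+ e) ⟩
    (2ℤ * (2ℤ * 0ℤ - 1ℤ - 2ℤ * + i)) * (s * + e)   ∎
    where
    open ≡-Reasoning
    s = -1ℤ ^ i
    e = bin i i
    e' = bin (suc i) (suc i)
    push : + (2 ℕ.* (suc (i ℕ.+ i) ℕ.* e)) ≡ 2ℤ * ((1ℤ + (+ i + + i)) * + e)
    push = trans (pos-* 2 (suc (i ℕ.+ i) ℕ.* e)) (cong (2ℤ *_) (pos-* (suc (i ℕ.+ i)) e))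
    ring₁ : ∀ n s e → n * (-1ℤ * s * e) ≡ - s * (n * e)
    ring₁ = solve-∀
    ring₂ : ∀ s i e → - s * (2ℤ * ((1ℤ + (i + i)) * e)) ≡ (2ℤ * (2ℤ * 0ℤ - 1ℤ - 2ℤ * i)) * (s * e)
    ring₂ = solve-∀
  B-suc (suc K) zero rewrite B₀ K = begin
    1ℤ * (B K 1 + + 4 * 1ℤ)                          ≡⟨ *-distribˡ-+ 1ℤ (B K 1) (+ 4) ⟩
    1ℤ * B K 1 + + 4                                 ≡⟨ cong (_+ + 4) (trans (B-suc K 0) (cong (2ℤ * (2ℤ * + K - 1ℤ - 2ℤ * 0ℤ) *_) (B₀ K))) ⟩
    2ℤ * (2ℤ * + K - 1ℤ - 2ℤ * 0ℤ) * 1ℤ + + 4        ≡⟨ ring (+ K) ⟩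
    2ℤ * (2ℤ * (1ℤ + + K) - 1ℤ - 2ℤ * 0ℤ) * 1ℤ       ∎
    where
    open ≡-Reasoning
    ring : ∀ K → 2ℤ * (2ℤ * K - 1ℤ - 2ℤ * 0ℤ) * 1ℤ + + 4 ≡ 2ℤ * (2ℤ * (1ℤ + K) - 1ℤ - 2ℤ * 0ℤ) * 1ℤ
    ring = solve-∀
  B-suc (suc K) (suc i) = begin
    + suc (suc i) * (B K (suc (suc i)) + + 4 * B K (suc i))                         ≡⟨ *-distribˡ-+ (+ suc (suc i)) (B K (suc (suc i))) _ ⟩
    + suc (suc i) * B K (suc (suc i)) + + suc (suc i) * (+ 4 * B K (suc i))          ≡⟨ cong (_+ + suc (suc i) * (+ 4 * B K (suc i))) (B-suc K (suc i)) ⟩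
    (2ℤ * (2ℤ * + K - 1ℤ - 2ℤ * + suc i)) * B K (suc i) + + suc (suc i) * (+ 4 * B K (suc i)) ≡⟨ ring₁ (+ K) (+ i) (B K (suc i)) ⟩
    (2ℤ * (2ℤ * (1ℤ + + K) - 1ℤ - 2ℤ * (1ℤ + + i))) * B K (suc i) + + 4 * ((1ℤ + + i) * B K (suc i)) ≡⟨ cong (λ t → (2ℤ * (2ℤ * (1ℤ + + K) - 1ℤ - 2ℤ * (1ℤ + + i))) * B K (suc i) + + 4 * t) (B-suc K i) ⟩
    (2ℤ * (2ℤ * (1ℤ + + K) - 1ℤ - 2ℤ * (1ℤ + + i))) * B K (suc i) + + 4 * ((2ℤ * (2ℤ * + K - 1ℤ - 2ℤ * + i)) * B K i) ≡⟨ ring₂ (+ K) (+ i) (B K (suc i)) (B K i) ⟩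
    (2ℤ * (2ℤ * (1ℤ + + K) - 1ℤ - 2ℤ * (1ℤ + + i))) * (B K (suc i) + + 4 * B K i)   ∎
    where
    open ≡-Reasoning
    ring₁ : ∀ K i x → (2ℤ * (2ℤ * K - 1ℤ - 2ℤ * (1ℤ + i))) * x + (1ℤ + (1ℤ + i)) * (+ 4 * x) ≡ (2ℤ * (2ℤ * (1ℤ + K) - 1ℤ - 2ℤ * (1ℤ + i))) * x + + 4 * ((1ℤ + i) * x)
    ring₁ = solve-∀
    ring₂ : ∀ K i x y → (2ℤ * (2ℤ * (1ℤ + K) - 1ℤ - 2ℤ * (1ℤ + i))) * x + + 4 * ((2ℤ * (2ℤ * K - 1ℤ - 2ℤ * i)) * y) ≡ (2ℤ * (2ℤ * (1ℤ + K) - 1ℤ - 2ℤ * (1ℤ + i))) * (x + + 4 * y)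
    ring₂ = solve-∀

  ∣-1^∣ : ∀ i → ∣ -1ℤ ^ i ∣ ≡ 1
  ∣-1^∣ zero = refl
  ∣-1^∣ (suc i) = trans (abs-* -1ℤ (-1ℤ ^ i)) (cong (1 ℕ.*_) (∣-1^∣ i))

  -- Central binomial coefficients are at most 4^i, and each Pascal step in K at most doubles the
  -- bound.
  B-bound : ∀ K i → ∣ B K i ∣ ℕ.≤ 2 ℕ.^ K ℕ.* 4 ℕ.^ i
  B-bound zero i = ℕₚ.≤-trans (ℕₚ.≤-reflexive (trans (abs-* (-1ℤ ^ i) (+ bin i i)) (cong (ℕ._* bin i i) (∣-1^∣ i)))) (ℕₚ.*-monoʳ-≤ 1 (central≤4^ i))
  B-bound (suc K) zero = ℕₚ.≤-trans (B-bound K 0) (ℕₚ.*-monoˡ-≤ 1 (ℕₚ.m≤n*m (2 ℕ.^ K) 2))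
  B-bound (suc K) (suc i) = begin
    ∣ B K (suc i) + + 4 * B K i ∣                   ≤⟨ ∣i+j∣≤∣i∣+∣j∣ (B K (suc i)) _ ⟩
    ∣ B K (suc i) ∣ ℕ.+ ∣ + 4 * B K i ∣             ≡⟨ cong (∣ B K (suc i) ∣ ℕ.+_) (abs-* (+ 4) (B K i)) ⟩
    ∣ B K (suc i) ∣ ℕ.+ 4 ℕ.* ∣ B K i ∣             ≤⟨ ℕₚ.+-mono-≤ (B-bound K (suc i)) (ℕₚ.*-monoʳ-≤ 4 (B-bound K i)) ⟩
    2 ℕ.^ K ℕ.* (4 ℕ.* 4 ℕ.^ i) ℕ.+ 4 ℕ.* (2 ℕ.^ K ℕ.* 4 ℕ.^ i) ≡⟨ ring (2 ℕ.^ K) (4 ℕ.^ i) ⟩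
    2 ℕ.* 2 ℕ.^ K ℕ.* (4 ℕ.* 4 ℕ.^ i)               ∎
    where
    open ℕₚ.≤-Reasoning
    ring : ∀ p q → p ℕ.* (4 ℕ.* q) ℕ.+ 4 ℕ.* (p ℕ.* q) ≡ 2 ℕ.* p ℕ.* (4 ℕ.* q)
    ring = ℕsolve-∀

  -- Trinomial revision binom(r, i + n) binom(i + n, i) = binom(r, i) binom(r - i, n) with r = K + i
  -- - 1/2.
  B-split : ∀ K i n → B (K ℕ.+ i) (i ℕ.+ n) * + bin i n ≡ B (K ℕ.+ i) i * B K n
  B-split K i zero rewrite ℕₚ.+-identityʳ i | B₀ K | bin-zeroʳ i = refl
  B-split K i (suc n) = *-cancelˡ-≡ (+ suc n) _ _ (begin
    + suc n * (B (K ℕ.+ i) (i ℕ.+ suc n) * + bin i (suc n))       ≡⟨ cong (λ m → + suc n * (B (K ℕ.+ i) m * + bin i (suc n))) (ℕₚ.+-suc i n) ⟩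
    + suc n * (b * + bin i (suc n))                               ≡⟨ ring₁ (+ suc n) b (+ bin i (suc n)) ⟩
    b * (+ suc n * + bin i (suc n))                               ≡⟨ cong (b *_) (trans (sym (pos-* (suc n) (bin i (suc n)))) (trans (cong +_ (bin-sucʳ i n)) (pos-* (suc (i ℕ.+ n)) (bin i n)))) ⟩
    b * (+ suc (i ℕ.+ n) * + bin i n)                             ≡⟨ ring₂ b (+ suc (i ℕ.+ n)) (+ bin i n) ⟩
    (+ suc (i ℕ.+ n) * b) * + bin i n                             ≡⟨ cong (_* + bin i n) (B-suc (K ℕ.+ i) (i ℕ.+ n)) ⟩
    2ℤ * (2ℤ * (+ K + + i) - 1ℤ - 2ℤ * (+ i + + n)) * B (K ℕ.+ i) (i ℕ.+ n) * + bin i n ≡⟨ ring₃ (+ K) (+ i) (+ n) (B (K ℕ.+ i) (i ℕ.+ n)) (+ bin i n) ⟩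
    2ℤ * (2ℤ * + K - 1ℤ - 2ℤ * + n) * (B (K ℕ.+ i) (i ℕ.+ n) * + bin i n) ≡⟨ cong (2ℤ * (2ℤ * + K - 1ℤ - 2ℤ * + n) *_) (B-split K i n) ⟩
    2ℤ * (2ℤ * + K - 1ℤ - 2ℤ * + n) * (B (K ℕ.+ i) i * B K n)     ≡⟨ ring₄ (2ℤ * (2ℤ * + K - 1ℤ - 2ℤ * + n)) (B (K ℕ.+ i) i) (B K n) ⟩
    B (K ℕ.+ i) i * (2ℤ * (2ℤ * + K - 1ℤ - 2ℤ * + n) * B K n)     ≡⟨ cong (B (K ℕ.+ i) i *_) (sym (B-suc K n)) ⟩
    B (K ℕ.+ i) i * (+ suc n * B K (suc n))                       ≡⟨ ring₁' (B (K ℕ.+ i) i) (+ suc n) (B K (suc n)) ⟩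
    + suc n * (B (K ℕ.+ i) i * B K (suc n))                       ∎)
    where
    open ≡-Reasoning
    b = B (K ℕ.+ i) (suc (i ℕ.+ n))
    ring₁ : ∀ x y z → x * (y * z) ≡ y * (x * z)
    ring₁ = solve-∀
    ring₁' : ∀ x y z → x * (y * z) ≡ y * (x * z)
    ring₁' = solve-∀
    ring₂ : ∀ x y z → x * (y * z) ≡ y * x * z
    ring₂ = solve-∀
    ring₃ : ∀ K i n x y → 2ℤ * (2ℤ * (K + i) - 1ℤ - 2ℤ * (i + n)) * x * y ≡ 2ℤ * (2ℤ * K - 1ℤ - 2ℤ * n) * (x * y)
    ring₃ = solve-∀
    ring₄ : ∀ x y z → x * (y * z) ≡ y * (x * z)
    ring₄ = solve-∀

  -- Jets of the powers of z

  -- Treats the nodes ε = -1 and ε = 1 together: f h i is 2^(i+1) times the coefficient of (z - ε)^i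
  -- in z^h = (ε + (z - ε))^h.
  module Powers (ε : ℤ) (f : ℕ → ℕ → ℤ) (f₀ : ∀ i → f 0 i ≡ δ₀ i 2ℤ)
                (f-suc : ∀ h i → f (suc h) i ≡ 2ℤ * (f h -ˢ i) + ε * f h i) where

    above : ∀ h n → f h (suc (h ℕ.+ n)) ≡ 0ℤ
    above zero n = f₀ (suc n)
    above (suc h) n = trans (f-suc h _) (trans (cong₂ (λ x y → 2ℤ * x + ε * y) (above h n) (trans (cong (λ m → f h (suc m)) (sym (ℕₚ.+-suc h n))) (above h (suc n)))) (ring ε))
      where
      ring : ∀ ε → 2ℤ * 0ℤ + ε * 0ℤ ≡ 0ℤ
      ring = solve-∀

    below : ∀ i n → f (i ℕ.+ n) i ≡ 2ℤ ^ suc i * (+ bin i n * ε ^ n)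
    below zero zero = f₀ 0
    below zero (suc n) = trans (f-suc n 0) (trans (cong (λ y → 2ℤ * 0ℤ + ε * y) (below 0 n)) (ring ε (ε ^ n)))
      where
      ring : ∀ ε e → 2ℤ * 0ℤ + ε * (2ℤ * 1ℤ * (1ℤ * e)) ≡ 2ℤ * 1ℤ * (1ℤ * (ε * e))
      ring = solve-∀
    below (suc i) zero = trans (f-suc (i ℕ.+ 0) (suc i)) (trans (cong₂ (λ x y → 2ℤ * x + ε * y) (below i 0) top) (ring ε (2ℤ ^ suc i) (cong +_ (bin-zeroʳ i))))
      where
      top : f (i ℕ.+ 0) (suc i) ≡ 0ℤ
      top = trans (cong (λ m → f m (suc i)) (ℕₚ.+-identityʳ i)) (trans (cong (λ m → f i (suc m)) (sym (ℕₚ.+-identityʳ i))) (above i 0))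
      ring : ∀ ε p {b} → b ≡ 1ℤ → 2ℤ * (p * (b * 1ℤ)) + ε * 0ℤ ≡ 2ℤ * p * (1ℤ * 1ℤ)
      ring ε p refl = r ε p
        where
        r : ∀ ε p → 2ℤ * (p * (1ℤ * 1ℤ)) + ε * 0ℤ ≡ 2ℤ * p * (1ℤ * 1ℤ)
        r = solve-∀
    below (suc i) (suc n) = trans (f-suc (i ℕ.+ suc n) (suc i)) (trans (cong₂ (λ x y → 2ℤ * x + ε * y) (below i (suc n)) (trans (cong (λ m → f m (suc i)) (ℕₚ.+-suc i n)) (below (suc i) n)))
      (ring ε (2ℤ ^ suc i) (ε ^ n) (+ bin i (suc n)) (+ bin (suc i) n)))
      where
      ring : ∀ ε p e b c → 2ℤ * (p * (b * (ε * e))) + ε * (2ℤ * p * (c * e)) ≡ 2ℤ * p * ((b + c) * (ε * e))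
      ring = solve-∀

  private
    ε₋ : ∀ x y → 2ℤ * x - y ≡ 2ℤ * x + -1ℤ * y
    ε₋ = solve-∀

    ε₊ : ∀ x y → 2ℤ * x + y ≡ 2ℤ * x + 1ℤ * y
    ε₊ = solve-∀

  module Powers₋ = Powers -1ℤ (λ h → at₋ (zpow h)) (λ i → refl) (λ h i → ε₋ (at₋ (zpow h) -ˢ i) (at₋ (zpow h) i))
  module Powers₊ = Powers 1ℤ (λ h → at₊ (zpow h)) (λ i → refl) (λ h i → ε₊ (at₊ (zpow h) -ˢ i) (at₊ (zpow h) i))

  at₀-zpow : ∀ i n → at₀ (zpow (i ℕ.+ n)) i ≡ δ₀ n 1ℤ
  at₀-zpow zero zero = refl
  at₀-zpow zero (suc n) = refl
  at₀-zpow (suc i) n = at₀-zpow i n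

  at₀-zpow-above : ∀ h n → at₀ (zpow h) (suc (h ℕ.+ n)) ≡ 0ℤ
  at₀-zpow-above zero n = refl
  at₀-zpow-above (suc h) n = at₀-zpow-above h n

-- Taylor polynomials of the square root

module SquareRoot where

  open DividedDifferences using (2ℤ)
  open HalfBinomial
  open import Data.Nat as ℕ using (ℕ; zero; suc)
  import Data.Nat.Properties as ℕₚ
  open import Data.Nat.Tactic.RingSolver using () renaming (solve-∀ to ℕsolve-∀)
  open import Data.Integer using (ℤ; +_; 0ℤ; 1ℤ; _+_; _*_; _-_; -_; ∣_∣; _^_)
  open import Data.Integer.Properties
  open import Data.Integer.Tactic.RingSolver using (solve-∀)
  open import Relation.Binary.PropositionalEquality

  abs-^ : ∀ i n → ∣ i ^ n ∣ ≡ ∣ i ∣ ℕ.^ n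
  abs-^ i zero    = refl
  abs-^ i (suc n) = trans (abs-* i (i ^ n)) (cong (∣ i ∣ ℕ.*_) (abs-^ i n))

  ^-distribʳ-* : ∀ m n k → (m ℕ.* n) ℕ.^ k ≡ m ℕ.^ k ℕ.* n ℕ.^ k
  ^-distribʳ-* m n zero    = refl
  ^-distribʳ-* m n (suc k) = trans (cong (m ℕ.* n ℕ.*_) (^-distribʳ-* m n k)) (ring m n (m ℕ.^ k) (n ℕ.^ k))
    where
    ring : ∀ m n p r → m ℕ.* n ℕ.* (p ℕ.* r) ≡ m ℕ.* p ℕ.* (n ℕ.* r)
    ring = ℕsolve-∀

  private
    c : ℕ → ℤ
    c = B 1

    c-suc : ∀ i → + suc i * c (suc i) ≡ (2ℤ * (1ℤ - 2ℤ * + i)) * c i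
    c-suc i = B-suc 1 i

    cancelˡ : ∀ {x y} n → + suc n * x ≡ + suc n * y → x ≡ y
    cancelˡ n e = *-cancelˡ-≡ (+ suc n) _ _ e

    -- The sum of c (i + l) c (j - l) over l ≤ j, which for i = 0 is a full coefficient of the
    -- squared series.
    tail : ℕ → ℕ → ℤ
    tail i zero    = c i * c 0
    tail i (suc j) = c i * c (suc j) + tail (suc i) j

    -- Closed form of the partial sums of the Cauchy square, found by Gosper summation.
    tail-closed : ∀ m j → (+ suc (m ℕ.+ j) * + (m ℕ.+ j)) * tail (suc m) j ≡ (2ℤ * ((1ℤ - 2ℤ * + m) * (1ℤ - 2ℤ * + j))) * ((+ m - + j) * (c m * c j))
    tail-closed m zero = begin
      (+ suc (m ℕ.+ 0) * + (m ℕ.+ 0)) * (c (suc m) * 1ℤ)        ≡⟨ cong (λ n → (+ suc n * + n) * (c (suc m) * 1ℤ)) (ℕₚ.+-identityʳ m) ⟩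
      (+ suc m * + m) * (c (suc m) * 1ℤ)                        ≡⟨ ring₁ (+ suc m) (+ m) (c (suc m)) ⟩
      + m * (+ suc m * c (suc m))                               ≡⟨ cong (+ m *_) (c-suc m) ⟩
      + m * ((2ℤ * (1ℤ - 2ℤ * + m)) * c m)                      ≡⟨ ring₂ (+ m) (c m) ⟩
      (2ℤ * ((1ℤ - 2ℤ * + m) * (1ℤ - 2ℤ * 0ℤ))) * ((+ m - 0ℤ) * (c m * 1ℤ)) ∎
      where
      open ≡-Reasoning
      ring₁ : ∀ s m c → (s * m) * (c * 1ℤ) ≡ m * (s * c)
      ring₁ = solve-∀
      ring₂ : ∀ m c → m * ((2ℤ * (1ℤ - 2ℤ * m)) * c) ≡ (2ℤ * ((1ℤ - 2ℤ * m) * (1ℤ - 2ℤ * 0ℤ))) * ((m - 0ℤ) * (c * 1ℤ))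
      ring₂ = solve-∀
    tail-closed m (suc j) rewrite ℕₚ.+-suc m j = cancelˡ m (cancelˡ j (begin
      + suc j * (+ suc m * ((+ suc (suc s) * + suc s) * (a' * b' + tail (suc (suc m)) j)))                      ≡⟨ ring₁ (+ suc j) (+ suc m) (+ suc (suc s)) (+ suc s) a' b' (tail (suc (suc m)) j) ⟩
      (+ suc (suc s) * + suc s) * ((+ suc m * a') * (+ suc j * b')) + + suc j * (+ suc m * ((+ suc (suc s) * + suc s) * tail (suc (suc m)) j)) ≡⟨ cong (λ t → (+ suc (suc s) * + suc s) * ((+ suc m * a') * (+ suc j * b')) + + suc j * (+ suc m * t)) (tail-closed (suc m) j) ⟩
      (+ suc (suc s) * + suc s) * ((+ suc m * a') * (+ suc j * b')) + + suc j * (+ suc m * ((2ℤ * ((1ℤ - 2ℤ * + suc m) * (1ℤ - 2ℤ * + j))) * ((+ suc m - + j) * (a' * c j)))) ≡⟨ ring₂ (+ m) (+ j) (+ suc m * a') (+ suc j * b') a' (c j) ⟩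
      lhs (+ m) (+ j) (+ suc m * a') (+ suc j * b') (c j)                                                       ≡⟨ cong₂ (λ x y → lhs (+ m) (+ j) x y (c j)) (c-suc m) (c-suc j) ⟩
      lhs (+ m) (+ j) ((2ℤ * (1ℤ - 2ℤ * + m)) * c m) ((2ℤ * (1ℤ - 2ℤ * + j)) * c j) (c j)                       ≡⟨ ring₃ (+ m) (+ j) (c m) (c j) ⟩
      rhs (+ m) (+ j) (c m) ((2ℤ * (1ℤ - 2ℤ * + j)) * c j)                                                      ≡⟨ cong (rhs (+ m) (+ j) (c m)) (sym (c-suc j)) ⟩
      rhs (+ m) (+ j) (c m) (+ suc j * b')                                                                      ≡⟨ ring₄ (+ m) (+ j) (c m) b' ⟩
      + suc j * (+ suc m * ((2ℤ * ((1ℤ - 2ℤ * + m) * (1ℤ - 2ℤ * + suc j))) * ((+ m - + suc j) * (c m * b'))))   ∎))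
      where
      open ≡-Reasoning
      s = m ℕ.+ j
      a' = c (suc m)
      b' = c (suc j)
      lhs : ℤ → ℤ → ℤ → ℤ → ℤ → ℤ
      lhs m j x y b = ((1ℤ + (1ℤ + (m + j))) * (1ℤ + (m + j))) * (x * y) + (1ℤ + j) * ((2ℤ * ((1ℤ - 2ℤ * (1ℤ + m)) * (1ℤ - 2ℤ * j))) * (((1ℤ + m) - j) * (x * b)))
      rhs : ℤ → ℤ → ℤ → ℤ → ℤ
      rhs m j a y = (1ℤ + m) * ((2ℤ * ((1ℤ - 2ℤ * m) * (1ℤ - 2ℤ * (1ℤ + j)))) * ((m - (1ℤ + j)) * (a * y)))
      ring₁ : ∀ j m s t x y z → j * (m * ((s * t) * (x * y + z))) ≡ (s * t) * ((m * x) * (j * y)) + j * (m * ((s * t) * z))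
      ring₁ = solve-∀
      ring₂ : ∀ m j x y a b → ((1ℤ + (1ℤ + (m + j))) * (1ℤ + (m + j))) * (x * y) + (1ℤ + j) * ((1ℤ + m) * ((2ℤ * ((1ℤ - 2ℤ * (1ℤ + m)) * (1ℤ - 2ℤ * j))) * (((1ℤ + m) - j) * (a * b)))) ≡
        ((1ℤ + (1ℤ + (m + j))) * (1ℤ + (m + j))) * (x * y) + (1ℤ + j) * ((2ℤ * ((1ℤ - 2ℤ * (1ℤ + m)) * (1ℤ - 2ℤ * j))) * (((1ℤ + m) - j) * (((1ℤ + m) * a) * b)))
      ring₂ = solve-∀
      ring₃ : ∀ m j a b → ((1ℤ + (1ℤ + (m + j))) * (1ℤ + (m + j))) * (((2ℤ * (1ℤ - 2ℤ * m)) * a) * ((2ℤ * (1ℤ - 2ℤ * j)) * b)) + (1ℤ + j) * ((2ℤ * ((1ℤ - 2ℤ * (1ℤ + m)) * (1ℤ - 2ℤ * j))) * (((1ℤ + m) - j) * (((2ℤ * (1ℤ - 2ℤ * m)) * a) * b))) ≡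
        (1ℤ + m) * ((2ℤ * ((1ℤ - 2ℤ * m) * (1ℤ - 2ℤ * (1ℤ + j)))) * ((m - (1ℤ + j)) * (a * ((2ℤ * (1ℤ - 2ℤ * j)) * b))))
      ring₃ = solve-∀
      ring₄ : ∀ m j a b → (1ℤ + m) * ((2ℤ * ((1ℤ - 2ℤ * m) * (1ℤ - 2ℤ * (1ℤ + j)))) * ((m - (1ℤ + j)) * (a * ((1ℤ + j) * b)))) ≡ (1ℤ + j) * ((1ℤ + m) * ((2ℤ * ((1ℤ - 2ℤ * m) * (1ℤ - 2ℤ * (1ℤ + j)))) * ((m - (1ℤ + j)) * (a * b))))
      ring₄ = solve-∀

    -- The square of the series of √(1 + 4x) is 1 + 4x. The closed form evaluates the sum without
    -- its first term, and the two cancel.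
    cauchy-square : ∀ n → tail 0 (suc (suc n)) ≡ 0ℤ
    cauchy-square n = cancelˡ n (cancelˡ (suc n) (begin
      + suc (suc n) * (+ suc n * (1ℤ * c (suc (suc n)) + tail 1 (suc n)))                        ≡⟨ ring₁ (+ suc (suc n)) (+ suc n) (c (suc (suc n))) (tail 1 (suc n)) ⟩
      + suc n * (+ suc (suc n) * c (suc (suc n))) + (+ suc (suc n) * + suc n) * tail 1 (suc n)    ≡⟨ cong₂ (λ x y → + suc n * x + y) (c-suc (suc n)) (tail-closed 0 (suc n)) ⟩
      + suc n * ((2ℤ * (1ℤ - 2ℤ * + suc n)) * c (suc n)) + (2ℤ * ((1ℤ - 2ℤ * 0ℤ) * (1ℤ - 2ℤ * + suc n))) * ((0ℤ - + suc n) * (1ℤ * c (suc n))) ≡⟨ ring₂ (+ suc n) (c (suc n)) ⟩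
      0ℤ                                                                                         ≡⟨ ring₃ (+ suc (suc n)) (+ suc n) ⟩
      + suc (suc n) * (+ suc n * 0ℤ)                                                             ∎))
      where
      open ≡-Reasoning
      ring₁ : ∀ s n x y → s * (n * (1ℤ * x + y)) ≡ n * (s * x) + (s * n) * y
      ring₁ = solve-∀
      ring₂ : ∀ n x → n * ((2ℤ * (1ℤ - 2ℤ * n)) * x) + (2ℤ * ((1ℤ - 2ℤ * 0ℤ) * (1ℤ - 2ℤ * n))) * ((0ℤ - n) * (1ℤ * x)) ≡ 0ℤ
      ring₂ = solve-∀
      ring₃ : ∀ s n → 0ℤ ≡ s * (n * 0ℤ)
      ring₃ = solve-∀

  module Taylor (y : ℕ) (v : ℤ) where
    Y : ℤ
    Y = + y

    -- Y^n times the Taylor polynomial of degree n of (1 + 4v/Y)^(K - 1/2)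
    τ : ℕ → ℕ → ℤ
    τ K zero    = 1ℤ
    τ K (suc n) = Y * τ K n + B K (suc n) * v ^ suc n

    private
      t : ℕ → ℤ
      t = τ 1

      -- For i = 0 this is the squared series truncated at total degree n and made homogeneous with
      -- Y, which for n ≥ 1 is Y^(n-1) (Y + 4v).
      Q : ℕ → ℕ → ℤ
      Q i zero    = c i * v ^ i
      Q i (suc j) = (c i * v ^ i) * t (suc j) + Q (suc i) j

      Q-suc : ∀ i j → Q i (suc j) ≡ Y * Q i j + v ^ (i ℕ.+ suc j) * tail i (suc j)
      Q-suc i zero = trans (cong (λ p → (c i * v ^ i) * t 1 + c (suc i) * p) (trans (cong (v *_) (sym (*-identityʳ (v ^ i)))) refl))
          (trans (ring Y v (c i) (c (suc i)) (v ^ i) (c 1)) (cong (λ p → Y * (c i * v ^ i) + p * (c i * c 1 + c (suc i) * 1ℤ)) (sym (^-distribˡ-+-* v i 1))))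
        where
        ring : ∀ Y v a b w d → (a * w) * (Y * 1ℤ + d * (v * 1ℤ)) + b * (v * (w * 1ℤ)) ≡ Y * (a * w) + (w * (v * 1ℤ)) * (a * d + b * 1ℤ)
        ring = solve-∀
      Q-suc i (suc j) = begin
        (c i * v ^ i) * (Y * t (suc j) + c (suc (suc j)) * v ^ suc (suc j)) + Q (suc i) (suc j)       ≡⟨ cong (λ z → (c i * v ^ i) * (Y * t (suc j) + c (suc (suc j)) * v ^ suc (suc j)) + z) (Q-suc (suc i) j) ⟩
        (c i * v ^ i) * (Y * t (suc j) + c (suc (suc j)) * v ^ suc (suc j)) + (Y * Q (suc i) j + v ^ (suc i ℕ.+ suc j) * tail (suc i) (suc j)) ≡⟨ cong (λ p → (c i * v ^ i) * (Y * t (suc j) + c (suc (suc j)) * v ^ suc (suc j)) + (Y * Q (suc i) j + p * tail (suc i) (suc j))) (trans (cong (v ^_) (sym (ℕₚ.+-suc i (suc j)))) (^-distribˡ-+-* v i (suc (suc j)))) ⟩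
        (c i * v ^ i) * (Y * t (suc j) + c (suc (suc j)) * v ^ suc (suc j)) + (Y * Q (suc i) j + (v ^ i * v ^ suc (suc j)) * tail (suc i) (suc j)) ≡⟨ ring Y (c i) (v ^ i) (t (suc j)) (c (suc (suc j))) (v ^ suc (suc j)) (Q (suc i) j) (tail (suc i) (suc j)) ⟩
        Y * ((c i * v ^ i) * t (suc j) + Q (suc i) j) + (v ^ i * v ^ suc (suc j)) * (c i * c (suc (suc j)) + tail (suc i) (suc j)) ≡⟨ cong (λ p → Y * Q i (suc j) + p * tail i (suc (suc j))) (sym (^-distribˡ-+-* v i (suc (suc j)))) ⟩
        Y * Q i (suc j) + v ^ (i ℕ.+ suc (suc j)) * tail i (suc (suc j)) ∎
        where
        open ≡-Reasoning
        ring : ∀ Y a w t d u q r → (a * w) * (Y * t + d * u) + (Y * q + (w * u) * r) ≡ Y * ((a * w) * t + q) + (w * u) * (a * d + r)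
        ring = solve-∀

      Q₀ : ∀ n → Q 0 (suc n) ≡ Y ^ n * (Y + + 4 * v)
      Q₀ zero = ring Y v
        where
        ring : ∀ Y v → (1ℤ * 1ℤ) * (Y * 1ℤ + 2ℤ * (v * 1ℤ)) + 2ℤ * (v * 1ℤ) ≡ 1ℤ * (Y + + 4 * v)
        ring = solve-∀
      Q₀ (suc n) = trans (Q-suc 0 (suc n)) (trans (cong₂ (λ p q → Y * p + v ^ suc (suc n) * q) (Q₀ n) (cauchy-square n)) (ring Y (Y ^ n) (Y + + 4 * v) (v ^ suc (suc n))))
        where
        ring : ∀ Y p z w → Y * (p * z) + w * 0ℤ ≡ (Y * p) * z
        ring = solve-∀

      θ : ℕ → ℕ → ℤ
      θ i zero    = c i * v ^ i
      θ i (suc j) = Y ^ suc j * (c i * v ^ i) + θ (suc i) j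

      θ-suc : ∀ i j → θ i (suc j) ≡ Y * θ i j + c (i ℕ.+ suc j) * v ^ (i ℕ.+ suc j)
      θ-suc i zero rewrite ℕₚ.+-comm i 1 = cong (_+ c (suc i) * v ^ suc i) (cong (_* (c i * v ^ i)) (*-identityʳ Y))
      θ-suc i (suc j) rewrite θ-suc (suc i) j | ℕₚ.+-suc i (suc j) = ring Y (Y ^ suc j) (c i * v ^ i) (θ (suc i) j) _
        where
        ring : ∀ Y p x q r → (Y * p) * x + (Y * q + r) ≡ Y * (p * x + q) + r
        ring = solve-∀

      θ₀ : ∀ n → θ 0 n ≡ t n
      θ₀ zero = refl
      θ₀ (suc n) = trans (θ-suc 0 n) (cong (λ p → Y * p + c (suc n) * v ^ suc n) (θ₀ n))

    module _ (small : 8 ℕ.* ∣ v ∣ ℕ.≤ y) where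
      private
        q : ℕ
        q = 4 ℕ.* ∣ v ∣

        2q≤y : 2 ℕ.* q ℕ.≤ y
        2q≤y = ℕₚ.≤-trans (ℕₚ.≤-reflexive (ring ∣ v ∣)) small
          where
          ring : ∀ n → 2 ℕ.* (4 ℕ.* n) ≡ 8 ℕ.* n
          ring = ℕsolve-∀

        term : ∀ i → ∣ c i * v ^ i ∣ ℕ.≤ 2 ℕ.* q ℕ.^ i
        term i = begin
          ∣ c i * v ^ i ∣                      ≡⟨ trans (abs-* (c i) (v ^ i)) (cong (∣ c i ∣ ℕ.*_) (abs-^ v i)) ⟩
          ∣ c i ∣ ℕ.* ∣ v ∣ ℕ.^ i              ≤⟨ ℕₚ.*-monoˡ-≤ (∣ v ∣ ℕ.^ i) (B-bound 1 i) ⟩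
          2 ℕ.* 4 ℕ.^ i ℕ.* ∣ v ∣ ℕ.^ i        ≡⟨ trans (ℕₚ.*-assoc 2 (4 ℕ.^ i) _) (cong (2 ℕ.*_) (sym (^-distribʳ-* 4 ∣ v ∣ i))) ⟩
          2 ℕ.* q ℕ.^ i                        ∎
          where open ℕₚ.≤-Reasoning

        Δ : ℕ → ℕ → ℤ
        Δ i j = Y ^ i * t j - t (i ℕ.+ j)

        Δ-bound : ∀ i j → y ℕ.* ∣ Δ i j ∣ ℕ.+ 4 ℕ.* q ℕ.^ suc (i ℕ.+ j) ℕ.≤ 4 ℕ.* (q ℕ.^ suc j ℕ.* y ℕ.^ i)
        Δ-bound zero j = ℕₚ.≤-reflexive (trans (cong (λ u → y ℕ.* ∣ u ∣ ℕ.+ 4 ℕ.* q ℕ.^ suc j) (ring (t j))) (trans (cong (ℕ._+ 4 ℕ.* q ℕ.^ suc j) (ℕₚ.*-zeroʳ y)) (cong (4 ℕ.*_) (sym (ℕₚ.*-identityʳ (q ℕ.^ suc j))))))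
          where
          ring : ∀ x → 1ℤ * x - x ≡ 0ℤ
          ring = solve-∀
        Δ-bound (suc i) j = begin
          y ℕ.* ∣ Δ (suc i) j ∣ ℕ.+ 4 ℕ.* (q ℕ.* r)                            ≤⟨ ℕₚ.+-mono-≤ (ℕₚ.*-monoʳ-≤ y step) (ℕₚ.≤-trans (ℕₚ.≤-reflexive (ring₁ q r)) (ℕₚ.*-monoˡ-≤ r (ℕₚ.*-monoʳ-≤ 2 2q≤y))) ⟩
          y ℕ.* (y ℕ.* ∣ Δ i j ∣ ℕ.+ 2 ℕ.* r) ℕ.+ 2 ℕ.* y ℕ.* r                ≡⟨ ring₂ y ∣ Δ i j ∣ r ⟩
          y ℕ.* (y ℕ.* ∣ Δ i j ∣ ℕ.+ 4 ℕ.* r)                                  ≤⟨ ℕₚ.*-monoʳ-≤ y (Δ-bound i j) ⟩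
          y ℕ.* (4 ℕ.* (q ℕ.^ suc j ℕ.* y ℕ.^ i))                              ≡⟨ ring₃ y (q ℕ.^ suc j) (y ℕ.^ i) ⟩
          4 ℕ.* (q ℕ.^ suc j ℕ.* (y ℕ.* y ℕ.^ i))                              ∎
          where
          open ℕₚ.≤-Reasoning
          r = q ℕ.^ suc (i ℕ.+ j)
          e : Δ (suc i) j ≡ Y * Δ i j - c (suc (i ℕ.+ j)) * v ^ suc (i ℕ.+ j)
          e = ring Y (Y ^ i) (t j) (t (i ℕ.+ j)) (c (suc (i ℕ.+ j)) * v ^ suc (i ℕ.+ j))
            where
            ring : ∀ Y p a b x → (Y * p) * a - (Y * b + x) ≡ Y * (p * a - b) - x
            ring = solve-∀
          step : ∣ Δ (suc i) j ∣ ℕ.≤ y ℕ.* ∣ Δ i j ∣ ℕ.+ 2 ℕ.* r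
          step = begin
            ∣ Δ (suc i) j ∣                                                    ≡⟨ cong ∣_∣ e ⟩
            ∣ Y * Δ i j - c (suc (i ℕ.+ j)) * v ^ suc (i ℕ.+ j) ∣              ≤⟨ ∣i-j∣≤∣i∣+∣j∣ (Y * Δ i j) _ ⟩
            ∣ Y * Δ i j ∣ ℕ.+ ∣ c (suc (i ℕ.+ j)) * v ^ suc (i ℕ.+ j) ∣        ≤⟨ ℕₚ.+-mono-≤ (ℕₚ.≤-reflexive (abs-* Y (Δ i j))) (term (suc (i ℕ.+ j))) ⟩
            y ℕ.* ∣ Δ i j ∣ ℕ.+ 2 ℕ.* r                                        ∎
          ring₁ : ∀ q r → 4 ℕ.* (q ℕ.* r) ≡ 2 ℕ.* (2 ℕ.* q) ℕ.* r
          ring₁ = ℕsolve-∀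
          ring₂ : ∀ y d r → y ℕ.* (y ℕ.* d ℕ.+ 2 ℕ.* r) ℕ.+ 2 ℕ.* y ℕ.* r ≡ y ℕ.* (y ℕ.* d ℕ.+ 4 ℕ.* r)
          ring₂ = ℕsolve-∀
          ring₃ : ∀ y a b → y ℕ.* (4 ℕ.* (a ℕ.* b)) ≡ 4 ℕ.* (a ℕ.* (y ℕ.* b))
          ring₃ = ℕsolve-∀

        -- For i = 0 and j = n this compares the truncated square with the square of the truncation:
        -- up to sign, the products of total degree above n.
        D : ℕ → ℕ → ℕ → ℤ
        D n i j = Y ^ n * Q i j - θ i j * t n

        D-term : ∀ n i j → i ℕ.+ j ≡ n → y ℕ.* ∣ Y ^ n * ((c i * v ^ i) * t j) - (Y ^ j * (c i * v ^ i)) * t n ∣ ℕ.≤ 8 ℕ.* (q ℕ.^ suc n ℕ.* y ℕ.^ n)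
        D-term n i j refl = begin
          y ℕ.* ∣ Y ^ (i ℕ.+ j) * (x * t j) - (Y ^ j * x) * t (i ℕ.+ j) ∣      ≡⟨ cong (λ u → y ℕ.* ∣ u ∣) (trans (cong (λ p → p * (x * t j) - (Y ^ j * x) * t (i ℕ.+ j)) (^-distribˡ-+-* Y i j)) (ring (Y ^ i) (Y ^ j) x (t j) (t (i ℕ.+ j)))) ⟩
          y ℕ.* ∣ (Y ^ j * x) * Δ i j ∣                                        ≡⟨ cong (y ℕ.*_) (trans (abs-* (Y ^ j * x) (Δ i j)) (cong (ℕ._* ∣ Δ i j ∣) (trans (abs-* (Y ^ j) x) (cong (ℕ._* ∣ x ∣) (abs-^ Y j))))) ⟩
          y ℕ.* (y ℕ.^ j ℕ.* ∣ x ∣ ℕ.* ∣ Δ i j ∣)                              ≡⟨ ring₁ y (y ℕ.^ j) ∣ x ∣ ∣ Δ i j ∣ ⟩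
          y ℕ.^ j ℕ.* (∣ x ∣ ℕ.* (y ℕ.* ∣ Δ i j ∣))                            ≤⟨ ℕₚ.*-monoʳ-≤ (y ℕ.^ j) (ℕₚ.*-mono-≤ (term i) (ℕₚ.≤-trans (ℕₚ.m≤m+n _ _) (Δ-bound i j))) ⟩
          y ℕ.^ j ℕ.* (2 ℕ.* q ℕ.^ i ℕ.* (4 ℕ.* (q ℕ.* q ℕ.^ j ℕ.* y ℕ.^ i)))  ≡⟨ ring₂ (y ℕ.^ j) (q ℕ.^ i) q (q ℕ.^ j) (y ℕ.^ i) ⟩
          8 ℕ.* (q ℕ.* (q ℕ.^ i ℕ.* q ℕ.^ j) ℕ.* (y ℕ.^ i ℕ.* y ℕ.^ j))        ≡⟨ cong₂ (λ a b → 8 ℕ.* (q ℕ.* a ℕ.* b)) (sym (ℕₚ.^-distribˡ-+-* q i j)) (sym (ℕₚ.^-distribˡ-+-* y i j)) ⟩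
          8 ℕ.* (q ℕ.^ suc (i ℕ.+ j) ℕ.* y ℕ.^ (i ℕ.+ j))                      ∎
          where
          open ℕₚ.≤-Reasoning
          x = c i * v ^ i
          ring : ∀ p r x a b → (p * r) * (x * a) - (r * x) * b ≡ (r * x) * (p * a - b)
          ring = solve-∀
          ring₁ : ∀ y p x d → y ℕ.* (p ℕ.* x ℕ.* d) ≡ p ℕ.* (x ℕ.* (y ℕ.* d))
          ring₁ = ℕsolve-∀
          ring₂ : ∀ a b q d e → a ℕ.* (2 ℕ.* b ℕ.* (4 ℕ.* (q ℕ.* d ℕ.* e))) ≡ 8 ℕ.* (q ℕ.* (b ℕ.* d) ℕ.* (e ℕ.* a))
          ring₂ = ℕsolve-∀

        D-bound : ∀ n i j → i ℕ.+ j ≡ n → y ℕ.* ∣ D n i j ∣ ℕ.≤ suc j ℕ.* (8 ℕ.* (q ℕ.^ suc n ℕ.* y ℕ.^ n))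
        D-bound n i zero e = ℕₚ.≤-trans (ℕₚ.≤-reflexive (cong (λ u → y ℕ.* ∣ u ∣) (ring (Y ^ n) (c i * v ^ i) (t n)))) (ℕₚ.≤-trans (D-term n i 0 e) (ℕₚ.m≤m+n _ _))
          where
          ring : ∀ p x t → p * x - x * t ≡ p * (x * 1ℤ) - (1ℤ * x) * t
          ring = solve-∀
        D-bound n i (suc j) e = begin
          y ℕ.* ∣ D n i (suc j) ∣                          ≡⟨ cong (λ u → y ℕ.* ∣ u ∣) (ring (Y ^ n) (c i * v ^ i) (t (suc j)) (Q (suc i) j) (Y ^ suc j) (θ (suc i) j) (t n)) ⟩
          y ℕ.* ∣ T + D n (suc i) j ∣                      ≤⟨ ℕₚ.*-monoʳ-≤ y (∣i+j∣≤∣i∣+∣j∣ T _) ⟩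
          y ℕ.* (∣ T ∣ ℕ.+ ∣ D n (suc i) j ∣)              ≡⟨ ℕₚ.*-distribˡ-+ y ∣ T ∣ _ ⟩
          y ℕ.* ∣ T ∣ ℕ.+ y ℕ.* ∣ D n (suc i) j ∣          ≤⟨ ℕₚ.+-mono-≤ (D-term n i (suc j) e) (D-bound n (suc i) j (trans (sym (ℕₚ.+-suc i j)) e)) ⟩
          suc (suc j) ℕ.* (8 ℕ.* (q ℕ.^ suc n ℕ.* y ℕ.^ n)) ∎
          where
          open ℕₚ.≤-Reasoning
          T = Y ^ n * ((c i * v ^ i) * t (suc j)) - (Y ^ suc j * (c i * v ^ i)) * t n
          ring : ∀ p x a r s u t → p * (x * a + r) - (s * x + u) * t ≡ (p * (x * a) - (s * x) * t) + (p * r - u * t)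
          ring = solve-∀

      τ²-bound : ∀ m → let n = suc m in
        ∣ Y * (Y ^ n * (Y ^ m * (Y + + 4 * v))) - Y * (τ 1 n * τ 1 n) ∣ ℕ.≤ suc n ℕ.* (8 ℕ.* (q ℕ.^ suc n ℕ.* y ℕ.^ n))
      τ²-bound m = ℕₚ.≤-trans (ℕₚ.≤-reflexive (trans (cong ∣_∣ e) (abs-* Y (D n 0 n)))) (D-bound n 0 n refl)
        where
        n = suc m
        e : Y * (Y ^ n * (Y ^ m * (Y + + 4 * v))) - Y * (t n * t n) ≡ Y * D n 0 n
        e = trans (ring Y (Y ^ n * (Y ^ m * (Y + + 4 * v))) (t n * t n)) (cong₂ (λ a b → Y * (Y ^ n * a - b * t n)) (sym (Q₀ m)) (sym (θ₀ n)))
          where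
          ring : ∀ Y a b → Y * a - Y * b ≡ Y * (a - b)
          ring = solve-∀

      τ-near : ∀ n → y ℕ.* ∣ Y ^ n - τ 1 n ∣ ℕ.≤ 4 ℕ.* (q ℕ.* y ℕ.^ n)
      τ-near n = begin
        y ℕ.* ∣ Y ^ n - t n ∣                           ≡⟨ cong₂ (λ a b → y ℕ.* ∣ a - t b ∣) (sym (*-identityʳ (Y ^ n))) (sym (ℕₚ.+-identityʳ n)) ⟩
        y ℕ.* ∣ Δ n 0 ∣                                 ≤⟨ ℕₚ.≤-trans (ℕₚ.m≤m+n _ _) (Δ-bound n 0) ⟩
        4 ℕ.* (q ℕ.* 1 ℕ.* y ℕ.^ n)                     ≡⟨ cong (λ a → 4 ℕ.* (a ℕ.* y ℕ.^ n)) (ℕₚ.*-identityʳ q) ⟩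
        4 ℕ.* (q ℕ.* y ℕ.^ n)                           ∎
        where open ℕₚ.≤-Reasoning

    -- Multiplication by 1 + 4v/Y raises the exponent by one. Pascal's rule accounts for all terms
    -- but the top one, which exceeds the degree.
    τ-pascal : ∀ K n → (Y + + 4 * v) * τ K n ≡ Y * τ (suc K) n + + 4 * (B K n * v ^ suc n)
    τ-pascal K zero rewrite B₀ K = ring Y v
      where
      ring : ∀ Y v → (Y + + 4 * v) * 1ℤ ≡ Y * 1ℤ + + 4 * (1ℤ * (v * 1ℤ))
      ring = solve-∀
    τ-pascal K (suc n) = begin
      (Y + + 4 * v) * (Y * τ K n + b' * w)                                            ≡⟨ ring₁ Y v (τ K n) (b' * w) ⟩
      Y * ((Y + + 4 * v) * τ K n) + (Y + + 4 * v) * (b' * w)                          ≡⟨ cong (λ u → Y * u + (Y + + 4 * v) * (b' * w)) (τ-pascal K n) ⟩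
      Y * (Y * τ (suc K) n + + 4 * (B K n * w)) + (Y + + 4 * v) * (b' * w)            ≡⟨ ring₂ Y v (τ (suc K) n) (B K n) b' w ⟩
      Y * (Y * τ (suc K) n + (b' + + 4 * B K n) * w) + + 4 * (b' * (v * w))           ∎
      where
      open ≡-Reasoning
      b' = B K (suc n)
      w = v ^ suc n
      ring₁ : ∀ Y v t x → (Y + + 4 * v) * (Y * t + x) ≡ Y * ((Y + + 4 * v) * t) + (Y + + 4 * v) * x
      ring₁ = solve-∀
      ring₂ : ∀ Y v t b b' w → Y * (Y * t + + 4 * (b * w)) + (Y + + 4 * v) * (b' * w) ≡ Y * (Y * t + (b' + + 4 * b) * w) + + 4 * (b' * (v * w))
      ring₂ = solve-∀

-- Approximation of half-integral powers at one node

module Node where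

  open HalfBinomial
  open SquareRoot
  open import Data.Nat as ℕ using (ℕ; zero; suc)
  import Data.Nat.Properties as ℕₚ
  open import Data.Nat.Tactic.RingSolver using () renaming (solve-∀ to ℕsolve-∀)
  open import Data.Integer using (ℤ; +_; -[1+_]; 1ℤ; _+_; _*_; _-_; -_; ∣_∣; _^_)
  open import Data.Integer.Properties
  open import Data.Integer.Tactic.RingSolver using (solve-∀)
  open import Data.Product using (∃; _,_; proj₁; proj₂)
  open import Relation.Binary.PropositionalEquality

  private
    -- The factor p b + A t turns the error into p² b² - A² t². Times y this is `main` + `tail`:
    -- `main` stems from the factor 1 + v/x₂ in b²/A² = (1 + v/X)(1 + v/x₂), `tail` from the squared
    -- Taylor polynomial.
    sqrt-error : ∀ X x₂ A b t p y v Z K → + y ≡ + 4 * + X → Z ≡ + y + + 4 * v → ∣ Z ∣ ℕ.≤ 2 ℕ.* y → A ℕ.* A ≡ X ℕ.* x₂ →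
      + b * + b ≡ (+ X + v) * (+ x₂ + v) → A ℕ.≤ 2 ℕ.* b → ∣ + p * + p * Z - + y * (+ t * + t) ∣ ℕ.≤ K →
      p ℕ.* (∣ + p * + b - + A * + t ∣ ℕ.* (y ℕ.* A)) ℕ.≤ 2 ℕ.* ((p ℕ.* p) ℕ.* (X ℕ.* (2 ℕ.* y ℕ.* ∣ v ∣)) ℕ.+ (A ℕ.* A) ℕ.* K)
    sqrt-error X x₂ A b t p y v Z K y≡ Z≡ ∣Z∣≤ A² b² A≤2b tail-bound = begin
        p ℕ.* (E ℕ.* (y ℕ.* A))                               ≤⟨ ℕₚ.*-monoʳ-≤ p (ℕₚ.*-monoʳ-≤ E (ℕₚ.*-monoʳ-≤ y A≤2b)) ⟩
        p ℕ.* (E ℕ.* (y ℕ.* (2 ℕ.* b)))                       ≡⟨ ring₁ p E y b ⟩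
        2 ℕ.* (y ℕ.* (E ℕ.* (p ℕ.* b)))                       ≤⟨ ℕₚ.*-monoʳ-≤ 2 (ℕₚ.*-monoʳ-≤ y (ℕₚ.*-monoʳ-≤ E (ℕₚ.m≤m+n (p ℕ.* b) (A ℕ.* t)))) ⟩
        2 ℕ.* (y ℕ.* (E ℕ.* (p ℕ.* b ℕ.+ A ℕ.* t)))           ≡⟨ cong (2 ℕ.*_) (sym product) ⟩
        2 ℕ.* ∣ main + tail ∣                                 ≤⟨ ℕₚ.*-monoʳ-≤ 2 (∣i+j∣≤∣i∣+∣j∣ main tail) ⟩
        2 ℕ.* (∣ main ∣ ℕ.+ ∣ tail ∣)                         ≤⟨ ℕₚ.*-monoʳ-≤ 2 (ℕₚ.+-mono-≤ main≤ tail≤) ⟩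
        2 ℕ.* ((p ℕ.* p) ℕ.* (X ℕ.* (2 ℕ.* y ℕ.* ∣ v ∣)) ℕ.+ (A ℕ.* A) ℕ.* K) ∎
        where
        open ℕₚ.≤-Reasoning
        E = ∣ + p * + b - + A * + t ∣
        main tail : ℤ
        main = (+ p * + p) * (+ X * (Z * v))
        tail = (+ A * + A) * (+ p * + p * Z - + y * (+ t * + t))
        main≤ : ∣ main ∣ ℕ.≤ (p ℕ.* p) ℕ.* (X ℕ.* (2 ℕ.* y ℕ.* ∣ v ∣))
        main≤ = ℕₚ.≤-trans (ℕₚ.≤-reflexive (trans (abs-* (+ p * + p) (+ X * (Z * v))) (cong₂ ℕ._*_ (abs-* (+ p) (+ p)) (trans (abs-* (+ X) (Z * v)) (cong (X ℕ.*_) (abs-* Z v))))))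
          (ℕₚ.*-monoʳ-≤ (p ℕ.* p) (ℕₚ.*-monoʳ-≤ X (ℕₚ.*-monoˡ-≤ ∣ v ∣ ∣Z∣≤)))
        tail≤ : ∣ tail ∣ ℕ.≤ (A ℕ.* A) ℕ.* K
        tail≤ = ℕₚ.≤-trans (ℕₚ.≤-reflexive (trans (abs-* (+ A * + A) (+ p * + p * Z - + y * (+ t * + t))) (cong (ℕ._* ∣ + p * + p * Z - + y * (+ t * + t) ∣) (abs-* (+ A) (+ A)))))
          (ℕₚ.*-monoʳ-≤ (A ℕ.* A) tail-bound)
        ring₃ : ∀ P X v x A t y → (P * P) * (X * ((+ 4 * X + + 4 * v) * v)) + (X * x) * (P * P * (+ 4 * X + + 4 * v)) - (A * A) * (y * (t * t)) ≡ (+ 4 * X) * ((P * P) * ((X + v) * (x + v))) - y * ((A * A) * (t * t))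
        ring₃ = solve-∀
        ring₄ : ∀ M a P Z y t → M + a * (P * P * Z - y * (t * t)) ≡ M + a * (P * P * Z) - a * (y * (t * t))
        ring₄ = solve-∀
        ring₅ : ∀ Y P b A t → Y * ((P * P) * (b * b)) - Y * ((A * A) * (t * t)) ≡ Y * ((P * b - A * t) * (P * b + A * t))
        ring₅ = solve-∀
        A²ℤ : + A * + A ≡ + X * + x₂
        A²ℤ = trans (sym (pos-* A A)) (trans (cong +_ A²) (pos-* X x₂))
        Z≡' : Z ≡ + 4 * + X + + 4 * v
        Z≡' = trans Z≡ (cong (_+ + 4 * v) y≡)
        identity : main + tail ≡ + y * ((+ p * + b - + A * + t) * (+ p * + b + + A * + t))
        identity = trans (ring₄ main (+ A * + A) (+ p) Z (+ y) (+ t))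
          (trans (cong₂ (λ a z → (+ p * + p) * (+ X * (z * v)) + a * (+ p * + p * z) - (+ A * + A) * (+ y * (+ t * + t))) A²ℤ Z≡')
          (trans (ring₃ (+ p) (+ X) v (+ x₂) (+ A) (+ t) (+ y))
          (trans (cong₂ (λ y' w → y' * ((+ p * + p) * w) - + y * ((+ A * + A) * (+ t * + t))) (sym y≡) (sym b²))
          (ring₅ (+ y) (+ p) (+ b) (+ A) (+ t)))))
        sum≡ : + p * + b + + A * + t ≡ + (p ℕ.* b ℕ.+ A ℕ.* t)
        sum≡ = cong₂ _+_ (sym (pos-* p b)) (sym (pos-* A t))
        product : ∣ main + tail ∣ ≡ y ℕ.* (E ℕ.* (p ℕ.* b ℕ.+ A ℕ.* t))
        product = trans (cong ∣_∣ identity) (trans (abs-* (+ y) ((+ p * + b - + A * + t) * (+ p * + b + + A * + t))) (cong (y ℕ.*_) (trans (abs-* (+ p * + b - + A * + t) (+ p * + b + + A * + t)) (cong (λ s → E ℕ.* ∣ s ∣) sum≡))))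
        ring₁ : ∀ p E y b → p ℕ.* (E ℕ.* (y ℕ.* (2 ℕ.* b))) ≡ 2 ℕ.* (y ℕ.* (E ℕ.* (p ℕ.* b)))
        ring₁ = ℕsolve-∀

    abs-A4 : ∀ A w u → ∣ + A * (+ 4 * (w * u)) ∣ ≡ A ℕ.* (4 ℕ.* (∣ w ∣ ℕ.* ∣ u ∣))
    abs-A4 A w u = trans (abs-* (+ A) (+ 4 * (w * u))) (cong (A ℕ.*_) (trans (abs-* (+ 4) (w * u)) (cong (4 ℕ.*_) (abs-* w u))))

    G-ring : ∀ p X y N A n q → 2 ℕ.* ((p ℕ.* p) ℕ.* (X ℕ.* (2 ℕ.* y ℕ.* N)) ℕ.+ A ℕ.* (n ℕ.* (8 ℕ.* (q ℕ.* p)))) ≡ p ℕ.* (4 ℕ.* (y ℕ.* p ℕ.* (X ℕ.* N)) ℕ.+ 16 ℕ.* n ℕ.* (A ℕ.* q))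
    G-ring = ℕsolve-∀

  module Approximation (X x₂ A b : ℕ) (v : ℤ) (X≥ : 4 ℕ.* ∣ v ∣ ℕ.≤ X) (A² : A ℕ.* A ≡ X ℕ.* x₂)
           (b² : + b * + b ≡ (+ X + v) * (+ x₂ + v)) (A≤2b : A ℕ.≤ 2 ℕ.* b) where

    private
      y N q : ℕ
      y = 4 ℕ.* X
      N = ∣ v ∣
      q = 4 ℕ.* N

    open Taylor y v public

    Z : ℤ
    Z = Y + + 4 * v

    -- The error bound after multiplication by y A: the first summand is due to the factor 1 + v/x₂
    -- in b²/A², the second to truncating the series.
    G : ℕ → ℕ → ℕ
    G C n = 4 ℕ.* (y ℕ.^ suc n ℕ.* (X ℕ.* N)) ℕ.+ C ℕ.* ((A ℕ.* A) ℕ.* q ℕ.^ suc n)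

    private
      16N≤y : 16 ℕ.* N ℕ.≤ y
      16N≤y = ℕₚ.≤-trans (ℕₚ.≤-reflexive (ring N)) (ℕₚ.*-monoʳ-≤ 4 X≥)
        where
        ring : ∀ n → 16 ℕ.* n ≡ 4 ℕ.* (4 ℕ.* n)
        ring = ℕsolve-∀

      small : 8 ℕ.* N ℕ.≤ y
      small = ℕₚ.≤-trans (ℕₚ.*-monoˡ-≤ N (ℕₚ.m≤m+n 8 8)) 16N≤y

      ∣Z∣≤ : ∣ Z ∣ ℕ.≤ 2 ℕ.* y
      ∣Z∣≤ = begin
        ∣ Y + + 4 * v ∣          ≤⟨ ∣i+j∣≤∣i∣+∣j∣ Y (+ 4 * v) ⟩
        y ℕ.+ ∣ + 4 * v ∣        ≡⟨ cong (y ℕ.+_) (abs-* (+ 4) v) ⟩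
        y ℕ.+ 4 ℕ.* N            ≤⟨ ℕₚ.+-monoʳ-≤ y (ℕₚ.≤-trans (ℕₚ.*-monoˡ-≤ N (ℕₚ.m≤m+n 4 12)) 16N≤y) ⟩
        y ℕ.+ y                  ≡⟨ cong (y ℕ.+_) (sym (ℕₚ.+-identityʳ y)) ⟩
        2 ℕ.* y                  ∎
        where open ℕₚ.≤-Reasoning

      pos-^ : ∀ m n → (+ m) ^ n ≡ + (m ℕ.^ n)
      pos-^ m zero    = refl
      pos-^ m (suc n) = trans (cong (+ m *_) (pos-^ m n)) (sym (pos-* m (m ℕ.^ n)))

      near⇒pos : ∀ a t → ∣ + a - t ∣ ℕ.≤ a → ∃ λ t' → t ≡ + t'
      near⇒pos a (+ t') _ = t' , refl
      near⇒pos zero -[1+ n ] ()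
      near⇒pos (suc a) -[1+ n ] p = contradiction p
        where
        contradiction : suc (a ℕ.+ suc n) ℕ.≤ suc a → ∃ λ t' → -[1+ n ] ≡ + t'
        contradiction p with ℕₚ.<⇒≱ (ℕₚ.m<m+n (suc a) {suc n} (ℕ.s≤s ℕ.z≤n)) p
        ... | ()

    module _ (X>0 : 0 ℕ.< X) where
      private
        instance
          y≢0 : ℕ.NonZero y
          y≢0 = ℕ.>-nonZero (ℕₚ.*-mono-< {0} {4} (ℕ.s≤s ℕ.z≤n) X>0)

        -- Nonnegativity keeps p b + A t from cancelling in `sqrt-error`.
        τ≥0 : ∀ n → ∃ λ t → τ 1 n ≡ + t
        τ≥0 n = near⇒pos (y ℕ.^ n) (τ 1 n) (ℕₚ.*-cancelˡ-≤ y (begin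
          y ℕ.* ∣ + (y ℕ.^ n) - τ 1 n ∣     ≡⟨ cong (λ p → y ℕ.* ∣ p - τ 1 n ∣) (sym (pos-^ y n)) ⟩
          y ℕ.* ∣ Y ^ n - τ 1 n ∣           ≤⟨ τ-near small n ⟩
          4 ℕ.* (q ℕ.* y ℕ.^ n)             ≡⟨ ring N (y ℕ.^ n) ⟩
          16 ℕ.* N ℕ.* y ℕ.^ n              ≤⟨ ℕₚ.*-monoˡ-≤ (y ℕ.^ n) 16N≤y ⟩
          y ℕ.* y ℕ.^ n                     ∎))
          where
          open ℕₚ.≤-Reasoning
          ring : ∀ n p → 4 ℕ.* (4 ℕ.* n ℕ.* p) ≡ 16 ℕ.* n ℕ.* p
          ring = ℕsolve-∀

      -- The error of b / A as an approximation to √(1 + v / X), against its Taylor polynomial.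
      ε : ℕ → ℕ → ℤ
      ε r e = Y ^ e * (Z ^ r * + b) - + A * τ (suc r) (r ℕ.+ e)

      ε₀-bound : ∀ m → ∣ Y ^ suc m * + b - + A * τ 1 (suc m) ∣ ℕ.* (y ℕ.* A) ℕ.≤ G (16 ℕ.* suc (suc m)) (suc m)
      ε₀-bound m = cancel (suc m) (proj₁ (τ≥0 (suc m))) (proj₂ (τ≥0 (suc m)))
        (ℕₚ.≤-trans (ℕₚ.≤-reflexive (cong (λ u → ∣ u - Y * (τ 1 (suc m) * τ 1 (suc m)) ∣) (ring Y (Y ^ m) Z))) (τ²-bound small m))
        where
        ring : ∀ Y p Z → (Y * p) * (Y * p) * Z ≡ Y * ((Y * p) * (p * Z))
        ring = solve-∀
        cancel : ∀ n t → τ 1 n ≡ + t → ∣ Y ^ n * Y ^ n * Z - Y * (τ 1 n * τ 1 n) ∣ ℕ.≤ suc n ℕ.* (8 ℕ.* (q ℕ.^ suc n ℕ.* y ℕ.^ n)) →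
          ∣ Y ^ n * + b - + A * τ 1 n ∣ ℕ.* (y ℕ.* A) ℕ.≤ G (16 ℕ.* suc n) n
        cancel n t τ≡ h = ℕₚ.*-cancelˡ-≤ (y ℕ.^ n) {{ℕₚ.m^n≢0 y n}} (ℕₚ.≤-trans
          (subst₂ (λ T P → y ℕ.^ n ℕ.* (∣ P * + b - + A * T ∣ ℕ.* (y ℕ.* A)) ℕ.≤ 2 ℕ.* ((y ℕ.^ n ℕ.* y ℕ.^ n) ℕ.* (X ℕ.* (2 ℕ.* y ℕ.* N)) ℕ.+ (A ℕ.* A) ℕ.* (suc n ℕ.* (8 ℕ.* (q ℕ.^ suc n ℕ.* y ℕ.^ n)))))
            (sym τ≡) (sym (pos-^ y n))
            (sqrt-error X x₂ A b t (y ℕ.^ n) y v Z _ (pos-* 4 X) refl ∣Z∣≤ A² b² A≤2b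
              (subst₂ (λ T P → ∣ P * P * Z - Y * (T * T) ∣ ℕ.≤ suc n ℕ.* (8 ℕ.* (q ℕ.^ suc n ℕ.* y ℕ.^ n))) τ≡ (pos-^ y n) h)))
          (ℕₚ.≤-reflexive (G-ring (y ℕ.^ n) X y N (A ℕ.* A) (suc n) (q ℕ.^ suc n))))

      ε-suc : ∀ r e → Y * ε (suc r) e ≡ Z * ε r (suc e) + + A * (+ 4 * (B (suc r) (r ℕ.+ suc e) * v ^ suc (r ℕ.+ suc e)))
      ε-suc r e rewrite ℕₚ.+-suc r e = trans (ring₁ Y (Y ^ e) (Z * Z ^ r) (+ b) (+ A) (τ (suc (suc r)) n))
        (trans (cong (λ u → Y * (Y ^ e * ((Z * Z ^ r) * + b)) - + A * u) τ-eq) (ring₂ Y (Y ^ e) Z (Z ^ r) (+ b) (+ A) (τ (suc r) n) _))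
        where
        n = suc (r ℕ.+ e)
        τ-eq : Y * τ (suc (suc r)) n ≡ Z * τ (suc r) n - + 4 * (B (suc r) n * v ^ suc n)
        τ-eq = trans (ring (Y * τ (suc (suc r)) n) (+ 4 * (B (suc r) n * v ^ suc n))) (cong (_- + 4 * (B (suc r) n * v ^ suc n)) (sym (τ-pascal (suc r) n)))
          where
          ring : ∀ a b → a ≡ a + b - b
          ring = solve-∀
        ring₁ : ∀ Y p z b A t → Y * (p * (z * b) - A * t) ≡ Y * (p * (z * b)) - A * (Y * t)
        ring₁ = solve-∀
        ring₂ : ∀ Y p Z z b A t u → Y * (p * ((Z * z) * b)) - A * (Z * t - u) ≡ Z * ((Y * p) * (z * b) - A * t) + A * u
        ring₂ = solve-∀

      -- A further power of Z costs a factor |Z|/y ≤ 2 and the overflow term of `τ-pascal`, which C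
      -- ≥ 2^r bounds by G. The summand G on the left absorbs it, so the bound just doubles.
      ε-bound : ∀ C r e n → r ℕ.+ e ≡ suc n → 16 ℕ.* suc (suc n) ℕ.≤ C → 2 ℕ.^ r ℕ.≤ C →
        ∣ ε r e ∣ ℕ.* (y ℕ.* A) ℕ.+ G C (suc n) ℕ.≤ 2 ℕ.^ suc r ℕ.* G C (suc n)
      ε-bound C zero .(suc m) m refl C≥ _ = begin
        ∣ ε 0 (suc m) ∣ ℕ.* (y ℕ.* A) ℕ.+ G C (suc m)                              ≡⟨ cong (λ u → ∣ u ∣ ℕ.* (y ℕ.* A) ℕ.+ G C (suc m)) (ring (Y ^ suc m) (+ b) (+ A * τ 1 (suc m))) ⟩
        ∣ Y ^ suc m * + b - + A * τ 1 (suc m) ∣ ℕ.* (y ℕ.* A) ℕ.+ G C (suc m)      ≤⟨ ℕₚ.+-monoˡ-≤ (G C (suc m)) (ℕₚ.≤-trans (ε₀-bound m) (ℕₚ.+-monoʳ-≤ (4 ℕ.* (y ℕ.^ suc (suc m) ℕ.* (X ℕ.* N))) (ℕₚ.*-monoˡ-≤ ((A ℕ.* A) ℕ.* q ℕ.^ suc (suc m)) C≥))) ⟩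
        G C (suc m) ℕ.+ G C (suc m)                                                ≡⟨ cong (G C (suc m) ℕ.+_) (sym (ℕₚ.+-identityʳ (G C (suc m)))) ⟩
        2 ℕ.* G C (suc m)                                                          ∎
        where
        open ℕₚ.≤-Reasoning
        ring : ∀ p b t → p * (1ℤ * b) - t ≡ p * b - t
        ring = solve-∀
      ε-bound C (suc r) e n eq C≥ C≥₂ = begin
        ∣ ε (suc r) e ∣ ℕ.* (y ℕ.* A) ℕ.+ g                      ≤⟨ ℕₚ.+-monoˡ-≤ g step ⟩
        2 ℕ.* (∣ ε r (suc e) ∣ ℕ.* (y ℕ.* A)) ℕ.+ g ℕ.+ g        ≡⟨ ring₁ (∣ ε r (suc e) ∣ ℕ.* (y ℕ.* A)) g ⟩
        2 ℕ.* (∣ ε r (suc e) ∣ ℕ.* (y ℕ.* A) ℕ.+ g)              ≤⟨ ℕₚ.*-monoʳ-≤ 2 (ε-bound C r (suc e) n eq' C≥ (ℕₚ.≤-trans (ℕₚ.m≤n*m (2 ℕ.^ r) 2) C≥₂)) ⟩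
        2 ℕ.* (2 ℕ.^ suc r ℕ.* g)                                ≡⟨ sym (ℕₚ.*-assoc 2 (2 ℕ.^ suc r) g) ⟩
        2 ℕ.^ suc (suc r) ℕ.* g                                  ∎
        where
        open ℕₚ.≤-Reasoning
        g = G C (suc n)
        eq' : r ℕ.+ suc e ≡ suc n
        eq' = trans (ℕₚ.+-suc r e) eq
        Q = q ℕ.^ suc (suc n)
        inhom : ∣ + A * (+ 4 * (B (suc r) (r ℕ.+ suc e) * v ^ suc (r ℕ.+ suc e))) ∣ ℕ.≤ A ℕ.* (2 ℕ.^ suc r ℕ.* Q)
        inhom rewrite eq' = begin
          ∣ + A * (+ 4 * (B (suc r) (suc n) * v ^ suc (suc n))) ∣          ≡⟨ trans (abs-A4 A (B (suc r) (suc n)) (v ^ suc (suc n))) (cong (λ u → A ℕ.* (4 ℕ.* (∣ B (suc r) (suc n) ∣ ℕ.* u))) (abs-^ v (suc (suc n)))) ⟩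
          A ℕ.* (4 ℕ.* (∣ B (suc r) (suc n) ∣ ℕ.* N ℕ.^ suc (suc n)))      ≤⟨ ℕₚ.*-monoʳ-≤ A (ℕₚ.*-monoʳ-≤ 4 (ℕₚ.*-monoˡ-≤ (N ℕ.^ suc (suc n)) (B-bound (suc r) (suc n)))) ⟩
          A ℕ.* (4 ℕ.* (2 ℕ.^ suc r ℕ.* 4 ℕ.^ suc n ℕ.* N ℕ.^ suc (suc n))) ≡⟨ ring (A) (2 ℕ.^ suc r) (4 ℕ.^ suc n) (N ℕ.^ suc (suc n)) ⟩
          A ℕ.* (2 ℕ.^ suc r ℕ.* (4 ℕ.^ suc (suc n) ℕ.* N ℕ.^ suc (suc n))) ≡⟨ cong (λ u → A ℕ.* (2 ℕ.^ suc r ℕ.* u)) (sym (^-distribʳ-* 4 N (suc (suc n)))) ⟩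
          A ℕ.* (2 ℕ.^ suc r ℕ.* Q)                                        ∎
          where
          ring : ∀ A p r s → A ℕ.* (4 ℕ.* (p ℕ.* r ℕ.* s)) ≡ A ℕ.* (p ℕ.* (4 ℕ.* r ℕ.* s))
          ring = ℕsolve-∀
        raw : y ℕ.* ∣ ε (suc r) e ∣ ℕ.≤ 2 ℕ.* y ℕ.* ∣ ε r (suc e) ∣ ℕ.+ A ℕ.* (2 ℕ.^ suc r ℕ.* Q)
        raw = begin
          y ℕ.* ∣ ε (suc r) e ∣                                            ≡⟨ sym (abs-* Y (ε (suc r) e)) ⟩
          ∣ Y * ε (suc r) e ∣                                              ≡⟨ cong ∣_∣ (ε-suc r e) ⟩
          ∣ Z * ε r (suc e) + + A * (+ 4 * (B (suc r) (r ℕ.+ suc e) * v ^ suc (r ℕ.+ suc e))) ∣ ≤⟨ ∣i+j∣≤∣i∣+∣j∣ (Z * ε r (suc e)) _ ⟩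
          ∣ Z * ε r (suc e) ∣ ℕ.+ ∣ + A * (+ 4 * (B (suc r) (r ℕ.+ suc e) * v ^ suc (r ℕ.+ suc e))) ∣ ≤⟨ ℕₚ.+-mono-≤ (ℕₚ.≤-trans (ℕₚ.≤-reflexive (abs-* Z (ε r (suc e)))) (ℕₚ.*-monoˡ-≤ ∣ ε r (suc e) ∣ ∣Z∣≤)) inhom ⟩
          2 ℕ.* y ℕ.* ∣ ε r (suc e) ∣ ℕ.+ A ℕ.* (2 ℕ.^ suc r ℕ.* Q)        ∎
        ring₁ : ∀ a g → 2 ℕ.* a ℕ.+ g ℕ.+ g ≡ 2 ℕ.* (a ℕ.+ g)
        ring₁ = ℕsolve-∀
        ring₂ : ∀ a y A → a ℕ.* (y ℕ.* A) ≡ A ℕ.* (y ℕ.* a)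
        ring₂ = ℕsolve-∀
        ring₃ : ∀ A y a p Q → A ℕ.* (2 ℕ.* y ℕ.* a ℕ.+ A ℕ.* (p ℕ.* Q)) ≡ 2 ℕ.* (a ℕ.* (y ℕ.* A)) ℕ.+ p ℕ.* ((A ℕ.* A) ℕ.* Q)
        ring₃ = ℕsolve-∀
        step : ∣ ε (suc r) e ∣ ℕ.* (y ℕ.* A) ℕ.≤ 2 ℕ.* (∣ ε r (suc e) ∣ ℕ.* (y ℕ.* A)) ℕ.+ g
        step = begin
          ∣ ε (suc r) e ∣ ℕ.* (y ℕ.* A)                                                    ≡⟨ ring₂ ∣ ε (suc r) e ∣ y A ⟩
          A ℕ.* (y ℕ.* ∣ ε (suc r) e ∣)                                                    ≤⟨ ℕₚ.*-monoʳ-≤ A raw ⟩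
          A ℕ.* (2 ℕ.* y ℕ.* ∣ ε r (suc e) ∣ ℕ.+ A ℕ.* (2 ℕ.^ suc r ℕ.* Q))                ≡⟨ ring₃ A y ∣ ε r (suc e) ∣ (2 ℕ.^ suc r) Q ⟩
          2 ℕ.* (∣ ε r (suc e) ∣ ℕ.* (y ℕ.* A)) ℕ.+ 2 ℕ.^ suc r ℕ.* ((A ℕ.* A) ℕ.* Q)      ≤⟨ ℕₚ.+-monoʳ-≤ (2 ℕ.* (∣ ε r (suc e) ∣ ℕ.* (y ℕ.* A))) (ℕₚ.≤-trans (ℕₚ.*-monoˡ-≤ ((A ℕ.* A) ℕ.* Q) C≥₂) (ℕₚ.m≤n+m _ (4 ℕ.* (y ℕ.^ suc (suc n) ℕ.* (X ℕ.* N))))) ⟩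
          2 ℕ.* (∣ ε r (suc e) ∣ ℕ.* (y ℕ.* A)) ℕ.+ g                                      ∎

-- Small integral linear forms in A, b and c

module Rickert where

  open DividedDifferences
  open Contiguity
  open HalfBinomial
  open SquareRoot
  open Node
  open import Data.Nat as ℕ using (ℕ; zero; suc)
  import Data.Nat.Properties as ℕₚ
  open import Data.Nat.Tactic.RingSolver using () renaming (solve-∀ to ℕsolve-∀)
  open import Data.Integer using (ℤ; +_; -[1+_]; 0ℤ; 1ℤ; -1ℤ; _+_; _*_; _-_; -_; ∣_∣; _^_)
  open import Data.Integer.Properties
  open import Data.Integer.Tactic.RingSolver using (solve-∀)
  open import Data.Product using (_,_)
  open import Data.Empty using (⊥; ⊥-elim)
  open import Relation.Binary.PropositionalEquality
  open import Relation.Nullary using (¬_)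

  private
    <⇒≡0 : ∀ W z {U} → W ℕ.* ∣ z ∣ ℕ.≤ U → U ℕ.< W → z ≡ 0ℤ
    <⇒≡0 W (+ zero)  _ _ = refl
    <⇒≡0 W (+ suc n) h small = ⊥-elim (ℕₚ.<⇒≱ small (ℕₚ.≤-trans (ℕₚ.m≤m*n W (suc n)) h))
    <⇒≡0 W -[1+ n ]  h small = ⊥-elim (ℕₚ.<⇒≱ small (ℕₚ.≤-trans (ℕₚ.m≤m*n W (suc n)) h))

  module TaylorJets (y : ℕ) (N : ℤ) (K : ℕ) where
    private
      Y : ℤ
      Y = + y

    -- Y^M times the Taylor polynomial in z of degree M of (1 + 4Nz/Y)^(K - 1/2). The inner minus
    -- sign compensates that of `_·_⊖_·_`.
    taylor : ℕ → Jets
    taylor zero    = one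
    taylor (suc M) = Y · taylor M ⊖ (- (B K (suc M) * N ^ suc M)) · zpow (suc M)

    dd-taylor : ∀ M b c a → M ℕ.+ 2 ℕ.≤ b ℕ.+ c ℕ.+ a → dd (taylor M) b c a ≡ 0ℤ
    dd-taylor zero b c a h = dd-one b c a h
    dd-taylor (suc M) b c a h = trans (dd-linear Y (taylor M) (- (B K (suc M) * N ^ suc M)) (zpow (suc M)) b c a)
      (trans (cong₂ (λ u w → Y * u - (- (B K (suc M) * N ^ suc M)) * w) (dd-taylor M b c a (ℕₚ.<⇒≤ h)) (dd-zpow (suc M) b c a h)) (ring Y (B K (suc M) * N ^ suc M)))
      where
      ring : ∀ Y c → Y * 0ℤ - (- c) * 0ℤ ≡ 0ℤ
      ring = solve-∀

    private
      flip-sign : ∀ x c z → x - (- c) * z ≡ x + c * z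
      flip-sign = solve-∀

    module At (ε : ℤ) (at : Jets → ℕ → ℤ) (at-one : ∀ i → at one i ≡ δ₀ i 2ℤ)
              (at-suc : ∀ M i → at (taylor (suc M)) i ≡ Y * at (taylor M) i - (- (B K (suc M) * N ^ suc M)) * at (zpow (suc M)) i)
              (above : ∀ h n → at (zpow h) (suc (h ℕ.+ n)) ≡ 0ℤ)
              (below : ∀ i n → at (zpow (i ℕ.+ n)) i ≡ 2ℤ ^ suc i * (+ bin i n * ε ^ n)) where

      open Taylor y (ε * N) using (τ)

      taylor-above : ∀ M n → at (taylor M) (suc (M ℕ.+ n)) ≡ 0ℤ
      taylor-above zero n = at-one (suc n)
      taylor-above (suc M) n = trans (at-suc M (suc (suc M ℕ.+ n))) (trans (cong₂ (λ u w → Y * u - (- (B K (suc M) * N ^ suc M)) * w) (trans (cong (λ m → at (taylor M) (suc m)) (sym (ℕₚ.+-suc M n))) (taylor-above M (suc n))) (above (suc M) n)) (ring Y (B K (suc M) * N ^ suc M)))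
        where
        ring : ∀ Y c → Y * 0ℤ - (- c) * 0ℤ ≡ 0ℤ
        ring = solve-∀

      private
        ^-distribʳ : ∀ x y n → (x * y) ^ n ≡ x ^ n * y ^ n
        ^-distribʳ x y zero = refl
        ^-distribʳ x y (suc n) = trans (cong (x * y *_) (^-distribʳ x y n)) (ring x y (x ^ n) (y ^ n))
          where
          ring : ∀ x y p q → x * y * (p * q) ≡ x * p * (y * q)
          ring = solve-∀

        coefficient : ∀ K' i n → K' ℕ.+ i ≡ K → (B K (i ℕ.+ n) * N ^ (i ℕ.+ n)) * at (zpow (i ℕ.+ n)) i ≡ 2ℤ ^ suc i * (B K i * (N ^ i * (B K' n * (ε * N) ^ n)))
        coefficient K' i n refl = begin
          (B K (i ℕ.+ n) * N ^ (i ℕ.+ n)) * at (zpow (i ℕ.+ n)) i                              ≡⟨ cong₂ (λ p w → (B K (i ℕ.+ n) * p) * w) (^-distribˡ-+-* N i n) (below i n) ⟩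
          (B K (i ℕ.+ n) * (N ^ i * N ^ n)) * (2ℤ ^ suc i * (+ bin i n * ε ^ n))               ≡⟨ ring₁ (B K (i ℕ.+ n)) (N ^ i) (N ^ n) (2ℤ ^ suc i) (+ bin i n) (ε ^ n) ⟩
          2ℤ ^ suc i * (N ^ i * ((B K (i ℕ.+ n) * + bin i n) * (ε ^ n * N ^ n)))               ≡⟨ cong₂ (λ b w → 2ℤ ^ suc i * (N ^ i * (b * w))) (B-split K' i n) (sym (^-distribʳ ε N n)) ⟩
          2ℤ ^ suc i * (N ^ i * ((B K i * B K' n) * (ε * N) ^ n))                              ≡⟨ ring₂ (2ℤ ^ suc i) (N ^ i) (B K i) (B K' n) ((ε * N) ^ n) ⟩
          2ℤ ^ suc i * (B K i * (N ^ i * (B K' n * (ε * N) ^ n)))                              ∎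
          where
          open ≡-Reasoning
          ring₁ : ∀ b p q s c e → (b * (p * q)) * (s * (c * e)) ≡ s * (p * ((b * c) * (e * q)))
          ring₁ = solve-∀
          ring₂ : ∀ s p b b' w → s * (p * ((b * b') * w)) ≡ s * (b * (p * (b' * w)))
          ring₂ = solve-∀

      -- Differentiating i times commutes with truncation; it lowers the degree to n and the
      -- exponent to K' - 1/2 with K' = K - i. So the coefficient at the node is a multiple of a
      -- `τ`.
      taylor-at : ∀ K' i n → K' ℕ.+ i ≡ K → at (taylor (i ℕ.+ n)) i ≡ 2ℤ ^ suc i * (B K i * (N ^ i * τ K' n))
      taylor-at K' zero zero refl = trans (at-one 0) (sym (cong (λ b → 2ℤ * 1ℤ * (b * (1ℤ * 1ℤ))) (B₀ K)))
      taylor-at K' (suc i) zero e = trans (at-suc (i ℕ.+ 0) (suc i)) (trans (flip-sign (Y * at (taylor (i ℕ.+ 0)) (suc i)) (B K (suc (i ℕ.+ 0)) * N ^ suc (i ℕ.+ 0)) (at (zpow (suc (i ℕ.+ 0))) (suc i)))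
        (trans (cong₂ (λ u w → Y * u + w) zero-above (coefficient K' (suc i) 0 e)) (trans (cong (λ b → Y * 0ℤ + 2ℤ ^ suc (suc i) * (B K (suc i) * (N ^ suc i * (b * 1ℤ)))) (B₀ K')) (ring Y (2ℤ ^ suc (suc i)) (B K (suc i)) (N ^ suc i)))))
        where
        zero-above : at (taylor (i ℕ.+ 0)) (suc i) ≡ 0ℤ
        zero-above = trans (cong (λ m → at (taylor (i ℕ.+ 0)) (suc m)) (sym (trans (cong (ℕ._+ 0) (ℕₚ.+-identityʳ i)) (ℕₚ.+-identityʳ i)))) (taylor-above (i ℕ.+ 0) 0)
        ring : ∀ Y s b p → Y * 0ℤ + s * (b * (p * (1ℤ * 1ℤ))) ≡ s * (b * (p * 1ℤ))
        ring = solve-∀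
      taylor-at K' i (suc n) e = trans (cong (λ m → at (taylor m) i) (ℕₚ.+-suc i n)) (trans (at-suc (i ℕ.+ n) i) (trans (flip-sign (Y * at (taylor (i ℕ.+ n)) i) (B K (suc (i ℕ.+ n)) * N ^ suc (i ℕ.+ n)) (at (zpow (suc (i ℕ.+ n))) i))
        (trans (cong₂ (λ u w → Y * u + w) (taylor-at K' i n e) coef) (ring Y (2ℤ ^ suc i) (B K i) (N ^ i) (τ K' n) (B K' (suc n) * (ε * N) ^ suc n)))))
        where
        coef : (B K (suc (i ℕ.+ n)) * N ^ suc (i ℕ.+ n)) * at (zpow (suc (i ℕ.+ n))) i ≡ 2ℤ ^ suc i * (B K i * (N ^ i * (B K' (suc n) * (ε * N) ^ suc n)))
        coef = trans (cong (λ m → (B K m * N ^ m) * at (zpow m) i) (sym (ℕₚ.+-suc i n))) (coefficient K' i (suc n) e)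
        ring : ∀ Y s b p t w → Y * (s * (b * (p * t))) + s * (b * (p * w)) ≡ s * (b * (p * (Y * t + w)))
        ring = solve-∀

    module At₋ = At -1ℤ at₋ (λ _ → refl) (λ _ _ → refl) Powers₋.above Powers₋.below
    module At₊ = At 1ℤ at₊ (λ _ → refl) (λ _ _ → refl) Powers₊.above Powers₊.below

    taylor-above₀ : ∀ M n → at₀ (taylor M) (suc (M ℕ.+ n)) ≡ 0ℤ
    taylor-above₀ zero n = refl
    taylor-above₀ (suc M) n = trans (cong₂ (λ u w → Y * u - (- (B K (suc M) * N ^ suc M)) * w) (trans (cong (λ m → at₀ (taylor M) (suc m)) (sym (ℕₚ.+-suc M n))) (taylor-above₀ M (suc n))) (at₀-zpow-above M n)) (ring Y (B K (suc M) * N ^ suc M))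
      where
      ring : ∀ Y c → Y * 0ℤ - (- c) * 0ℤ ≡ 0ℤ
      ring = solve-∀

    taylor-at₀ : ∀ i n → at₀ (taylor (i ℕ.+ n)) i ≡ B K i * (N ^ i * Y ^ n)
    taylor-at₀ zero zero = sym (cong (_* 1ℤ) (B₀ K))
    taylor-at₀ (suc i) zero = trans (cong₂ (λ u w → Y * u - (- (B K (suc (i ℕ.+ 0)) * N ^ suc (i ℕ.+ 0))) * w) zero-above (at₀-zpow i 0))
        (trans (cong (λ m → Y * 0ℤ - (- (B K (suc m) * N ^ suc m)) * 1ℤ) (ℕₚ.+-identityʳ i)) (ring Y (B K (suc i)) (N ^ suc i)))
      where
      zero-above : at₀ (taylor (i ℕ.+ 0)) (suc i) ≡ 0ℤ
      zero-above = trans (cong (λ m → at₀ (taylor (i ℕ.+ 0)) (suc m)) (sym (trans (cong (ℕ._+ 0) (ℕₚ.+-identityʳ i)) (ℕₚ.+-identityʳ i)))) (taylor-above₀ (i ℕ.+ 0) 0)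
      ring : ∀ Y b p → Y * 0ℤ - (- (b * p)) * 1ℤ ≡ b * (p * 1ℤ)
      ring = solve-∀
    taylor-at₀ i (suc n) = trans (cong (λ m → at₀ (taylor m) i) (ℕₚ.+-suc i n))
        (trans (cong₂ (λ u w → Y * u - (- (B K (suc (i ℕ.+ n)) * N ^ suc (i ℕ.+ n))) * w) (taylor-at₀ i n) (trans (cong (λ m → at₀ (zpow m) i) (sym (ℕₚ.+-suc i n))) (at₀-zpow i (suc n))))
        (ring Y (B K i) (N ^ i) (Y ^ n) (B K (suc (i ℕ.+ n)) * N ^ suc (i ℕ.+ n))))
      where
      ring : ∀ Y b p q c → Y * (b * (p * q)) - (- c) * 0ℤ ≡ b * (p * (Y * q))
      ring = solve-∀

  module Forms (X x₂ A b c N' : ℕ) (X>0 : 0 ℕ.< X) (A>0 : 0 ℕ.< A) (X≥ : 4 ℕ.* suc N' ℕ.≤ X) (A² : A ℕ.* A ≡ X ℕ.* x₂)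
               (b² : + b * + b ≡ (+ X + -[1+ N' ]) * (+ x₂ + -[1+ N' ])) (c² : + c * + c ≡ (+ X + + suc N') * (+ x₂ + + suc N'))
               (A≤2b : A ℕ.≤ 2 ℕ.* b) (A≤2c : A ℕ.≤ 2 ℕ.* c) (k : ℕ) where

    private
      y q K : ℕ
      y = 4 ℕ.* X
      q = 4 ℕ.* suc N'
      K = suc k
      N Y : ℤ
      N = + suc N'
      Y = + y

      module N₋ = Approximation X x₂ A b -[1+ N' ] X≥ A² b² A≤2b
      module N₊ = Approximation X x₂ A c (+ suc N') X≥ A² c² A≤2c

      fₛ : ℤ → ℕ → ℕ → ℤ
      fₛ Z b i = 2ℤ ^ suc i * (B K i * (N ^ i * (Z ^ (k ℕ.∸ i) * + b)))

    -- The jets of A Y^k (1 + 4Nz/Y)^(k + 1/2) with the square roots at -1 and 1 replaced by b/A and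
    -- c/A, so that all entries are integers. At each node this is a constant factor, and the Taylor
    -- recursion stays exact.
    forms : Jets
    forms = jets (fₛ N₋.Z b) (λ i → B K i * (N ^ i * (Y ^ (k ℕ.∸ i) * + A))) (fₛ N₊.Z c)

    private
      κ : ℤ
      κ = 2ℤ * + k + + 3

      ∸-step : ∀ {i} → i ℕ.< k → k ℕ.∸ i ≡ suc (k ℕ.∸ suc i)
      ∸-step {i} i<k = ℕₚ.+-∸-assoc 1 i<k

      stepₛ : ∀ z Z b → Z ≡ 2ℤ * z → ∀ i → i ℕ.< k → (+ suc i) * (z * fₛ Z b (suc i)) ≡ (2ℤ * N) * ((κ - 2ℤ * (+ suc i)) * fₛ Z b i)
      stepₛ z Z b Z≡ i i<k rewrite ∸-step i<k = begin
        (+ suc i) * (z * ((2ℤ * 2ℤ ^ suc i) * (B K (suc i) * ((N * N ^ i) * (w * + b)))))     ≡⟨ ring₁ (+ suc i) z (2ℤ ^ suc i) (B K (suc i)) N (N ^ i) w (+ b) ⟩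
        (+ suc i * B K (suc i)) * (2ℤ ^ suc i * ((2ℤ * z) * (N * (N ^ i * (w * + b)))))       ≡⟨ cong₂ (λ u Z' → u * (2ℤ ^ suc i * (Z' * (N * (N ^ i * (w * + b)))))) (B-suc K i) (sym Z≡) ⟩
        (2ℤ * (2ℤ * (1ℤ + + k) - 1ℤ - 2ℤ * + i)) * B K i * (2ℤ ^ suc i * (Z * (N * (N ^ i * (w * + b))))) ≡⟨ ring₂ (+ k) (+ i) (B K i) (2ℤ ^ suc i) Z N (N ^ i) w (+ b) ⟩
        (2ℤ * N) * ((2ℤ * + k + + 3 - 2ℤ * (1ℤ + + i)) * (2ℤ ^ suc i * (B K i * (N ^ i * ((Z * w) * + b))))) ∎
        where
        open ≡-Reasoning
        w = Z ^ (k ℕ.∸ suc i)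
        ring₁ : ∀ i z s u N n w b → i * (z * ((2ℤ * s) * (u * ((N * n) * (w * b))))) ≡ (i * u) * (s * ((2ℤ * z) * (N * (n * (w * b)))))
        ring₁ = solve-∀
        ring₂ : ∀ k i u s Z N n w b → (2ℤ * (2ℤ * (1ℤ + k) - 1ℤ - 2ℤ * i)) * u * (s * (Z * (N * (n * (w * b))))) ≡ (2ℤ * N) * ((2ℤ * k + + 3 - 2ℤ * (1ℤ + i)) * (s * (u * (n * ((Z * w) * b)))))
        ring₂ = solve-∀

      Y≡ : Y ≡ + 4 * + X
      Y≡ = pos-* 4 X

      step₀' : ∀ i → i ℕ.< k → (+ suc i) * ((2ℤ * (2ℤ * + X)) * at₀ forms (suc i)) ≡ (2ℤ * N) * ((κ - 2ℤ * (+ suc i)) * at₀ forms i)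
      step₀' i i<k rewrite ∸-step i<k = begin
        (+ suc i) * ((2ℤ * (2ℤ * + X)) * (B K (suc i) * ((N * N ^ i) * (w * + A))))           ≡⟨ ring₁ (+ suc i) (+ X) (B K (suc i)) N (N ^ i) w (+ A) ⟩
        (+ suc i * B K (suc i)) * ((+ 4 * + X) * (N * (N ^ i * (w * + A))))                   ≡⟨ cong₂ (λ u Z' → u * (Z' * (N * (N ^ i * (w * + A))))) (B-suc K i) (sym Y≡) ⟩
        (2ℤ * (2ℤ * (1ℤ + + k) - 1ℤ - 2ℤ * + i)) * B K i * (Y * (N * (N ^ i * (w * + A))))    ≡⟨ ring₂ (+ k) (+ i) (B K i) Y N (N ^ i) w (+ A) ⟩
        (2ℤ * N) * ((2ℤ * + k + + 3 - 2ℤ * (1ℤ + + i)) * (B K i * (N ^ i * ((Y * w) * + A)))) ∎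
        where
        open ≡-Reasoning
        w = Y ^ (k ℕ.∸ suc i)
        ring₁ : ∀ i X u N n w b → i * ((2ℤ * (2ℤ * X)) * (u * ((N * n) * (w * b)))) ≡ (i * u) * ((+ 4 * X) * (N * (n * (w * b))))
        ring₁ = solve-∀
        ring₂ : ∀ k i u Z N n w b → (2ℤ * (2ℤ * (1ℤ + k) - 1ℤ - 2ℤ * i)) * u * (Z * (N * (n * (w * b)))) ≡ (2ℤ * N) * ((2ℤ * k + + 3 - 2ℤ * (1ℤ + i)) * (u * (n * ((Z * w) * b))))
        ring₂ = solve-∀

      Z≡ : ∀ v → Y + + 4 * v ≡ 2ℤ * (2ℤ * (+ X + v))
      Z≡ v = trans (cong (_+ + 4 * v) Y≡) (ring (+ X) v)
        where
        ring : ∀ X v → + 4 * X + + 4 * v ≡ 2ℤ * (2ℤ * (X + v))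
        ring = solve-∀

      hypergeometric : Hypergeometric forms k (+ X) N κ
      hypergeometric = record
        { step₋ = stepₛ (2ℤ * (+ X - N)) N₋.Z b (Z≡ -[1+ N' ])
        ; step₀ = step₀'
        ; step₊ = stepₛ (2ℤ * (+ X + N)) N₊.Z c (Z≡ (+ suc N'))
        }

      κ-odd : ∀ m → κ - 2ℤ * m ≢ 0ℤ
      κ-odd m e = odd (+ k + 1ℤ - m) (trans (ring (+ k) m) e)
        where
        ring : ∀ k m → 2ℤ * (k + 1ℤ - m) + 1ℤ ≡ 2ℤ * k + + 3 - 2ℤ * m
        ring = solve-∀
        odd : ∀ z → 2ℤ * z + 1ℤ ≢ 0ℤ
        odd z e = ℕₚ.even≢odd ∣ z ∣ 0 (trans (sym (abs-* 2ℤ z)) (cong ∣_∣ (trans (ring' (2ℤ * z)) (cong (_- 1ℤ) e))))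
          where
          ring' : ∀ x → x ≡ x + 1ℤ - 1ℤ
          ring' = solve-∀

      Y^≢0 : ∀ n → Y ^ n ≢ 0ℤ
      Y^≢0 n e with i^n≡0⇒i≡0 Y n e
      ... | e' = ℕₚ.<⇒≢ (ℕₚ.*-mono-< {0} {4} (ℕ.s≤s ℕ.z≤n) X>0) (sym (+-injective e'))

      forms₀≢0 : at₀ forms 0 ≢ 0ℤ
      forms₀≢0 e rewrite B₀ k = case (i*j≡0⇒i≡0∨j≡0 (Y ^ k) (trans (ring (Y ^ k * + A)) e))
        where
        open import Data.Sum using (_⊎_; inj₁; inj₂)
        ring : ∀ x → x ≡ 1ℤ * (1ℤ * x)
        ring = solve-∀
        case : Y ^ k ≡ 0ℤ ⊎ + A ≡ 0ℤ → ⊥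
        case (inj₁ e) = Y^≢0 k e
        case (inj₂ e) = ℕₚ.<⇒≢ A>0 (sym (+-injective e))

    not-all-vanish : ¬ Vanishes hypergeometric k k k
    not-all-vanish = nonvanishing hypergeometric (λ ()) κ-odd forms₀≢0 k k k ℕₚ.≤-refl ℕₚ.≤-refl ℕₚ.≤-refl

    module _ (d' C : ℕ) (C≥ : 16 ℕ.* suc (k ℕ.+ suc d') ℕ.≤ C) (C≥₂ : 2 ℕ.^ k ℕ.≤ C) (M≤ : k ℕ.+ suc d' ℕ.+ 2 ℕ.≤ k ℕ.+ k ℕ.+ suc k) where
      private
        d M : ℕ
        d = suc d'
        M = k ℕ.+ d

      open TaylorJets y N K

      error : Jets
      error = (+ (y ℕ.* A) * Y ^ d) · forms ⊖ (+ (y ℕ.* A) * + A) · taylor M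

      private
        g : ℕ
        g = N₊.G C M

        -- One factor 2^K bounds the binomial coefficient `B K i`, the other comes from `ε-bound`.
        E : ℕ
        E = 2 ℕ.^ K ℕ.* (2 ℕ.^ K ℕ.* g)

        q≤y : q ℕ.≤ y
        q≤y = ℕₚ.*-monoʳ-≤ 4 (ℕₚ.≤-trans (ℕₚ.m≤n*m (suc N') 4) X≥)

        G-mono : ∀ i n → q ℕ.^ i ℕ.* N₊.G C n ℕ.≤ N₊.G C (i ℕ.+ n)
        G-mono i n = ℕₚ.≤-trans (ℕₚ.≤-reflexive (ring (q ℕ.^ i) (y ℕ.* y ℕ.^ n) (X ℕ.* suc N') C (A ℕ.* A) (q ℕ.* q ℕ.^ n)))
          (ℕₚ.+-mono-≤ (ℕₚ.*-monoʳ-≤ 4 (ℕₚ.*-monoˡ-≤ (X ℕ.* suc N') (ℕₚ.≤-trans (ℕₚ.*-monoˡ-≤ (y ℕ.^ suc n) (ℕₚ.^-monoˡ-≤ i q≤y)) (ℕₚ.≤-reflexive (shift y)))))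
            (ℕₚ.≤-reflexive (cong (λ u → C ℕ.* ((A ℕ.* A) ℕ.* u)) (shift q))))
          where
          shift : ∀ y → y ℕ.^ i ℕ.* y ℕ.^ suc n ≡ y ℕ.^ suc (i ℕ.+ n)
          shift y = trans (sym (ℕₚ.^-distribˡ-+-* y i (suc n))) (cong (y ℕ.^_) (ℕₚ.+-suc i n))
          ring : ∀ s p x C a r → s ℕ.* (4 ℕ.* (p ℕ.* x) ℕ.+ C ℕ.* (a ℕ.* r)) ≡ 4 ℕ.* (s ℕ.* p ℕ.* x) ℕ.+ C ℕ.* (a ℕ.* (s ℕ.* r))
          ring = ℕsolve-∀

        -- the error at a node, once the common factors have been pulled out of ε
        node : ∀ i r e → r ℕ.+ i ≡ k → ∣ e ∣ ℕ.* (y ℕ.* A) ℕ.≤ 2 ℕ.^ suc r ℕ.* N₊.G C (r ℕ.+ d) →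
          ∣ + (y ℕ.* A) * (2ℤ ^ suc i * ((B K i * N ^ i) * e)) ∣ ℕ.≤ 2 ℕ.^ suc i ℕ.* E
        node i r e refl h = begin
          ∣ + (y ℕ.* A) * (2ℤ ^ suc i * ((B K i * N ^ i) * e)) ∣                              ≡⟨ abs-product (y ℕ.* A) (2ℤ ^ suc i) (B K i) (N ^ i) e ⟩
          (y ℕ.* A) ℕ.* (∣ 2ℤ ^ suc i ∣ ℕ.* ((∣ B K i ∣ ℕ.* ∣ N ^ i ∣) ℕ.* ∣ e ∣))             ≡⟨ cong₂ (λ s t → (y ℕ.* A) ℕ.* (s ℕ.* ((∣ B K i ∣ ℕ.* t) ℕ.* ∣ e ∣))) (abs-^ 2ℤ (suc i)) (abs-^ N i) ⟩
          (y ℕ.* A) ℕ.* (2 ℕ.^ suc i ℕ.* ((∣ B K i ∣ ℕ.* suc N' ℕ.^ i) ℕ.* ∣ e ∣))             ≡⟨ ring₁ (y ℕ.* A) (2 ℕ.^ suc i) (∣ B K i ∣) (suc N' ℕ.^ i) ∣ e ∣ ⟩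
          2 ℕ.^ suc i ℕ.* (∣ B K i ∣ ℕ.* suc N' ℕ.^ i ℕ.* (∣ e ∣ ℕ.* (y ℕ.* A)))               ≤⟨ ℕₚ.*-monoʳ-≤ (2 ℕ.^ suc i) (ℕₚ.*-mono-≤ (ℕₚ.*-monoˡ-≤ (suc N' ℕ.^ i) (B-bound K i)) h) ⟩
          2 ℕ.^ suc i ℕ.* (2 ℕ.^ K ℕ.* 4 ℕ.^ i ℕ.* suc N' ℕ.^ i ℕ.* (2 ℕ.^ suc r ℕ.* N₊.G C (r ℕ.+ d))) ≡⟨ cong (2 ℕ.^ suc i ℕ.*_) (trans (ring₂ (2 ℕ.^ K) (4 ℕ.^ i) (suc N' ℕ.^ i) (2 ℕ.^ suc r) (N₊.G C (r ℕ.+ d))) (cong (λ s → 2 ℕ.^ K ℕ.* (2 ℕ.^ suc r ℕ.* (s ℕ.* N₊.G C (r ℕ.+ d)))) (sym (^-distribʳ-* 4 (suc N') i)))) ⟩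
          2 ℕ.^ suc i ℕ.* (2 ℕ.^ K ℕ.* (2 ℕ.^ suc r ℕ.* (q ℕ.^ i ℕ.* N₊.G C (r ℕ.+ d))))       ≤⟨ ℕₚ.*-monoʳ-≤ (2 ℕ.^ suc i) (ℕₚ.*-monoʳ-≤ (2 ℕ.^ K) (ℕₚ.*-mono-≤ (ℕₚ.^-monoʳ-≤ 2 (ℕ.s≤s (ℕₚ.m≤m+n r i))) (ℕₚ.≤-trans (G-mono i (r ℕ.+ d)) (ℕₚ.≤-reflexive (cong (N₊.G C) assoc))))) ⟩
          2 ℕ.^ suc i ℕ.* E                                                                   ∎
          where
          open ℕₚ.≤-Reasoning
          assoc : i ℕ.+ (r ℕ.+ d) ≡ r ℕ.+ i ℕ.+ d
          assoc = trans (sym (ℕₚ.+-assoc i r d)) (cong (ℕ._+ d) (ℕₚ.+-comm i r))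
          abs-product : ∀ a s b n e → ∣ + a * (s * ((b * n) * e)) ∣ ≡ a ℕ.* (∣ s ∣ ℕ.* ((∣ b ∣ ℕ.* ∣ n ∣) ℕ.* ∣ e ∣))
          abs-product a s b n e = trans (abs-* (+ a) (s * ((b * n) * e))) (cong (a ℕ.*_) (trans (abs-* s ((b * n) * e)) (cong (∣ s ∣ ℕ.*_) (trans (abs-* (b * n) e) (cong (ℕ._* ∣ e ∣) (abs-* b n))))))
          ring₁ : ∀ a s b n e → a ℕ.* (s ℕ.* ((b ℕ.* n) ℕ.* e)) ≡ s ℕ.* (b ℕ.* n ℕ.* (e ℕ.* a))
          ring₁ = ℕsolve-∀
          ring₂ : ∀ p f n s g → p ℕ.* f ℕ.* n ℕ.* (s ℕ.* g) ≡ p ℕ.* (s ℕ.* (f ℕ.* n ℕ.* g))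
          ring₂ = ℕsolve-∀

        factor : ∀ a Yd s b n z c A t → (a * Yd) * (s * (b * (n * (z * c)))) - (a * A) * (s * (b * (n * t))) ≡ a * (s * ((b * n) * (Yd * (z * c) - A * t)))
        factor = solve-∀

        M-split : ∀ i r → r ℕ.+ i ≡ k → M ≡ i ℕ.+ (r ℕ.+ d)
        M-split i r refl = trans (cong (ℕ._+ d) (ℕₚ.+-comm r i)) (ℕₚ.+-assoc i r d)

        n≤ : ∀ r i n → r ℕ.+ i ≡ k → r ℕ.+ d ≡ suc n → 16 ℕ.* suc (suc n) ℕ.≤ C
        n≤ r i n refl e = ℕₚ.≤-trans (ℕₚ.*-monoʳ-≤ 16 (ℕ.s≤s (subst (ℕ._≤ M) e (ℕₚ.+-monoˡ-≤ d (ℕₚ.m≤m+n r i))))) C≥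

        2^r≤C : ∀ r i → r ℕ.+ i ≡ k → 2 ℕ.^ r ℕ.≤ C
        2^r≤C r i refl = ℕₚ.≤-trans (ℕₚ.^-monoʳ-≤ 2 (ℕₚ.m≤m+n r i)) C≥₂

        bound₋ : ∀ i → i ℕ.≤ k → ∣ at₋ error i ∣ ℕ.≤ 2 ℕ.^ suc i ℕ.* E
        bound₋ i i≤k = subst (λ u → ∣ u ∣ ℕ.≤ 2 ℕ.^ suc i ℕ.* E) (sym eq)
          (node i r (N₋.ε X>0 r d) r+i (ℕₚ.≤-trans (ℕₚ.m≤m+n _ _) (subst (λ n → ∣ N₋.ε X>0 r d ∣ ℕ.* (y ℕ.* A) ℕ.+ N₋.G C n ℕ.≤ 2 ℕ.^ suc r ℕ.* N₋.G C n) (sym (ℕₚ.+-suc r d'))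
            (N₋.ε-bound X>0 C r d (r ℕ.+ d') (ℕₚ.+-suc r d') (n≤ r i (r ℕ.+ d') r+i (ℕₚ.+-suc r d')) (2^r≤C r i r+i)))))
          where
          r = k ℕ.∸ i
          r+i : r ℕ.+ i ≡ k
          r+i = ℕₚ.m∸n+n≡m i≤k
          eq : at₋ error i ≡ + (y ℕ.* A) * (2ℤ ^ suc i * ((B K i * N ^ i) * N₋.ε X>0 r d))
          eq = trans (cong (λ t → (+ (y ℕ.* A) * Y ^ d) * fₛ N₋.Z b i - (+ (y ℕ.* A) * + A) * t) (trans (cong (λ m → at₋ (taylor m) i) (M-split i r r+i)) (trans (At₋.taylor-at (suc r) i (r ℕ.+ d) (cong suc r+i)) (cong (λ v → 2ℤ ^ suc i * (B K i * (N ^ i * Taylor.τ y v (suc r) (r ℕ.+ d)))) (-1*i≡-i N)))))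
            (factor (+ (y ℕ.* A)) (Y ^ d) (2ℤ ^ suc i) (B K i) (N ^ i) (N₋.Z ^ r) (+ b) (+ A) (N₋.τ (suc r) (r ℕ.+ d)))

        bound₊ : ∀ i → i ℕ.≤ k → ∣ at₊ error i ∣ ℕ.≤ 2 ℕ.^ suc i ℕ.* E
        bound₊ i i≤k = subst (λ u → ∣ u ∣ ℕ.≤ 2 ℕ.^ suc i ℕ.* E) (sym eq)
          (node i r (N₊.ε X>0 r d) r+i (ℕₚ.≤-trans (ℕₚ.m≤m+n _ _) (subst (λ n → ∣ N₊.ε X>0 r d ∣ ℕ.* (y ℕ.* A) ℕ.+ N₊.G C n ℕ.≤ 2 ℕ.^ suc r ℕ.* N₊.G C n) (sym (ℕₚ.+-suc r d'))
            (N₊.ε-bound X>0 C r d (r ℕ.+ d') (ℕₚ.+-suc r d') (n≤ r i (r ℕ.+ d') r+i (ℕₚ.+-suc r d')) (2^r≤C r i r+i)))))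
          where
          r = k ℕ.∸ i
          r+i : r ℕ.+ i ≡ k
          r+i = ℕₚ.m∸n+n≡m i≤k
          eq : at₊ error i ≡ + (y ℕ.* A) * (2ℤ ^ suc i * ((B K i * N ^ i) * N₊.ε X>0 r d))
          eq = trans (cong (λ t → (+ (y ℕ.* A) * Y ^ d) * fₛ N₊.Z c i - (+ (y ℕ.* A) * + A) * t) (trans (cong (λ m → at₊ (taylor m) i) (M-split i r r+i)) (trans (At₊.taylor-at (suc r) i (r ℕ.+ d) (cong suc r+i)) (cong (λ v → 2ℤ ^ suc i * (B K i * (N ^ i * Taylor.τ y v (suc r) (r ℕ.+ d)))) (*-identityˡ N)))))
            (factor (+ (y ℕ.* A)) (Y ^ d) (2ℤ ^ suc i) (B K i) (N ^ i) (N₊.Z ^ r) (+ c) (+ A) (N₊.τ (suc r) (r ℕ.+ d)))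

        bound₀ : ∀ i → i ℕ.≤ k → ∣ at₀ error i ∣ ℕ.≤ E
        bound₀ i i≤k = subst (λ u → ∣ u ∣ ℕ.≤ E) (sym eq) ℕ.z≤n
          where
          r = k ℕ.∸ i
          r+i : r ℕ.+ i ≡ k
          r+i = ℕₚ.m∸n+n≡m i≤k
          ring : ∀ a Yd b n z A → (a * Yd) * (b * (n * (z * A))) - (a * A) * (b * (n * (z * Yd))) ≡ 0ℤ
          ring = solve-∀
          eq : at₀ error i ≡ 0ℤ
          eq = trans (cong (λ t → (+ (y ℕ.* A) * Y ^ d) * at₀ forms i - (+ (y ℕ.* A) * + A) * t) (trans (cong (λ m → at₀ (taylor m) i) (M-split i r r+i)) (trans (taylor-at₀ i (r ℕ.+ d)) (cong (λ p → B K i * (N ^ i * p)) (^-distribˡ-+-* Y r d)))))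
            (ring (+ (y ℕ.* A)) (Y ^ d) (B K i) (N ^ i) (Y ^ r) (+ A))

      -- With at least M + 2 nodes the Taylor polynomial is killed, so the form is the divided
      -- difference of `error`, up to scaling. The jets of `error` vanish at 0 and consist of node
      -- errors `ε` at -1 and 1.
      form-bound : ∀ b c a → b ℕ.≤ suc k → c ℕ.≤ suc k → a ℕ.≤ suc k → M ℕ.+ 2 ℕ.≤ b ℕ.+ c ℕ.+ a →
        (y ℕ.* A) ℕ.* y ℕ.^ d ℕ.* ∣ dd forms b c a ∣ ℕ.≤ 2 ℕ.^ (a ℕ.+ c) ℕ.* (2 ℕ.^ (a ℕ.+ b ℕ.+ c) ℕ.* E)
      form-bound b c a hb hc ha hM = subst (ℕ._≤ 2 ℕ.^ (a ℕ.+ c) ℕ.* (2 ℕ.^ (a ℕ.+ b ℕ.+ c) ℕ.* E)) eq (dd-bound error k E bound₋ bound₀ bound₊ b c a hb hc ha)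
        where
        ring : ∀ x u w → x * u - w * 0ℤ ≡ x * u
        ring = solve-∀
        eq : ∣ dd error b c a ∣ ≡ (y ℕ.* A) ℕ.* y ℕ.^ d ℕ.* ∣ dd forms b c a ∣
        eq = trans (cong ∣_∣ (trans (dd-linear (+ (y ℕ.* A) * Y ^ d) forms (+ (y ℕ.* A) * + A) (taylor M) b c a)
               (trans (cong (λ t → (+ (y ℕ.* A) * Y ^ d) * dd forms b c a - (+ (y ℕ.* A) * + A) * t) (dd-taylor M b c a hM)) (ring (+ (y ℕ.* A) * Y ^ d) (dd forms b c a) (+ (y ℕ.* A) * + A)))))
             (trans (abs-* (+ (y ℕ.* A) * Y ^ d) (dd forms b c a)) (cong (ℕ._* ∣ dd forms b c a ∣) (trans (abs-* (+ (y ℕ.* A)) (Y ^ d)) (cong ((y ℕ.* A) ℕ.*_) (abs-^ Y d)))))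

      -- The three integral forms would be smaller than 1, hence zero, against `not-all-vanish`. The
      -- power of 2 is that of an extra node at -1 or 1, and it dominates that of an extra node at
      -- 0.
      impossible : 2 ℕ.^ (suc k ℕ.+ k) ℕ.* (2 ℕ.^ (suc k ℕ.+ k ℕ.+ k) ℕ.* (2 ℕ.^ K ℕ.* (2 ℕ.^ K ℕ.* N₊.G C M))) ℕ.< (y ℕ.* A) ℕ.* y ℕ.^ d → ⊥
      impossible small = not-all-vanish
        ( vanish k k (suc k) (ℕₚ.n≤1+n k) (ℕₚ.n≤1+n k) ℕₚ.≤-refl M≤ ℕₚ.≤-refl
        , vanish (suc k) k k ℕₚ.≤-refl (ℕₚ.n≤1+n k) (ℕₚ.n≤1+n k) (ℕₚ.≤-trans M≤ (ℕₚ.≤-reflexive (ℕₚ.+-suc (k ℕ.+ k) k)))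
            (ℕₚ.*-mono-≤ (ℕₚ.^-monoʳ-≤ 2 (ℕₚ.n≤1+n (k ℕ.+ k))) (ℕₚ.≤-reflexive (cong (λ m → 2 ℕ.^ (m ℕ.+ k) ℕ.* E) (ℕₚ.+-suc k k))))
        , vanish k (suc k) k (ℕₚ.n≤1+n k) ℕₚ.≤-refl (ℕₚ.n≤1+n k) (ℕₚ.≤-trans M≤ (ℕₚ.≤-reflexive (trans (ℕₚ.+-suc (k ℕ.+ k) k) (cong (ℕ._+ k) (sym (ℕₚ.+-suc k k))))))
            (ℕₚ.*-mono-≤ (ℕₚ.≤-reflexive (cong (2 ℕ.^_) (ℕₚ.+-suc k k))) (ℕₚ.≤-reflexive (cong (λ m → 2 ℕ.^ m ℕ.* E) (ℕₚ.+-suc (k ℕ.+ k) k)))))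
        where
        W = (y ℕ.* A) ℕ.* y ℕ.^ d
        vanish : ∀ b c a → b ℕ.≤ suc k → c ℕ.≤ suc k → a ℕ.≤ suc k → M ℕ.+ 2 ℕ.≤ b ℕ.+ c ℕ.+ a →
          2 ℕ.^ (a ℕ.+ c) ℕ.* (2 ℕ.^ (a ℕ.+ b ℕ.+ c) ℕ.* E) ℕ.≤ 2 ℕ.^ (suc k ℕ.+ k) ℕ.* (2 ℕ.^ (suc k ℕ.+ k ℕ.+ k) ℕ.* E) → dd forms b c a ≡ 0ℤ
        vanish b c a hb hc ha hM ≤E = <⇒≡0 W (dd forms b c a) (ℕₚ.≤-trans (form-bound b c a hb hc ha hM) ≤E) small

-- Choice of the degree

module Pade where

  open SquareRoot using (^-distribʳ-*)
  open Rickert using (module Forms)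
  open import Data.Nat
  open import Data.Nat.Properties
  open import Data.Nat.Tactic.RingSolver using (solve-∀)
  import Data.Integer as ℤ
  import Data.Integer.Properties as ℤₚ
  open import Data.Integer using (+_)
  open import Data.Product using (∃; _×_; _,_)
  open import Data.Empty using (⊥; ⊥-elim)
  open import Relation.Binary.PropositionalEquality
  open import Relation.Nullary using (¬_; yes; no)
  open import Relation.Unary using (Decidable)

  square-cancel-≤ : ∀ {m n} → m * m ≤ n * n → m ≤ n
  square-cancel-≤ {m} {n} h with m ≤? n
  ... | yes m≤n = m≤n
  ... | no m≰n = ⊥-elim (<⇒≱ (*-mono-< (≰⇒> m≰n) (≰⇒> m≰n)) h)

  n<2^n : ∀ n → n < 2 ^ n
  n<2^n zero = s≤s z≤n
  n<2^n (suc n) = begin-strict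
    suc n          <⟨ s≤s (n<2^n n) ⟩
    suc (2 ^ n)    ≤⟨ +-monoˡ-≤ (2 ^ n) (m^n>0 2 n) ⟩
    2 ^ n + 2 ^ n  ≡⟨ cong (_+_ (2 ^ n)) (sym (+-identityʳ (2 ^ n))) ⟩
    2 * 2 ^ n      ∎
    where open ≤-Reasoning

  -- A serves as fuel: k + fuel stays at least A, so the search must stop before the fuel is
  -- exhausted.
  last : ∀ {P : ℕ → Set} → Decidable P → ∀ A → (∀ k → P k → k < A) → ∀ k → P k → ∃ λ l → k ≤ l × P l × ¬ P (suc l)
  last {P} P? A bounded k Pk = go A k Pk (m≤n+m A k)
    where
    go : ∀ fuel k → P k → A ≤ k + fuel → ∃ λ l → k ≤ l × P l × ¬ P (suc l)
    go zero k Pk A≤ = ⊥-elim (<⇒≱ (bounded k Pk) (subst (A ≤_) (+-identityʳ k) A≤))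
    go (suc fuel) k Pk A≤ with P? (suc k)
    ... | no ¬P = k , ≤-refl , Pk , ¬P
    ... | yes P' with go fuel (suc k) P' (subst (A ≤_) (+-suc k fuel) A≤)
    ...   | l , k<l , Pl , ¬P = l , <⇒≤ k<l , Pl , ¬P

  -- The conditions on the degree k for the linear form to be smaller than 1; they are used with a = 7 and a = 11,
  -- kept as variables because products with large literals would be unfolded.
  Main Remainder : (a X N A k : ℕ) → Set
  Main      a X N A k = 2 ^ a * ((2 ^ k) ^ 9 * (X ^ k * (X * N))) < A
  Remainder a X N A k = 2 ^ a * ((2 ^ k) ^ 10 * (A * (N ^ k) ^ 3)) < (X ^ k) ^ 2

  module Degree (a₁ a₂ X N A e : ℕ) .{{N≢0 : NonZero N}} (a₁≡ : a₁ ≡ 7) (a₂≡ : a₂ ≡ 11) (e≥ : 25 ≤ e) (X≥ : 2 ^ e * N ^ 4 ≤ X) (A≥ : X ^ 20 ≤ A) where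
    private
      N≤N⁴ : N ≤ N ^ 4
      N≤N⁴ = m≤m*n N (N ^ 3) {{m^n≢0 N 3}}

      2ᵉN≤X : 2 ^ e * N ≤ X
      2ᵉN≤X = ≤-trans (*-monoʳ-≤ (2 ^ e) N≤N⁴) X≥

      2ᵉ≤X : 2 ^ e ≤ X
      2ᵉ≤X = ≤-trans (m≤m*n (2 ^ e) N) 2ᵉN≤X

    8N≤X : 8 * N ≤ X
    8N≤X = ≤-trans (*-monoˡ-≤ N (^-monoʳ-≤ 2 {3} {e} (≤-trans (m≤m+n 3 22) e≥))) 2ᵉN≤X

    N≤X : N ≤ X
    N≤X = ≤-trans (m≤n*m N 8) 8N≤X

    X>0 : 0 < X
    X>0 = ≤-trans (>-nonZero⁻¹ N) N≤X

    private instance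
      X≢0 : NonZero X
      X≢0 = >-nonZero X>0

    A>0 : 0 < A
    A>0 = ≤-trans (m^n>0 X 20) A≥

    X≤A : X ≤ A
    X≤A = ≤-trans (m≤m*n X (X ^ 19) {{m^n≢0 X 19}}) A≥

    private
      -- 7 + 9 · 13 = 124 < 125 = 25 · 5 gives 2^7 (2^13)^9 < X^5, and 5 + 13 + 2 = 20 is the
      -- exponent in A ≥ X^20.
      start : ∀ k → k ≡ 13 → Main a₁ X N A k
      start k k≡ = <-≤-trans (begin-strict
        2 ^ a₁ * ((2 ^ k) ^ 9 * (X ^ k * (X * N)))   ≡⟨ sym (*-assoc (2 ^ a₁) ((2 ^ k) ^ 9) (X ^ k * (X * N))) ⟩
        2 ^ a₁ * (2 ^ k) ^ 9 * (X ^ k * (X * N))     <⟨ *-monoˡ-< (X ^ k * (X * N)) {{m*n≢0 (X ^ k) (X * N) {{m^n≢0 X k}} {{m*n≢0 X N}}}} power< ⟩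
        X ^ 5 * (X ^ k * (X * N))                   ≤⟨ *-monoʳ-≤ (X ^ 5) (*-monoʳ-≤ (X ^ k) (*-monoʳ-≤ X N≤X)) ⟩
        X ^ 5 * (X ^ k * (X * X))                   ≡⟨ ring X (X ^ k) ⟩
        X ^ 7 * X ^ k                               ≡⟨ sym (^-distribˡ-+-* X 7 k) ⟩
        X ^ (7 + k)                                 ≡⟨ cong (λ k → X ^ (7 + k)) k≡ ⟩
        X ^ 20                                      ∎) A≥
        where
        open ≤-Reasoning
        ring : ∀ X p → (X * (X * (X * (X * (X * 1))))) * (p * (X * X)) ≡ (X * (X * (X * (X * (X * (X * (X * 1))))))) * p
        ring = solve-∀
        exponent : suc (a₁ + k * 9) ≤ e * 5
        exponent = subst₂ (λ a k → suc (a + k * 9) ≤ e * 5) (sym a₁≡) (sym k≡) (*-monoˡ-≤ 5 e≥)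
        power< : 2 ^ a₁ * (2 ^ k) ^ 9 < X ^ 5
        power< = begin-strict
          2 ^ a₁ * (2 ^ k) ^ 9   ≡⟨ trans (cong (2 ^ a₁ *_) (^-*-assoc 2 k 9)) (sym (^-distribˡ-+-* 2 a₁ (k * 9))) ⟩
          2 ^ (a₁ + k * 9)       <⟨ ^-monoʳ-< 2 (s≤s (s≤s z≤n)) exponent ⟩
          2 ^ (e * 5)           ≡⟨ sym (^-*-assoc 2 e 5) ⟩
          (2 ^ e) ^ 5           ≤⟨ ^-monoˡ-≤ 5 2ᵉ≤X ⟩
          X ^ 5                 ∎

      bounded : ∀ k → Main a₁ X N A k → k < A
      bounded k main = <-trans (n<2^n k) (≤-<-trans (begin
        u                                   ≤⟨ m≤m*n u (u ^ 8) {{m^n≢0 u 8 {{m^n≢0 2 k}}}} ⟩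
        u ^ 9                               ≤⟨ m≤m*n (u ^ 9) (X ^ k * (X * N)) {{m*n≢0 (X ^ k) (X * N) {{m^n≢0 X k}} {{m*n≢0 X N}}}} ⟩
        u ^ 9 * (X ^ k * (X * N))           ≤⟨ m≤n*m (u ^ 9 * (X ^ k * (X * N))) (2 ^ a₁) {{m^n≢0 2 a₁}} ⟩
        2 ^ a₁ * (u ^ 9 * (X ^ k * (X * N))) ∎) main)
        where
        open ≤-Reasoning
        u = 2 ^ k

      -- Failure of `Main` at k + 1 bounds A from above. What remains is 27 + 19k < 25 (k - 2), true
      -- exactly from k = 13 on, and 3k + 1 ≤ 4 (k - 2) for the powers of N; here 27 = 11 + 7 + 9.
      remainder : ∀ t k j → t ≡ 13 → k ≡ t + j → ¬ Main a₁ X N A (suc k) → Remainder a₂ X N A k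
      remainder t k j t≡ k≡ ¬main = begin-strict
        2 ^ a₂ * (u ^ 10 * (A * n ^ 3))                                           ≤⟨ *-monoʳ-≤ (2 ^ a₂) (*-monoʳ-≤ (u ^ 10) (*-monoˡ-≤ (n ^ 3) (≮⇒≥ ¬main))) ⟩
        2 ^ a₂ * (u ^ 10 * (2 ^ a₁ * ((2 * u) ^ 9 * (X * w * (X * N))) * n ^ 3))   ≡⟨ trans (ring₁ (2 ^ a₂) (2 ^ a₁) 2 u w n X N) (cong (λ c → c * u ^ 19 * (N * n ^ 3) * (w * X ^ 2)) constant) ⟩
        2 ^ a * u ^ 19 * (N * n ^ 3) * (w * X ^ 2)                               <⟨ *-monoˡ-< (w * X ^ 2) {{m*n≢0 w (X ^ 2) {{m^n≢0 X k}} {{m^n≢0 X 2}}}} key ⟩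
        X ^ (11 + j) * (w * X ^ 2)                                                ≡⟨ ring₂ (X ^ (11 + j)) w (X ^ 2) ⟩
        w * (X ^ 2 * X ^ (11 + j))                                                ≡⟨ cong (w *_) (trans (sym (^-distribˡ-+-* X 2 (11 + j))) (cong (X ^_) (sym k≡'))) ⟩
        w * w                                                                     ≡⟨ cong (w *_) (sym (*-identityʳ w)) ⟩
        w ^ 2                                                                     ∎
        where
        open ≤-Reasoning
        u = 2 ^ k
        w = X ^ k
        n = N ^ k
        k≡' : k ≡ 2 + (11 + j)
        k≡' = trans k≡ (cong (_+ j) t≡)
        ring₁ : ∀ a b t u w n X N → a * ((u * (u * (u * (u * (u * (u * (u * (u * (u * (u * 1)))))))))) * (b * (((t * u) * ((t * u) * ((t * u) * ((t * u) * ((t * u) * ((t * u) * ((t * u) * ((t * u) * ((t * u) * 1))))))))) * (X * w * (X * N))) * (n * (n * (n * 1))))) ≡ (a * (b * (t * (t * (t * (t * (t * (t * (t * (t * (t * 1))))))))))) * (u * (u * (u * (u * (u * (u * (u * (u * (u * (u * (u * (u * (u * (u * (u * (u * (u * (u * (u * 1))))))))))))))))))) * (N * (n * (n * (n * 1)))) * (w * (X * (X * 1)))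
        ring₁ = solve-∀
        a = a₂ + (a₁ + 9)
        constant : 2 ^ a₂ * (2 ^ a₁ * 2 ^ 9) ≡ 2 ^ a
        constant = trans (cong (2 ^ a₂ *_) (sym (^-distribˡ-+-* 2 a₁ 9))) (sym (^-distribˡ-+-* 2 a₂ (a₁ + 9)))
        a≡ : a ≡ 27
        a≡ = cong₂ (λ a₁ a₂ → a₂ + (a₁ + 9)) a₁≡ a₂≡
        ring₂ : ∀ p w x → p * (w * x) ≡ w * (x * p)
        ring₂ = solve-∀
        exponent : suc (a + k * 19) ≤ e * (11 + j)
        exponent = ≤-trans (subst₂ (λ a k → suc (a + k * 19) ≤ 25 * (11 + j)) (sym a≡) (sym k≡') (≤-trans (m≤m+n _ (6 * j)) (≤-reflexive (ring j)))) (*-monoˡ-≤ (11 + j) e≥)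
          where
          ring : ∀ j → suc (27 + (2 + (11 + j)) * 19) + 6 * j ≡ 25 * (11 + j)
          ring = solve-∀
        exponent' : suc (k * 3) ≤ 4 * (11 + j)
        exponent' = subst (λ k → suc (k * 3) ≤ 4 * (11 + j)) (sym k≡') (≤-trans (m≤m+n _ (4 + j)) (≤-reflexive (ring j)))
          where
          ring : ∀ j → suc ((2 + (11 + j)) * 3) + (4 + j) ≡ 4 * (11 + j)
          ring = solve-∀
        key : 2 ^ a * u ^ 19 * (N * n ^ 3) < X ^ (11 + j)
        key = begin-strict
          2 ^ a * u ^ 19 * (N * n ^ 3)         ≡⟨ cong₂ _*_ (trans (cong (2 ^ a *_) (^-*-assoc 2 k 19)) (sym (^-distribˡ-+-* 2 a (k * 19)))) (cong (N *_) (^-*-assoc N k 3)) ⟩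
          2 ^ (a + k * 19) * N ^ suc (k * 3)   <⟨ *-monoˡ-< (N ^ suc (k * 3)) {{m^n≢0 N (suc (k * 3))}} (^-monoʳ-< 2 (s≤s (s≤s z≤n)) exponent) ⟩
          2 ^ (e * (11 + j)) * N ^ suc (k * 3)  ≤⟨ *-monoʳ-≤ (2 ^ (e * (11 + j))) (^-monoʳ-≤ N exponent') ⟩
          2 ^ (e * (11 + j)) * N ^ (4 * (11 + j)) ≡⟨ cong₂ _*_ (sym (^-*-assoc 2 e (11 + j))) (sym (^-*-assoc N 4 (11 + j))) ⟩
          (2 ^ e) ^ (11 + j) * (N ^ 4) ^ (11 + j) ≡⟨ sym (^-distribʳ-* (2 ^ e) (N ^ 4) (11 + j)) ⟩
          (2 ^ e * N ^ 4) ^ (11 + j)            ≤⟨ ^-monoˡ-≤ (11 + j) X≥ ⟩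
          X ^ (11 + j)                          ∎

      choose : ∀ t → t ≡ 13 → ∃ λ k₁ → Main a₁ X N A (suc k₁) × Remainder a₂ X N A (suc k₁)
      choose t t≡ = go (last {Main a₁ X N A} (λ k → 2 ^ a₁ * ((2 ^ k) ^ 9 * (X ^ k * (X * N))) <? A) A bounded t (start t t≡))
        where
        go : (∃ λ l → t ≤ l × Main a₁ X N A l × ¬ Main a₁ X N A (suc l)) → ∃ λ k₁ → Main a₁ X N A (suc k₁) × Remainder a₂ X N A (suc k₁)
        go (zero , t≤0 , _) = ⊥-elim (<⇒≱ (subst (0 <_) (sym t≡) (s≤s z≤n)) t≤0)
        go (suc k₁ , t≤k , main , ¬main) = k₁ , main , remainder t (suc k₁) (suc k₁ ∸ t) t≡ (sym (m+[n∸m]≡n t≤k)) ¬main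

    degree : ∃ λ k₁ → Main a₁ X N A (suc k₁) × Remainder a₂ X N A (suc k₁)
    degree = choose 13 refl

  module Small (a₁ a₂ X N A k₁ : ℕ) (a₁≡ : a₁ ≡ 7) (a₂≡ : a₂ ≡ 11) .{{X≢0 : NonZero X}} .{{A≢0 : NonZero A}} (main : Main a₁ X N A (suc k₁)) (rem : Remainder a₂ X N A (suc k₁)) where
    private
      k : ℕ
      k = suc k₁
    private
      u w n y q d M : ℕ
      u = 2 ^ k
      w = X ^ k
      n = N ^ k
      y = 4 * X
      q = 4 * N
      d = suc (k₁ + k₁)
      M = k + d

      4^k : 4 ^ k ≡ u * u
      4^k = ^-distribʳ-* 2 2 k

      cube : ∀ t → t ^ suc M ≡ (t ^ k) ^ 3
      cube t = trans (cong (t ^_) (ring k₁)) (sym (^-*-assoc t k 3))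
        where
        ring : ∀ k₁ → suc (suc k₁ + suc (k₁ + k₁)) ≡ suc k₁ * 3
        ring = solve-∀

      square : ∀ t → t * t ^ d ≡ (t ^ k) ^ 2
      square t = trans (cong (t ^_) (ring k₁)) (sym (^-*-assoc t k 2))
        where
        ring : ∀ k₁ → suc (suc (k₁ + k₁)) ≡ suc k₁ * 2
        ring = solve-∀

      y^k : y ^ k ≡ u * u * w
      y^k = trans (^-distribʳ-* 4 X k) (cong (_* w) 4^k)

      q^k : q ^ k ≡ u * u * n
      q^k = trans (^-distribʳ-* 4 N k) (cong (_* n) 4^k)

      G : ℕ
      G = 4 * (y ^ suc M * (X * N)) + 64 * u * (A * A * q ^ suc M)

      G≡ : G ≡ 4 * ((u * u * w) ^ 3 * (X * N)) + 64 * u * (A * A * (u * u * n) ^ 3)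
      G≡ = cong₂ (λ s t → 4 * (s * (X * N)) + 64 * u * (A * A * t)) (trans (cube y) (cong (_^ 3) y^k)) (trans (cube q) (cong (_^ 3) q^k))

      powers : ∀ g → 2 ^ (suc k + k) * (2 ^ (suc k + k + k) * (2 ^ suc k * (2 ^ suc k * g))) ≡ (2 * u * u) * ((2 * u * u * u) * ((2 * u) * ((2 * u) * g)))
      powers g = cong₂ (λ s t → s * (t * (2 ^ suc k * (2 ^ suc k * g)))) (^-distribˡ-+-* 2 (suc k) k) (trans (^-distribˡ-+-* 2 (suc k + k) k) (cong (_* u) (^-distribˡ-+-* 2 (suc k) k)))

      ring₁ : ∀ t f s u w n X N A → t * ((t * u * u) * ((t * u * u * u) * ((t * u) * ((t * u) * (f * (((u * u * w) * ((u * u * w) * ((u * u * w) * 1))) * (X * N)) + s * u * (A * A * ((u * u * n) * ((u * u * n) * ((u * u * n) * 1))))))))) ≡ ((u * u * w) * ((u * u * w) * 1)) * ((t * (t * (t * (t * (t * f))))) * ((u * (u * (u * (u * (u * (u * (u * (u * (u * 1))))))))) * (w * (X * N)))) + u * u * u * u * A * ((t * (t * (t * (t * (t * s))))) * ((u * (u * (u * (u * (u * (u * (u * (u * (u * (u * 1)))))))))) * (A * (n * (n * (n * 1))))))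
      ring₁ = solve-∀
      ring₂ : ∀ u w A → (((u * u * w) * ((u * u * w) * 1))) * A + u * u * u * u * A * (w * (w * 1)) ≡ 2 * (A * ((u * u * w) * ((u * u * w) * 1)))
      ring₂ = solve-∀
      ring₃ : ∀ y A p → 2 * (A * (y * p)) ≡ 2 * (y * A * p)
      ring₃ = solve-∀

      instance
        u≢0 : NonZero u
        u≢0 = m^n≢0 2 k
        w≢0 : NonZero w
        w≢0 = m^n≢0 X k

      uuw : NonZero ((u * u * w) ^ 2)
      uuw = m^n≢0 (u * u * w) 2 {{m*n≢0 (u * u) w {{m*n≢0 u u}}}}
      u4A : NonZero (u * u * u * u * A)
      u4A = m*n≢0 (u * u * u * u) A {{m*n≢0 (u * u * u) u {{m*n≢0 (u * u) u {{m*n≢0 u u}}}}}}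

    -- Here M + 1 = 3k, so that 64 · 2^k meets both lower bounds required of C.
    C≥ : 16 * suc M ≤ 64 * u
    C≥ = begin
      16 * suc M       ≡⟨ ring k₁ ⟩
      48 * k           ≤⟨ *-mono-≤ (m≤m+n 48 16) (<⇒≤ (n<2^n k)) ⟩
      64 * u           ∎
      where
      open ≤-Reasoning
      ring : ∀ k₁ → 16 * suc (suc k₁ + suc (k₁ + k₁)) ≡ 48 * suc k₁
      ring = solve-∀

    -- After doubling, `Main` bounds the part of the first summand of G and `Remainder` that of the
    -- second, each by A (u² w)². The constants are 2^5 · 4 = 2^7 and 2^5 · 64 = 2^11; d = 2k - 1 is
    -- the largest value compatible with 3k + 1 nodes.
    small : 2 ^ (suc k + k) * (2 ^ (suc k + k + k) * (2 ^ suc k * (2 ^ suc k * G))) < y * A * y ^ d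
    small = *-cancelˡ-< 2 _ _ (begin-strict
      2 * (2 ^ (suc k + k) * (2 ^ (suc k + k + k) * (2 ^ suc k * (2 ^ suc k * G))))           ≡⟨ cong (2 *_) (trans (powers G) (cong (λ g → (2 * u * u) * ((2 * u * u * u) * ((2 * u) * ((2 * u) * g)))) G≡)) ⟩
      2 * ((2 * u * u) * ((2 * u * u * u) * ((2 * u) * ((2 * u) * (4 * ((u * u * w) ^ 3 * (X * N)) + 64 * u * (A * A * (u * u * n) ^ 3)))))) ≡⟨ trans (ring₁ 2 4 64 u w n X N A) (cong₂ (λ c₁ c₂ → ((u * u * w) ^ 2) * (c₁ * (u ^ 9 * (w * (X * N)))) + u * u * u * u * A * (c₂ * (u ^ 10 * (A * n ^ 3)))) {x = 2 * (2 * (2 * (2 * (2 * 4))))} {u = 2 * (2 * (2 * (2 * (2 * 64))))} (cong (2 ^_) (sym a₁≡)) (cong (2 ^_) (sym a₂≡))) ⟩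
      ((u * u * w) ^ 2) * (2 ^ a₁ * (u ^ 9 * (w * (X * N)))) + u * u * u * u * A * (2 ^ a₂ * (u ^ 10 * (A * n ^ 3))) <⟨ +-mono-< (*-monoʳ-< ((u * u * w) ^ 2) {{uuw}} main) (*-monoʳ-< (u * u * u * u * A) {{u4A}} rem) ⟩
      ((u * u * w) ^ 2) * A + u * u * u * u * A * w ^ 2                                       ≡⟨ ring₂ u w A ⟩
      2 * (A * (u * u * w) ^ 2)                                                               ≡⟨ cong (λ s → 2 * (A * s)) (sym (trans (square y) (cong (_^ 2) y^k))) ⟩
      2 * (A * (y * y ^ d))                                                                   ≡⟨ ring₃ y A (y ^ d) ⟩
      2 * (y * A * y ^ d)                                                                     ∎)
      where open ≤-Reasoning

  halve : ∀ N {m} → 8 * N ≤ m → ∃ λ m' → m ≡ N + m' × N ≤ m'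
  halve N {m} h = m ∸ N , sym (m+[n∸m]≡n (≤-trans (m≤n*m N 8) h)) , ≤-trans (≤-reflexive (sym (m+n∸m≡n N N))) (∸-monoˡ-≤ N (≤-trans (≤-trans (≤-reflexive (ring N)) (*-monoˡ-≤ N (m≤m+n 2 6))) h))
    where
    ring : ∀ n → n + n ≡ 2 * n
    ring = solve-∀

  -- 8N ≤ X ≤ x₂ gives X - N ≥ X/2 and x₂ - N ≥ x₂/2, hence b² ≥ A²/4.
  double-bound : ∀ X x₂ A b N → 8 * N ≤ X → X ≤ x₂ → A * A ≡ X * x₂ → + b ℤ.* + b ≡ (+ X ℤ.- + N) ℤ.* (+ x₂ ℤ.- + N) → A ≤ 2 * b
  double-bound X x₂ A b N 8N≤X X≤x₂ A² b² with halve N 8N≤X | halve N (≤-trans 8N≤X X≤x₂)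
  ... | X' , X≡ , N≤X' | x' , x≡ , N≤x' = square-cancel-≤ (begin
    A * A                  ≡⟨ A² ⟩
    X * x₂                 ≡⟨ cong₂ _*_ X≡ x≡ ⟩
    (N + X') * (N + x')    ≤⟨ *-mono-≤ (+-monoˡ-≤ X' N≤X') (+-monoˡ-≤ x' N≤x') ⟩
    (X' + X') * (x' + x')  ≡⟨ ring₁ X' x' ⟩
    4 * (X' * x')          ≡⟨ cong (4 *_) (sym bb) ⟩
    4 * (b * b)            ≡⟨ ring₂ b ⟩
    (2 * b) * (2 * b)      ∎)
    where
    open ≤-Reasoning
    ring₁ : ∀ X x → (X + X) * (x + x) ≡ 4 * (X * x)
    ring₁ = solve-∀
    ring₂ : ∀ b → 4 * (b * b) ≡ (2 * b) * (2 * b)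
    ring₂ = solve-∀
    minus : ∀ {m m'} → m ≡ N + m' → + m ℤ.- + N ≡ + m'
    minus {m' = m'} refl = trans (ℤₚ.m-n≡m⊖n (N + m') N) (trans (ℤₚ.⊖-≥ (m≤m+n N m')) (cong +_ (m+n∸m≡n N m')))
    bb : b * b ≡ X' * x'
    bb = ℤₚ.+-injective (trans (ℤₚ.pos-* b b) (trans b² (trans (cong₂ ℤ._*_ (minus X≡) (minus x≡)) (sym (ℤₚ.pos-* X' x')))))

  pade′ : ∀ a₁ a₂ X x₂ A b c N e → a₁ ≡ 7 → a₂ ≡ 11 → 1 ≤ N → 25 ≤ e → 2 ^ e * N ^ 4 ≤ X → X ^ 20 ≤ A → A * A ≡ X * x₂ →
    + b ℤ.* + b ≡ (+ X ℤ.- + N) ℤ.* (+ x₂ ℤ.- + N) → + c ℤ.* + c ≡ (+ X ℤ.+ + N) ℤ.* (+ x₂ ℤ.+ + N) → ⊥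
  pade′ a₁ a₂ X x₂ A b c (suc N') e a₁≡ a₂≡ N≥1 e≥ X≥ A≥ A² b² c² =
    go degree
    where
    open Degree a₁ a₂ X (suc N') A e a₁≡ a₂≡ e≥ X≥ A≥
    instance
      X≢0 : NonZero X
      X≢0 = >-nonZero X>0
      A≢0 : NonZero A
      A≢0 = >-nonZero A>0
    X≤x₂ : X ≤ x₂
    X≤x₂ = *-cancelˡ-≤ X (≤-trans (*-mono-≤ X≤A X≤A) (≤-reflexive A²))
    A≤2c : A ≤ 2 * c
    A≤2c = ≤-trans (square-cancel-≤ (≤-trans (≤-reflexive A²) (≤-trans (*-mono-≤ (m≤m+n X (suc N')) (m≤m+n x₂ (suc N')))
      (≤-reflexive (sym (ℤₚ.+-injective (trans (ℤₚ.pos-* c c) (trans c² (sym (ℤₚ.pos-* (X + suc N') (x₂ + suc N')))))))))) ) (m≤n*m c 2)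
    ring : ∀ k₁ → suc k₁ + suc (k₁ + k₁) + 2 ≡ suc k₁ + suc k₁ + suc (suc k₁)
    ring = solve-∀
    go : (∃ λ k₁ → Main a₁ X (suc N') A (suc k₁) × Remainder a₂ X (suc N') A (suc k₁)) → ⊥
    go (k₁ , main , rem) = Forms.impossible X x₂ A b c N' X>0 A>0 (≤-trans (*-monoˡ-≤ (suc N') (m≤m+n 4 4)) 8N≤X) A² b² c²
      (double-bound X x₂ A b (suc N') 8N≤X X≤x₂ A² b²) A≤2c (suc k₁) (k₁ + k₁) (64 * 2 ^ suc k₁)
      C≥ (m≤n*m (2 ^ suc k₁) 64) (≤-reflexive (ring k₁)) small
      where open Small a₁ a₂ X (suc N') A k₁ a₁≡ a₂≡ main rem

  pade : ∀ X x₂ A b c N e → 1 ≤ N → 25 ≤ e → 2 ^ e * N ^ 4 ≤ X → X ^ 20 ≤ A → A * A ≡ X * x₂ →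
    + b ℤ.* + b ≡ (+ X ℤ.- + N) ℤ.* (+ x₂ ℤ.- + N) → + c ℤ.* + c ≡ (+ X ℤ.+ + N) ℤ.* (+ x₂ ℤ.+ + N) → ⊥
  pade X x₂ A b c N e = pade′ 7 11 X x₂ A b c N e refl refl

-- The triangle inequality near O

module Triangle where

  open Heights
  open import Data.Nat hiding (parity)
  open import Data.Nat.Properties
  open import Data.Nat.Coprimality using (Coprime)
  open import Data.Nat.Tactic.RingSolver using (solve-∀)
  open import Data.Integer.Tactic.RingSolver using () renaming (solve-∀ to ℤsolve-∀)
  import Data.Integer as ℤ
  import Data.Integer.Properties as ℤₚ
  open import Data.Integer using (ℤ; +_)
  open import Data.Product using (∃; _×_; _,_; proj₁; proj₂)
  open import Data.Sum using (_⊎_; inj₁; inj₂)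
  open import Relation.Binary.PropositionalEquality
  open Pade using (square-cancel-≤)
  open ≤-Reasoning

  -- E and F are the roots of a quadratic with half sum G and discriminant (a²−q²)(b²−r²)·4abqr;
  -- the two summands below bound G and the square root of the discriminant.
  module _ (a q b r E F γ τ θ m n : ℕ) (γ≡ : a * b ≡ q * r + γ) (sum : E + F ≡ γ * (a * r + b * q) + γ * (a * r + b * q))
           (disc : (γ * (a * r + b * q)) * (γ * (a * r + b * q)) ≤ E * F + 4 * ((a * b) * (q * r)) * ((a * b) * (a * b)))
           (near-a : τ * q ≤ m * m * θ * a) (near-b : τ * r ≤ n * n * θ * b) where
    private
      δ G α : ℕ
      δ = a * r + b * q
      G = γ * δ
      α = a * b + q * r

      sum-part : τ * G ≤ (m * m + n * n) * θ * (α * α)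
      sum-part = begin
        τ * (γ * δ)                                              ≤⟨ *-monoʳ-≤ τ (*-monoˡ-≤ δ (subst (γ ≤_) (sym γ≡) (m≤n+m γ (q * r)))) ⟩
        τ * ((a * b) * (a * r + b * q))                          ≡⟨ r₁ τ a b q r ⟩
        (a * a * b) * (τ * r) + (a * b * b) * (τ * q)            ≤⟨ +-mono-≤ (*-monoʳ-≤ (a * a * b) near-b) (*-monoʳ-≤ (a * b * b) near-a) ⟩
        (a * a * b) * (n * n * θ * b) + (a * b * b) * (m * m * θ * a) ≡⟨ r₂ a b m n θ ⟩
        (m * m + n * n) * θ * ((a * b) * (a * b))                ≤⟨ *-monoʳ-≤ ((m * m + n * n) * θ) (*-mono-≤ (m≤m+n (a * b) (q * r)) (m≤m+n (a * b) (q * r))) ⟩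
        (m * m + n * n) * θ * (α * α)                            ∎
        where
        r₁ : ∀ τ a b q r → τ * ((a * b) * (a * r + b * q)) ≡ (a * a * b) * (τ * r) + (a * b * b) * (τ * q)
        r₁ = solve-∀
        r₂ : ∀ a b m n θ → (a * a * b) * (n * n * θ * b) + (a * b * b) * (m * m * θ * a) ≡ (m * m + n * n) * θ * ((a * b) * (a * b))
        r₂ = solve-∀

      root-part : ∀ z → z * z ≤ 4 * ((a * b) * (q * r)) * ((a * b) * (a * b)) → τ * z ≤ (2 * (m * n)) * θ * (α * α)
      root-part z z² = square-cancel-≤ (begin
        (τ * z) * (τ * z)                                                            ≡⟨ r₀ τ z ⟩
        τ * τ * (z * z)                                                              ≤⟨ *-monoʳ-≤ (τ * τ) z² ⟩
        τ * τ * (4 * ((a * b) * (q * r)) * ((a * b) * (a * b)))                      ≡⟨ r₁ τ a b q r ⟩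
        4 * ((a * b) * (a * b) * (a * b)) * ((τ * q) * (τ * r))                      ≤⟨ *-monoʳ-≤ (4 * ((a * b) * (a * b) * (a * b))) (*-mono-≤ near-a near-b) ⟩
        4 * ((a * b) * (a * b) * (a * b)) * ((m * m * θ * a) * (n * n * θ * b))      ≡⟨ r₂ a b m n θ ⟩
        ((2 * (m * n)) * θ * ((a * b) * (a * b))) * ((2 * (m * n)) * θ * ((a * b) * (a * b))) ≤⟨ *-mono-≤ mono mono ⟩
        ((2 * (m * n)) * θ * (α * α)) * ((2 * (m * n)) * θ * (α * α))                ∎)
        where
        mono : (2 * (m * n)) * θ * ((a * b) * (a * b)) ≤ (2 * (m * n)) * θ * (α * α)
        mono = *-monoʳ-≤ ((2 * (m * n)) * θ) (*-mono-≤ (m≤m+n (a * b) (q * r)) (m≤m+n (a * b) (q * r)))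
        r₀ : ∀ τ z → (τ * z) * (τ * z) ≡ τ * τ * (z * z)
        r₀ = solve-∀
        r₁ : ∀ τ a b q r → τ * τ * (4 * ((a * b) * (q * r)) * ((a * b) * (a * b))) ≡ 4 * ((a * b) * (a * b) * (a * b)) * ((τ * q) * (τ * r))
        r₁ = solve-∀
        r₂ : ∀ a b m n θ → 4 * ((a * b) * (a * b) * (a * b)) * ((m * m * θ * a) * (n * n * θ * b)) ≡ ((2 * (m * n)) * θ * ((a * b) * (a * b))) * ((2 * (m * n)) * θ * ((a * b) * (a * b)))
        r₂ = solve-∀

      bound : ∀ z → E ≤ G + z → z * z ≤ 4 * ((a * b) * (q * r)) * ((a * b) * (a * b)) → τ * E ≤ (m + n) * (m + n) * θ * (α * α)
      bound z E≤ z² = begin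
        τ * E                                    ≤⟨ *-monoʳ-≤ τ E≤ ⟩
        τ * (G + z)                              ≡⟨ *-distribˡ-+ τ G z ⟩
        τ * G + τ * z                            ≤⟨ +-mono-≤ sum-part (root-part z z²) ⟩
        (m * m + n * n) * θ * (α * α) + (2 * (m * n)) * θ * (α * α) ≡⟨ r₁ m n θ (α * α) ⟩
        (m + n) * (m + n) * θ * (α * α)          ∎
        where
        r₁ : ∀ m n θ x → (m * m + n * n) * θ * x + (2 * (m * n)) * θ * x ≡ (m + n) * (m + n) * θ * x
        r₁ = solve-∀

    larger-root : τ * E ≤ (m + n) * (m + n) * θ * (α * α)
    larger-root = go (≤-total E G)
      where
      go : E ≤ G ⊎ G ≤ E → τ * E ≤ (m + n) * (m + n) * θ * (α * α)
      go (inj₁ E≤G) = bound 0 (≤-trans E≤G (≤-reflexive (sym (+-identityʳ G)))) z≤n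
      -- E = G + z and F = G - z, so z² = G² - E F is bounded by `disc`.
      go (inj₂ G≤E) = bound z (≤-reflexive E≡) (+-cancelˡ-≤ (E * F) (z * z) (4 * ((a * b) * (q * r)) * ((a * b) * (a * b))) (≤-trans (≤-reflexive EF+z²) disc))
        where
        z = E ∸ G
        E≡ : E ≡ G + z
        E≡ = sym (m+[n∸m]≡n G≤E)
        G≡ : G ≡ F + z
        G≡ = +-cancelˡ-≡ G G (F + z) (trans (sym sum) (trans (cong (_+ F) E≡) (r₁ G z F)))
          where
          r₁ : ∀ g z f → g + z + f ≡ g + (f + z)
          r₁ = solve-∀
        EF+z² : E * F + z * z ≡ G * G
        EF+z² = trans (cong (λ e → e * F + z * z) (trans E≡ (cong (_+ z) G≡))) (trans (r₁ F z) (cong₂ _*_ (sym G≡) (sym G≡)))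
          where
          r₁ : ∀ f z → (f + z + z) * f + z * z ≡ (f + z) * (f + z)
          r₁ = solve-∀

  module _ (a q b r γ W : ℕ) (γ≡ : a * b ≡ q * r + γ) (W≡ : W + 4 * ((a * b) * (q * r)) ≡ (a * r + b * q) * (a * r + b * q)) (q≤a : q ≤ a) where
    private
      δ α t : ℕ
      δ = a * r + b * q
      α = a * b + q * r
      t = (a * b) * (q * r)

      α²≡ : α * α ≡ γ * γ + 4 * t
      α²≡ = trans (cong (λ x → (x + q * r) * (x + q * r)) γ≡) (trans (r₁ (q * r) γ) (cong (λ x → γ * γ + 4 * (x * (q * r))) (sym γ≡)))
        where
        r₁ : ∀ x g → (x + g + x) * (x + g + x) ≡ g * g + 4 * ((x + g) * x)
        r₁ = solve-∀

    -- As α² = γ² + 4t and δ² = W + 4t, the two sides differ by 4t ((ab)² + δ² - α²), and α² ≤ (ab)²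
    -- + δ² because q ≤ a.
    discriminant : (γ * δ) * (γ * δ) ≤ (α * α) * W + 4 * t * ((a * b) * (a * b))
    discriminant = +-cancelʳ-≤ (4 * t * (δ * δ)) ((γ * δ) * (γ * δ)) ((α * α) * W + 4 * t * ((a * b) * (a * b))) (begin
      (γ * δ) * (γ * δ) + 4 * t * (δ * δ)                          ≡⟨ r₁ γ δ t ⟩
      (γ * γ + 4 * t) * (δ * δ)                                    ≡⟨ cong₂ _*_ (sym α²≡) (sym W≡) ⟩
      (α * α) * (W + 4 * t)                                        ≡⟨ r₂ (α * α) W t ⟩
      (α * α) * W + 4 * t * (α * α)                                ≤⟨ +-monoʳ-≤ ((α * α) * W) (*-monoʳ-≤ (4 * t) α²≤) ⟩
      (α * α) * W + 4 * t * ((a * b) * (a * b) + δ * δ)            ≡⟨ r₃ ((α * α) * W) t ((a * b) * (a * b)) (δ * δ) ⟩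
      (α * α) * W + 4 * t * ((a * b) * (a * b)) + 4 * t * (δ * δ)  ∎)
      where
      r₁ : ∀ g d t → (g * d) * (g * d) + 4 * t * (d * d) ≡ (g * g + 4 * t) * (d * d)
      r₁ = solve-∀
      r₂ : ∀ x w t → x * (w + 4 * t) ≡ x * w + 4 * t * x
      r₂ = solve-∀
      r₃ : ∀ x t y z → x + 4 * t * (y + z) ≡ x + 4 * t * y + 4 * t * z
      r₃ = solve-∀
      α²≤ : α * α ≤ (a * b) * (a * b) + δ * δ
      α²≤ = begin
        α * α                                                                       ≡⟨ r₄ a b q r ⟩
        (a * b) * (a * b) + 2 * ((a * b) * (q * r)) + (q * r) * (q * r)             ≤⟨ +-monoʳ-≤ ((a * b) * (a * b) + 2 * ((a * b) * (q * r))) (*-mono-≤ (*-monoˡ-≤ r q≤a) (*-monoˡ-≤ r q≤a)) ⟩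
        (a * b) * (a * b) + 2 * ((a * b) * (q * r)) + (a * r) * (a * r)             ≤⟨ m≤m+n ((a * b) * (a * b) + 2 * ((a * b) * (q * r)) + (a * r) * (a * r)) ((b * q) * (b * q)) ⟩
        (a * b) * (a * b) + 2 * ((a * b) * (q * r)) + (a * r) * (a * r) + (b * q) * (b * q) ≡⟨ r₅ a b q r ⟩
        (a * b) * (a * b) + δ * δ                                                   ∎
        where
        r₄ : ∀ a b q r → (a * b + q * r) * (a * b + q * r) ≡ (a * b) * (a * b) + 2 * ((a * b) * (q * r)) + (q * r) * (q * r)
        r₄ = solve-∀
        r₅ : ∀ a b q r → (a * b) * (a * b) + 2 * ((a * b) * (q * r)) + (a * r) * (a * r) + (b * q) * (b * q) ≡ (a * b) * (a * b) + (a * r + b * q) * (a * r + b * q)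
        r₅ = solve-∀

  -- Free of square roots: τ q ≤ m² θ a stands for √(q/a) ≤ m √(θ/τ), so that distances become the
  -- multipliers m and n, which add.
  Triangle : (a₁ a₂ a₃ a₄ q₁ q₂ q₃ q₄ : ℕ) → Set
  Triangle a₁ a₂ a₃ a₄ q₁ q₂ q₃ q₄ = ∀ τ θ m n → τ * q₁ ≤ m * m * θ * a₁ → τ * q₃ ≤ n * n * θ * a₃ →
    τ * q₄ ≤ (m + n) * (m + n) * θ * a₄ × τ * q₂ ≤ (m + n) * (m + n) * θ * a₂

  -- Near O the function √(q/a) measures the distance from O; this is its triangle inequality for P₁ and P₃,
  -- whose sum and difference are P₄ and P₂.
  module _ (a₁ a₂ a₃ a₄ q₁ q₂ q₃ q₄ : ℕ) (q₂>0 : 0 < q₂) (q₄>0 : 0 < q₄) (cop₂ : Coprime a₂ q₂) (cop₄ : Coprime a₄ q₄)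
           (a₂>0 : 0 < a₂) (a₄>0 : 0 < a₄) (q₁<a₁ : q₁ < a₁) (q₃<a₃ : q₃ < a₃)
           (product : (+ a₂ ℤ.* + a₄) ℤ.* ((+ a₃ ℤ.* + q₁ ℤ.- + a₁ ℤ.* + q₃) ℤ.* (+ a₃ ℤ.* + q₁ ℤ.- + a₁ ℤ.* + q₃)) ≡
                      (+ q₂ ℤ.* + q₄) ℤ.* ((+ a₁ ℤ.* + a₃ ℤ.+ + q₁ ℤ.* + q₃) ℤ.* (+ a₁ ℤ.* + a₃ ℤ.+ + q₁ ℤ.* + q₃)))
           (sum : (+ a₂ ℤ.* + q₄ ℤ.+ + a₄ ℤ.* + q₂) ℤ.* ((+ a₃ ℤ.* + q₁ ℤ.- + a₁ ℤ.* + q₃) ℤ.* (+ a₃ ℤ.* + q₁ ℤ.- + a₁ ℤ.* + q₃)) ≡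
                  (+ q₂ ℤ.* + q₄) ℤ.* ((+ a₁ ℤ.* + a₃ ℤ.- + q₁ ℤ.* + q₃) ℤ.* (+ a₁ ℤ.* + q₃ ℤ.+ + a₃ ℤ.* + q₁) ℤ.+ (+ a₁ ℤ.* + a₃ ℤ.- + q₁ ℤ.* + q₃) ℤ.* (+ a₁ ℤ.* + q₃ ℤ.+ + a₃ ℤ.* + q₁)))
           (distinct : + a₃ ℤ.* + q₁ ℤ.- + a₁ ℤ.* + q₃ ≢ + 0) where
    private
      β : ℤ
      β = + a₃ ℤ.* + q₁ ℤ.- + a₁ ℤ.* + q₃
      α γ δ : ℕ
      α = a₁ * a₃ + q₁ * q₃
      γ = a₁ * a₃ ∸ q₁ * q₃
      δ = a₁ * q₃ + a₃ * q₁
      γ≡ : a₁ * a₃ ≡ q₁ * q₃ + γ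
      γ≡ = sym (m+[n∸m]≡n (*-mono-≤ (<⇒≤ q₁<a₁) (<⇒≤ q₃<a₃)))
      αℤ : + α ≡ + a₁ ℤ.* + a₃ ℤ.+ + q₁ ℤ.* + q₃
      αℤ = cong₂ ℤ._+_ (ℤₚ.pos-* a₁ a₃) (ℤₚ.pos-* q₁ q₃)
      δℤ : + δ ≡ + a₁ ℤ.* + q₃ ℤ.+ + a₃ ℤ.* + q₁
      δℤ = cong₂ ℤ._+_ (ℤₚ.pos-* a₁ q₃) (ℤₚ.pos-* a₃ q₁)
      γℤ : + γ ≡ + a₁ ℤ.* + a₃ ℤ.- + q₁ ℤ.* + q₃
      γℤ = trans (r (+ (q₁ * q₃)) (+ γ)) (cong₂ ℤ._-_ (trans (cong +_ (sym γ≡)) (ℤₚ.pos-* a₁ a₃)) (ℤₚ.pos-* q₁ q₃))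
        where
        r : ∀ x y → y ≡ (x ℤ.+ y) ℤ.- x
        r = ℤsolve-∀
      pos-square : ∀ x y c → + (x * y * c) ≡ (+ x ℤ.* + y) ℤ.* + c
      pos-square x y c = trans (ℤₚ.pos-* (x * y) c) (cong (ℤ._* + c) (ℤₚ.pos-* x y))

    triangle : Triangle a₁ a₂ a₃ a₄ q₁ q₂ q₃ q₄
    triangle = conclude (gauss {+ a₂} {+ a₄} {q₂} {q₄} q₂>0 q₄>0 cop₂ cop₄ {αz ℤ.* αz} {γz ℤ.* δz ℤ.+ γz ℤ.* δz} {β ℤ.* β} product sum)
      where
      αz = + a₁ ℤ.* + a₃ ℤ.+ + q₁ ℤ.* + q₃
      γz = + a₁ ℤ.* + a₃ ℤ.- + q₁ ℤ.* + q₃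
      δz = + a₁ ℤ.* + q₃ ℤ.+ + a₃ ℤ.* + q₁
      conclude : (∃ λ C → αz ℤ.* αz ≡ (+ a₂ ℤ.* + a₄) ℤ.* C × γz ℤ.* δz ℤ.+ γz ℤ.* δz ≡ (+ a₂ ℤ.* + q₄ ℤ.+ + a₄ ℤ.* + q₂) ℤ.* C × β ℤ.* β ≡ (+ q₂ ℤ.* + q₄) ℤ.* C) → Triangle a₁ a₂ a₃ a₄ q₁ q₂ q₃ q₄
      conclude (C , eu , ev , ew) = go (proj₁ positive) (proj₂ positive)
        where
        β²>0 = square-pos β distinct
        positive : ∃ λ k → C ≡ + suc k
        positive = pos*⇒pos (q₂ * q₄) C (proj₁ β²>0) (trans (cong (ℤ._* C) (ℤₚ.pos-* q₂ q₄)) (trans (sym ew) (proj₂ β²>0)))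
        go : ∀ k → C ≡ + suc k → Triangle a₁ a₂ a₃ a₄ q₁ q₂ q₃ q₄
        go k C≡ = nonneg (suc k) {{_}} C≡
          where
          nonneg : ∀ c .{{_ : NonZero c}} → C ≡ + c → Triangle a₁ a₂ a₃ a₄ q₁ q₂ q₃ q₄
          nonneg c C≡ τ θ m n near₁ near₃ = scale a₂ a₄ q₄ a₂>0 (*-comm a₂ a₄) (larger-root a₁ q₁ a₃ q₃ E F γ τ θ m n γ≡ EF disc near₁ near₃)
            , scale a₄ a₂ q₂ a₄>0 refl (larger-root a₁ q₁ a₃ q₃ F E γ τ θ m n γ≡ (trans (+-comm F E) EF) (subst (λ x → (γ * δ) * (γ * δ) ≤ x + 4 * ((a₁ * a₃) * (q₁ * q₃)) * ((a₁ * a₃) * (a₁ * a₃))) (*-comm E F) disc) near₁ near₃)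
            where
            E F W : ℕ
            -- c is the factor from `gauss`. Then E F = α² W with W = β², which is where
            -- `discriminant` applies.
            E = a₂ * q₄ * c
            F = a₄ * q₂ * c
            W = q₂ * q₄ * c
            u : α * α ≡ a₂ * a₄ * c
            u = ℤₚ.+-injective (trans (ℤₚ.pos-* α α) (trans (cong₂ ℤ._*_ αℤ αℤ) (trans eu (trans (cong ((+ a₂ ℤ.* + a₄) ℤ.*_) C≡) (sym (pos-square a₂ a₄ c))))))
            EF : E + F ≡ γ * δ + γ * δ
            EF = ℤₚ.+-injective (trans (cong₂ ℤ._+_ (pos-square a₂ q₄ c) (pos-square a₄ q₂ c)) (trans (sym (ℤₚ.*-distribʳ-+ (+ c) (+ a₂ ℤ.* + q₄) (+ a₄ ℤ.* + q₂)))
              (trans (cong ((+ a₂ ℤ.* + q₄ ℤ.+ + a₄ ℤ.* + q₂) ℤ.*_) (sym C≡)) (trans (sym ev) (sym (cong₂ ℤ._+_ γδ γδ))))))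
              where
              γδ : + (γ * δ) ≡ γz ℤ.* δz
              γδ = trans (ℤₚ.pos-* γ δ) (cong₂ ℤ._*_ γℤ δℤ)
            Wℤ : + W ≡ β ℤ.* β
            Wℤ = trans (pos-square q₂ q₄ c) (trans (cong ((+ q₂ ℤ.* + q₄) ℤ.*_) (sym C≡)) (sym ew))
            W≡ : W + 4 * ((a₁ * a₃) * (q₁ * q₃)) ≡ δ * δ
            W≡ = ℤₚ.+-injective (trans (cong₂ ℤ._+_ Wℤ (trans (ℤₚ.pos-* 4 ((a₁ * a₃) * (q₁ * q₃))) (cong (+ 4 ℤ.*_) (trans (ℤₚ.pos-* (a₁ * a₃) (q₁ * q₃)) (cong₂ ℤ._*_ (ℤₚ.pos-* a₁ a₃) (ℤₚ.pos-* q₁ q₃))))))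
              (trans (r (+ a₁) (+ a₃) (+ q₁) (+ q₃)) (sym (trans (ℤₚ.pos-* δ δ) (cong₂ ℤ._*_ δℤ δℤ)))))
              where
              r : ∀ a b q r → (b ℤ.* q ℤ.- a ℤ.* r) ℤ.* (b ℤ.* q ℤ.- a ℤ.* r) ℤ.+ + 4 ℤ.* ((a ℤ.* b) ℤ.* (q ℤ.* r)) ≡ (a ℤ.* r ℤ.+ b ℤ.* q) ℤ.* (a ℤ.* r ℤ.+ b ℤ.* q)
              r = ℤsolve-∀
            disc : (γ * δ) * (γ * δ) ≤ E * F + 4 * ((a₁ * a₃) * (q₁ * q₃)) * ((a₁ * a₃) * (a₁ * a₃))
            disc = subst (λ x → (γ * δ) * (γ * δ) ≤ x + 4 * ((a₁ * a₃) * (q₁ * q₃)) * ((a₁ * a₃) * (a₁ * a₃)))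
              (trans (cong (_* W) u) (r a₂ a₄ q₂ q₄ c)) (discriminant a₁ q₁ a₃ q₃ γ W γ≡ W≡ (<⇒≤ q₁<a₁))
              where
              r : ∀ a b q r c → (a * b * c) * (q * r * c) ≡ (a * r * c) * (b * q * c)
              r = solve-∀
            scale : ∀ x y z → 0 < x → x * y ≡ a₄ * a₂ → τ * (x * z * c) ≤ (m + n) * (m + n) * θ * (α * α) → τ * z ≤ (m + n) * (m + n) * θ * y
            scale x y z x>0 xy≡ le = *-cancelˡ-≤ (x * c) {{m*n≢0 x c {{>-nonZero x>0}}}} (begin
              x * c * (τ * z)                             ≡⟨ r₁ x c τ z ⟩
              τ * (x * z * c)                             ≤⟨ le ⟩
              (m + n) * (m + n) * θ * (α * α)             ≡⟨ cong ((m + n) * (m + n) * θ *_) (trans u (cong (_* c) (trans (*-comm a₂ a₄) (sym xy≡)))) ⟩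
              (m + n) * (m + n) * θ * (x * y * c)         ≡⟨ r₂ ((m + n) * (m + n) * θ) x y c ⟩
              x * c * ((m + n) * (m + n) * θ * y)         ∎)
              where
              r₁ : ∀ x c τ z → x * c * (τ * z) ≡ τ * (x * z * c)
              r₁ = solve-∀
              r₂ : ∀ k x y c → k * (x * y * c) ≡ x * c * (k * y)
              r₂ = solve-∀

-- The gap between two integral multiples

module Gap where

  open Heights
  open Growth
  open Triangle
  open SquareRoot using (^-distribʳ-*)
  open import Data.Nat hiding (parity)
  open import Data.Nat.Properties
  import Data.Nat.Divisibility as ℕD
  open import Data.Nat.DivMod using (_/_; _%_; m≡m%n+[m/n]*n; m%n<n)
  open import Data.Nat.Coprimality using (Coprime)
  open import Data.Nat.Tactic.RingSolver using (solve-∀)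
  import Data.Integer as ℤ
  import Data.Integer.Properties as ℤₚ
  open import Data.Integer using (ℤ; +_)
  open import Data.Product using (_×_; proj₁; proj₂)
  open import Data.Sum using (_⊎_; inj₁; inj₂)
  open import Data.Empty using (⊥; ⊥-elim)
  open import Relation.Binary.PropositionalEquality
  open import Relation.Nullary using (yes; no; ¬_)
  open ≤-Reasoning

  private
    signed-triangle : ∀ {p₁ p₂ p₃ p₄ : ℤ} (a₁ a₂ a₃ a₄ q₁ q₂ q₃ q₄ : ℕ) → p₁ ≡ + a₁ → p₂ ≡ + a₂ → p₃ ≡ + a₃ → p₄ ≡ + a₄ →
      0 < q₂ → 0 < q₄ → Coprime a₂ q₂ → Coprime a₄ q₄ → 0 < a₂ → 0 < a₄ → q₁ < a₁ → q₃ < a₃ →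
      (p₂ ℤ.* p₄) ℤ.* ((p₃ ℤ.* + q₁ ℤ.- p₁ ℤ.* + q₃) ℤ.* (p₃ ℤ.* + q₁ ℤ.- p₁ ℤ.* + q₃)) ≡
        (+ q₂ ℤ.* + q₄) ℤ.* ((p₁ ℤ.* p₃ ℤ.+ + q₁ ℤ.* + q₃) ℤ.* (p₁ ℤ.* p₃ ℤ.+ + q₁ ℤ.* + q₃)) →
      (p₂ ℤ.* + q₄ ℤ.+ p₄ ℤ.* + q₂) ℤ.* ((p₃ ℤ.* + q₁ ℤ.- p₁ ℤ.* + q₃) ℤ.* (p₃ ℤ.* + q₁ ℤ.- p₁ ℤ.* + q₃)) ≡
        (+ q₂ ℤ.* + q₄) ℤ.* ((p₁ ℤ.* p₃ ℤ.- + q₁ ℤ.* + q₃) ℤ.* (p₁ ℤ.* + q₃ ℤ.+ p₃ ℤ.* + q₁) ℤ.+ (p₁ ℤ.* p₃ ℤ.- + q₁ ℤ.* + q₃) ℤ.* (p₁ ℤ.* + q₃ ℤ.+ p₃ ℤ.* + q₁)) →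
      p₃ ℤ.* + q₁ ℤ.- p₁ ℤ.* + q₃ ≢ + 0 → Triangle a₁ a₂ a₃ a₄ q₁ q₂ q₃ q₄
    signed-triangle a₁ a₂ a₃ a₄ q₁ q₂ q₃ q₄ refl refl refl refl = triangle a₁ a₂ a₃ a₄ q₁ q₂ q₃ q₄

    signed-double : ∀ {p p'} a a' q q' ω → p ≡ + a → p' ≡ + a' → a * a ≡ q * q + ω →
      p' ℤ.* (+ 4 ℤ.* ((p ℤ.* + q) ℤ.* (p ℤ.* p ℤ.- + q ℤ.* + q))) ≡ + q' ℤ.* ((p ℤ.* p ℤ.+ + q ℤ.* + q) ℤ.* (p ℤ.* p ℤ.+ + q ℤ.* + q)) →
      a' * (4 * ((a * q) * ω)) ≡ q' * ((a * a + q * q) * (a * a + q * q))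
    signed-double a a' q q' ω refl refl ω≡ e = ℤₚ.+-injective (trans (ℤₚ.pos-* a' (4 * ((a * q) * ω)))
      (trans (cong (+ a' ℤ.*_) (trans (ℤₚ.pos-* 4 ((a * q) * ω)) (cong (+ 4 ℤ.*_) (trans (ℤₚ.pos-* (a * q) ω) (cong₂ ℤ._*_ (ℤₚ.pos-* a q) ω-signed)))))
        (trans e (sym (trans (ℤₚ.pos-* q' ((a * a + q * q) * (a * a + q * q))) (cong (+ q' ℤ.*_) (trans (ℤₚ.pos-* (a * a + q * q) (a * a + q * q)) (cong₂ ℤ._*_ s-signed s-signed))))))))
      where
      open import Data.Integer.Tactic.RingSolver using () renaming (solve-∀ to ℤsolve-∀)
      r : ∀ x y → y ≡ (x ℤ.+ y) ℤ.- x
      r = ℤsolve-∀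
      ω-signed : + ω ≡ + a ℤ.* + a ℤ.- + q ℤ.* + q
      ω-signed = trans (r (+ (q * q)) (+ ω)) (cong₂ ℤ._-_ (trans (cong +_ (sym ω≡)) (ℤₚ.pos-* a a)) (ℤₚ.pos-* q q))
      s-signed : + (a * a + q * q) ≡ + a ℤ.* + a ℤ.+ + q ℤ.* + q
      s-signed = cong₂ ℤ._+_ (ℤₚ.pos-* a a) (ℤₚ.pos-* q q)

    module _ (a a' q q' ω : ℕ) (a>0 : 0 < a) (ω>0 : 0 < ω) (ω≡ : a * a ≡ q * q + ω)
             (double : a' * (4 * ((a * q) * ω)) ≡ q' * ((a * a + q * q) * (a * a + q * q))) where

      -- q'/a' is 4 (q/a) times a² ω / (a² + q²)², which is at most 1: doubling a point at most
      -- doubles √(q/a).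
      doubled-lower : a * q' ≤ 4 * q * a'
      doubled-lower = *-cancelˡ-≤ (a * ω) {{m*n≢0 a ω {{>-nonZero a>0}} {{>-nonZero ω>0}}}} (begin
        a * ω * (a * q')                              ≡⟨ r₁ a ω q' ⟩
        q' * ((a * a) * ω)                            ≤⟨ *-monoʳ-≤ q' (*-mono-≤ (m≤m+n (a * a) (q * q)) (≤-trans (m≤n+m ω (q * q)) (≤-trans (≤-reflexive (sym ω≡)) (m≤m+n (a * a) (q * q))))) ⟩
        q' * ((a * a + q * q) * (a * a + q * q))      ≡⟨ sym double ⟩
        a' * (4 * ((a * q) * ω))                      ≡⟨ r₂ a a' q ω ⟩
        a * ω * (4 * q * a')                          ∎)
        where
        r₁ : ∀ a w q → a * w * (a * q) ≡ q * ((a * a) * w)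
        r₁ = solve-∀
        r₂ : ∀ a b q w → b * (4 * ((a * q) * w)) ≡ a * w * (4 * q * b)
        r₂ = solve-∀

      -- For a ≥ 4q the factor 4 a² ω / (a² + q²)² is at least 3; this is a polynomial inequality
      -- once ω is written as 15 q² + y.
      doubled-upper : 4 * q ≤ a → 3 * q * a' ≤ a * q'
      doubled-upper 4q≤a = *-cancelˡ-≤ (4 * (a * ω)) {{m*n≢0 4 (a * ω) {{_}} {{m*n≢0 a ω {{>-nonZero a>0}} {{>-nonZero ω>0}}}}}} (begin
        4 * (a * ω) * (3 * q * a')                        ≡⟨ r₁ a a' q ω ⟩
        3 * (a' * (4 * ((a * q) * ω)))                    ≡⟨ cong (3 *_) double ⟩
        3 * (q' * ((a * a + q * q) * (a * a + q * q)))    ≡⟨ r₂ q' (a * a) (q * q) ⟩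
        q' * (3 * ((a * a + q * q) * (a * a + q * q)))    ≤⟨ *-monoʳ-≤ q' main ⟩
        q' * (4 * ((a * a) * ω))                          ≡⟨ r₃ q' a ω ⟩
        4 * (a * ω) * (a * q')                            ∎)
        where
        r₁ : ∀ a b q w → 4 * (a * w) * (3 * q * b) ≡ 3 * (b * (4 * ((a * q) * w)))
        r₁ = solve-∀
        r₂ : ∀ q x y → 3 * (q * ((x + y) * (x + y))) ≡ q * (3 * ((x + y) * (x + y)))
        r₂ = solve-∀
        r₃ : ∀ q a w → q * (4 * ((a * a) * w)) ≡ 4 * (a * w) * (a * q)
        r₃ = solve-∀
        15q²≤ω : 15 * (q * q) ≤ ω
        15q²≤ω = +-cancelˡ-≤ (q * q) (15 * (q * q)) ω (≤-trans (≤-reflexive (r q)) (≤-trans (*-mono-≤ 4q≤a 4q≤a) (≤-reflexive ω≡)))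
          where
          r : ∀ q → q * q + 15 * (q * q) ≡ (4 * q) * (4 * q)
          r = solve-∀
        poly : ∀ Q y → 3 * ((Q + (15 * Q + y) + Q) * (Q + (15 * Q + y) + Q)) ≤ 4 * ((Q + (15 * Q + y)) * (15 * Q + y))
        poly Q y = subst (3 * ((Q + (15 * Q + y) + Q) * (Q + (15 * Q + y) + Q)) ≤_) (r Q y) (m≤m+n (3 * ((Q + (15 * Q + y) + Q) * (Q + (15 * Q + y) + Q))) (93 * (Q * Q) + 22 * (Q * y) + y * y))
          where
          r : ∀ Q y → 3 * ((Q + (15 * Q + y) + Q) * (Q + (15 * Q + y) + Q)) + (93 * (Q * Q) + 22 * (Q * y) + y * y) ≡ 4 * ((Q + (15 * Q + y)) * (15 * Q + y))
          r = solve-∀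
        main : 3 * ((a * a + q * q) * (a * a + q * q)) ≤ 4 * ((a * a) * ω)
        main = subst₂ (λ x w → 3 * ((x + q * q) * (x + q * q)) ≤ 4 * (x * w)) (trans (cong (λ w → q * q + w) ω≡') (sym ω≡)) ω≡' (poly (q * q) (ω ∸ 15 * (q * q)))
          where
          ω≡' : 15 * (q * q) + (ω ∸ 15 * (q * q)) ≡ ω
          ω≡' = m+[n∸m]≡n 15q²≤ω

    -- x^64 ≤ c^21 x₈ with 21 = 16 + 4 + 1, and c ≤ x.
    eightfold : ∀ c x x₂ x₄ x₈ → 0 < x → c ≤ x → x ^ 4 ≤ c * x₂ → x₂ ^ 4 ≤ c * x₄ → x₄ ^ 4 ≤ c * x₈ → x ^ 43 ≤ x₈
    eightfold c x x₂ x₄ x₈ x>0 c≤x h₂ h₄ h₈ = *-cancelˡ-≤ (x ^ 21) {{m^n≢0 x 21 {{>-nonZero x>0}}}} (begin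
      x ^ 21 * x ^ 43                  ≡⟨ sym (^-distribˡ-+-* x 21 43) ⟩
      x ^ 64                           ≡⟨ sym (^-*-assoc x 4 16) ⟩
      (x ^ 4) ^ 16                     ≤⟨ ^-monoˡ-≤ 16 h₂ ⟩
      (c * x₂) ^ 16                    ≡⟨ trans (^-distribʳ-* c x₂ 16) (cong (c ^ 16 *_) (sym (^-*-assoc x₂ 4 4))) ⟩
      c ^ 16 * (x₂ ^ 4) ^ 4            ≤⟨ *-monoʳ-≤ (c ^ 16) (^-monoˡ-≤ 4 h₄) ⟩
      c ^ 16 * (c * x₄) ^ 4            ≡⟨ cong (c ^ 16 *_) (^-distribʳ-* c x₄ 4) ⟩
      c ^ 16 * (c ^ 4 * x₄ ^ 4)        ≤⟨ *-monoʳ-≤ (c ^ 16) (*-monoʳ-≤ (c ^ 4) h₈) ⟩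
      c ^ 16 * (c ^ 4 * (c * x₈))      ≡⟨ trans (r (c ^ 16) (c ^ 4) c x₈) (cong (_* x₈) (trans (cong (c ^ 16 *_) (sym (^-distribˡ-+-* c 4 1))) (sym (^-distribˡ-+-* c 16 5)))) ⟩
      c ^ 21 * x₈                      ≤⟨ *-monoˡ-≤ x₈ (^-monoˡ-≤ 21 c≤x) ⟩
      x ^ 21 * x₈                      ∎)
      where
      r : ∀ u v c x → u * (v * (c * x)) ≡ u * (v * (c * 1)) * x
      r = solve-∀

    -- X⁴ ≤ 4 K⁴ ν⁴ X ≤ L² ν⁴ X ≤ X³, impossible for X > 1.
    small-remainder : ∀ K L X ν b → 4 * ((K * K) * (K * K)) ≤ L * L → 0 < L → 0 < ν → L * ((ν * ν) * (ν * ν)) < X →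
      X ≤ K * ν * b → (b * b) * (b * b) ≤ 4 * X → ⊥
    small-remainder K L X ν b K≤L L>0 ν>0 L<X X≤ b≤ = <-irrefl refl (begin-strict
      (X * X) * (X * X)                                             ≤⟨ *-mono-≤ (*-mono-≤ X≤ X≤) (*-mono-≤ X≤ X≤) ⟩
      ((K * ν * b) * (K * ν * b)) * ((K * ν * b) * (K * ν * b))     ≡⟨ r₁ K ν b ⟩
      (K * K) * (K * K) * ν⁴ * ((b * b) * (b * b))                  ≤⟨ *-monoʳ-≤ ((K * K) * (K * K) * ν⁴) b≤ ⟩
      (K * K) * (K * K) * ν⁴ * (4 * X)                              ≡⟨ r₂ ((K * K) * (K * K)) ν⁴ X ⟩
      4 * ((K * K) * (K * K)) * (ν⁴ * X)                            ≤⟨ *-monoˡ-≤ (ν⁴ * X) K≤L ⟩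
      L * L * (ν⁴ * X)                                              ≡⟨ r₃ L ν⁴ X ⟩
      (L * ν⁴) * (X * L)                                            ≤⟨ *-mono-≤ (<⇒≤ L<X) (*-monoʳ-≤ X (≤-trans (m≤m*n L ν⁴) (<⇒≤ L<X))) ⟩
      X * (X * X)                                                   <⟨ *-monoˡ-< (X * X) {{m*n≢0 X X}} X>1 ⟩
      X * X * (X * X)                                               ∎)
      where
      ν⁴ = (ν * ν) * (ν * ν)
      instance
        ν≢0 : NonZero ν
        ν≢0 = >-nonZero ν>0
        ν²≢0 : NonZero (ν * ν)
        ν²≢0 = m*n≢0 ν ν
        ν⁴≢0 : NonZero ν⁴
        ν⁴≢0 = m*n≢0 (ν * ν) (ν * ν)
        X≢0 : NonZero X
        X≢0 = >-nonZero (≤-trans (s≤s z≤n) L<X)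
      X>1 : X < X * X
      X>1 = m<m*n X X (≤-trans (s≤s (≤-trans L>0 (m≤m*n L ν⁴))) L<X)
      r₁ : ∀ K v b → ((K * v * b) * (K * v * b)) * ((K * v * b) * (K * v * b)) ≡ (K * K) * (K * K) * ((v * v) * (v * v)) * ((b * b) * (b * b))
      r₁ = solve-∀
      r₂ : ∀ k v X → k * v * (4 * X) ≡ 4 * k * (v * X)
      r₂ = solve-∀
      r₃ : ∀ L v X → L * L * (v * X) ≡ (L * v) * (X * L)
      r₃ = solve-∀

  module _ (S : Abscissae) (positive : ∀ n → Abscissae.p S (suc n) ≡ + ℤ.∣ Abscissae.p S (suc n) ∣) where
    open Abscissae S
    private
      a : ℕ → ℕ
      a n = ℤ.∣ p n ∣

      q<a : ∀ n → q (suc n) < a (suc n)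
      q<a n = go (comp S n)
        where
        go : Component (p (suc n)) (q (suc n)) → q (suc n) < a (suc n)
        go (identity b p≡ q<b) = subst (q (suc n) <_) (cong ℤ.∣_∣ (sym p≡)) q<b
        go (egg b p≡ _) with trans (sym p≡) (positive n)
        ... | ()

      a>0 : ∀ n → 0 < a (suc n)
      a>0 n = ≤-trans (s≤s z≤n) (q<a n)

    H≡∣p∣ : ∀ n → H S (suc n) ≡ ℤ.∣ p (suc n) ∣
    H≡∣p∣ n = m≥n⇒m⊔n≡m (<⇒≤ (q<a n))

    private
      a-mono : ∀ {m n} → suc m ≤ suc n → a (suc m) ≤ a (suc n)
      a-mono {m} {n} m≤n = subst₂ _≤_ (H≡∣p∣ m) (H≡∣p∣ n) (h-mono S m≤n)

      a-double : ∀ i → (a (suc i) * a (suc i)) * (a (suc i) * a (suc i)) ≤ 4 * a (suc i + suc i)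
      a-double i = subst₂ (λ x y → (x * x) * (x * x) ≤ 4 * y) (H≡∣p∣ i) (H≡∣p∣ (i + suc i)) (h-double S i)

      module Doubling (i : ℕ) where
        x = suc i
        ω : ℕ
        ω = a x * a x ∸ q x * q x
        q²<a² : q x * q x < a x * a x
        q²<a² = *-mono-< (q<a i) (q<a i)
        ω≡ : a x * a x ≡ q x * q x + ω
        ω≡ = sym (m+[n∸m]≡n (<⇒≤ q²<a²))
        doubleℕ : a (x + x) * (4 * ((a x * q x) * ω)) ≡ q (x + x) * ((a x * a x + q x * q x) * (a x * a x + q x * q x))
        doubleℕ = signed-double (a x) (a (x + x)) (q x) (q (x + x)) ω (positive i) (positive (i + x)) ω≡ (double i)
        lower : a x * q (x + x) ≤ 4 * q x * a (x + x)
        lower = doubled-lower (a x) (a (x + x)) (q x) (q (x + x)) ω (a>0 i) (m<n⇒0<n∸m q²<a²) ω≡ doubleℕ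
        upper : 4 * q x ≤ a x → 3 * q x * a (x + x) ≤ a x * q (x + x)
        upper = doubled-upper (a x) (a (x + x)) (q x) (q (x + x)) ω (a>0 i) (m<n⇒0<n∸m q²<a²) ω≡ doubleℕ

      -- The squared distance q/a from O grows at least by the factor r from the x-th multiple to
      -- the y-th.
      Far : ℕ → ℕ → ℕ → Set
      Far r x y = r * q x * a y ≤ a x * q y

      far-trans : ∀ {r s} x y z → Far r x (suc y) → Far s (suc y) z → Far (r * s) x z
      far-trans {r} {s} x y z f g = *-cancelˡ-≤ (q (suc y)) {{>-nonZero (q>0 y)}} (begin
        q (suc y) * (r * s * q x * a z)      ≡⟨ r₁ r s (q x) (q (suc y)) (a z) ⟩
        r * q x * (s * q (suc y) * a z)      ≤⟨ *-monoʳ-≤ (r * q x) g ⟩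
        r * q x * (a (suc y) * q z)          ≡⟨ sym (*-assoc (r * q x) (a (suc y)) (q z)) ⟩
        r * q x * a (suc y) * q z            ≤⟨ *-monoˡ-≤ (q z) f ⟩
        a x * q (suc y) * q z                ≡⟨ r₂ (a x) (q (suc y)) (q z) ⟩
        q (suc y) * (a x * q z)              ∎)
        where
        r₁ : ∀ r s x y z → y * (r * s * x * z) ≡ r * x * (s * y * z)
        r₁ = solve-∀
        r₂ : ∀ x y z → x * y * z ≡ y * (x * z)
        r₂ = solve-∀

      far-double : ∀ {c} i → 4 * c * q (suc i) ≤ a (suc i) → c * q (suc i + suc i) ≤ a (suc i + suc i)
      far-double {c} i le = *-cancelˡ-≤ (4 * q x) {{m*n≢0 4 (q x) {{_}} {{>-nonZero (q>0 i)}}}} (begin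
        4 * q x * (c * q (x + x))   ≡⟨ r c (q x) (q (x + x)) ⟩
        4 * c * q x * q (x + x)     ≤⟨ *-monoˡ-≤ (q (x + x)) le ⟩
        a x * q (x + x)             ≤⟨ Doubling.lower i ⟩
        4 * q x * a (x + x)         ∎)
        where
        x = suc i
        r : ∀ c q r → 4 * q * (c * r) ≡ 4 * c * q * r
        r = solve-∀

    module _ (m′ : ℕ) where
      private
        m = suc m′

        -- In the distance √(q/a), the j-th multiple is at most k times as far from O as the m-th.
        Near : ℕ → ℕ → Set
        Near j k = a m * q j ≤ k * k * q m * a j

        -- The triangle inequality for xP and (x + y)P, whose sum and difference are (2x + y)P and
        -- yP.
        near-sum : ∀ {x y k l} → 0 < x → 0 < y → Near x k → Near (x + y) l → Near (x + (x + y)) (k + l) × Near y (k + l)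
        near-sum {suc i} {suc j} {k} {l} _ _ = signed-triangle (a x) (a y) (a (x + y)) (a (x + (x + y))) (q x) (q y) (q (x + y)) (q (x + (x + y)))
          (positive i) (positive j) (positive (i + y)) (positive (i + (x + y))) (q>0 j) (q>0 (i + (x + y))) (coprime j) (coprime (i + (x + y)))
          (a>0 j) (a>0 (i + (x + y))) (q<a i) (q<a (i + y)) (product i j) (sum i j) (distinct i j) (a m) (q m) k l
          where
          x = suc i
          y = suc j

        near-m : Near m 1
        near-m = ≤-reflexive (r (a m) (q m))
          where
          r : ∀ a q → a * q ≡ 1 * 1 * q * a
          r = solve-∀

        near-multiple : ∀ k → Near (suc k * m) (suc k)
        near-multiple zero = subst (λ j → Near j 1) (sym (+-identityʳ m)) near-m
        near-multiple (suc zero) = subst (λ j → Near (m + j) 2) (sym (+-identityʳ m)) (Doubling.lower m′)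
        near-multiple (suc (suc k)) = proj₁ (near-sum {m} {suc k * m} {1} {suc (suc k)} (s≤s z≤n) (s≤s z≤n) near-m (near-multiple (suc k)))

        too-far : ∀ {r} y → 5 ≤ r → Far r m (suc y) → ¬ Near (suc y) 2
        too-far {r} y 5≤r far near = <-irrefl refl (begin-strict
          4 * q m * a (suc y)     <⟨ *-monoˡ-< (a (suc y)) {{>-nonZero (a>0 y)}} (*-monoˡ-< (q m) {{>-nonZero (q>0 m′)}} (≤-refl {5})) ⟩
          5 * q m * a (suc y)     ≤⟨ *-monoˡ-≤ (a (suc y)) (*-monoˡ-≤ (q m) 5≤r) ⟩
          r * q m * a (suc y)     ≤⟨ far ⟩
          a m * q (suc y)         ≤⟨ near ⟩
          4 * q m * a (suc y)     ∎)

        -- A doubling may divide a/q by 4, so 64 leaves room for three doublings that each multiply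
        -- q/a by at least 3. The resulting 9 and 27 exceed 4 = 2², so 4mP and 8mP are not `Near`
        -- with factor 2.
        module Contraction (large : 64 * q m ≤ a m) where
          far₂ : Far 3 m (m + m)
          far₂ = Doubling.upper m′ (≤-trans (*-monoˡ-≤ (q m) (≤ᵇ⇒≤ 4 64 _)) large)
          large₂ : 16 * q (m + m) ≤ a (m + m)
          large₂ = far-double {16} m′ large
          far₄ : Far 9 m ((m + m) + (m + m))
          far₄ = far-trans {3} {3} m (m′ + m) ((m + m) + (m + m)) far₂ (Doubling.upper (m′ + m) (≤-trans (*-monoˡ-≤ (q (m + m)) (≤ᵇ⇒≤ 4 16 _)) large₂))
          far₈ : Far 27 m (((m + m) + (m + m)) + ((m + m) + (m + m)))
          far₈ = far-trans {9} {3} m (m′ + m + (m + m)) (((m + m) + (m + m)) + ((m + m) + (m + m))) far₄ (Doubling.upper (m′ + m + (m + m)) (far-double {4} (m′ + m) large₂))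

          not-near₄ : ¬ Near (4 * m) 2
          not-near₄ near = too-far (m′ + m + (m + m)) (≤ᵇ⇒≤ 5 9 _) far₄ (subst (λ j → Near j 2) (r m) near)
            where
            r : ∀ m → 4 * m ≡ (m + m) + (m + m)
            r = solve-∀
          not-near₈ : ¬ Near (8 * m) 2
          not-near₈ near = too-far (m′ + m + (m + m) + ((m + m) + (m + m))) (≤ᵇ⇒≤ 5 27 _) far₈ (subst (λ j → Near j 2) (r m) near)
            where
            r : ∀ m → 8 * m ≡ ((m + m) + (m + m)) + ((m + m) + (m + m))
            r = solve-∀

      module _ (n′ e : ℕ) (m<n : m < suc n′) (odd : ¬ 2 ℕD.∣ suc n′) (q≡ : q (suc n′) ≡ q m) (e≡ : e ≡ 25) (large : 2 ^ e * q m ^ 4 ≤ a m) where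
        private
          n = suc n′

          -- The denominators agree, and numerators grow with the index.
          near-n : Near n 1
          near-n = ≤-trans (*-mono-≤ (a-mono (<⇒≤ m<n)) (≤-reflexive q≡)) (≤-reflexive (r (a n) (q m)))
            where
            r : ∀ a q → a * q ≡ 1 * 1 * q * a
            r = solve-∀

          ν>0 = q>0 m′

          large₆₄ : 64 * q m ≤ a m
          large₆₄ = ≤-trans (*-mono-≤ (subst (λ e → 64 ≤ 2 ^ e) (sym e≡) (≤ᵇ⇒≤ 64 (2 ^ 25) _)) (m≤m*n (q m) (q m ^ 3) {{m^n≢0 (q m) 3 {{>-nonZero ν>0}}}})) large

          open Contraction large₆₄

          -- Even c contradict the oddness of n. For c = 3, 5, 7 the sum or the difference of nP and
          -- mP is 4mP or 8mP, which would be `Near` with factor 1 + 1.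
          not-multiple : ∀ c → c < 8 → n ≢ c * m
          not-multiple 0 _ ()
          not-multiple 1 _ e = <-irrefl (trans (sym (+-identityʳ m)) (sym e)) m<n
          not-multiple 2 _ e = odd (subst (2 ℕD.∣_) (sym e) (ℕD.m∣m*n m))
          not-multiple 3 _ e = not-near₄ (proj₁ (near-sum {m} {2 * m} {1} {1} (s≤s z≤n) (s≤s z≤n) near-m (subst (λ j → Near j 1) e near-n)))
          not-multiple 4 _ e = odd (subst (2 ℕD.∣_) (sym e) (ℕD.∣-trans (ℕD.divides 2 refl) (ℕD.m∣m*n {4} m)))
          not-multiple 5 _ e = not-near₄ (proj₂ (near-sum {m} {4 * m} {1} {1} (s≤s z≤n) (s≤s z≤n) near-m (subst (λ j → Near j 1) e near-n)))
          not-multiple 6 _ e = odd (subst (2 ℕD.∣_) (sym e) (ℕD.∣-trans (ℕD.divides 3 refl) (ℕD.m∣m*n {6} m)))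
          not-multiple 7 _ e = not-near₈ (proj₁ (near-sum {m} {6 * m} {1} {1} (s≤s z≤n) (s≤s z≤n) near-m (subst (λ j → Near j 1) e near-n)))
          not-multiple (suc (suc (suc (suc (suc (suc (suc (suc c)))))))) c<8 _ = <⇒≱ c<8 (m≤m+n 8 c)

          -- As 2 (r + 1) ≤ m, the fourth power of a (r + 1) is at most 4 a m, too small for a point
          -- this close to O. L = 2^14 satisfies 4 · 81⁴ ≤ L², where 81 = 9².
          not-near-remainder : ∀ k r L → L ≡ 2 ^ 14 → k ≤ 9 → suc r + suc r ≤ m → ¬ Near (suc r) k
          not-near-remainder k r L L≡ k≤9 2r≤m near = small-remainder (k * k) L (a m) (q m) (a (suc r)) K≤L (subst (0 <_) (sym L≡) (m^n>0 2 14)) ν>0 L<X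
            (≤-trans (m≤m*n (a m) (q (suc r)) {{>-nonZero (q>0 r)}}) near) (≤-trans (a-double r) (*-monoʳ-≤ 4 (a-mono 2r≤m)))
            where
            k²≤ : k * k ≤ 81
            k²≤ = *-mono-≤ k≤9 k≤9
            K≤L : 4 * ((k * k * (k * k)) * (k * k * (k * k))) ≤ L * L
            K≤L = ≤-trans (*-monoʳ-≤ 4 (*-mono-≤ (*-mono-≤ k²≤ k²≤) (*-mono-≤ k²≤ k²≤))) (subst (λ L → 4 * ((81 * 81) * (81 * 81)) ≤ L * L) (sym L≡) (≤ᵇ⇒≤ (4 * ((81 * 81) * (81 * 81))) (2 ^ 14 * 2 ^ 14) _))
            ν⁴ = (q m * q m) * (q m * q m)
            ν⁴≡ : q m ^ 4 ≡ ν⁴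
            ν⁴≡ = r₀ (q m)
              where
              r₀ : ∀ v → v * (v * (v * (v * 1))) ≡ (v * v) * (v * v)
              r₀ = solve-∀
            L<X : L * ν⁴ < a m
            L<X = ≤-trans (*-monoˡ-< ν⁴ {{subst NonZero ν⁴≡ (m^n≢0 (q m) 4 {{>-nonZero ν>0}})}} (subst₂ (λ L e → L < 2 ^ e) (sym L≡) (sym e≡) (<ᵇ⇒< (2 ^ 14) (2 ^ 25) _)))
              (≤-trans (≤-reflexive (cong (2 ^ e *_) (sym ν⁴≡))) large)

          far-apart : 8 * m ≤ n → a m ^ 43 ≤ a n
          far-apart 8m≤n = ≤-trans (eightfold 4 (a m) (a (m + m)) (a (m + m + (m + m))) (a (m + m + (m + m) + (m + m + (m + m)))) (a>0 m′)
              (≤-trans (m≤n*m 4 (16 * q m) {{m*n≢0 16 (q m) {{_}} {{>-nonZero ν>0}}}}) (≤-trans (≤-reflexive (r (q m))) large₆₄))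
              (fourth m′) (fourth (m′ + m)) (fourth (m′ + m + (m + m))))
            (a-mono (subst (_≤ n) (r₈ m) 8m≤n))
            where
            r : ∀ q → 16 * q * 4 ≡ 64 * q
            r = solve-∀
            r₈ : ∀ m → 8 * m ≡ m + m + (m + m) + (m + m + (m + m))
            r₈ = solve-∀
            fourth : ∀ i → a (suc i) ^ 4 ≤ 4 * a (suc i + suc i)
            fourth i = ≤-trans (≤-reflexive (r₄ (a (suc i)))) (a-double i)
              where
              r₄ : ∀ v → v * (v * (v * (v * 1))) ≡ (v * v) * (v * v)
              r₄ = solve-∀

          not-close : ¬ n < 8 * m
          not-close n<8m = by-remainder (n % m) refl
            where
            c = n / m
            division : n ≡ n % m + c * m
            division = m≡m%n+[m/n]*n n m
            c<8 : c < 8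
            c<8 = *-cancelʳ-< m c 8 (≤-trans (s≤s (≤-trans (m≤n+m (c * m) (n % m)) (≤-reflexive (sym division)))) n<8m)
            -- The remainder of n modulo m is r + 1. If it is at most m/2, it is reached as nP -
            -- cmP, at distance factor c + 1. Otherwise m minus the remainder is, as (c + 1)mP - nP,
            -- with factor c + 2 ≤ 9.
            by-quotient : ∀ r c → c < 8 → suc r < m → n ≡ suc r + c * m → ⊥
            by-quotient r zero _ r<m n≡ = <⇒≱ m<n (≤-trans (≤-reflexive n≡) (≤-trans (≤-reflexive (+-identityʳ (suc r))) (<⇒≤ r<m)))
            by-quotient r (suc c) c<8 r<m n≡ = go (≤-total (suc r + suc r) m)
              where
              go : suc r + suc r ≤ m ⊎ m ≤ suc r + suc r → ⊥
              go (inj₁ 2r≤m) = not-near-remainder (suc c + 1) r (2 ^ 14) refl (+-monoˡ-≤ 1 (<⇒≤ c<8)) 2r≤m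
                (proj₂ (near-sum {suc c * m} {suc r} {suc c} {1} (s≤s z≤n) (s≤s z≤n) (near-multiple c) (subst (λ j → Near j 1) (trans n≡ (+-comm (suc r) (suc c * m))) near-n)))
              go (inj₂ m≤2r) = below (m ∸ suc r) (m+[n∸m]≡n (<⇒≤ r<m))
                where
                below : ∀ t → suc r + t ≡ m → ⊥
                below zero e = <-irrefl (trans (sym (+-identityʳ (suc r))) e) r<m
                below (suc t) e = not-near-remainder (1 + suc (suc c)) t (2 ^ 14) refl (s≤s c<8) (≤-trans (+-monoˡ-≤ (suc t) (+-cancelˡ-≤ (suc r) (suc t) (suc r) (≤-trans (≤-reflexive e) m≤2r))) (≤-reflexive e))
                  (proj₂ (near-sum {n} {suc t} {1} {suc (suc c)} (s≤s z≤n) (s≤s z≤n) near-n (subst (λ j → Near j (suc (suc c))) n+t (near-multiple (suc c)))))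
                  where
                  n+t : m + suc c * m ≡ n + suc t
                  n+t = trans (cong (_+ suc c * m) (sym e)) (trans (r₁ (suc r) (suc t) (suc c * m)) (cong (_+ suc t) (sym n≡)))
                    where
                    r₁ : ∀ x y z → x + y + z ≡ x + z + y
                    r₁ = solve-∀
            by-remainder : ∀ r → n % m ≡ r → ⊥
            by-remainder zero r≡ = not-multiple c c<8 (trans division (cong (_+ c * m) r≡))
            by-remainder (suc r) r≡ = by-quotient r c c<8 (subst (_< m) r≡ (m%n<n n m)) (trans division (cong (_+ c * m) r≡))

        gap : a m ^ 43 ≤ a n
        gap = go (8 * m ≤? n)
          where
          go : _ → a m ^ 43 ≤ a n
          go (yes 8m≤n) = far-apart 8m≤n
          go (no n<8m) = ⊥-elim (not-close (≰⇒> n<8m))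

-- From the orbit to its abscissae in lowest terms

module Reduction where

  open Line
  open Multiples
  open Fractions
  open Heights
  open import Data.Nat as ℕ using (ℕ; suc)
  open import Data.Integer as ℤ using (ℤ; +_; 0ℤ)
  import Data.Integer.Properties as ℤₚ
  open import Data.Rational using (0ℚ; _+_; _*_; _-_; -_; ↥_; ↧ₙ_)
  open import Data.Rational.Properties
  open import Data.Rational.Solver using (module +-*-Solver)
  open +-*-Solver
  open import Data.Product using (∃; _,_; proj₁; proj₂)
  open import Relation.Binary.PropositionalEquality

  private
    positive-product : ∀ {a b c d} → (∃ λ k → a ≡ + suc k) → 0 ℕ.< b → 0 ℕ.< c → 0 ℕ.< d → ∃ λ k → a ℤ.* (+ b ℤ.* (+ c ℤ.* + d)) ≡ + suc k
    positive-product {b = suc b} {suc c} {suc d} (k , refl) _ _ _ = _ , refl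

  -- For y = n / d the curve equation with cleared denominators is M³ d² p (p² - q²) = n² q³, and n
  -- ≢ 0.
  componentZ : ∀ {M} → 0 ℕ.< M → ∀ {D} → D ≡ ι (+ M) * ι (+ M) → ∀ {x y} → On D x y → y ≢ 0ℚ → (F : Fraction M x) →
    let p = Fraction.p F; q = + Fraction.q F in ∃ λ k → p ℤ.* (p ℤ.* p ℤ.- q ℤ.* q) ≡ + suc k
  componentZ {M} M>0 {D} D≡ {x} {y} on y≢0 F =
    pos*⇒pos (M ℕ.* M ℕ.* M ℕ.* (d ℕ.* d)) c (proj₁ right) (trans (cong (ℤ._* c) cast) (trans cleared (proj₂ right)))
    where
    p = Fraction.p F
    q = Fraction.q F
    n = ↥ y
    d = ↧ₙ y
    c = p ℤ.* (p ℤ.* p ℤ.- + q ℤ.* + q)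
    m = ι (+ M)
    n≢0 : n ≢ 0ℤ
    n≢0 e = y≢0 (integral-domain (ι (+ d)) y (trans (*-comm (ι (+ d)) y) (trans (*-denominator y) (cong ι e))) (ι≢0 {+ d} λ ()))
    right : ∃ λ k → (n ℤ.* n) ℤ.* (+ q ℤ.* (+ q ℤ.* + q)) ≡ + suc k
    right = positive-product (square-pos n n≢0) (Fraction.q>0 F) (Fraction.q>0 F) (Fraction.q>0 F)
    cast : + (M ℕ.* M ℕ.* M ℕ.* (d ℕ.* d)) ≡ (+ M ℤ.* + M ℤ.* + M) ℤ.* (+ d ℤ.* + d)
    cast = trans (ℤₚ.pos-* (M ℕ.* M ℕ.* M) (d ℕ.* d)) (cong₂ ℤ._*_ (trans (ℤₚ.pos-* (M ℕ.* M) M) (cong (ℤ._* + M) (ℤₚ.pos-* M M))) (ℤₚ.pos-* d d))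
    P = ι p
    Q = ι (+ q)
    δ = ι (+ d)
    r₁ : ∀ m d p q → ((m * m * m) * (d * d)) * (p * (p * p - q * q)) ≡ (d * d) * ((m * p) * (m * p) * (m * p) - (m * m) * (q * q) * (m * p))
    r₁ = solve 4 (λ m d p q → ((m :* m :* m) :* (d :* d)) :* (p :* (p :* p :- q :* q)) := (d :* d) :* ((m :* p) :* (m :* p) :* (m :* p) :- (m :* m) :* (q :* q) :* (m :* p))) refl
    r₂ : ∀ D d x q → (d * d) * ((x * q) * (x * q) * (x * q) - D * (q * q) * (x * q)) ≡ (d * d) * ((x * x * x - D * x) * (q * (q * q)))
    r₂ = solve 4 (λ D d x q → (d :* d) :* ((x :* q) :* (x :* q) :* (x :* q) :- D :* (q :* q) :* (x :* q)) := (d :* d) :* ((x :* x :* x :- D :* x) :* (q :* (q :* q)))) refl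
    r₃ : ∀ d y s → (d * d) * ((y * y) * s) ≡ ((y * d) * (y * d)) * s
    r₃ = solve 3 (λ d y s → (d :* d) :* ((y :* y) :* s) := ((y :* d) :* (y :* d)) :* s) refl
    rational : ((m * m * m) * (δ * δ)) * (P * (P * P - Q * Q)) ≡ (ι n * ι n) * (Q * (Q * Q))
    rational = trans (r₁ m δ P Q) (trans (cong₂ (λ s t → (δ * δ) * (s * s * s - t * (Q * Q) * s)) (sym (Fraction.value F)) (sym D≡))
      (trans (r₂ D δ x Q) (trans (cong (λ t → (δ * δ) * (t * (Q * (Q * Q)))) (sym on)) (trans (r₃ δ y (Q * (Q * Q))) (cong (λ t → (t * t) * (Q * (Q * Q))) (*-denominator y))))))
    cleared : ((+ M ℤ.* + M ℤ.* + M) ℤ.* (+ d ℤ.* + d)) ℤ.* c ≡ (n ℤ.* n) ℤ.* (+ q ℤ.* (+ q ℤ.* + q))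
    cleared = ι-injective (trans (sym (trans (cong₂ _*_ left₁ left₂) (ι-* ((+ M ℤ.* + M ℤ.* + M) ℤ.* (+ d ℤ.* + d)) c)))
      (trans rational (trans (cong₂ _*_ (ι-* n n) (trans (cong (Q *_) (ι-* (+ q) (+ q))) (ι-* (+ q) (+ q ℤ.* + q)))) (ι-* (n ℤ.* n) (+ q ℤ.* (+ q ℤ.* + q))))))
      where
      left₁ : (m * m * m) * (δ * δ) ≡ ι ((+ M ℤ.* + M ℤ.* + M) ℤ.* (+ d ℤ.* + d))
      left₁ = trans (cong₂ _*_ (trans (cong (_* m) (ι-* (+ M) (+ M))) (ι-* (+ M ℤ.* + M) (+ M))) (ι-* (+ d) (+ d))) (ι-* (+ M ℤ.* + M ℤ.* + M) (+ d ℤ.* + d))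
      left₂ : P * (P * P - Q * Q) ≡ ι c
      left₂ = trans (cong (P *_) (trans (cong₂ _-_ (ι-* p p) (ι-* (+ q) (+ q))) (ι-- (p ℤ.* p) (+ q ℤ.* + q)))) (ι-* p (p ℤ.* p ℤ.- + q ℤ.* + q))

  module _ {N P} (O : Orbit N P) {M : ℕ} (M>0 : 0 ℕ.< M) (D≡ : Orbit.D O ≡ ι (+ M) * ι (+ M)) where
    open Orbit O

    reduced : ∀ n → Fraction M (x n)
    reduced n = fraction M M>0 (x n)

    abscissae : Abscissae
    abscissae = record
      { p = λ n → Fraction.p (reduced n)
      ; q = λ n → Fraction.q (reduced n)
      ; q>0 = λ n → Fraction.q>0 (reduced (suc n))
      ; coprime = λ n → Fraction.coprime (reduced (suc n))
      ; component = λ n → componentZ M>0 D≡ (on-curve n) (y≢0 n) (reduced (suc n))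
      ; product = λ i j → PairZ.productZ M>0 D≡ (reduced (suc i)) (reduced (suc j)) (reduced (suc i ℕ.+ suc j)) (reduced (suc i ℕ.+ (suc i ℕ.+ suc j)))
          (pair-product (proj₂ (sum-line i j)) (proj₂ (sum-line i (i ℕ.+ suc j))) (on-curve i) (x-injective i j))
      ; sum = λ i j → PairZ.sumZ M>0 D≡ (reduced (suc i)) (reduced (suc j)) (reduced (suc i ℕ.+ suc j)) (reduced (suc i ℕ.+ (suc i ℕ.+ suc j)))
          (pair-sum (proj₂ (sum-line i j)) (proj₂ (sum-line i (i ℕ.+ suc j))) (on-curve i))
      ; distinct = λ i j → distinctZ M>0 D≡ (reduced (suc i)) (reduced (suc i ℕ.+ suc j)) (x-injective i j)
      ; double = λ i → doubleZ M>0 D≡ {x (suc i)} {y (suc i)} {x (suc i ℕ.+ suc i)} (reduced (suc i)) (reduced (suc i ℕ.+ suc i)) (on-curve i) (doubling (proj₂ (sum-line i i)) (on-curve i))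
      }

-- Signs, the tripling check and the contradiction

module Conclusion where

  open Heights
  open Growth
  open Gap
  open Pade using (pade; square-cancel-≤)
  open import Data.Nat hiding (parity)
  open import Data.Nat.Properties
  import Data.Nat.Divisibility as ℕD
  open import Data.Nat.Tactic.RingSolver using (solve-∀)
  import Data.Integer as ℤ
  import Data.Integer.Properties as ℤₚ
  open import Data.Integer using (ℤ; +_; -[1+_])
  open import Data.Integer.Tactic.RingSolver using () renaming (solve-∀ to ℤsolve-∀)
  open import Data.Product using (∃; _×_; _,_; proj₁; proj₂)
  open import Data.Sum using (_⊎_; inj₁; inj₂)
  open import Data.Empty using (⊥; ⊥-elim)
  open import Relation.Binary.PropositionalEquality
  open import Relation.Nullary using (¬_)
  open import Relation.Nullary.Decidable using (toWitness; _⊎-dec_; ¬?)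
  open ≤-Reasoning

  private
    square : ∀ z → z ℤ.* z ≡ + (ℤ.∣ z ∣ * ℤ.∣ z ∣)
    square (+ n)    = sym (ℤₚ.pos-* n n)
    square -[1+ n ] = refl

    nonneg : ∀ z w Q α → z ℤ.* + suc w ≡ + Q ℤ.* (α ℤ.* α) → ∃ λ k → z ≡ + k
    nonneg (+ k) _ _ _ _ = k , refl
    nonneg -[1+ k ] w Q α e with trans e (trans (cong (+ Q ℤ.*_) (square α)) (sym (ℤₚ.pos-* Q (ℤ.∣ α ∣ * ℤ.∣ α ∣))))
    ... | ()

    Positive Negative : ℤ → Set
    Positive p = p ≡ + ℤ.∣ p ∣
    Negative p = ∃ λ a → p ≡ -[1+ a ]

    positive-factor : ∀ {p p' q'} → Component p' q' → 0 < ℤ.∣ p ∣ → Positive p → (∃ λ k → p ℤ.* p' ≡ + k) → Positive p'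
    positive-factor (identity a refl _) _ _ _ = refl
    positive-factor {+ suc a} (egg b refl _) _ _ (_ , ())
    positive-factor { -[1+ a ]} (egg b refl _) _ () _

    negative-factor : ∀ {p p' q'} → Component p' q' → Negative p → (∃ λ k → p ℤ.* p' ≡ + k) → Negative p'
    negative-factor (egg a p≡ _) _ _ = a , p≡
    negative-factor (identity zero _ ()) _ _
    negative-factor (identity (suc a) refl _) (b , refl) (_ , ())

  module _ (S : Abscissae) where
    open Abscissae S
    private
      -- These are the abscissae of R - P and R + P for R = (n + 2)P, and their product is a square
      -- by `product`. So parity of the index governs the component.
      nonneg-product : ∀ n → ∃ λ k → p (suc n) ℤ.* p (suc (suc (suc n))) ≡ + k
      nonneg-product n = nonneg (p (suc n) ℤ.* p (suc (suc (suc n)))) (proj₁ β²) (q (suc n) * q (suc (suc (suc n)))) (p 1 ℤ.* p (suc (suc n)) ℤ.+ + q 1 ℤ.* + q (suc (suc n)))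
        (trans (cong ((p (suc n) ℤ.* p (suc (suc (suc n)))) ℤ.*_) (sym (proj₂ β²)))
          (trans (product 0 n) (cong (ℤ._* ((p 1 ℤ.* p (suc (suc n)) ℤ.+ + q 1 ℤ.* + q (suc (suc n))) ℤ.* (p 1 ℤ.* p (suc (suc n)) ℤ.+ + q 1 ℤ.* + q (suc (suc n))))) (sym (ℤₚ.pos-* (q (suc n)) (q (suc (suc (suc n)))))))))
        where
        β² = square-pos (p (suc (suc n)) ℤ.* + q 1 ℤ.- p 1 ℤ.* + q (suc (suc n))) (distinct 0 n)

      ∣p∣>0 : ∀ n → 0 < ℤ.∣ p (suc n) ∣
      ∣p∣>0 n = go (comp S n)
        where
        go : Component (p (suc n)) (q (suc n)) → 0 < ℤ.∣ p (suc n) ∣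
        go (identity a p≡ q<a) = subst (0 <_) (cong ℤ.∣_∣ (sym p≡)) (≤-trans (s≤s z≤n) q<a)
        go (egg a p≡ _) = subst (0 <_) (cong ℤ.∣_∣ (sym p≡)) (s≤s z≤n)

      positive-double : Positive (p 2)
      positive-double = sym (trans (cong (λ z → + ℤ.∣ z ∣) (proj₂ p₂≥0)) (sym (proj₂ p₂≥0)))
        where
        r : ∀ p q → + 4 ℤ.* ((p ℤ.* q) ℤ.* (p ℤ.* p ℤ.- q ℤ.* q)) ≡ + 4 ℤ.* (q ℤ.* (p ℤ.* (p ℤ.* p ℤ.- q ℤ.* q)))
        r = ℤsolve-∀
        pos : ∀ {x} q → 0 < q → (∃ λ k → x ≡ + suc k) → ∃ λ k → + 4 ℤ.* (+ q ℤ.* x) ≡ + suc k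
        pos (suc q) _ (k , refl) = _ , refl
        f = pos (q 1) (q>0 0) (component 0)
        p₂≥0 : ∃ λ k → p 2 ≡ + k
        p₂≥0 = nonneg (p 2) (proj₁ f) (q 2) (p 1 ℤ.* p 1 ℤ.+ + q 1 ℤ.* + q 1) (trans (cong (p 2 ℤ.*_) (sym (trans (r (p 1) (+ q 1)) (proj₂ f)))) (double 0))

      all-positive : Positive (p 1) → ∀ n → Positive (p (suc n))
      all-positive h zero = h
      all-positive h (suc zero) = positive-double
      all-positive h (suc (suc n)) = positive-factor {p (suc n)} (comp S (suc (suc n))) (∣p∣>0 n) (all-positive h n) (nonneg-product n)

      odd-negative : Negative (p 1) → ∀ k → Negative (p (suc (k + k)))
      odd-negative h zero = h
      odd-negative h (suc k) = subst (λ n → Negative (p (suc (suc n)))) (sym (+-suc k k)) (negative-factor {p (suc (k + k))} (comp S (suc (suc (k + k)))) (odd-negative h k) (nonneg-product (k + k)))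

      H-negative : ∀ {n} → Negative (p (suc n)) → H S (suc n) ≡ q (suc n)
      H-negative {n} (a , p≡) = go (comp S n)
        where
        go : Component (p (suc n)) (q (suc n)) → H S (suc n) ≡ q (suc n)
        go (egg b p≡b b<q) = trans (cong (λ z → ℤ.∣ z ∣ ⊔ q (suc n)) p≡b) (m≤n⇒m⊔n≡n (<⇒≤ b<q))
        go (identity b p≡b _) with trans (sym p≡) p≡b
        ... | ()

      H₁<H₂ : H S 1 < H S 2
      H₁<H₂ = *-cancelˡ-< 4 (H S 1) (H S 2) (begin-strict
        4 * H S 1                              <⟨ *-monoʳ-< 4 (m<m*n (H S 1) (H S 1) {{>-nonZero (h>0 S 0)}} (h₁≥2 S)) ⟩
        4 * (H S 1 * H S 1)                    ≤⟨ *-monoˡ-≤ (H S 1 * H S 1) (*-mono-≤ (h₁≥2 S) (h₁≥2 S)) ⟩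
        (H S 1 * H S 1) * (H S 1 * H S 1)      ≤⟨ h-double S 0 ⟩
        4 * H S 2                              ∎)

      -- On the egg the height is the denominator, which cannot return to its first value.
      positive₁ : ∀ k → q (suc (suc k + suc k)) ≡ q 1 → Positive (p 1)
      positive₁ k q≡ = go (comp S 0)
        where
        go : Component (p 1) (q 1) → Positive (p 1)
        go (identity a p≡ _) = trans p≡ (cong (λ z → + ℤ.∣ z ∣) (sym p≡))
        go (egg a p≡ _) = ⊥-elim (<⇒≱ H₁<H₂ (≤-trans (h-mono S {1} {suc (suc k + suc k)} (s≤s (s≤s z≤n)))
          (≤-reflexive (trans (H-negative (odd-negative (a , p≡) (suc k))) (trans q≡ (sym (H-negative (a , p≡))))))))

    -- Tripling

    private
      e f : ℕ → ℕ → ℕ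
      e a q = (a * a + q * q) * (a * a + q * q)
      f a q = 4 * ((a * q) * (a * a ∸ q * q))

      dist : ℕ → ℕ → ℕ
      dist x y = (x ∸ y) + (y ∸ x)

      -- `e` / `f` is the abscissa of 2P before reduction. If 3P had the denominator q, then a p₃ d²
      -- = q² s² with d = |e q - a f| and s = a e + q f. Evaluation shows that a d² never divides q²
      -- s² in this range.
      no-tripling : ∀ {a} → a < 56 → ∀ {q} → q < a → q ≡ 0 ⊎ ¬ (a * (dist (e a q * q) (a * f a q) * dist (e a q * q) (a * f a q)) ℕD.∣ (q * q) * ((a * e a q + q * f a q) * (a * e a q + q * f a q)))
      no-tripling = toWitness {a? = allUpTo? (λ a → allUpTo? (λ q → (q ≟ 0) ⊎-dec ¬? (a * (dist (e a q * q) (a * f a q) * dist (e a q * q) (a * f a q)) ℕD.∣? (q * q) * ((a * e a q + q * f a q) * (a * e a q + q * f a q)))) a) 56} _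

      abs-dist : ∀ x y → ℤ.∣ + x ℤ.- + y ∣ ≡ dist x y
      abs-dist x y with ≤-total x y
      ... | inj₁ x≤y = trans (cong ℤ.∣_∣ (ℤₚ.m-n≡m⊖n x y)) (trans (ℤₚ.∣⊖∣-≤ x≤y) (cong (_+ (y ∸ x)) (sym (m≤n⇒m∸n≡0 x≤y))))
      ... | inj₂ y≤x = trans (cong ℤ.∣_∣ (trans (ℤₚ.m-n≡m⊖n x y) (ℤₚ.⊖-≥ y≤x))) (trans (sym (+-identityʳ (x ∸ y))) (cong (λ t → x ∸ y + t) (sym (m≤n⇒m∸n≡0 y≤x))))

      -- The equations for 2P and 3P, after elimination of 2P
      tripling : ∀ {p₁ p₂ p₃ q₁ q₂ : ℤ} {E F : ℤ} → q₂ ≢ + 0 → (p₁ ℤ.* p₃) ℤ.* ((p₂ ℤ.* q₁ ℤ.- p₁ ℤ.* q₂) ℤ.* (p₂ ℤ.* q₁ ℤ.- p₁ ℤ.* q₂)) ≡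
        (q₁ ℤ.* q₁) ℤ.* ((p₁ ℤ.* p₂ ℤ.+ q₁ ℤ.* q₂) ℤ.* (p₁ ℤ.* p₂ ℤ.+ q₁ ℤ.* q₂)) → p₂ ℤ.* F ≡ q₂ ℤ.* E →
        (p₁ ℤ.* p₃) ℤ.* ((E ℤ.* q₁ ℤ.- p₁ ℤ.* F) ℤ.* (E ℤ.* q₁ ℤ.- p₁ ℤ.* F)) ≡ (q₁ ℤ.* q₁) ℤ.* ((p₁ ℤ.* E ℤ.+ q₁ ℤ.* F) ℤ.* (p₁ ℤ.* E ℤ.+ q₁ ℤ.* F))
      tripling {p₁} {p₂} {p₃} {q₁} {q₂} {E} {F} q₂≢0 product double = cancel _ _ (cancel _ _
          (trans (r₁ p₁ p₃ q₁ q₂ E F) (trans (cong (λ t → (p₁ ℤ.* p₃) ℤ.* ((t ℤ.* q₁ ℤ.- p₁ ℤ.* q₂ ℤ.* F) ℤ.* (t ℤ.* q₁ ℤ.- p₁ ℤ.* q₂ ℤ.* F))) (sym double))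
            (trans (r₂ p₁ p₂ p₃ q₁ q₂ F) (trans (cong (F ℤ.* F ℤ.*_) product) (trans (r₃ p₁ p₂ q₁ q₂ F)
              (trans (cong (λ t → (q₁ ℤ.* q₁) ℤ.* ((p₁ ℤ.* t ℤ.+ q₁ ℤ.* q₂ ℤ.* F) ℤ.* (p₁ ℤ.* t ℤ.+ q₁ ℤ.* q₂ ℤ.* F))) double) (r₄ p₁ q₁ q₂ E F))))))))
        where
        cancel : ∀ x y → q₂ ℤ.* x ≡ q₂ ℤ.* y → x ≡ y
        cancel x y = ℤₚ.*-cancelˡ-≡ q₂ x y {{ℤ.≢-nonZero q₂≢0}}
        r₁ : ∀ p₁ p₃ q₁ q₂ E F → q₂ ℤ.* (q₂ ℤ.* ((p₁ ℤ.* p₃) ℤ.* ((E ℤ.* q₁ ℤ.- p₁ ℤ.* F) ℤ.* (E ℤ.* q₁ ℤ.- p₁ ℤ.* F)))) ≡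
          (p₁ ℤ.* p₃) ℤ.* (((q₂ ℤ.* E) ℤ.* q₁ ℤ.- p₁ ℤ.* q₂ ℤ.* F) ℤ.* ((q₂ ℤ.* E) ℤ.* q₁ ℤ.- p₁ ℤ.* q₂ ℤ.* F))
        r₁ = ℤsolve-∀
        r₂ : ∀ p₁ p₂ p₃ q₁ q₂ F → (p₁ ℤ.* p₃) ℤ.* (((p₂ ℤ.* F) ℤ.* q₁ ℤ.- p₁ ℤ.* q₂ ℤ.* F) ℤ.* ((p₂ ℤ.* F) ℤ.* q₁ ℤ.- p₁ ℤ.* q₂ ℤ.* F)) ≡
          F ℤ.* F ℤ.* ((p₁ ℤ.* p₃) ℤ.* ((p₂ ℤ.* q₁ ℤ.- p₁ ℤ.* q₂) ℤ.* (p₂ ℤ.* q₁ ℤ.- p₁ ℤ.* q₂)))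
        r₂ = ℤsolve-∀
        r₃ : ∀ p₁ p₂ q₁ q₂ F → F ℤ.* F ℤ.* ((q₁ ℤ.* q₁) ℤ.* ((p₁ ℤ.* p₂ ℤ.+ q₁ ℤ.* q₂) ℤ.* (p₁ ℤ.* p₂ ℤ.+ q₁ ℤ.* q₂))) ≡
          (q₁ ℤ.* q₁) ℤ.* ((p₁ ℤ.* (p₂ ℤ.* F) ℤ.+ q₁ ℤ.* q₂ ℤ.* F) ℤ.* (p₁ ℤ.* (p₂ ℤ.* F) ℤ.+ q₁ ℤ.* q₂ ℤ.* F))
        r₃ = ℤsolve-∀
        r₄ : ∀ p₁ q₁ q₂ E F → (q₁ ℤ.* q₁) ℤ.* ((p₁ ℤ.* (q₂ ℤ.* E) ℤ.+ q₁ ℤ.* q₂ ℤ.* F) ℤ.* (p₁ ℤ.* (q₂ ℤ.* E) ℤ.+ q₁ ℤ.* q₂ ℤ.* F)) ≡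
          q₂ ℤ.* (q₂ ℤ.* ((q₁ ℤ.* q₁) ℤ.* ((p₁ ℤ.* E ℤ.+ q₁ ℤ.* F) ℤ.* (p₁ ℤ.* E ℤ.+ q₁ ℤ.* F))))
        r₄ = ℤsolve-∀

      tripling-∣ : ∀ a q (p₃ E′ F′ : ℤ) → E′ ≡ + e a q → F′ ≡ + f a q →
        (+ a ℤ.* p₃) ℤ.* ((E′ ℤ.* + q ℤ.- + a ℤ.* F′) ℤ.* (E′ ℤ.* + q ℤ.- + a ℤ.* F′)) ≡ (+ q ℤ.* + q) ℤ.* ((+ a ℤ.* E′ ℤ.+ + q ℤ.* F′) ℤ.* (+ a ℤ.* E′ ℤ.+ + q ℤ.* F′)) →
        a * (dist (e a q * q) (a * f a q) * dist (e a q * q) (a * f a q)) ℕD.∣ (q * q) * ((a * e a q + q * f a q) * (a * e a q + q * f a q))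
      tripling-∣ a q p₃ E′ F′ E≡ F≡ eq = ℕD.divides ℤ.∣ p₃ ∣ (sym (trans (r ℤ.∣ p₃ ∣ a (d * d)) (trans (sym left) (trans (cong ℤ.∣_∣ eq) right))))
        where
        d = dist (e a q * q) (a * f a q)
        r : ∀ x a d → x * (a * d) ≡ a * x * d
        r = solve-∀
        d≡ : ℤ.∣ E′ ℤ.* + q ℤ.- + a ℤ.* F′ ∣ ≡ d
        d≡ = trans (cong ℤ.∣_∣ (cong₂ ℤ._-_ (trans (cong (ℤ._* + q) E≡) (sym (ℤₚ.pos-* (e a q) q))) (trans (cong (+ a ℤ.*_) F≡) (sym (ℤₚ.pos-* a (f a q)))))) (abs-dist (e a q * q) (a * f a q))
        left : ℤ.∣ (+ a ℤ.* p₃) ℤ.* ((E′ ℤ.* + q ℤ.- + a ℤ.* F′) ℤ.* (E′ ℤ.* + q ℤ.- + a ℤ.* F′)) ∣ ≡ a * ℤ.∣ p₃ ∣ * (d * d)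
        left = trans (ℤₚ.abs-* (+ a ℤ.* p₃) _) (cong₂ _*_ (ℤₚ.abs-* (+ a) p₃) (trans (ℤₚ.abs-* (E′ ℤ.* + q ℤ.- + a ℤ.* F′) (E′ ℤ.* + q ℤ.- + a ℤ.* F′)) (cong₂ _*_ d≡ d≡)))
        s≡ : ℤ.∣ + a ℤ.* E′ ℤ.+ + q ℤ.* F′ ∣ ≡ a * e a q + q * f a q
        s≡ = cong ℤ.∣_∣ (cong₂ ℤ._+_ (trans (cong (+ a ℤ.*_) E≡) (sym (ℤₚ.pos-* a (e a q)))) (trans (cong (+ q ℤ.*_) F≡) (sym (ℤₚ.pos-* q (f a q)))))
        right : ℤ.∣ (+ q ℤ.* + q) ℤ.* ((+ a ℤ.* E′ ℤ.+ + q ℤ.* F′) ℤ.* (+ a ℤ.* E′ ℤ.+ + q ℤ.* F′)) ∣ ≡ (q * q) * ((a * e a q + q * f a q) * (a * e a q + q * f a q))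
        right = trans (ℤₚ.abs-* (+ q ℤ.* + q) _) (cong₂ _*_ (ℤₚ.abs-* (+ q) (+ q)) (trans (ℤₚ.abs-* (+ a ℤ.* E′ ℤ.+ + q ℤ.* F′) (+ a ℤ.* E′ ℤ.+ + q ℤ.* F′)) (cong₂ _*_ s≡ s≡)))

      large-p₁ : ∀ a → p 1 ≡ + a → q 1 < a → q 3 ≡ q 1 → 56 ≤ a
      large-p₁ a p≡ q<a q₃≡ = ≮⇒≥ (λ a<56 → go (no-tripling a<56 q<a))
        where
        r : ∀ x y → y ≡ (x ℤ.+ y) ℤ.- x
        r = ℤsolve-∀
        E≡ : (p 1 ℤ.* p 1 ℤ.+ + q 1 ℤ.* + q 1) ℤ.* (p 1 ℤ.* p 1 ℤ.+ + q 1 ℤ.* + q 1) ≡ + e a (q 1)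
        E≡ = sym (trans (ℤₚ.pos-* (a * a + q 1 * q 1) (a * a + q 1 * q 1)) (cong₂ ℤ._*_ s≡ s≡))
          where
          s≡ : + (a * a + q 1 * q 1) ≡ p 1 ℤ.* p 1 ℤ.+ + q 1 ℤ.* + q 1
          s≡ = cong₂ ℤ._+_ (trans (ℤₚ.pos-* a a) (sym (cong₂ ℤ._*_ p≡ p≡))) (ℤₚ.pos-* (q 1) (q 1))
        F≡ : + 4 ℤ.* ((p 1 ℤ.* + q 1) ℤ.* (p 1 ℤ.* p 1 ℤ.- + q 1 ℤ.* + q 1)) ≡ + f a (q 1)
        F≡ = sym (trans (ℤₚ.pos-* 4 ((a * q 1) * ω)) (cong (+ 4 ℤ.*_) (trans (ℤₚ.pos-* (a * q 1) ω) (cong₂ ℤ._*_ (trans (ℤₚ.pos-* a (q 1)) (cong (ℤ._* + q 1) (sym p≡))) ω≡))))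
          where
          ω = a * a ∸ q 1 * q 1
          ω≡ : + ω ≡ p 1 ℤ.* p 1 ℤ.- + q 1 ℤ.* + q 1
          ω≡ = trans (r (+ (q 1 * q 1)) (+ ω)) (cong₂ ℤ._-_ (trans (cong +_ (m+[n∸m]≡n (*-mono-≤ (<⇒≤ q<a) (<⇒≤ q<a)))) (trans (ℤₚ.pos-* a a) (sym (cong₂ ℤ._*_ p≡ p≡)))) (ℤₚ.pos-* (q 1) (q 1)))
        equation : (p 1 ℤ.* p 3) ℤ.* _ ≡ _
        equation = tripling {p 1} {p 2} {p 3} {+ q 1} {+ q 2} {(p 1 ℤ.* p 1 ℤ.+ + q 1 ℤ.* + q 1) ℤ.* (p 1 ℤ.* p 1 ℤ.+ + q 1 ℤ.* + q 1)} {+ 4 ℤ.* ((p 1 ℤ.* + q 1) ℤ.* (p 1 ℤ.* p 1 ℤ.- + q 1 ℤ.* + q 1))}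
          (λ z → <⇒≢ (q>0 1) (sym (ℤₚ.+-injective z)))
          (trans (product 0 0) (cong (λ t → (+ q 1 ℤ.* + t) ℤ.* ((p 1 ℤ.* p 2 ℤ.+ + q 1 ℤ.* + q 2) ℤ.* (p 1 ℤ.* p 2 ℤ.+ + q 1 ℤ.* + q 2))) q₃≡)) (double 0)
        E₁ F₁ : ℤ
        E₁ = (p 1 ℤ.* p 1 ℤ.+ + q 1 ℤ.* + q 1) ℤ.* (p 1 ℤ.* p 1 ℤ.+ + q 1 ℤ.* + q 1)
        F₁ = + 4 ℤ.* ((p 1 ℤ.* + q 1) ℤ.* (p 1 ℤ.* p 1 ℤ.- + q 1 ℤ.* + q 1))
        go : _ → ⊥
        go (inj₁ q≡0) = <⇒≢ (q>0 0) (sym q≡0)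
        go (inj₂ ¬∣) = ¬∣ (tripling-∣ a (q 1) (p 3) E₁ F₁ E≡ F≡
          (subst (λ z → (z ℤ.* p 3) ℤ.* ((E₁ ℤ.* + q 1 ℤ.- z ℤ.* F₁) ℤ.* (E₁ ℤ.* + q 1 ℤ.- z ℤ.* F₁)) ≡ (+ q 1 ℤ.* + q 1) ℤ.* ((z ℤ.* E₁ ℤ.+ + q 1 ℤ.* F₁) ℤ.* (z ℤ.* E₁ ℤ.+ + q 1 ℤ.* F₁))) p≡ equation))

    -- `gap` gives x₂ ≥ X^43, so A² = X x₂ ≥ X^40, and the three squares are the input of `pade`
    -- with q 1 in the role of N.
    no-two-multiples : ∀ i j → suc i < suc j → let m = suc (suc i + suc i); n = suc (suc j + suc j) in q m ≡ q 1 → q n ≡ q 1 →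
      ∀ A b c → p m ℤ.* p n ≡ + (A * A) → (p m ℤ.- + q 1) ℤ.* (p n ℤ.- + q 1) ≡ + (b * b) → (p m ℤ.+ + q 1) ℤ.* (p n ℤ.+ + q 1) ≡ + (c * c) → ⊥
    no-two-multiples i j i<j qm qn A b c A² b² c² = main (comp S 0)
      where
      m′ = suc i + suc i
      n′ = suc j + suc j
      m = suc m′
      n = suc n′
      positive : ∀ k → Positive (p (suc k))
      positive = all-positive (positive₁ i qm)
      X = ℤ.∣ p m ∣
      x₂ = ℤ.∣ p n ∣
      m<n : m < n
      m<n = s≤s (+-mono-< i<j i<j)
      odd : ¬ 2 ℕD.∣ n
      odd (ℕD.divides k n≡) = even≢odd k (suc j) (trans (*-comm 2 k) (trans (sym n≡) (cong (λ t → suc (suc j + t)) (sym (+-identityʳ (suc j))))))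
      large : ∀ e → e ≡ 25 → Component (p 1) (q 1) → 2 ^ e * q 1 ^ 4 ≤ X
      large e e≡ (egg a p≡ _) with trans (sym p≡) (positive 0)
      ... | ()
      large e e≡ (identity a p≡ q<a) = ≤-trans (large-height S p≡ q<a e e≡ {m} (size i refl)) (≤-reflexive (H≡∣p∣ S positive m′))
        where
        -- i = 0 is the case m = 3, where the tripling check supplies 56 ≤ a; otherwise m ≥ 5.
        size : ∀ t → t ≡ i → 5 ≤ m ⊎ (56 ≤ a × 3 ≤ m)
        size zero refl = inj₂ (large-p₁ a p≡ q<a qm , ≤-refl)
        size (suc t) refl = inj₁ (s≤s (+-mono-≤ (s≤s (s≤s (z≤n {t}))) (s≤s (s≤s (z≤n {t})))))
      main : Component (p 1) (q 1) → ⊥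
      main comp₁ = contradiction 25 refl
        where
        contradiction : ∀ e → e ≡ 25 → ⊥
        contradiction e e≡ = pade X x₂ A b c (q 1) e (q>0 0) (≤-reflexive (sym e≡)) X-large X²⁰≤A A²≡ b²≡ c²≡
          where
          X-large : 2 ^ e * q 1 ^ 4 ≤ X
          X-large = large e e≡ comp₁
          instance
            X≢0 : NonZero X
            X≢0 = >-nonZero (∣p∣>0 m′)
          x₂-large : X ^ 43 ≤ x₂
          x₂-large = gap S positive m′ n′ e m<n odd (trans qn (sym qm)) e≡ (subst (λ t → 2 ^ e * t ^ 4 ≤ X) (sym qm) X-large)
          A²≡ : A * A ≡ X * x₂
          A²≡ = ℤₚ.+-injective (trans (sym A²) (trans (cong₂ ℤ._*_ (positive m′) (positive n′)) (sym (ℤₚ.pos-* X x₂))))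
          b²≡ : + b ℤ.* + b ≡ (+ X ℤ.- + q 1) ℤ.* (+ x₂ ℤ.- + q 1)
          b²≡ = trans (sym (ℤₚ.pos-* b b)) (trans (sym b²) (cong₂ (λ u v → (u ℤ.- + q 1) ℤ.* (v ℤ.- + q 1)) (positive m′) (positive n′)))
          c²≡ : + c ℤ.* + c ≡ (+ X ℤ.+ + q 1) ℤ.* (+ x₂ ℤ.+ + q 1)
          c²≡ = trans (sym (ℤₚ.pos-* c c)) (trans (sym c²) (cong₂ (λ u v → (u ℤ.+ + q 1) ℤ.* (v ℤ.+ + q 1)) (positive m′) (positive n′)))
          X²⁰≤A : X ^ 20 ≤ A
          X²⁰≤A = square-cancel-≤ (begin
            X ^ 20 * X ^ 20    ≡⟨ sym (^-distribˡ-+-* X 20 20) ⟩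
            X ^ 40             ≤⟨ ^-monoʳ-≤ X (≤ᵇ⇒≤ 40 43 _) ⟩
            X ^ 43             ≤⟨ x₂-large ⟩
            x₂                 ≤⟨ m≤n*m x₂ X ⟩
            X * x₂             ≡⟨ sym A²≡ ⟩
            A * A              ∎)

-- Back to integral points

module Final where

  open import Defs
  open Line
  open Multiples
  open Fractions
  open Classes
  open Heights using (Abscissae)
  open Reduction
  open Conclusion
  open import Data.Nat as ℕ using (ℕ; suc; s≤s; z≤n)
  import Data.Nat.Properties as ℕₚ
  import Data.Nat.Divisibility as ℕD
  open import Data.Integer as ℤ using (ℤ; +_; -[1+_]; 0ℤ)
  import Data.Integer.Properties as ℤₚ
  open import Data.Rational using (ℚ; 0ℚ; _+_; _*_; _-_; -_)
  open import Data.Rational.Properties using (*-comm; +-identityʳ)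
  open import Data.Rational.Solver using (module +-*-Solver)
  open +-*-Solver
  open import Data.Product using (∃; _,_; proj₁; proj₂)
  open import Data.Sum using (inj₁; inj₂)
  open import Data.Empty using (⊥; ⊥-elim)
  open import Relation.Binary.PropositionalEquality
  open import Relation.Nullary using (¬_)
  open import Relation.Binary.Definitions using (tri<; tri≈; tri>)

  Integerℚ : ℚ → Set
  Integerℚ x = ∃ λ Z → x ≡ ι Z

  module _ {N P} (O : Orbit N P) {M : ℕ} (M>0 : 0 ℕ.< M) (sf : SquareFreeℕ M) (D≡ : Orbit.D O ≡ ι (+ M) * ι (+ M)) where
    open Orbit O
    private
      S : Abscissae
      S = abscissae O M>0 D≡
      open Abscissae S using (p; q; q>0; coprime)

      m : ℚ
      m = ι (+ M)

      m≢0 : m ≢ 0ℚ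
      m≢0 = ι≢0 {+ M} (λ e → ℕₚ.<⇒≢ M>0 (sym (ℤₚ.+-injective e)))

      value : ∀ n → x n * ι (+ q n) ≡ m * ι (p n)
      value n = Fraction.value (reduced O M>0 D≡ n)

      root₀ : 0ℚ * 0ℚ * 0ℚ - D * 0ℚ ≡ 0ℚ
      root₀ = r D
        where
        r : ∀ D → 0ℚ * 0ℚ * 0ℚ - D * 0ℚ ≡ 0ℚ
        r = solve 1 (λ D → con 0ℚ :* con 0ℚ :* con 0ℚ :- D :* con 0ℚ := con 0ℚ) refl

      root₊ : m * m * m - D * m ≡ 0ℚ
      root₊ = trans (cong (λ d → m * m * m - d * m) D≡) (r m)
        where
        r : ∀ m → m * m * m - (m * m) * m ≡ 0ℚ
        r = solve 1 (λ m → m :* m :* m :- (m :* m) :* m := con 0ℚ) refl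

      root₋ : (- m) * (- m) * (- m) - D * (- m) ≡ 0ℚ
      root₋ = trans (cong (λ d → (- m) * (- m) * (- m) - d * (- m)) D≡) (r m)
        where
        r : ∀ m → (- m) * (- m) * (- m) - (m * m) * (- m) ≡ 0ℚ
        r = solve 1 (λ m → (:- m) :* (:- m) :* (:- m) :- (m :* m) :* (:- m) := con 0ℚ) refl

      minus-zero : ∀ x → x - 0ℚ ≡ x
      minus-zero x = r x
        where
        r : ∀ x → x - 0ℚ ≡ x
        r = solve 1 (λ x → x :- con 0ℚ := x) refl

      minus-neg : ∀ x → x - (- m) ≡ x + m
      minus-neg x = r x m
        where
        r : ∀ x m → x - (- m) ≡ x + m
        r = solve 2 (λ x m → x :- (:- m) := x :+ m) refl

    -- Z - M, Z and Z + M would be squares, whence 4 ∣ M, against square-freeness.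
    even-not-integral : ∀ k → ¬ Integerℚ (x (suc (suc (k ℕ.+ k))))
    even-not-integral k (Z , x≡) = two (sf 2 (progression {t₋} {t₀} {t₊} {M} e₁ e₂))
      where
      two : ¬ 2 ≡ 1
      two ()
      class₀ = even-class O 0ℚ root₀ k
      class₊ = even-class O m root₊ k
      class₋ = even-class O (- m) root₋ k
      sq₀ = integer-square Z (proj₁ class₀) (trans (sym x≡) (trans (sym (minus-zero (x (suc (suc (k ℕ.+ k)))))) (proj₂ class₀)))
      sq₊ = integer-square (Z ℤ.- + M) (proj₁ class₊) (trans (sym (ι-- Z (+ M))) (trans (cong (_- m) (sym x≡)) (proj₂ class₊)))
      sq₋ = integer-square (Z ℤ.+ + M) (proj₁ class₋) (trans (sym (ι-+ Z (+ M))) (trans (cong (_+ m) (sym x≡)) (trans (sym (minus-neg (x (suc (suc (k ℕ.+ k)))))) (proj₂ class₋))))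
      t₀ = proj₁ sq₀
      t₋ = proj₁ sq₊
      t₊ = proj₁ sq₋
      open import Data.Integer.Tactic.RingSolver using (solve-∀)
      r : ∀ z m → z ≡ (z ℤ.- m) ℤ.+ m
      r = solve-∀
      e₁ : t₀ ℕ.* t₀ ≡ t₋ ℕ.* t₋ ℕ.+ M
      e₁ = ℤₚ.+-injective (trans (sym (proj₂ sq₀)) (trans (r Z (+ M)) (cong (ℤ._+ + M) (proj₂ sq₊))))
      e₂ : t₊ ℕ.* t₊ ≡ t₀ ℕ.* t₀ ℕ.+ M
      e₂ = ℤₚ.+-injective (trans (sym (proj₂ sq₋)) (cong (ℤ._+ + M) (proj₂ sq₀)))

    private
      cleared : ∀ n Z → x n ≡ ι Z → ℤ.∣ Z ∣ ℕ.* q n ≡ M ℕ.* ℤ.∣ p n ∣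
      cleared n Z x≡ = trans (sym (ℤₚ.abs-* Z (+ q n))) (trans (cong ℤ.∣_∣ (ι-injective {Z ℤ.* + q n} {+ M ℤ.* p n}
        (trans (sym (ι-* Z (+ q n))) (trans (cong (_* ι (+ q n)) (sym x≡)) (trans (value n) (ι-* (+ M) (p n))))))) (ℤₚ.abs-* (+ M) (p n)))

    -- Integral odd multiples have the square class of P at every root, hence the same gcd with M as P.
    denominator : ∀ k → Integerℚ (x 1) → Integerℚ (x (suc (k ℕ.+ k))) → q (suc (k ℕ.+ k)) ≡ q 1
    denominator k (X , X≡) (Z , Z≡) = sym (denominator-unique M>0 sf (cleared 1 X X≡) (cleared (suc (k ℕ.+ k)) Z Z≡) (coprime 0) (coprime (k ℕ.+ k))
        (gcd∣ M>0 sf X Z (proj₁ sq₀) (proj₁ sq₊) (proj₂ sq₀) (proj₂ sq₊))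
        (gcd∣ M>0 sf Z X (proj₁ sq₀) (proj₁ sq₊) (trans (ℤₚ.*-comm Z X) (proj₂ sq₀)) (trans (ℤₚ.*-comm (Z ℤ.- + M) (X ℤ.- + M)) (proj₂ sq₊))))
      where
      class₀ = odd-class O 0ℚ root₀ k
      class₊ = odd-class O m root₊ k
      sq₀ = integer-square (X ℤ.* Z) (proj₁ class₀) (trans (sym (ι-* X Z)) (trans (cong₂ _*_ (trans (sym X≡) (sym (minus-zero (x 1)))) (trans (sym Z≡) (sym (minus-zero (x (suc (k ℕ.+ k))))))) (proj₂ class₀)))
      sq₊ = integer-square ((X ℤ.- + M) ℤ.* (Z ℤ.- + M)) (proj₁ class₊) (trans (sym (ι-* (X ℤ.- + M) (Z ℤ.- + M)))
        (trans (cong₂ _*_ (trans (sym (ι-- X (+ M))) (cong (_- m) (sym X≡))) (trans (sym (ι-- Z (+ M))) (cong (_- m) (sym Z≡)))) (proj₂ class₊)))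

    private
      module _ (r : ℚ) (ρ : ℤ) (root : r * r * r - D * r ≡ 0ℚ) (scaled : r * ι (+ q 1) ≡ m * ι ρ) where
        shifted : ∀ n → q n ≡ q 1 → (x n - r) * ι (+ q 1) ≡ m * ι (p n ℤ.- ρ)
        shifted n qn = trans (r₁ (x n) r (ι (+ q 1))) (trans (cong₂ _-_ (trans (cong (λ t → x n * ι (+ t)) (sym qn)) (value n)) scaled) (trans (r₂ m (ι (p n)) (ι ρ)) (cong (m *_) (ι-- (p n) ρ))))
          where
          r₁ : ∀ x r q → (x - r) * q ≡ x * q - r * q
          r₁ = solve 3 (λ x r q → (x :- r) :* q := x :* q :- r :* q) refl
          r₂ : ∀ m a b → m * a - m * b ≡ m * (a - b)
          r₂ = solve 3 (λ m a b → m :* a :- m :* b := m :* (a :- b)) refl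

        -- By `scaled`, r = M ρ / q 1, so p n - ρ is (x n - r) q 1 / M. Both x k - r and x l - r
        -- have the class of x 1 - r; dividing the product of the two squares by (M (x 1 - r))²
        -- gives the root s.
        product-square : ∀ k l → q (suc (k ℕ.+ k)) ≡ q 1 → q (suc (l ℕ.+ l)) ≡ q 1 → ∃ λ s → (p (suc (k ℕ.+ k)) ℤ.- ρ) ℤ.* (p (suc (l ℕ.+ l)) ℤ.- ρ) ≡ + (s ℕ.* s)
        product-square k l qk ql = integer-square ((p k′ ℤ.- ρ) ℤ.* (p l′ ℤ.- ρ)) s (trans (sym (ι-* (p k′ ℤ.- ρ) (p l′ ℤ.- ρ))) rational)
          where
          k′ = suc (k ℕ.+ k)
          l′ = suc (l ℕ.+ l)
          Q = ι (+ q 1)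
          t = proj₁ (odd-class O r root k)
          u = proj₁ (odd-class O r root l)
          e = x 1 - r
          w = m * e
          w≢0 : w ≢ 0ℚ
          w≢0 z = x-root≢0 O r root 0 (integral-domain m e z m≢0)
          s = div (Q * (t * u)) w
          A = ι (p k′ ℤ.- ρ)
          B = ι (p l′ ℤ.- ρ)
          r₁ : ∀ m e a b → (m * e) * ((m * e) * (a * b)) ≡ (e * e) * ((m * a) * (m * b))
          r₁ = solve 4 (λ m e a b → (m :* e) :* ((m :* e) :* (a :* b)) := (e :* e) :* ((m :* a) :* (m :* b))) refl
          r₂ : ∀ e x y q → (e * e) * ((x * q) * (y * q)) ≡ (q * q) * ((e * x) * (e * y))
          r₂ = solve 4 (λ e x y q → (e :* e) :* ((x :* q) :* (y :* q)) := (q :* q) :* ((e :* x) :* (e :* y))) refl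
          r₃ : ∀ q t u → (q * q) * ((t * t) * (u * u)) ≡ (q * (t * u)) * (q * (t * u))
          r₃ = solve 3 (λ q t u → (q :* q) :* ((t :* t) :* (u :* u)) := (q :* (t :* u)) :* (q :* (t :* u))) refl
          r₄ : ∀ s w → (s * w) * (s * w) ≡ w * (w * (s * s))
          r₄ = solve 2 (λ s w → (s :* w) :* (s :* w) := w :* (w :* (s :* s))) refl
          rational : A * B ≡ s * s
          rational = cancelˡ w w≢0 (cancelˡ w w≢0 (trans (r₁ m e A B) (trans (cong₂ (λ a b → (e * e) * (a * b)) (sym (shifted k′ qk)) (sym (shifted l′ ql)))
            (trans (r₂ e (x k′ - r) (x l′ - r) Q) (trans (cong₂ (λ a b → (Q * Q) * (a * b)) (proj₂ (odd-class O r root k)) (proj₂ (odd-class O r root l)))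
              (trans (r₃ Q t u) (trans (cong₂ _*_ (sym (div-* (Q * (t * u)) w w≢0)) (sym (div-* (Q * (t * u)) w w≢0))) (r₄ s w))))))))

    -- Both denominators equal q 1, so the roots 0, M and -M of the cubic turn into the shifts 0, q
    -- 1 and -q 1 of the numerators.
    no-two-odd : ∀ i j → i ℕ.< j → Integerℚ (x 1) → Integerℚ (x (suc (suc i ℕ.+ suc i))) → Integerℚ (x (suc (suc j ℕ.+ suc j))) → ⊥
    no-two-odd i j i<j int₁ intᵢ intⱼ = no-two-multiples S i j (s≤s i<j) qi qj (proj₁ sq₀) (proj₁ sq₊) (proj₁ sq₋)
        (trans (sym (cong₂ ℤ._*_ (ℤₚ.+-identityʳ (p mᵢ)) (ℤₚ.+-identityʳ (p mⱼ)))) (proj₂ sq₀)) (proj₂ sq₊)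
        (trans (sym (cong₂ (λ a b → (p mᵢ ℤ.+ a) ℤ.* (p mⱼ ℤ.+ b)) (ℤₚ.neg-involutive (+ q 1)) (ℤₚ.neg-involutive (+ q 1)))) (proj₂ sq₋))
      where
      mᵢ = suc (suc i ℕ.+ suc i)
      mⱼ = suc (suc j ℕ.+ suc j)
      qi = denominator (suc i) int₁ intᵢ
      qj = denominator (suc j) int₁ intⱼ
      sq₀ = product-square 0ℚ 0ℤ root₀ (r₀ (ι (+ q 1)) m) (suc i) (suc j) qi qj
        where
        r₀ : ∀ q m → 0ℚ * q ≡ m * 0ℚ
        r₀ = solve 2 (λ q m → con 0ℚ :* q := m :* con 0ℚ) refl
      sq₊ = product-square m (+ q 1) root₊ refl (suc i) (suc j) qi qj
      sq₋ = product-square (- m) (ℤ.- (+ q 1)) root₋ (trans (r₁ m (ι (+ q 1))) (cong (m *_) (ι-neg (+ q 1)))) (suc i) (suc j) qi qj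
        where
        r₁ : ∀ m q → (- m) * q ≡ m * (- q)
        r₁ = solve 2 (λ m q → (:- m) :* q := m :* (:- q)) refl

    at-most-one : Integerℚ (x 1) → ∀ m n → Integerℚ (x (suc (suc m))) → Integerℚ (x (suc (suc n))) → m ≡ n
    at-most-one int₁ m n intₘ intₙ = go (odd-index m intₘ) (odd-index n intₙ)
      where
      odd-index : ∀ m → Integerℚ (x (suc (suc m))) → ∃ λ k → m ≡ suc (k ℕ.+ k)
      odd-index m int with parity m
      ... | inj₁ (k , m≡) = ⊥-elim (even-not-integral k (subst (λ n → Integerℚ (x (suc (suc n)))) (trans m≡ (cong (k ℕ.+_) (ℕₚ.+-identityʳ k))) int))
      ... | inj₂ (k , m≡) = k , trans m≡ (cong (λ t → suc (k ℕ.+ t)) (ℕₚ.+-identityʳ k))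
      at : ∀ {m} k → m ≡ suc (k ℕ.+ k) → Integerℚ (x (suc (suc m))) → Integerℚ (x (suc (suc k ℕ.+ suc k)))
      at k refl = subst (λ n → Integerℚ (x (suc (suc n)))) (sym (ℕₚ.+-suc k k))
      go : (∃ λ k → m ≡ suc (k ℕ.+ k)) → (∃ λ k → n ≡ suc (k ℕ.+ k)) → m ≡ n
      go (i , m≡) (j , n≡) with ℕₚ.<-cmp i j
      ... | tri< i<j _ _ = ⊥-elim (no-two-odd i j i<j int₁ (at i m≡ intₘ) (at j n≡ intₙ))
      ... | tri≈ _ i≡j _ = trans m≡ (trans (cong (λ k → suc (k ℕ.+ k)) i≡j) (sym n≡))
      ... | tri> _ _ j<i = ⊥-elim (no-two-odd j i j<i int₁ (at j n≡ intₙ) (at i m≡ intₘ))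

  integral-abscissa : ∀ {Q} → Integral Q → ∀ {x y} → Q ≡ aff x y → Integerℚ x
  integral-abscissa (integral a b) refl = a , refl

open import Defs
open import Data.Nat using (ℕ; suc; s≤s; z≤n; _<_)
import Data.Nat.Properties as ℕₚ
import Data.Nat.Divisibility as ℕD
open import Data.Integer using (ℤ; +_; -[1+_]; 0ℤ)
import Data.Integer as ℤ
import Data.Integer.Properties as ℤₚ
open import Data.Rational using (0ℚ)
import Data.Rational as ℚ
open import Relation.Binary.PropositionalEquality using (_≡_; _≢_; refl; sym; trans; cong)
open Line using (integral-domain)
open Multiples using (Orbit; orbit)
open Fractions using (ι; ι≢0; ι-*)
open Final using (integral-abscissa; at-most-one)
theorem2 : (N : ℤ) → SquareFree N → (P : Point) → OnCurve N P →
    Integral P → NonTorsion N P →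
    (m n : ℕ) → 1 < m → 1 < n →
    Integral (smul N m P) → Integral (smul N n P) → m ≡ n
theorem2 N sf .(aff (fromℤ a) (fromℤ b)) on (integral a b) nt (suc (suc m)) (suc (suc n)) (s≤s (s≤s z≤n)) (s≤s (s≤s z≤n)) intₘ intₙ =
  cong (λ k → suc (suc k)) (at-most-one multiples M>0 sf D≡ (integral-abscissa (integral a b) (Orbit.point multiples)) m n
    (integral-abscissa intₘ (Orbit.multiple multiples (suc m))) (integral-abscissa intₙ (Orbit.multiple multiples (suc n))))
  where
  N≢0 : N ≢ 0ℤ
  N≢0 refl with sf 2 (4 ℕD.∣0)
  ... | ()
  M>0 : 0 < ℤ.∣ N ∣
  M>0 = ℕₚ.n≢0⇒n>0 (λ z → N≢0 (ℤₚ.∣i∣≡0⇒i≡0 z))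
  D≢0 : fromℤ N ℚ.* fromℤ N ≢ 0ℚ
  D≢0 z = ι≢0 {N} N≢0 (integral-domain (ι N) (ι N) z (ι≢0 {N} N≢0))
  multiples : Orbit N (aff (fromℤ a) (fromℤ b))
  multiples = orbit N (fromℤ a) (fromℤ b) on nt D≢0
  square : ∀ N → N ℤ.* N ≡ + ℤ.∣ N ∣ ℤ.* + ℤ.∣ N ∣
  square (+ n) = refl
  square -[1+ n ] = refl
  D≡ : fromℤ N ℚ.* fromℤ N ≡ ι (+ ℤ.∣ N ∣) ℚ.* ι (+ ℤ.∣ N ∣)
  D≡ = trans (ι-* N N) (trans (cong ι (square N)) (sym (ι-* (+ ℤ.∣ N ∣) (+ ℤ.∣ N ∣))))
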